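{- Let $m\ge 1$ be an integer, $N=43^m$, $f=\phi(43^m)/6$ and $q=11^f$ (here $\mathrm{ord}_{43^m}(11)=\phi(43^m)/6$, so $N\mid q-1$). Let $\gamma$ be a fixed primitive element of $\mathbb{F}_q$, let $C_i=\{\gamma^{i+jN}\mid 0\le j\le\frac{q-1}{N}-1\}$ for $0\le i\le N-1$, and let $D=\bigcup_{i=0}^{43^{m-1}-1}C_i$. Then $\mathrm{Cay}(\mathbb{F}_q,D)$ is a strongly regular graph.
   Context: $\phi$ is the Euler totient function and $\mathrm{ord}_n(a)$ is the multiplicative order of $a$ modulo $n$. For $D\subseteq\mathbb{F}_q^*$ with $-D=D$, $\mathrm{Cay}(\mathbb{F}_q,D)$ is the graph with vertex set $\mathbb{F}_q$ in which two vertices are adjacent if and only if their difference belongs to $D$. A strongly regular graph srg$(v,k,\lambda,\mu)$ is a simple undirected regular graph of order $v$ and valency $k$, neither complete nor edgeless, such that any two adjacent vertices have exactly $\lambda$ common neighbors and any two (distinct) nonadjacent vertices have exactly $\mu$ common neighbors; connectedness is not required. -}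

module Defs where

open import Level using (Level; _⊔_)
open import Algebra.Bundles using (CommutativeRing)
import Algebra.Properties.Semiring.Exp as Exp
open import Data.Fin.Base using (Fin)
open import Data.List.Base using (length; filter; map; upTo)
open import Data.Nat.Base using (ℕ; suc; NonZero; _+_; _*_; _∸_; _^_; _/_; _%_; _≤_; _<_)
open import Data.Nat.Coprimality using (coprime?)
open import Data.Product.Base using (∃-syntax; _×_; proj₁)
open import Function.Bundles using (Inverse)
open import Relation.Binary.Bundles using (Setoid)
open import Relation.Binary.Core using (Rel)
open import Relation.Binary.Definitions using (Symmetric; _Respects₂_)
import Relation.Binary.Construct.On as On
open import Relation.Binary.PropositionalEquality using (_≡_)
import Relation.Binary.PropositionalEquality.Properties as ≡
open import Relation.Nullary.Negation using (¬_)
open import Relation.Unary using (Pred)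

private
  variable
    a e p c ℓ : Level

------------------------------------------------------------------------
-- Arithmetic

-- Euler's totient: the number of k with 1 ≤ k ≤ n and gcd(k, n) = 1.
φ : ℕ → ℕ
φ n = length (filter (λ k → coprime? k n) (map suc (upTo n)))

-- IsOrd n a d : d = ord_n(a), the least positive d with aᵈ ≡ 1 (mod n).
record IsOrd (n : ℕ) .{{_ : NonZero n}} (a d : ℕ) : Set where
  field
    positive : 1 ≤ d
    power≡1  : (a ^ d) % n ≡ 1 % n
    minimal  : ∀ k → 1 ≤ k → (a ^ k) % n ≡ 1 % n → d ≤ k

------------------------------------------------------------------------
-- Cardinality

HasCardinality : Setoid a e → ℕ → Set (a ⊔ e)
HasCardinality S n = Inverse S (≡.setoid (Fin n))

-- The elements of S satisfying P.  Two of them are equal when they are equal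
-- in S, so different proofs of P do not count as different elements.
subsetoid : (S : Setoid a e) → Pred (Setoid.Carrier S) p → Setoid (a ⊔ p) e
subsetoid S P = On.setoid S (proj₁ {A = Setoid.Carrier S} {B = P})

------------------------------------------------------------------------
-- Strongly regular graphs

-- srg(v, k, λ, μ), for the graph with vertex set V and adjacency relation E.
record IsSRG (V : Setoid a e) (E : Rel (Setoid.Carrier V) p)
             (v k λ′ μ : ℕ) : Set (a ⊔ e ⊔ p) where
  open Setoid V using (Carrier; _≈_)
  field
    E-resp-≈    : E Respects₂ _≈_
    loopless    : ∀ x → ¬ E x x
    undirected  : Symmetric E
    order       : HasCardinality V v
    regular     : ∀ x → HasCardinality (subsetoid V (λ z → E x z)) k
    notComplete : ¬ (∀ x y → ¬ x ≈ y → E x y)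
    notEdgeless : ¬ (∀ x y → ¬ E x y)
    adjacent    : ∀ x y → E x y →
                  HasCardinality (subsetoid V (λ z → E x z × E y z)) λ′
    nonadjacent : ∀ x y → ¬ x ≈ y → ¬ E x y →
                  HasCardinality (subsetoid V (λ z → E x z × E y z)) μ

IsStronglyRegular : (V : Setoid a e) → Rel (Setoid.Carrier V) p → Set (a ⊔ e ⊔ p)
IsStronglyRegular V E = ∃[ v ] ∃[ k ] ∃[ λ′ ] ∃[ μ ] IsSRG V E v k λ′ μ

------------------------------------------------------------------------
-- Finite fields and cyclotomic classes

record IsFiniteField (F : CommutativeRing c ℓ) (q : ℕ) : Set (c ⊔ ℓ) where
  open CommutativeRing F using (_≈_; 0#; 1#; setoid) renaming (_*_ to _·_)
  field
    0≉1         : ¬ 0# ≈ 1#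
    inverse     : ∀ x → ¬ x ≈ 0# → ∃[ y ] (x · y ≈ 1#)
    cardinality : HasCardinality setoid q

module _ (F : CommutativeRing c ℓ) where
  open CommutativeRing F using (Carrier; _≈_; _-_; 0#; semiring)
  open Exp semiring using () renaming (_^_ to _^ᶠ_)

  -- γ generates the multiplicative group of nonzero elements.
  IsPrimitiveElement : Carrier → Set (c ⊔ ℓ)
  IsPrimitiveElement γ = ¬ γ ≈ 0# × (∀ x → ¬ x ≈ 0# → ∃[ n ] (x ≈ γ ^ᶠ n))

  -- C_i = { γ^(i + jN) | 0 ≤ j ≤ (q-1)/N - 1 }; the division is exact when
  -- N ∣ q - 1.
  CyclotomicClass : (q N : ℕ) .{{_ : NonZero N}} → Carrier → ℕ → Pred Carrier ℓ
  CyclotomicClass q N γ i x = ∃[ j ] (j < (q ∸ 1) / N × x ≈ γ ^ᶠ (i + j * N))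

  -- C_0 ∪ … ∪ C_(s-1)
  ClassUnion : (q N : ℕ) .{{_ : NonZero N}} → Carrier → (s : ℕ) → Pred Carrier ℓ
  ClassUnion q N γ s x = ∃[ i ] (i < s × CyclotomicClass q N γ i x)

  -- The hypotheses 0 ∉ D and -D = D are not arguments: they amount to Cay D
  -- being loopless and undirected, which IsSRG demands.
  Cay : Pred Carrier p → Rel Carrier p
  Cay D x y = D (x - y)

{-# OPTIONS --safe #-}
-- With ψ the additive character and η_t the Gauss period of the t-th cyclotomic class of order
-- N = 43^m, the sum of ψ over γ^t D is an interval sum S_t of M = 43^(m−1) periods.  Since 1 + 43ℤ
-- lies in the group generated by 11 modulo N, η_t depends only on t mod M unless M ∣ t, so that
-- 43 S_t + 1 is the projection of η to the characters of order exactly N, evaluated at the multiple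
-- of M in the interval.  By Stickelberger's congruence the Gauss sums of these characters are
-- divisible by 11^θ with θ = (f − 1) / 2, hence 43 S_t + 1 = 11^θ Y_t.  Moreover Y_t ≡ 21 (mod 43),
-- ∑ Y_t = 0 and ∑ Y_t² = 21 · 22 (q − 1) by Parseval, so the sum of the nonnegative numbers
-- (Y_t − 21)(Y_t + 22) is 0 and Y_t ∈ {21, −22}: D has two nontrivial character values, and Fourier
-- inversion shows that the graph is strongly regular.
--
-- The divisibility avoids p-adic numbers.  In the monoid ring of (F, +) × (F, *) the Gauss sum of
-- ω^(−A) is built up along the base 11 digits of A: Frobenius gives A ↦ 11 A for free, and A ↦ A + 1
-- costs a Jacobi sum that stays nonzero in F and gains a factor τ, where τ^11 is a multiple of 11 τ.
-- Dividing the periods by 11 repeatedly and inverting a Fourier transform over F on ℤ/43 does the rest.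
module Submission where

open import Defs

-- The six cosets of the group generated by 11 modulo 43 have residue sums 129 = 3 · 43 or 172 = 4 ·
-- 43. A coset and its negative add up to 7 · 43, so this is as balanced as possible, and every
-- Gauss sum involved is divisible by 11^θ, the largest power of 11 below √q. After division
-- Parseval's total per term is (43 - 1) · 11 = 21 · 22, by 1 + 43 = 4 · 11. It leaves no slack,
-- because 21 and -22 are neighbours in their class modulo 43. The class itself comes from 11³ ≡ -2,
-- θ ≡ 3 (mod 7) and -2 · 21 ≡ 1.
--
-- No root of unity is adjoined to ℤ: the additive character is replaced by the sum of its
-- conjugates, which is 10 on elements of trace 0 and -1 elsewhere. The nonzero elements of the
-- prime field lie in C_0, so the periods and D are invariant under them, and the replacement costs
-- only factors 10.
--
-- Reduction modulo a prime above 11 is replaced by evaluating the monoid ring of (F, *) in F. A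
-- divisibility at that prime becomes one for Z times the Gauss sum, where Z has nonzero value in F;
-- this value is cancelled at the end.

-- Finite sums over ℕ, and permutations of finite sets

module FiniteSums where

  open import Algebra.Bundles using (CommutativeSemiring; CommutativeRing)
  open import Data.Fin.Base using (Fin; zero; suc; toℕ; fromℕ<)
  open import Data.Fin.Permutation using (Permutation; permutation)
  open import Data.Fin.Properties using (toℕ<n; toℕ-fromℕ<; toℕ-injective; any?; injective⇒≤)
  import Data.Fin.Properties as Fin
  import Data.Integer.Properties as ℤ
  open import Data.Nat.Base using (ℕ; zero; suc; _<_; z<s; s<s; _%_; NonZero)
  import Data.Nat.Base as ℕ
  import Data.Nat.Properties as ℕ
  open import Data.Nat.DivMod using (m%n<n; m<n⇒m%n≡m; %-distribˡ-*; m%n%n≡m%n)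
  open import Data.Product.Base using (_,_; ∃-syntax; proj₁; proj₂)
  open import Function.Base using (_∘_)
  open import Function.Definitions using (Injective)
  open import Relation.Binary.PropositionalEquality as ≡ using (_≡_; cong)
  open import Relation.Nullary.Decidable using (yes; no)
  open import Relation.Nullary.Negation using (¬_; contradiction)

  mod-inverse : ∀ k .{{_ : NonZero k}} a b i → i < k → (a ℕ.* b) % k ≡ 1 % k → (a ℕ.* ((b ℕ.* i) % k)) % k ≡ i
  mod-inverse k a b i i<k ab = begin
    (a ℕ.* ((b ℕ.* i) % k)) % k              ≡⟨ %-distribˡ-* a _ k ⟩
    ((a % k) ℕ.* (((b ℕ.* i) % k) % k)) % k  ≡⟨ cong (λ x → ((a % k) ℕ.* x) % k) (m%n%n≡m%n (b ℕ.* i) k) ⟩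
    ((a % k) ℕ.* ((b ℕ.* i) % k)) % k        ≡⟨ %-distribˡ-* a (b ℕ.* i) k ⟨
    (a ℕ.* (b ℕ.* i)) % k                    ≡⟨ cong (_% k) (ℕ.*-assoc a b i) ⟨
    (a ℕ.* b ℕ.* i) % k                      ≡⟨ %-distribˡ-* (a ℕ.* b) i k ⟩
    ((a ℕ.* b) % k ℕ.* (i % k)) % k          ≡⟨ cong (λ x → (x ℕ.* (i % k)) % k) ab ⟩
    (1 % k ℕ.* (i % k)) % k                  ≡⟨ %-distribˡ-* 1 i k ⟨
    (1 ℕ.* i) % k                            ≡⟨ cong (_% k) (ℕ.*-identityˡ i) ⟩
    i % k                                    ≡⟨ m<n⇒m%n≡m i<k ⟩
    i                                        ∎
    where open ≡.≡-Reasoning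

  module Sum {c ℓ} (R : CommutativeSemiring c ℓ) where
    open CommutativeSemiring R
    open import Algebra.Properties.Semiring.Sum semiring public
      using (sum; sum-cong-≋; ∑-distrib-+; ∑-comm; *-distribˡ-sum; *-distribʳ-sum; sum-permute; sum-replicate-zero)
    open import Algebra.Properties.Semiring.Mult semiring using () renaming (_×_ to _×ᴿ_)
    open import Relation.Binary.Reasoning.Setoid setoid

    ∑ : ℕ → (ℕ → Carrier) → Carrier
    ∑ zero    g = 0#
    ∑ (suc n) g = g 0 + ∑ n (g ∘ suc)

    ∑≡sum : ∀ n g → ∑ n g ≡ sum {n} (λ i → g (toℕ i))
    ∑≡sum zero    g = ≡.refl
    ∑≡sum (suc n) g = cong (g 0 +_) (∑≡sum n (g ∘ suc))

    ∑-cong< : ∀ n {g h} → (∀ i → i < n → g i ≈ h i) → ∑ n g ≈ ∑ n h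
    ∑-cong< zero    eq = refl
    ∑-cong< (suc n) eq = +-cong (eq 0 z<s) (∑-cong< n (λ i i<n → eq (suc i) (s<s i<n)))

    ∑-cong : ∀ n {g h} → (∀ i → g i ≈ h i) → ∑ n g ≈ ∑ n h
    ∑-cong n eq = ∑-cong< n (λ i _ → eq i)

    ∑-zero : ∀ n {g} → (∀ i → i < n → g i ≈ 0#) → ∑ n g ≈ 0#
    ∑-zero zero    eq = refl
    ∑-zero (suc n) eq = trans (+-cong (eq 0 z<s) (∑-zero n (λ i i<n → eq (suc i) (s<s i<n)))) (+-identityˡ 0#)

    ∑-single : ∀ n k g → k < n → (∀ i → i < n → ¬ i ≡ k → g i ≈ 0#) → ∑ n g ≈ g k
    ∑-single (suc n) zero    g _ off = trans (+-congˡ (∑-zero n (λ i i<n → off (suc i) (s<s i<n) (λ ())))) (+-identityʳ (g 0))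
    ∑-single (suc n) (suc k) g (s<s k<n) off = trans
      (+-cong (off 0 z<s (λ ())) (∑-single n k (g ∘ suc) k<n (λ i i<n i≢k → off (suc i) (s<s i<n) (i≢k ∘ ℕ.suc-injective))))
      (+-identityˡ _)

    ∑-+ : ∀ n g h → ∑ n (λ i → g i + h i) ≈ ∑ n g + ∑ n h
    ∑-+ n g h rewrite ∑≡sum n (λ i → g i + h i) | ∑≡sum n g | ∑≡sum n h = ∑-distrib-+ {n} (g ∘ toℕ) (h ∘ toℕ)

    ∑-*ˡ : ∀ n x g → x * ∑ n g ≈ ∑ n (λ i → x * g i)
    ∑-*ˡ zero    x g = zeroʳ x
    ∑-*ˡ (suc n) x g = trans (distribˡ x _ _) (+-congˡ (∑-*ˡ n x (g ∘ suc)))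

    ∑-*ʳ : ∀ n x g → ∑ n g * x ≈ ∑ n (λ i → g i * x)
    ∑-*ʳ zero    x g = zeroˡ x
    ∑-*ʳ (suc n) x g = trans (distribʳ x _ _) (+-congˡ (∑-*ʳ n x (g ∘ suc)))

    ∑-swap : ∀ m n (g : ℕ → ℕ → Carrier) → ∑ m (λ i → ∑ n (g i)) ≈ ∑ n (λ j → ∑ m (λ i → g i j))
    ∑-swap zero    n g = sym (∑-zero n (λ _ _ → refl))
    ∑-swap (suc m) n g = trans (+-congˡ (∑-swap m n (g ∘ suc))) (sym (∑-+ n (g 0) (λ j → ∑ m (λ i → g (suc i) j))))

    ∑-const : ∀ n x → ∑ n (λ _ → x) ≈ n ×ᴿ x
    ∑-const zero    x = refl
    ∑-const (suc n) x = +-congˡ (∑-const n x)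

    ∑-split : ∀ a b g → ∑ (a ℕ.+ b) g ≈ ∑ a g + ∑ b (λ i → g (a ℕ.+ i))
    ∑-split zero    b g = sym (+-identityˡ _)
    ∑-split (suc a) b g = trans (+-congˡ (∑-split a b (g ∘ suc))) (sym (+-assoc _ _ _))

    ∑-last : ∀ n g → ∑ (suc n) g ≈ ∑ n g + g n
    ∑-last zero    g = +-comm _ _
    ∑-last (suc n) g = trans (+-congˡ (∑-last n (g ∘ suc))) (sym (+-assoc _ _ _))

    ∑-cyclic₁ : ∀ n g → g n ≈ g 0 → ∑ n (g ∘ suc) ≈ ∑ n g
    ∑-cyclic₁ zero    g eq = refl
    ∑-cyclic₁ (suc n) g eq = begin
      ∑ (suc n) (g ∘ suc)        ≈⟨ ∑-last n (g ∘ suc) ⟩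
      ∑ n (g ∘ suc) + g (suc n)  ≈⟨ +-congˡ eq ⟩
      ∑ n (g ∘ suc) + g 0        ≈⟨ +-comm _ _ ⟩
      ∑ (suc n) g                ∎

    ∑-cyclic : ∀ n g → (∀ i → g (n ℕ.+ i) ≈ g i) → ∀ t → ∑ n (λ i → g (t ℕ.+ i)) ≈ ∑ n g
    ∑-cyclic n g per zero    = refl
    ∑-cyclic n g per (suc t) = begin
      ∑ n (λ i → g (suc t ℕ.+ i))  ≈⟨ ∑-cong n (λ i → reflexive (cong g (≡.sym (ℕ.+-suc t i)))) ⟩
      ∑ n (λ i → g (t ℕ.+ suc i))  ≈⟨ ∑-cyclic₁ n (λ i → g (t ℕ.+ i)) end ⟩
      ∑ n (λ i → g (t ℕ.+ i))      ≈⟨ ∑-cyclic n g per t ⟩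
      ∑ n g                        ∎
      where
      end : g (t ℕ.+ n) ≈ g (t ℕ.+ 0)
      end = begin
        g (t ℕ.+ n)  ≈⟨ reflexive (cong g (ℕ.+-comm t n)) ⟩
        g (n ℕ.+ t)  ≈⟨ per t ⟩
        g t          ≈⟨ reflexive (cong g (ℕ.+-identityʳ t)) ⟨
        g (t ℕ.+ 0)  ∎

    -- Sorts the indices below b a by their residue modulo a; this is how exponents of γ are later
    -- grouped into cyclotomic classes.
    ∑-block : ∀ a b g → ∑ (b ℕ.* a) g ≈ ∑ a (λ i → ∑ b (λ j → g (i ℕ.+ j ℕ.* a)))
    ∑-block a zero    g = sym (∑-zero a (λ _ _ → refl))
    ∑-block a (suc b) g = begin
      ∑ (a ℕ.+ b ℕ.* a) g
        ≈⟨ ∑-split a (b ℕ.* a) g ⟩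
      ∑ a g + ∑ (b ℕ.* a) (λ i → g (a ℕ.+ i))
        ≈⟨ +-cong (∑-cong a (λ i → reflexive (cong g (≡.sym (ℕ.+-identityʳ i)))))
                  (trans (∑-block a b (λ i → g (a ℕ.+ i)))
                         (∑-cong a (λ i → ∑-cong b (λ j → reflexive (cong g (lemma i (j ℕ.* a))))))) ⟩
      ∑ a (λ i → g (i ℕ.+ 0)) + ∑ a (λ i → ∑ b (λ j → g (i ℕ.+ (a ℕ.+ j ℕ.* a))))
        ≈⟨ ∑-+ a _ _ ⟨
      ∑ a (λ i → ∑ (suc b) (λ j → g (i ℕ.+ j ℕ.* a))) ∎
      where
      lemma : ∀ i k → a ℕ.+ (i ℕ.+ k) ≡ i ℕ.+ (a ℕ.+ k)
      lemma i k = ≡.trans (≡.sym (ℕ.+-assoc a i k)) (≡.trans (cong (ℕ._+ k) (ℕ.+-comm a i)) (ℕ.+-assoc i a k))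

    -- Multiplication by a unit u, with inverse v, permutes the residues modulo k, and g depends on
    -- the residue alone.
    ∑-multiply : ∀ k .{{_ : NonZero k}} u v → (u ℕ.* v) % k ≡ 1 % k → (g : ℕ → Carrier) →
                 (∀ i → g (i % k) ≈ g i) → ∑ k (λ j → g (u ℕ.* j)) ≈ ∑ k g
    ∑-multiply k u v uv≡1 g per = begin
      ∑ k (λ j → g (u ℕ.* j))                    ≈⟨ ∑-cong k (λ j → sym (per (u ℕ.* j))) ⟩
      ∑ k (λ j → g ((u ℕ.* j) % k))              ≡⟨ ∑≡sum k _ ⟩
      sum {k} (λ j → g ((u ℕ.* toℕ j) % k))      ≈⟨ sum-cong-≋ {k} (λ i → reflexive (cong g (≡.sym (toℕ-fromℕ< (m%n<n (u ℕ.* toℕ i) k))))) ⟩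
      sum {k} (λ i → g (toℕ (π u i)))            ≈⟨ sum-permute (g ∘ toℕ) perm ⟨
      sum {k} (g ∘ toℕ)                          ≡⟨ ∑≡sum k g ⟨
      ∑ k g                                      ∎
      where
      π : ℕ → Fin k → Fin k
      π w i = fromℕ< (m%n<n (w ℕ.* toℕ i) k)
      inv : ∀ a b → (a ℕ.* b) % k ≡ 1 % k → ∀ i → π a (π b i) ≡ i
      inv a b ab i = toℕ-injective (≡.trans (toℕ-fromℕ< _) (≡.trans (cong (λ x → (a ℕ.* x) % k) (toℕ-fromℕ< _)) eq))
        where
        eq = mod-inverse k a b (toℕ i) (toℕ<n i) ab
      perm : Permutation k k
      perm = permutation (π u) (π v) (inv u v uv≡1) (inv v u (≡.trans (cong (_% k) (ℕ.*-comm v u)) uv≡1))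

  -- If y were missed, punching it out would leave an injection from n + 1 elements into n.
  injective⇒surjective : ∀ {n} (f : Fin n → Fin n) → Injective _≡_ _≡_ f → ∀ y → ∃[ x ] f x ≡ y
  injective⇒surjective {suc n} f inj y with any? (λ x → f x Fin.≟ y)
  ... | yes hit = hit
  ... | no  miss = contradiction (injective⇒≤ {f = g} g-inj) (ℕ.<⇒≱ (ℕ.n<1+n n))
    where
    open import Data.Fin.Base using (punchOut)
    y≢ : ∀ x → ¬ y ≡ f x
    y≢ x eq = miss (x , ≡.sym eq)
    g : Fin (suc n) → Fin n
    g x = punchOut (y≢ x)
    g-inj : Injective _≡_ _≡_ g
    g-inj {a} {b} eq = inj (Fin.punchOut-injective (y≢ a) (y≢ b) eq)

  injective⇒permutation : ∀ {n} (f : Fin n → Fin n) → Injective _≡_ _≡_ f → Permutation n n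
  injective⇒permutation f inj = permutation f g fg (λ x → inj (fg (f x)))
    where
    g = λ y → proj₁ (injective⇒surjective f inj y)
    fg : ∀ y → f (g y) ≡ y
    fg y = proj₂ (injective⇒surjective f inj y)

  module SumHom {c₁ ℓ₁ c₂ ℓ₂} (R : CommutativeSemiring c₁ ℓ₁) (S : CommutativeSemiring c₂ ℓ₂) where
    private
      module R = CommutativeSemiring R
      module S = CommutativeSemiring S

    ∑-homo : (h : R.Carrier → S.Carrier) → h R.0# S.≈ S.0# →
             (∀ x y → h (x R.+ y) S.≈ h x S.+ h y) →
             ∀ n (g : ℕ → R.Carrier) → h (Sum.∑ R n g) S.≈ Sum.∑ S n (h ∘ g)
    ∑-homo h h0 h+ zero    g = h0
    ∑-homo h h0 h+ (suc n) g = S.trans (h+ _ _) (S.+-congˡ (∑-homo h h0 h+ n (g ∘ suc)))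

  module Sumᶻ = Sum (CommutativeRing.commutativeSemiring ℤ.+-*-commutativeRing)

-- Orders and orbits modulo prime powers

module Arithmetic where

  open import Data.Fin.Base using (Fin; toℕ; fromℕ<)
  open import Data.Fin.Properties using (toℕ<n; toℕ-fromℕ<; toℕ-injective)
  open import Data.Nat.Base
  open import Data.Nat.Divisibility
  open import Data.Nat.DivMod
  open import Data.Nat.Primality using (Prime; euclidsLemma; prime⇒nonZero; prime⇒nonTrivial)
  open import Data.Nat.Properties
  open import Data.Nat.Tactic.RingSolver using (solve-∀)
  open import Data.Product.Base using (_,_; ∃-syntax; proj₂)
  open import Data.Sum.Base using (inj₁; inj₂)
  open import Relation.Binary.Definitions using (tri<; tri≈; tri>)
  open import Relation.Binary.PropositionalEquality
  open import Relation.Nullary.Decidable using (yes; no)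
  open import Relation.Nullary.Negation using (¬_; contradiction)

  open FiniteSums
  open Sum +-*-commutativeSemiring

  module _ {n : ℕ} .{{_ : NonZero n}} where

    *-cong-mod : ∀ {a a′ b b′} → a % n ≡ a′ % n → b % n ≡ b′ % n → (a * b) % n ≡ (a′ * b′) % n
    *-cong-mod {a} {a′} {b} {b′} p q = begin
      (a * b) % n                  ≡⟨ %-distribˡ-* a b n ⟩
      ((a % n) * (b % n)) % n      ≡⟨ cong₂ (λ x y → (x * y) % n) p q ⟩
      ((a′ % n) * (b′ % n)) % n    ≡⟨ %-distribˡ-* a′ b′ n ⟨
      (a′ * b′) % n                ∎
      where open ≡-Reasoning

    ^-cong-mod : ∀ {a b} → a % n ≡ b % n → ∀ j → (a ^ j) % n ≡ (b ^ j) % n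
    ^-cong-mod p zero    = refl
    ^-cong-mod p (suc j) = *-cong-mod p (^-cong-mod p j)

    ^-mod-one : ∀ {a} → a % n ≡ 1 % n → ∀ j → (a ^ j) % n ≡ 1 % n
    ^-mod-one p j = trans (^-cong-mod p j) (cong (_% n) (^-zeroˡ j))

    mod-difference : ∀ a b → a % n ≡ b % n → n ∣ b ∸ a
    mod-difference a b p = divides (b / n ∸ a / n) (begin
      b ∸ a                                      ≡⟨ cong₂ _∸_ (m≡m%n+[m/n]*n b n) (m≡m%n+[m/n]*n a n) ⟩
      (b % n + b / n * n) ∸ (a % n + a / n * n)  ≡⟨ cong (λ x → (b % n + b / n * n) ∸ (x + a / n * n)) p ⟩
      (b % n + b / n * n) ∸ (b % n + a / n * n)  ≡⟨ [m+n]∸[m+o]≡n∸o (b % n) _ _ ⟩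
      b / n * n ∸ a / n * n                      ≡⟨ *-distribʳ-∸ n (b / n) (a / n) ⟨
      (b / n ∸ a / n) * n                        ∎)
      where open ≡-Reasoning

    quotient-of-one : 1 < n → ∀ x → x % n ≡ 1 % n → ∃[ y ] x ≡ 1 + n * y
    quotient-of-one 1<n x p = x / n , (begin
      x                  ≡⟨ m≡m%n+[m/n]*n x n ⟩
      x % n + x / n * n  ≡⟨ cong₂ _+_ (trans p (m<n⇒m%n≡m 1<n)) (*-comm (x / n) n) ⟩
      1 + n * (x / n)    ∎)
      where open ≡-Reasoning

  mod-one : ∀ n .{{_ : NonZero n}} y → (1 + n * y) % n ≡ 1 % n
  mod-one n y = trans (cong (λ z → (1 + z) % n) (*-comm n y)) ([m+kn]%n≡m%n 1 y n)

  module PrimePowers {p : ℕ} (pp : Prime p) where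
    private instance
      p≢0 : NonZero p
      p≢0 = prime⇒nonZero pp

    ∤-^ : ∀ {a} → ¬ p ∣ a → ∀ i → ¬ p ∣ a ^ i
    ∤-^ p∤a zero    d = p∤1 d
      where
      p∤1 : ¬ p ∣ 1
      p∤1 d = contradiction (∣⇒≤ d) (<⇒≱ (nonTrivial⇒n>1 p {{prime⇒nonTrivial pp}}))
    ∤-^ {a} p∤a (suc i) d with euclidsLemma a (a ^ i) pp d
    ... | inj₁ d′ = p∤a d′
    ... | inj₂ d′ = ∤-^ p∤a i d′

    cancel-prime-power : ∀ k x y → ¬ p ∣ x → p ^ k ∣ x * y → p ^ k ∣ y
    cancel-prime-power zero    x y p∤x d = 1∣ y
    cancel-prime-power (suc k) x y p∤x d with euclidsLemma x y pp (∣-trans (m∣m*n (p ^ k)) d)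
    ... | inj₁ p∣x = contradiction p∣x p∤x
    ... | inj₂ (divides-refl y′) =
      subst (p ^ suc k ∣_) (*-comm p y′) (*-monoʳ-∣ p (cancel-prime-power k x y′ p∤x (*-cancelˡ-∣ p (subst (p ^ suc k ∣_) (shuffle p x y′) d))))
      where
      shuffle : ∀ p x y → x * (y * p) ≡ p * (x * y)
      shuffle = solve-∀

  -- tri l is the binomial coefficient l choose 2.
  tri : ℕ → ℕ
  tri zero    = 0
  tri (suc l) = l + tri l

  -- The binomial theorem to second order. The quadratic coefficient is kept explicit because z²
  -- alone is not divisible enough in the first lifting step, whereas z³ always is.
  power-expansion : ∀ z l → ∃[ w ] (1 + z) ^ l ≡ 1 + l * z + tri l * (z * z) + z * z * z * w
  power-expansion z zero    = 0 , cong suc (sym (*-zeroʳ (z * z * z)))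
  power-expansion z (suc l) with w , eq ← power-expansion z l =
    w + tri l + z * w , trans (cong ((1 + z) *_) eq) (collect z l (tri l) w)
    where
    collect : ∀ z l t w → (1 + z) * (1 + l * z + t * (z * z) + z * z * z * w) ≡
                        1 + (1 + l) * z + (l + t) * (z * z) + z * z * z * (w + t + z * w)
    collect = solve-∀

  module Lifting {p : ℕ} (pp : Prime p) (c : ℕ) (tri-p : tri p ≡ p * c)
                 (a d v₀ : ℕ) (a≡ : a ≡ 1 + p * (d + p * v₀)) (p∤d : ¬ p ∣ d) where
    open PrimePowers pp
    private instance
      nonZero-p : NonZero p
      nonZero-p = prime⇒nonZero pp

    -- Each p-th power multiplies the deviation from 1 by p and keeps its leading coefficient d
    -- modulo p. For k = 0 the term z² carries only p² where p³ is wanted; `tri-p` supplies the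
    -- missing factor.
    power-p^k : ∀ k → ∃[ v ] a ^ (p ^ k) ≡ 1 + p ^ suc k * (d + p * v)
    power-p^k zero    = v₀ , trans (*-identityʳ a) (trans a≡ (cong (λ x → 1 + x * (d + p * v₀)) (sym (*-identityʳ p))))
    power-p^k (suc k) = let v , eq = power-p^k k in step v eq (power-expansion (p ^ suc k * (d + p * v)) p)
      where
      open ≡-Reasoning
      collect : ∀ p c M u w → let z = p * M * u in
                1 + p * z + p * c * (z * z) + z * z * z * w ≡
                1 + p * (p * M) * (u + p * (c * M * (u * u) + M * M * (u * u * u) * w))
      collect = solve-∀
      regroup : ∀ d p v x y → d + p * v + p * (x + y) ≡ d + p * (v + x + y)
      regroup = solve-∀
      M = p ^ k
      step : ∀ v → a ^ (p ^ k) ≡ 1 + p ^ suc k * (d + p * v) →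
             (let z = p ^ suc k * (d + p * v) in ∃[ w ] (1 + z) ^ p ≡ 1 + p * z + tri p * (z * z) + z * z * z * w) →
             ∃[ v′ ] a ^ (p ^ suc k) ≡ 1 + p ^ suc (suc k) * (d + p * v′)
      step v eq (w , exp) = _ , (begin
        a ^ (p * M)                                         ≡⟨ cong (a ^_) (*-comm p M) ⟩
        a ^ (M * p)                                         ≡⟨ ^-*-assoc a M p ⟨
        (a ^ M) ^ p                                         ≡⟨ cong (_^ p) eq ⟩
        (1 + z) ^ p                                         ≡⟨ exp ⟩
        1 + p * z + tri p * (z * z) + z * z * z * w         ≡⟨ cong (λ x → 1 + p * z + x * (z * z) + z * z * z * w) tri-p ⟩
        1 + p * z + p * c * (z * z) + z * z * z * w         ≡⟨ collect p c M u w ⟩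
        1 + p * (p * M) * (u + p * (c * M * (u * u) + M * M * (u * u * u) * w))
          ≡⟨ cong (λ x → 1 + p * (p * M) * x) (regroup d p v _ _) ⟩
        1 + p * (p * M) * (d + p * (v + c * M * (u * u) + M * M * (u * u * u) * w)) ∎)
        where
        u = d + p * v
        z = p * M * u

    -- If e = l p^k, then a^e ≡ 1 + p^(k+1) d l modulo p^(k+2). As d is a unit modulo p, the
    -- hypothesis at the next level forces p ∣ l.
    order-divides : ∀ k e → ∃[ y ] a ^ e ≡ 1 + p ^ suc k * y → p ^ k ∣ e
    order-divides zero    e _       = 1∣ e
    order-divides (suc k) e (y , eqy) with order-divides k e (p * y , trans eqy (cong suc (shuffle p (p ^ k) y)))
      where
      shuffle : ∀ p M y → p * (p * M) * y ≡ p * M * (p * y)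
      shuffle = solve-∀
    ... | divides-refl l = let v , eq = power-p^k k in step v eq (power-expansion (p ^ suc k * (d + p * v)) l)
      where
      open ≡-Reasoning
      M = p ^ k
      collect : ∀ p M u w l t → let z = p * M * u in
                1 + l * z + t * (z * z) + z * z * z * w ≡
                1 + (p * M) * (u * l + p * (t * M * (u * u) + M * z * (u * u) * w))
      collect = solve-∀
      regroup : ∀ d p v l x y → (d + p * v) * l + p * (x + y) ≡ p * (v * l + x + y) + d * l
      regroup = solve-∀
      shuffle : ∀ p M y → (p * M) * (p * y) ≡ p * (p * M) * y
      shuffle = solve-∀
      shuffle′ : ∀ p l M → l * p * M ≡ l * (p * M)
      shuffle′ = solve-∀
      step : ∀ v → a ^ (p ^ k) ≡ 1 + p ^ suc k * (d + p * v) →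
             (let z = p ^ suc k * (d + p * v) in ∃[ w ] (1 + z) ^ l ≡ 1 + l * z + tri l * (z * z) + z * z * z * w) →
             p ^ suc k ∣ l * p ^ k
      step v eq (w , exp) with euclidsLemma d l pp p∣dl
        where
        u = d + p * v
        z = p * M * u
        p*y≡ : p * y ≡ p * (v * l + tri l * M * (u * u) + M * z * (u * u) * w) + d * l
        p*y≡ = *-cancelˡ-≡ _ _ (p * M) {{m^n≢0 p (suc k)}} (suc-injective (begin
          1 + (p * M) * (p * y)                        ≡⟨ cong suc (shuffle p M y) ⟩
          1 + p * (p * M) * y                          ≡⟨ eqy ⟨
          a ^ (l * M)                                  ≡⟨ cong (a ^_) (*-comm l M) ⟩
          a ^ (M * l)                                  ≡⟨ ^-*-assoc a M l ⟨
          (a ^ M) ^ l                                  ≡⟨ cong (_^ l) eq ⟩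
          (1 + z) ^ l                                  ≡⟨ exp ⟩
          1 + l * z + tri l * (z * z) + z * z * z * w  ≡⟨ collect p M u w l (tri l) ⟩
          1 + (p * M) * (u * l + p * (tri l * M * (u * u) + M * z * (u * u) * w))
            ≡⟨ cong (λ x → 1 + p * M * x) (regroup d p v l _ _) ⟩
          1 + (p * M) * (p * (v * l + tri l * M * (u * u) + M * z * (u * u) * w) + d * l) ∎))
        p∣dl : p ∣ d * l
        p∣dl = ∣m+n∣m⇒∣n (subst (p ∣_) p*y≡ (m∣m*n y)) (m∣m*n _)
      ... | inj₁ p∣d = contradiction p∣d p∤d
      ... | inj₂ (divides-refl l′) = divides l′ (shuffle′ p l′ M)

    module Orbits (k : ℕ) where
      M N : ℕ
      M = p ^ k
      N = p ^ suc k

      instance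
        M≢0 : NonZero M
        M≢0 = m^n≢0 p k
        N≢0 : NonZero N
        N≢0 = m^n≢0 p (suc k)

      1<N : 1 < N
      1<N = <-≤-trans (nonTrivial⇒n>1 p {{prime⇒nonTrivial pp}}) (m≤m*n p M)

      p∤a : ¬ p ∣ a
      p∤a p∣a = ∤-^ (λ p∣1 → <⇒≱ (nonTrivial⇒n>1 p {{prime⇒nonTrivial pp}}) (∣⇒≤ p∣1)) 1
                    (∣m+n∣m⇒∣n (subst (p ∣_) (trans a≡ (+-comm 1 _)) p∣a) (m∣m*n (d + p * v₀)))

      a≡1[mod-p] : a % p ≡ 1 % p
      a≡1[mod-p] = trans (cong (_% p) a≡) (mod-one p (d + p * v₀))

      a^M≡1 : (a ^ M) % N ≡ 1 % N
      a^M≡1 = trans (cong (_% N) (proj₂ (power-p^k k))) (mod-one N _)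

      module Orbit (u : ℕ) (p∤u : ¬ p ∣ u) where

        point : ℕ → ℕ
        point j = (a ^ j * u) % N

        point<N : ∀ j → point j < N
        point<N j = m%n<n (a ^ j * u) N

        point-mod-p : ∀ j → point j % p ≡ u % p
        point-mod-p j = begin
          (a ^ j * u) % N % p  ≡⟨ m∣n⇒o%n%m≡o%m p N (a ^ j * u) (m∣m*n M) ⟩
          (a ^ j * u) % p      ≡⟨ *-cong-mod {p} {a ^ j} {1} {u} (^-mod-one {p} {a} a≡1[mod-p] j) refl ⟩
          (1 * u) % p          ≡⟨ cong (_% p) (*-identityˡ u) ⟩
          u % p                ∎
          where open ≡-Reasoning

        -- The number a^i u is prime to p, so a coincidence modulo N gives a^(j-i) ≡ 1, and
        -- `order-divides` would make M divide j - i, although 0 < j - i < M.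
        point-distinct : ∀ {i j} → i < j → j < M → ¬ point i ≡ point j
        point-distinct {i} {j} i<j j<M eq = <⇒≱ (≤-<-trans (m∸n≤m j i) j<M) (∣⇒≤ {{>-nonZero (m<n⇒0<n∸m i<j)}} M∣j∸i)
          where
          open ≡-Reasoning
          e = j ∸ i
          difference : a ^ j * u ∸ a ^ i * u ≡ a ^ i * u * (a ^ e ∸ 1)
          difference = begin
            a ^ j * u ∸ a ^ i * u                  ≡⟨ cong (λ x → a ^ x * u ∸ a ^ i * u) (m+[n∸m]≡n (<⇒≤ i<j)) ⟨
            a ^ (i + e) * u ∸ a ^ i * u            ≡⟨ cong (λ x → x * u ∸ a ^ i * u) (^-distribˡ-+-* a i e) ⟩
            a ^ i * a ^ e * u ∸ a ^ i * u          ≡⟨ cong₂ _∸_ (shuffle (a ^ i) (a ^ e) u) (sym (*-identityʳ (a ^ i * u))) ⟩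
            a ^ i * u * a ^ e ∸ a ^ i * u * 1      ≡⟨ *-distribˡ-∸ (a ^ i * u) (a ^ e) 1 ⟨
            a ^ i * u * (a ^ e ∸ 1)                ∎
            where
            shuffle : ∀ x y z → x * y * z ≡ x * z * y
            shuffle = solve-∀
          p∤a^iu : ¬ p ∣ a ^ i * u
          p∤a^iu p∣ with euclidsLemma (a ^ i) u pp p∣
          ... | inj₁ p∣a^i = ∤-^ p∤a i p∣a^i
          ... | inj₂ p∣u   = p∤u p∣u
          N∣ : N ∣ a ^ e ∸ 1
          N∣ = cancel-prime-power (suc k) (a ^ i * u) (a ^ e ∸ 1) p∤a^iu
                 (subst (N ∣_) difference (mod-difference {N} (a ^ i * u) (a ^ j * u) eq))
          a≢0 : NonZero a
          a≢0 = ≢-nonZero λ { refl → p∤a (p ∣0) }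
          M∣j∸i : M ∣ j ∸ i
          M∣j∸i = order-divides k e (quotient N∣ , (begin
            a ^ e                    ≡⟨ m+[n∸m]≡n (m^n>0 a {{a≢0}} e) ⟨
            1 + (a ^ e ∸ 1)          ≡⟨ cong suc (_∣_.equality N∣) ⟩
            1 + quotient N∣ * N      ≡⟨ cong suc (*-comm (quotient N∣) N) ⟩
            1 + N * quotient N∣      ∎))

        point-injective : ∀ {i j} → i < M → j < M → point i ≡ point j → i ≡ j
        point-injective {i} {j} i<M j<M eq with <-cmp i j
        ... | tri< i<j _ _ = contradiction eq (point-distinct i<j j<M)
        ... | tri≈ _ i≡j _ = i≡j
        ... | tri> _ _ j<i = contradiction (sym eq) (point-distinct j<i i<M)

        -- All points agree modulo p, so a point is determined by its quotient by p, of which there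
        -- are M. Injectivity then makes the orbit the whole residue class of u modulo p.
        level-fin : Fin M → Fin M
        level-fin j = fromℕ< (m<n*o⇒m/o<n {point (toℕ j)} {M} {p} (subst (point (toℕ j) <_) (*-comm p M) (point<N (toℕ j))))

        toℕ-level : ∀ j → toℕ (level-fin j) ≡ point (toℕ j) / p
        toℕ-level j = toℕ-fromℕ< _

        same-level : ∀ {x y} → x % p ≡ y % p → x / p ≡ y / p → x ≡ y
        same-level {x} {y} r q = trans (m≡m%n+[m/n]*n x p) (trans (cong₂ (λ s t → s + t * p) r q) (sym (m≡m%n+[m/n]*n y p)))

        level-injective : ∀ {i j} → level-fin i ≡ level-fin j → i ≡ j
        level-injective {i} {j} eq = toℕ-injective (point-injective (toℕ<n i) (toℕ<n j)
          (same-level (trans (point-mod-p (toℕ i)) (sym (point-mod-p (toℕ j))))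
                      (trans (sym (toℕ-level i)) (trans (cong toℕ eq) (toℕ-level j)))))

        orbit-surjective : ∀ w → w % p ≡ u % p → ∃[ j ] point j ≡ w % N
        orbit-surjective w w≡u with injective⇒surjective level-fin level-injective
                                      (fromℕ< (m<n*o⇒m/o<n {w % N} {M} {p} (subst (w % N <_) (*-comm p M) (m%n<n w N))))
        ... | j , eq = toℕ j , same-level
          (trans (point-mod-p (toℕ j)) (sym (trans (m∣n⇒o%n%m≡o%m p N w (m∣m*n M)) w≡u)))
          (trans (sym (toℕ-level j)) (trans (cong toℕ eq) (toℕ-fromℕ< _)))

        -- The orbit is a full residue class modulo p, whose members below N are u % p + p j with j
        -- < M.
        orbit-sum : ∑ M point ≡ M * (u % p) + p * ∑ M (λ j → j)
        orbit-sum = begin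
          ∑ M point                                      ≡⟨ ∑-cong M (λ j → trans (m≡m%n+[m/n]*n (point j) p) (cong₂ _+_ (point-mod-p j) (*-comm (point j / p) p))) ⟩
          ∑ M (λ j → u % p + p * (point j / p))          ≡⟨ ∑-+ M (λ _ → u % p) (λ j → p * (point j / p)) ⟩
          ∑ M (λ _ → u % p) + ∑ M (λ j → p * (point j / p))
            ≡⟨ cong₂ _+_ (∑-constant M (u % p)) (sym (∑-*ˡ M p (λ j → point j / p))) ⟩
          M * (u % p) + p * ∑ M (λ j → point j / p)      ≡⟨ cong (λ x → M * (u % p) + p * x) levels ⟩
          M * (u % p) + p * ∑ M (λ j → j)                ∎
          where
          open ≡-Reasoning
          ∑-constant : ∀ m x → ∑ m (λ _ → x) ≡ m * x
          ∑-constant zero    x = refl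
          ∑-constant (suc m) x = cong (x +_) (∑-constant m x)
          levels : ∑ M (λ j → point j / p) ≡ ∑ M (λ j → j)
          levels = begin
            ∑ M (λ j → point j / p)                          ≡⟨ ∑≡sum M _ ⟩
            sum {M} (λ j → point (toℕ j) / p)                ≡⟨ sum-cong-≋ (λ j → sym (toℕ-level j)) ⟩
            sum {M} (λ j → toℕ (level-fin j))                ≡⟨ sum-permute {M} toℕ (injective⇒permutation level-fin level-injective) ⟨
            sum {M} toℕ                                      ≡⟨ ∑≡sum M (λ j → j) ⟨
            ∑ M (λ j → j)                                    ∎

    -- Factors p are stripped from t until it is prime to p, which happens in time because p^k does
    -- not divide t. There the orbit is a whole residue class modulo p and contains the shifted
    -- number. Multiplying by p again scales the shift and the modulus alike.
    orbit-shift : ∀ k t → ¬ p ^ k ∣ t → ∀ s →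
                  ∃[ j ] (let open Orbits k in (a ^ j * t) % N ≡ (t + M * s) % N)
    orbit-shift zero    t M∤t s = contradiction (1∣ t) M∤t
    orbit-shift (suc k) t M∤t s with p ∣? t
    ... | no p∤t = Orbit.orbit-surjective t p∤t (t + M * s)
            (trans (cong (λ x → (t + x) % p) (trans (*-assoc p (p ^ k) s) (*-comm p (p ^ k * s)))) ([m+kn]%n≡m%n t (p ^ k * s) p))
      where open Orbits (suc k)
    ... | yes (divides-refl t′) with j , eq ← orbit-shift k t′ (λ d → M∤t (subst (_∣ t′ * p) (*-comm (p ^ k) p) (*-monoˡ-∣ p d))) s
      = j , (begin
        (a ^ j * (t′ * p)) % N                ≡⟨ cong (_% N) (*-assoc (a ^ j) t′ p) ⟨
        (a ^ j * t′ * p) % N                  ≡⟨ scale (a ^ j * t′) ⟨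
        (a ^ j * t′) % p ^ suc k * p          ≡⟨ cong (_* p) eq ⟩
        (t′ + p ^ k * s) % p ^ suc k * p      ≡⟨ scale (t′ + p ^ k * s) ⟩
        ((t′ + p ^ k * s) * p) % N            ≡⟨ cong (_% N) (shuffle t′ (p ^ k) s p) ⟩
        (t′ * p + M * s) % N                  ∎)
      where
      open ≡-Reasoning
      open Orbits (suc k)
      instance
        _ = m^n≢0 p (suc k)
        _ = m*n≢0 (p ^ suc k) p
      scale : ∀ x → x % p ^ suc k * p ≡ (x * p) % N
      scale x = trans (m%n*o≡m*o%[n*o] x (p ^ suc k) p) (%-congʳ {o = x * p} (*-comm (p ^ suc k) p))
      shuffle : ∀ t M s p → (t + M * s) * p ≡ t * p + p * M * s
      shuffle = solve-∀

-- The numerical data attached to 11 and 43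

module NumericalData where

  open import Data.Fin.Base using (Fin; toℕ; fromℕ<)
  open import Data.Fin.Properties using (toℕ-fromℕ<) renaming (all? to allFin?)
  open import Data.Nat.Base
  open import Data.Nat.Coprimality using (Coprime; coprime?; coprime-divisor)
  open import Data.Nat.Divisibility
  open import Data.Nat.DivMod
  open import Data.Nat.Primality using (Prime; prime?; euclidsLemma; prime⇒nonZero; prime⇒nonTrivial)
  open import Data.Nat.Properties
  open import Data.Nat.Tactic.RingSolver using (solve-∀)
  open import Data.Product.Base using (_,_; ∃-syntax; proj₁; proj₂)
  open import Data.Sum.Base using (inj₁; inj₂)
  open import Relation.Binary.PropositionalEquality
  open import Relation.Nullary.Decidable using (from-yes; from-no)
  open import Relation.Nullary.Negation using (¬_)

  open FiniteSums
  open Arithmetic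
  open Sum +-*-commutativeSemiring

  -- Here n = q − 1 and κ = (q − 1) / (r N).  The numbers 11, 10 and 43 enter only through
  -- equations, because sums and powers of literal length would be unfolded by conversion checking.
  record Constants : Set where
    field
      p r ℓ M N f θ κ n : ℕ
      p≡11       : p ≡ 11
      r≡10       : r ≡ 10
      ℓ≡43       : ℓ ≡ 43
      {{M≢0}}    : NonZero M
      {{N≢0}}    : NonZero N
      N≡ℓM       : N ≡ ℓ * M
      p^f≡1+n    : p ^ f ≡ suc n
      n≡Nrκ      : n ≡ N * (r * κ)
      f≡1+2θ     : f ≡ 1 + 2 * θ
      0<θ        : 0 < θ
      p^θ+2      : ∃[ x ] p ^ θ + 2 ≡ ℓ * x
      p^f≡1      : (p ^ f) % N ≡ 1 % N
      orbit      : ∀ t → ¬ M ∣ t → ∀ s → ∃[ i ] (p ^ i * t) % N ≡ (t + M * s) % N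
      residues   : ∀ a → 0 < a → a < ℓ → N * θ ≤ ∑ f (λ i → (p ^ i * a) % N)

  power-of-1+x : ∀ x f → ∃[ y ] (1 + x) ^ f ≡ 1 + x * y
  power-of-1+x x zero    = 0 , cong suc (sym (*-zeroʳ x))
  power-of-1+x x (suc f) with y , eq ← power-of-1+x x f = 1 + y + x * y , trans (cong ((1 + x) *_) eq) (expand x y)
    where
    expand : ∀ x y → (1 + x) * (1 + x * y) ≡ 1 + x * (1 + y + x * y)
    expand = solve-∀

  cancel-coprime-power : ∀ {d p} → Coprime d p → ∀ k {x} → d ∣ p ^ k * x → d ∣ x
  cancel-coprime-power {d} {p} cop zero    {x} h = subst (d ∣_) (+-identityʳ x) h
  cancel-coprime-power {d} {p} cop (suc k) {x} h = cancel-coprime-power cop k (coprime-divisor cop (subst (d ∣_) (*-assoc p (p ^ k) x) h))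

  gauss : ∀ m → 2 * ∑ m (λ j → j) + m ≡ m * m
  gauss zero    = refl
  gauss (suc m) = begin
    2 * ∑ (suc m) (λ j → j) + suc m     ≡⟨ cong (λ x → 2 * x + suc m) (∑-last m (λ j → j)) ⟩
    2 * (∑ m (λ j → j) + m) + suc m     ≡⟨ expand (∑ m (λ j → j)) m ⟩
    2 * ∑ m (λ j → j) + m + (1 + 2 * m) ≡⟨ cong (_+ (1 + 2 * m)) (gauss m) ⟩
    m * m + (1 + 2 * m)                 ≡⟨ square m ⟩
    suc m * suc m                       ∎
    where
    open ≡-Reasoning
    expand : ∀ s m → 2 * (s + m) + (1 + m) ≡ 2 * s + m + (1 + 2 * m)
    expand = solve-∀
    square : ∀ m → m * m + (1 + 2 * m) ≡ (1 + m) * (1 + m)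
    square = solve-∀

  ∑-constant : ∀ m x → ∑ m (λ _ → x) ≡ m * x
  ∑-constant zero    x = refl
  ∑-constant (suc m) x = cong (x +_) (∑-constant m x)

  -- The quotients d + ℓ v₀ and x₀ witness p^c ≡ 1 and p^c′ ≡ −2 (mod ℓ); the class sums are
  -- those of the cosets of ⟨p⟩ in (ℤ/ℓ)ˣ.
  record Base : Set where
    field
      p r ℓ c c′ ℓ′ C d v₀ x₀ : ℕ
      p≡11       : p ≡ 11
      r≡10       : r ≡ 10
      ℓ≡43       : ℓ ≡ 43
      p≡1+r      : p ≡ 1 + r
      c≡         : c ≡ 1 + 2 * c′
      ℓ≡         : ℓ ≡ 1 + 2 * ℓ′
      ℓ-prime    : Prime ℓ
      tri-ℓ      : tri ℓ ≡ ℓ * C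
      p^c≡       : p ^ c ≡ 1 + ℓ * (d + ℓ * v₀)
      ℓ∤d        : ¬ ℓ ∣ d
      ℓ∤p        : ¬ ℓ ∣ p
      r-coprime  : Coprime r ℓ
      c-order    : ∀ e → ∃[ y ] p ^ e ≡ 1 + ℓ * y → c ∣ e
      0<c′       : 0 < c′
      p^c′+2     : p ^ c′ + 2 ≡ ℓ * x₀
      class-sums : ∀ a → 0 < a → a < ℓ → let instance _ = prime⇒nonZero ℓ-prime in
                   c′ * ℓ ≤ ∑ c (λ i → (p ^ i * a) % ℓ)

  module Numbers (B : Base) (k : ℕ) where
    open Base B

    module L = Lifting ℓ-prime C tri-ℓ (p ^ c) d v₀ p^c≡ ℓ∤d
    open L.Orbits k public

    instance
      ℓ≢0 : NonZero ℓ
      ℓ≢0 = prime⇒nonZero ℓ-prime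

    1<ℓ : 1 < ℓ
    1<ℓ = nonTrivial⇒n>1 ℓ {{prime⇒nonTrivial ℓ-prime}}

    half : ℕ → ℕ
    half zero    = 0
    half (suc k) = ℓ′ + ℓ * half k

    ℓ^k≡1+2half : ∀ k → ℓ ^ k ≡ 1 + 2 * half k
    ℓ^k≡1+2half zero    = refl
    ℓ^k≡1+2half (suc k) = begin
      ℓ * ℓ ^ k                    ≡⟨ cong (ℓ *_) (ℓ^k≡1+2half k) ⟩
      ℓ * (1 + 2 * half k)         ≡⟨ expand ℓ (half k) ⟩
      ℓ + 2 * (ℓ * half k)         ≡⟨ cong (_+ 2 * (ℓ * half k)) ℓ≡ ⟩
      1 + 2 * ℓ′ + 2 * (ℓ * half k) ≡⟨ regroup ℓ′ (ℓ * half k) ⟩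
      1 + 2 * (ℓ′ + ℓ * half k)    ∎
      where
      open ≡-Reasoning
      expand : ∀ l h → l * (1 + 2 * h) ≡ l + 2 * (l * h)
      expand = solve-∀
      regroup : ∀ a b → 1 + 2 * a + 2 * b ≡ 1 + 2 * (a + b)
      regroup = solve-∀

    f θ : ℕ
    f = M * c
    θ = c′ + c * half k

    p^[i+cj] : ∀ i j a → p ^ (i + j * c) * a ≡ (p ^ c) ^ j * (p ^ i * a)
    p^[i+cj] i j a = begin
      p ^ (i + j * c) * a        ≡⟨ cong (_* a) (^-distribˡ-+-* p i (j * c)) ⟩
      p ^ i * p ^ (j * c) * a    ≡⟨ cong (λ x → p ^ i * p ^ x * a) (*-comm j c) ⟩
      p ^ i * p ^ (c * j) * a    ≡⟨ cong (λ x → p ^ i * x * a) (^-*-assoc p c j) ⟨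
      p ^ i * (p ^ c) ^ j * a    ≡⟨ shuffle (p ^ i) ((p ^ c) ^ j) a ⟩
      (p ^ c) ^ j * (p ^ i * a)  ∎
      where
      open ≡-Reasoning
      shuffle : ∀ x y z → x * y * z ≡ y * (x * z)
      shuffle = solve-∀

    p^cj : ∀ j → p ^ (c * j) ≡ (p ^ c) ^ j
    p^cj j = sym (^-*-assoc p c j)

    p^f≡1 : (p ^ f) % N ≡ 1 % N
    p^f≡1 = trans (cong (λ x → (p ^ x) % N) (*-comm M c)) (trans (cong (_% N) (p^cj M)) a^M≡1)

    -- Modulo ℓ the order is c, so e = e′ c, and the lifted order of p^c gives M ∣ e′.
    order-minimal : ∀ e → (p ^ e) % N ≡ 1 % N → f ∣ e
    order-minimal e eq with c-order e (let y , eqy = quotient-of-one {N} 1<N (p ^ e) eq in M * y , trans eqy (cong suc (*-assoc ℓ M y)))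
    ... | divides-refl e′ = *-monoˡ-∣ c (L.order-divides k e′ (quotient-of-one {N} 1<N _
            (trans (cong (_% N) (trans (sym (p^cj e′)) (cong (p ^_) (*-comm c e′)))) eq)))

    f≡1+2θ : f ≡ 1 + 2 * θ
    f≡1+2θ = begin
      M * c                              ≡⟨ cong (_* c) (ℓ^k≡1+2half k) ⟩
      (1 + 2 * half k) * c               ≡⟨ expand (half k) c ⟩
      c + 2 * (c * half k)               ≡⟨ cong (_+ 2 * (c * half k)) c≡ ⟩
      1 + 2 * c′ + 2 * (c * half k)      ≡⟨ regroup c′ (c * half k) ⟩
      1 + 2 * (c′ + c * half k)          ∎
      where
      open ≡-Reasoning
      expand : ∀ h c → (1 + 2 * h) * c ≡ c + 2 * (c * h)
      expand = solve-∀
      regroup : ∀ a b → 1 + 2 * a + 2 * b ≡ 1 + 2 * (a + b)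
      regroup = solve-∀

    -- Exponents are written i + j c. For fixed i, the numbers with varying j form the orbit of p^i
    -- a under p^c, a complete residue class modulo ℓ. The whole sum is therefore M times a class
    -- sum modulo ℓ plus a term independent of a.
    residue-sum : ∀ a → 0 < a → a < ℓ → N * θ ≤ ∑ f (λ i → (p ^ i * a) % N)
    residue-sum a 0<a a<ℓ = begin
      N * θ                                                    ≡⟨ closed-form ⟩
      M * (c′ * ℓ) + c * (ℓ * S)                               ≤⟨ +-monoˡ-≤ _ (*-monoʳ-≤ M (class-sums a 0<a a<ℓ)) ⟩
      M * ∑ c residue + c * (ℓ * S)                            ≡⟨ cong₂ _+_ (∑-*ˡ c M residue) (sym (∑-constant c (ℓ * S))) ⟩
      ∑ c (λ i → M * residue i) + ∑ c (λ _ → ℓ * S)            ≡⟨ ∑-+ c (λ i → M * residue i) (λ _ → ℓ * S) ⟨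
      ∑ c (λ i → M * residue i + ℓ * S)                        ≡⟨ ∑-cong c (λ i → Orbit.orbit-sum (p ^ i * a) (ℓ∤ i)) ⟨
      ∑ c (λ i → ∑ M (Orbit.point (p ^ i * a) (ℓ∤ i)))         ≡⟨ ∑-cong c (λ i → ∑-cong M (λ j → cong (_% N) (p^[i+cj] i j a))) ⟨
      ∑ c (λ i → ∑ M (λ j → (p ^ (i + j * c) * a) % N))        ≡⟨ ∑-block c M (λ i → (p ^ i * a) % N) ⟨
      ∑ f (λ i → (p ^ i * a) % N)                              ∎
      where
      open ≤-Reasoning
      S : ℕ
      S = ∑ M (λ j → j)
      residue : ℕ → ℕ
      residue i = (p ^ i * a) % ℓ
      ℓ∤ : ∀ i → ¬ ℓ ∣ p ^ i * a
      ℓ∤ i d with euclidsLemma (p ^ i) a ℓ-prime d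
      ... | inj₁ d′ = PrimePowers.∤-^ ℓ-prime ℓ∤p i d′
      ... | inj₂ d′ = <⇒≱ a<ℓ (∣⇒≤ {{>-nonZero 0<a}} d′)
      closed-form : N * θ ≡ M * (c′ * ℓ) + c * (ℓ * S)
      closed-form = *-cancelˡ-≡ _ _ 2 (+-cancelʳ-≡ (ℓ * M) _ _ (E.begin
        2 * (ℓ * M * θ) + ℓ * M                       E.≡⟨ step₁ ℓ M θ ⟩
        ℓ * M * (1 + 2 * θ)                           E.≡⟨ cong (ℓ * M *_) f≡1+2θ ⟨
        ℓ * M * (M * c)                               E.≡⟨ step₂ ℓ M c ⟩
        c * ℓ * (M * M)                               E.≡⟨ cong (c * ℓ *_) (gauss M) ⟨
        c * ℓ * (2 * S + M)                           E.≡⟨ step₃ c ℓ S M ⟩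
        2 * (c * (ℓ * S)) + c * (ℓ * M)               E.≡⟨ cong (λ x → 2 * (c * (ℓ * S)) + x * (ℓ * M)) c≡ ⟩
        2 * (c * (ℓ * S)) + (1 + 2 * c′) * (ℓ * M)    E.≡⟨ step₄ (c * (ℓ * S)) c′ ℓ M ⟩
        2 * (M * (c′ * ℓ) + c * (ℓ * S)) + ℓ * M      E.∎))
        where
        module E = ≡-Reasoning
        step₁ : ∀ l M θ → 2 * (l * M * θ) + l * M ≡ l * M * (1 + 2 * θ)
        step₁ = solve-∀
        step₂ : ∀ l M c → l * M * (M * c) ≡ c * l * (M * M)
        step₂ = solve-∀
        step₃ : ∀ c l S M → c * l * (2 * S + M) ≡ 2 * (c * (l * S)) + c * (l * M)
        step₃ = solve-∀
        step₄ : ∀ x c l M → 2 * x + (1 + 2 * c) * (l * M) ≡ 2 * (M * (c * l) + x) + l * M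
        step₄ = solve-∀

    orbit : ∀ t → ¬ M ∣ t → ∀ s → ∃[ i ] (p ^ i * t) % N ≡ (t + M * s) % N
    orbit t M∤t s with j , eq ← L.orbit-shift k t M∤t s = c * j , trans (cong (λ x → (x * t) % N) (p^cj j)) eq

    -- Since p^c ≡ 1 (mod ℓ) and θ ≡ c′ (mod c), the power p^θ is congruent to p^c′ ≡ -2.
    p^θ+2 : ∃[ x ] p ^ θ + 2 ≡ ℓ * x
    p^θ+2 with y , eq ← quotient-of-one {ℓ} 1<ℓ ((p ^ c) ^ half k) (^-mod-one {ℓ} {p ^ c} a≡1[mod-p] (half k)) =
      x₀ + p ^ c′ * y , (begin
        p ^ (c′ + c * half k) + 2          ≡⟨ cong (_+ 2) (^-distribˡ-+-* p c′ (c * half k)) ⟩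
        p ^ c′ * p ^ (c * half k) + 2      ≡⟨ cong (λ x → p ^ c′ * x + 2) (p^cj (half k)) ⟩
        p ^ c′ * (p ^ c) ^ half k + 2      ≡⟨ cong (λ x → p ^ c′ * x + 2) eq ⟩
        p ^ c′ * (1 + ℓ * y) + 2           ≡⟨ expand (p ^ c′) ℓ y ⟩
        p ^ c′ + 2 + ℓ * (p ^ c′ * y)      ≡⟨ cong (_+ ℓ * (p ^ c′ * y)) p^c′+2 ⟩
        ℓ * x₀ + ℓ * (p ^ c′ * y)          ≡⟨ *-distribˡ-+ ℓ x₀ (p ^ c′ * y) ⟨
        ℓ * (x₀ + p ^ c′ * y)              ∎)
      where
      open ≡-Reasoning
      expand : ∀ a l y → a * (1 + l * y) + 2 ≡ a + 2 + l * (a * y)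
      expand = solve-∀

    -- r = p - 1 divides p^f - 1 and is coprime to N, so it survives the division by N. The quotient
    -- κ is the number of cosets of the prime field units in one cyclotomic class.
    group-order : ∃[ κ ] p ^ f ≡ suc (N * (r * κ))
    group-order with u , eq ← quotient-of-one {N} 1<N (p ^ f) p^f≡1 | y , eq′ ← power-of-1+x r f
      with divides κ refl ← cancel-coprime-power r-coprime (suc k)
             (subst (r ∣_) (suc-injective (trans (sym eq′) (trans (cong (_^ f) (sym p≡1+r)) eq))) (m∣m*n y)) = κ , trans eq (cong (λ x → suc (N * x)) (*-comm κ r))

    N∣p^f∸1 : N ∣ p ^ f ∸ 1
    N∣p^f∸1 = divides (r * proj₁ group-order) (trans (cong (_∸ 1) (proj₂ group-order)) (*-comm N _))

    constants : Constants
    constants = record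
      { p = p ; r = r ; ℓ = ℓ ; M = M ; N = N ; f = f ; θ = θ ; κ = proj₁ group-order ; n = N * (r * proj₁ group-order)
      ; p≡11 = p≡11 ; r≡10 = r≡10 ; ℓ≡43 = ℓ≡43 ; M≢0 = M≢0 ; N≢0 = N≢0 ; N≡ℓM = refl
      ; p^f≡1+n = proj₂ group-order ; n≡Nrκ = refl ; f≡1+2θ = f≡1+2θ ; 0<θ = ≤-trans 0<c′ (m≤m+n c′ _)
      ; p^θ+2 = p^θ+2 ; p^f≡1 = p^f≡1 ; orbit = orbit ; residues = residue-sum }

  order-mod-43 : ∀ e → ∃[ y ] 11 ^ e ≡ 1 + 43 * y → 7 ∣ e
  order-mod-43 e (y , eq) = m%n≡0⇒n∣m e 7 (check (e % 7) (m%n<n e 7) (trans (sym reduce) (trans (cong (_% 43) eq) (mod-one 43 y))))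
    where
    open ≡-Reasoning
    power-of-11^7 : ∀ j → (11 ^ (j * 7)) % 43 ≡ 1
    power-of-11^7 j = begin
      (11 ^ (j * 7)) % 43    ≡⟨ cong (λ x → (11 ^ x) % 43) (*-comm j 7) ⟩
      (11 ^ (7 * j)) % 43    ≡⟨ cong (_% 43) (^-*-assoc 11 7 j) ⟨
      ((11 ^ 7) ^ j) % 43    ≡⟨ ^-mod-one {43} {11 ^ 7} refl j ⟩
      1                      ∎
    reduce : (11 ^ e) % 43 ≡ (11 ^ (e % 7)) % 43
    reduce = begin
      (11 ^ e) % 43                              ≡⟨ cong (λ x → (11 ^ x) % 43) (m≡m%n+[m/n]*n e 7) ⟩
      (11 ^ (e % 7 + e / 7 * 7)) % 43            ≡⟨ cong (_% 43) (^-distribˡ-+-* 11 (e % 7) (e / 7 * 7)) ⟩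
      (11 ^ (e % 7) * 11 ^ (e / 7 * 7)) % 43     ≡⟨ *-cong-mod {43} {11 ^ (e % 7)} {11 ^ (e % 7)} {11 ^ (e / 7 * 7)} {1} refl (power-of-11^7 (e / 7)) ⟩
      (11 ^ (e % 7) * 1) % 43                    ≡⟨ cong (_% 43) (*-identityʳ (11 ^ (e % 7))) ⟩
      (11 ^ (e % 7)) % 43                        ∎
    check : ∀ r → r < 7 → (11 ^ r) % 43 ≡ 1 → r ≡ 0
    check 0 _ _ = refl
    check 1 _ ()
    check 2 _ ()
    check 3 _ ()
    check 4 _ ()
    check 5 _ ()
    check 6 _ ()
    check (suc (suc (suc (suc (suc (suc (suc _))))))) (s<s (s<s (s<s (s<s (s<s (s<s (s<s ()))))))) _

  -- 129 = 3 · 43. Every coset sum is a multiple of 43, and opposite cosets add up to 7 · 43, so no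
  -- larger uniform bound can hold. All 42 nonzero residues are checked.
  class-sums-43 : ∀ a → 0 < a → a < 43 → 129 ≤ ∑ 7 (λ i → (11 ^ i * a) % 43)
  class-sums-43 (suc a) _ (s<s a<42) = subst (λ b → 129 ≤ ∑ 7 (λ i → (11 ^ i * suc b) % 43)) (toℕ-fromℕ< a<42) (check (fromℕ< a<42))
    where
    check : ∀ (a : Fin 42) → 129 ≤ ∑ 7 (λ i → (11 ^ i * suc (toℕ a)) % 43)
    check = from-yes (allFin? (λ (a : Fin 42) → 129 ≤? ∑ 7 (λ i → (11 ^ i * suc (toℕ a)) % 43)))

  base : Base
  base = record
    -- 11^7 = 1 + 43 (13 + 43 · 10539), so 11^7 is 1 modulo 43 but not modulo 43²; 11^3 + 2 = 43 ·
    -- 31; and 43 choose 2 is 43 · 21.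
    { p = 11 ; r = 10 ; ℓ = 43 ; c = 7 ; c′ = 3 ; ℓ′ = 21 ; C = 21 ; d = 13 ; v₀ = 10539 ; x₀ = 31
    ; p≡11 = refl ; r≡10 = refl ; ℓ≡43 = refl ; p≡1+r = refl ; c≡ = refl ; ℓ≡ = refl
    ; ℓ-prime = from-yes (prime? 43) ; tri-ℓ = refl ; p^c≡ = refl ; ℓ∤d = from-no (43 ∣? 13)
    ; ℓ∤p = from-no (43 ∣? 11) ; r-coprime = from-yes (coprime? 10 43) ; c-order = order-mod-43
    ; 0<c′ = s≤s z≤n ; p^c′+2 = refl ; class-sums = class-sums-43 }

-- Euler's totient at prime powers

module Totient where

  open import Data.Empty using (⊥-elim)
  open import Data.List.Base using (length; filter; map; upTo; applyUpTo)
  open import Data.List.Properties using (map-applyUpTo)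
  open import Data.Nat.Base
  open import Data.Nat.Coprimality using (Coprime; coprime?)
  open import Data.Nat.Divisibility
  open import Data.Nat.Primality using (Prime; prime⇒nonZero; prime⇒nonTrivial)
  open import Data.Nat.Properties
  open import Data.Product.Base using (_,_)
  open import Function.Base using (_∘_; id)
  open import Relation.Binary.PropositionalEquality
  open import Relation.Nullary.Decidable using (Dec; yes; no)
  open import Relation.Nullary.Negation using (¬_; contradiction)
  open import Relation.Unary using (Pred; Decidable)

  open FiniteSums
  open Arithmetic
  open NumericalData using (∑-constant)
  open Sum +-*-commutativeSemiring

  indicator : ∀ {a} {A : Set a} → Dec A → ℕ
  indicator (yes _) = 1
  indicator (no _)  = 0

  length-filter : ∀ {ℓ} {P : Pred ℕ ℓ} (P? : Decidable P) (g : ℕ → ℕ) n →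
                  length (filter P? (applyUpTo g n)) ≡ ∑ n (λ i → indicator (P? (g i)))
  length-filter P? g zero    = refl
  length-filter P? g (suc n) with P? (g 0)
  ... | yes _ = cong suc (length-filter P? (g ∘ suc) n)
  ... | no _  = length-filter P? (g ∘ suc) n

  module _ {p : ℕ} (pp : Prime p) (k : ℕ) where
    private instance
      p≢0 : NonZero p
      p≢0 = prime⇒nonZero pp
      M≢0 : NonZero (p ^ k)
      M≢0 = m^n≢0 p k
      N≢0 : NonZero (p ^ suc k)
      N≢0 = m^n≢0 p (suc k)
    open PrimePowers pp

    -- A common divisor d is prime to p, so in p^(k+1) = e d the full prime power divides e, which
    -- leaves d = 1.
    ∤⇒coprime : ∀ {x} → ¬ p ∣ x → Coprime x (p ^ suc k)
    ∤⇒coprime {x} p∤x {d} (d∣x , divides e eq) with cancel-prime-power (suc k) d e (λ p∣d → p∤x (∣-trans p∣d d∣x))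
                                                     (subst (p ^ suc k ∣_) (trans eq (*-comm e d)) ∣-refl)
    ... | divides y refl = m*n≡1⇒m≡1 d y (*-cancelʳ-≡ (d * y) 1 (p ^ suc k)
            (trans (*-assoc d y (p ^ suc k)) (trans (*-comm d (y * p ^ suc k)) (trans (sym eq) (sym (*-identityˡ (p ^ suc k)))))))

    coprime⇒∤ : ∀ {x} → Coprime x (p ^ suc k) → ¬ p ∣ x
    coprime⇒∤ cop p∣x = <⇒≢ (nonTrivial⇒n>1 p {{prime⇒nonTrivial pp}}) (sym (cop (p∣x , m∣m*n (p ^ k))))

    δ : ℕ → ℕ
    δ x = indicator (coprime? x (p ^ suc k))

    δ-∤ : ∀ {x} → ¬ p ∣ x → δ x ≡ 1
    δ-∤ {x} p∤x with coprime? x (p ^ suc k)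
    ... | yes _   = refl
    ... | no ¬cop = ⊥-elim (¬cop (∤⇒coprime p∤x))

    δ-∣ : ∀ {x} → p ∣ x → δ x ≡ 0
    δ-∣ {x} p∣x with coprime? x (p ^ suc k)
    ... | yes cop = contradiction p∣x (coprime⇒∤ cop)
    ... | no _    = refl

    totient-prime-power : φ (p ^ suc k) ≡ pred p * p ^ k
    totient-prime-power = begin
      length (filter (λ x → coprime? x N) (map suc (upTo N)))
        ≡⟨ cong (length ∘ filter (λ x → coprime? x N)) (map-applyUpTo id suc N) ⟩
      length (filter (λ x → coprime? x N) (applyUpTo suc N))
        ≡⟨ length-filter (λ x → coprime? x N) suc N ⟩
      ∑ N (λ i → δ (suc i))
        ≡⟨ cong (λ x → ∑ x (λ i → δ (suc i))) (*-comm p (p ^ k)) ⟩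
      ∑ (p ^ k * p) (λ i → δ (suc i))
        ≡⟨ ∑-block p (p ^ k) (λ i → δ (suc i)) ⟩
      ∑ p (λ i → ∑ (p ^ k) (λ j → δ (suc (i + j * p))))
        ≡⟨ cong (λ x → ∑ x (λ i → ∑ (p ^ k) (λ j → δ (suc (i + j * p))))) (suc-pred p) ⟨
      ∑ (suc (pred p)) (λ i → ∑ (p ^ k) (λ j → δ (suc (i + j * p))))
        ≡⟨ ∑-last (pred p) (λ i → ∑ (p ^ k) (λ j → δ (suc (i + j * p)))) ⟩
      ∑ (pred p) (λ i → ∑ (p ^ k) (λ j → δ (suc (i + j * p)))) + ∑ (p ^ k) (λ j → δ (suc (pred p + j * p)))
        ≡⟨ cong₂ _+_ (∑-cong< (pred p) (λ i i<p → ∑-cong (p ^ k) (λ j → δ-∤ (not-multiple i j i<p))))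
                     (∑-zero (p ^ k) (λ j _ → δ-∣ (multiple j))) ⟩
      ∑ (pred p) (λ i → ∑ (p ^ k) (λ j → 1)) + 0
        ≡⟨ +-identityʳ _ ⟩
      ∑ (pred p) (λ i → ∑ (p ^ k) (λ j → 1))
        ≡⟨ ∑-constant (pred p) _ ⟩
      pred p * ∑ (p ^ k) (λ j → 1)
        ≡⟨ cong (pred p *_) (trans (∑-constant (p ^ k) 1) (*-identityʳ (p ^ k))) ⟩
      pred p * p ^ k ∎
      where
      open ≡-Reasoning
      N = p ^ suc k
      -- Counting starts at 1: index i + j p stands for the number i + j p + 1, so the multiples of
      -- p sit in the last residue `pred p`.
      multiple : ∀ j → p ∣ suc (pred p + j * p)
      multiple j = divides (suc j) (cong (_+ j * p) (suc-pred p))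
      not-multiple : ∀ i j → i < pred p → ¬ p ∣ suc (i + j * p)
      not-multiple i j i<p d = <⇒≱ (subst (suc i <_) (suc-pred p) (s<s i<p)) (∣⇒≤ (∣m+n∣m⇒∣n (subst (p ∣_) (+-comm (suc i) (j * p)) d) (n∣m*n j)))

-- The cyclic multiplicative group of a finite field

module CyclicField where

  open import Algebra.Bundles using (CommutativeRing; CommutativeSemiring)
  open import Data.Fin.Base using (Fin; zero; suc; toℕ; fromℕ<)
  open import Data.Fin.Permutation using (Permutation)
  open import Data.Fin.Properties using (toℕ<n; toℕ-fromℕ<; toℕ-injective; pigeonhole; injective⇒≤)
  import Data.Fin.Properties as Fin
  open import Data.Nat.Base as ℕ using (ℕ; zero; suc; _<_; _≤_; z<s; _∸_; NonZero)
  open import Data.Nat.DivMod using (_%_; _/_; m%n<n; m≡m%n+[m/n]*n)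
  import Data.Nat.Properties as ℕ
  open import Data.Product.Base using (_,_; ∃-syntax; _×_; proj₁; proj₂)
  open import Data.Sum.Base using (inj₁; inj₂)
  open import Function.Bundles using (Inverse)
  open import Function.Definitions using (Injective)
  open import Relation.Binary.Definitions using (Decidable; tri<; tri≈; tri>)
  open import Relation.Binary.PropositionalEquality as ≡ using (_≡_)
  open import Relation.Nullary.Decidable using (yes; no)
  open import Relation.Nullary.Negation using (¬_; contradiction)
  import Relation.Unary as U

  open FiniteSums

  least : ∀ {p} {P : ℕ → Set p} → U.Decidable P → ∀ b → P b → ∃[ o ] P o × (∀ j → j < o → ¬ P j)
  least {P = P} P? b Pb = search b 0 (λ _ ()) (≡.subst P (≡.sym (ℕ.+-identityʳ b)) Pb)
    where
    search : ∀ fuel i → (∀ j → j < i → ¬ P j) → P (fuel ℕ.+ i) → ∃[ o ] P o × (∀ j → j < o → ¬ P j)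
    search zero       i below Pi = i , Pi , below
    search (suc fuel) i below Pb with P? i
    ... | yes Pi = i , Pi , below
    ... | no ¬Pi = search fuel (suc i) below′ (≡.subst P (≡.sym (ℕ.+-suc fuel i)) Pb)
      where
      below′ : ∀ j → j < suc i → ¬ P j
      below′ j j<1+i Pj with ℕ.m<1+n⇒m<n∨m≡n j<1+i
      ... | inj₁ j<i    = below j j<i Pj
      ... | inj₂ ≡.refl = ¬Pi Pj

  module Cyclic {c ℓ} (F : CommutativeRing c ℓ) {q : ℕ} (ff : IsFiniteField F q)
                (γ : CommutativeRing.Carrier F) (γ-primitive : IsPrimitiveElement F γ) where
    open CommutativeRing F hiding (zero)
    open IsFiniteField ff
    open import Algebra.Properties.CommutativeSemiring.Exp commutativeSemiring
    open import Relation.Binary.Reasoning.Setoid setoid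
    open Inverse cardinality using (to; from; to-cong; from-cong; strictlyInverseˡ; strictlyInverseʳ)

    to-injective : ∀ {x y} → to x ≡ to y → x ≈ y
    to-injective {x} {y} eq = trans (sym (strictlyInverseʳ x)) (trans (from-cong eq) (strictlyInverseʳ y))

    infix 4 _≟_
    _≟_ : Decidable _≈_
    x ≟ y with to x Fin.≟ to y
    ... | yes eq = yes (to-injective eq)
    ... | no neq = no (λ x≈y → neq (to-cong x≈y))

    inverse-of : ∀ x → ¬ x ≈ 0# → ∃[ y ] x * y ≈ 1#
    inverse-of = inverse

    cancelˡ : ∀ x {y z} → ¬ x ≈ 0# → x * y ≈ x * z → y ≈ z
    cancelˡ x {y} {z} x≉0 eq with x′ , xx′ ← inverse x x≉0 = begin
      y              ≈⟨ *-identityˡ y ⟨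
      1# * y         ≈⟨ *-congʳ (trans (*-comm x′ x) xx′) ⟨
      x′ * x * y     ≈⟨ *-assoc x′ x y ⟩
      x′ * (x * y)   ≈⟨ *-congˡ eq ⟩
      x′ * (x * z)   ≈⟨ *-assoc x′ x z ⟨
      x′ * x * z     ≈⟨ *-congʳ (trans (*-comm x′ x) xx′) ⟩
      1# * z         ≈⟨ *-identityˡ z ⟩
      z              ∎

    xy≈0⇒y≈0 : ∀ x {y} → ¬ x ≈ 0# → x * y ≈ 0# → y ≈ 0#
    xy≈0⇒y≈0 x x≉0 eq = cancelˡ x x≉0 (trans eq (sym (zeroʳ x)))

    *-≉0 : ∀ {x y} → ¬ x ≈ 0# → ¬ y ≈ 0# → ¬ x * y ≈ 0#
    *-≉0 {x} x≉0 y≉0 eq = y≉0 (xy≈0⇒y≈0 x x≉0 eq)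

    1≉0 : ¬ 1# ≈ 0#
    1≉0 eq = 0≉1 (sym eq)

    ^-≉0 : ∀ {x} → ¬ x ≈ 0# → ∀ i → ¬ x ^ i ≈ 0#
    ^-≉0 x≉0 zero    = 1≉0
    ^-≉0 x≉0 (suc i) = *-≉0 x≉0 (^-≉0 x≉0 i)

    γ≉0 : ¬ γ ≈ 0#
    γ≉0 = proj₁ γ-primitive

    γ^≉0 : ∀ i → ¬ γ ^ i ≈ 0#
    γ^≉0 = ^-≉0 γ≉0

    γ^-difference : ∀ {i j} → i ≤ j → γ ^ i ≈ γ ^ j → γ ^ (j ∸ i) ≈ 1#
    γ^-difference {i} {j} i≤j eq = cancelˡ (γ ^ i) (γ^≉0 i) (begin
      γ ^ i * γ ^ (j ∸ i)    ≈⟨ ^-homo-* γ i (j ∸ i) ⟨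
      γ ^ (i ℕ.+ (j ∸ i))    ≈⟨ ^-congʳ γ (ℕ.m+[n∸m]≡n i≤j) ⟩
      γ ^ j                  ≈⟨ eq ⟨
      γ ^ i                  ≈⟨ *-identityʳ (γ ^ i) ⟨
      γ ^ i * 1#             ∎)

    1^ : ∀ i → 1# ^ i ≈ 1#
    1^ zero    = refl
    1^ (suc i) = trans (*-identityˡ _) (1^ i)

    γ^-multiple : ∀ {o} → γ ^ o ≈ 1# → ∀ i j → γ ^ (i ℕ.+ j ℕ.* o) ≈ γ ^ i
    γ^-multiple {o} γ^o≈1 i j = begin
      γ ^ (i ℕ.+ j ℕ.* o)     ≈⟨ ^-homo-* γ i (j ℕ.* o) ⟩
      γ ^ i * γ ^ (j ℕ.* o)   ≈⟨ *-congˡ (^-congʳ γ (ℕ.*-comm j o)) ⟩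
      γ ^ i * γ ^ (o ℕ.* j)   ≈⟨ *-congˡ (^-assocʳ γ o j) ⟨
      γ ^ i * (γ ^ o) ^ j     ≈⟨ *-congˡ (trans (^-congˡ j γ^o≈1) (1^ j)) ⟩
      γ ^ i * 1#              ≈⟨ *-identityʳ (γ ^ i) ⟩
      γ ^ i                   ∎

    record IsOrder (n : ℕ) : Set ℓ where
      field
        0<n      : 0 < n
        γ^n≈1    : γ ^ n ≈ 1#
        distinct : ∀ {i j} → i < j → j < n → ¬ γ ^ i ≈ γ ^ j

    -- Two of q + 1 powers of γ coincide, so some positive power is 1. The search is for o with
    -- γ^(1+o) ≈ 1, which excludes the exponent 0; leastness separates the lower powers.
    has-order : ∃[ o ] IsOrder o
    has-order with i , j , i<j , eq ← pigeonhole (ℕ.n<1+n q) (λ i → to (γ ^ toℕ i))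
      with o , γ^[1+o]≈1 , min ← least {P = λ o → γ ^ suc o ≈ 1#} (λ o → γ ^ suc o ≟ 1#) (ℕ.pred (toℕ j ∸ toℕ i))
             (trans (^-congʳ γ (ℕ.suc-pred (toℕ j ∸ toℕ i) {{ℕ.>-nonZero (ℕ.m<n⇒0<n∸m i<j)}}))
                    (γ^-difference (ℕ.<⇒≤ i<j) (to-injective eq)))
      = suc o , record { 0<n = z<s ; γ^n≈1 = γ^[1+o]≈1 ; distinct = distinct }
      where
      distinct : ∀ {i j} → i < j → j < suc o → ¬ γ ^ i ≈ γ ^ j
      distinct {i} {j} i<j j<1+o eq = min (ℕ.pred (j ∸ i))
        (ℕ.≤-trans (ℕ.≤-reflexive (ℕ.suc-pred (j ∸ i) {{ℕ.>-nonZero (ℕ.m<n⇒0<n∸m i<j)}})) (ℕ.≤-trans (ℕ.m∸n≤m j i) (ℕ.s≤s⁻¹ j<1+o)))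
        (trans (^-congʳ γ (ℕ.suc-pred (j ∸ i) {{ℕ.>-nonZero (ℕ.m<n⇒0<n∸m i<j)}})) (γ^-difference (ℕ.<⇒≤ i<j) eq))

    -- The enumeration 0, 1, γ, γ², ... replaces the one given with the field, so that a sum over F
    -- splits into a term at 0 and a sum over exponents.
    element : ∀ {o} → Fin (suc o) → Carrier
    element zero    = 0#
    element (suc i) = γ ^ toℕ i

    module Order {n : ℕ} (isOrder : IsOrder n) where
      open IsOrder isOrder

      instance
        n≢0 : NonZero n
        n≢0 = ℕ.>-nonZero 0<n

      γ^-injective : ∀ {i j} → i < n → j < n → γ ^ i ≈ γ ^ j → i ≡ j
      γ^-injective {i} {j} i<n j<n eq with ℕ.<-cmp i j
      ... | tri< i<j _ _ = contradiction eq (distinct i<j j<n)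
      ... | tri≈ _ i≡j _ = i≡j
      ... | tri> _ _ j<i = contradiction (sym eq) (distinct j<i i<n)

      γ^-% : ∀ i → γ ^ (i % n) ≈ γ ^ i
      γ^-% i = trans (sym (γ^-multiple γ^n≈1 (i % n) (i / n))) (^-congʳ γ (≡.sym (m≡m%n+[m/n]*n i n)))

      γ^-mod : ∀ {i j} → γ ^ i ≈ γ ^ j → i % n ≡ j % n
      γ^-mod {i} {j} eq = γ^-injective (m%n<n i n) (m%n<n j n) (trans (γ^-% i) (trans eq (sym (γ^-% j))))

      log : ∀ x → ¬ x ≈ 0# → ∃[ e ] e < n × x ≈ γ ^ e
      log x x≉0 with k , x≈γ^k ← proj₂ γ-primitive x x≉0 = k % n , m%n<n k n , trans x≈γ^k (sym (γ^-% k))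

      index : Carrier → Fin (suc n)
      index x with x ≟ 0#
      ... | yes _  = zero
      ... | no x≉0 = suc (fromℕ< (proj₁ (proj₂ (log x x≉0))))

      element-index : ∀ x → element (index x) ≈ x
      element-index x with x ≟ 0#
      ... | yes x≈0 = sym x≈0
      ... | no x≉0 = trans (^-congʳ γ (toℕ-fromℕ< (proj₁ (proj₂ (log x x≉0))))) (sym (proj₂ (proj₂ (log x x≉0))))

      element-injective : ∀ {i j : Fin (suc n)} → element i ≈ element j → i ≡ j
      element-injective {zero}  {zero}  eq = ≡.refl
      element-injective {zero}  {suc j} eq = contradiction (sym eq) (γ^≉0 (toℕ j))
      element-injective {suc i} {zero}  eq = contradiction eq (γ^≉0 (toℕ i))
      element-injective {suc i} {suc j} eq = ≡.cong suc (toℕ-injective (γ^-injective (toℕ<n i) (toℕ<n j) eq))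

      index-cong : ∀ {x y} → x ≈ y → index x ≡ index y
      index-cong {x} {y} eq = element-injective (trans (element-index x) (trans eq (sym (element-index y))))

      index-element : ∀ i → index (element i) ≡ i
      index-element i = element-injective (element-index (element i))

      -- The given enumeration of F and the one by powers of γ inject into each other.
      q≡1+n : q ≡ suc n
      q≡1+n = ℕ.≤-antisym (injective⇒≤ {f = λ i → index (from i)} down) (injective⇒≤ {f = λ i → to (element i)} up)
        where
        down : Injective _≡_ _≡_ (λ i → index (from i))
        down {i} {j} eq = ≡.trans (≡.sym (strictlyInverseˡ i)) (≡.trans (to-cong (trans (sym (element-index (from i)))
                            (trans (reflexive (≡.cong element eq)) (element-index (from j))))) (strictlyInverseˡ j))
        up : Injective _≡_ _≡_ (λ i → to (element i))
        up eq = element-injective (to-injective eq)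

    order≡ : ∀ {n} → q ≡ suc n → IsOrder n
    order≡ q≡1+n with o , isOrder ← has-order = ≡.subst IsOrder (ℕ.suc-injective (≡.trans (≡.sym (Order.q≡1+n isOrder)) q≡1+n)) isOrder

-- Sums over a finite field

module FieldSums where

  open import Algebra.Bundles using (CommutativeRing)
  open import Data.Fin.Base using (Fin; zero; suc; toℕ)
  open import Data.Fin.Permutation using (Permutation; permutation)
  import Data.Fin.Properties as Fin
  open import Data.Nat.Base as ℕ using (ℕ; zero; suc)
  open import Data.Product.Base using (_,_)
  open import Function.Base using (_∘_)
  open import Relation.Binary.PropositionalEquality as ≡ using (_≡_)
  open import Relation.Nullary.Decidable using (Dec; yes; no)
  open import Relation.Nullary.Negation using (¬_; contradiction)

  open FiniteSums
  open CyclicField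

  module FieldSum {c ℓ} (F : CommutativeRing c ℓ) {q : ℕ} (ff : IsFiniteField F q)
                  (γ : CommutativeRing.Carrier F) (γ-primitive : IsPrimitiveElement F γ)
                  {n : ℕ} (isOrder : Cyclic.IsOrder F ff γ γ-primitive n)
                  {c′ ℓ′} (R : CommutativeRing c′ ℓ′) where
    open Cyclic F ff γ γ-primitive using (_≟_; inverse-of)
    open Cyclic.Order F ff γ γ-primitive isOrder
    private
      module F = CommutativeRing F
      module R = CommutativeRing R
      open import Algebra.Properties.Semiring.Exp F.semiring using (_^_)
    open R using (_≈_; _+_; _*_; 0#; 1#)
    open import Relation.Binary.Reasoning.Setoid R.setoid
    open Sum R.commutativeSemiring

    el : Fin (suc n) → F.Carrier
    el = Cyclic.element F ff γ γ-primitive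

    Congruent : (F.Carrier → R.Carrier) → Set _
    Congruent g = ∀ {x y} → x F.≈ y → g x ≈ g y

    ⟦_⟧ : ∀ {a} {A : Set a} → Dec A → R.Carrier
    ⟦ yes _ ⟧ = 1#
    ⟦ no  _ ⟧ = 0#

    ⟦⟧-yes : ∀ {a} {A : Set a} (d : Dec A) → A → ⟦ d ⟧ ≈ 1#
    ⟦⟧-yes (yes _) _ = R.refl
    ⟦⟧-yes (no ¬a) a = contradiction a ¬a

    ⟦⟧-no : ∀ {a} {A : Set a} (d : Dec A) → ¬ A → ⟦ d ⟧ ≈ 0#
    ⟦⟧-no (yes a) ¬a = contradiction a ¬a
    ⟦⟧-no (no _)  _  = R.refl

    ⟦⟧-⇔ : ∀ {a b} {A : Set a} {B : Set b} (d : Dec A) (e : Dec B) → (A → B) → (B → A) → ⟦ d ⟧ ≈ ⟦ e ⟧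
    ⟦⟧-⇔ (yes a) e A→B B→A = R.sym (⟦⟧-yes e (A→B a))
    ⟦⟧-⇔ (no ¬a) e A→B B→A = R.sym (⟦⟧-no e (λ b → ¬a (B→A b)))

    sum-single : ∀ {m} (k : Fin m) (g : Fin m → R.Carrier) → (∀ i → ¬ i ≡ k → g i ≈ 0#) → sum g ≈ g k
    sum-single {suc m} zero g off = begin
      g zero + sum (g ∘ suc)  ≈⟨ R.+-congˡ (sum-cong-≋ (λ i → off (suc i) (λ ()))) ⟩
      g zero + sum {m} (λ _ → 0#) ≈⟨ R.+-congˡ (sum-replicate-zero m) ⟩
      g zero + 0#             ≈⟨ R.+-identityʳ _ ⟩
      g zero                  ∎
    sum-single {suc m} (suc k) g off = begin
      g zero + sum (g ∘ suc)  ≈⟨ R.+-cong (off zero (λ ())) (sum-single k (g ∘ suc) (λ i i≢k → off (suc i) (i≢k ∘ Fin.suc-injective))) ⟩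
      0# + g (suc k)          ≈⟨ R.+-identityˡ _ ⟩
      g (suc k)               ∎

    abstract
      -- Made abstract so that its uses are not unfolded into a fold over `Fin (suc n)`; `ΣF≡` is
      -- the description available outside.
      ΣF : (F.Carrier → R.Carrier) → R.Carrier
      ΣF g = sum {suc n} (g ∘ el)

      ΣF-cong : ∀ {g h} → (∀ x → g x ≈ h x) → ΣF g ≈ ΣF h
      ΣF-cong eq = sum-cong-≋ (λ i → eq (el i))

      ΣF≡ : ∀ g → ΣF g ≡ g F.0# + ∑ n (λ e → g (γ ^ e))
      ΣF≡ g = ≡.cong (g F.0# +_) (≡.sym (∑≡sum n (λ e → g (γ ^ e))))

      ΣF-+ : ∀ g h → ΣF (λ x → g x + h x) ≈ ΣF g + ΣF h
      ΣF-+ g h = ∑-distrib-+ (g ∘ el) (h ∘ el)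

      ΣF-*ˡ : ∀ a g → a * ΣF g ≈ ΣF (λ x → a * g x)
      ΣF-*ˡ a g = *-distribˡ-sum a (g ∘ el)

      ΣF-*ʳ : ∀ a g → ΣF g * a ≈ ΣF (λ x → g x * a)
      ΣF-*ʳ a g = *-distribʳ-sum a (g ∘ el)

      ΣF-swap : ∀ (g : F.Carrier → F.Carrier → R.Carrier) → ΣF (λ x → ΣF (λ y → g x y)) ≈ ΣF (λ y → ΣF (λ x → g x y))
      ΣF-swap g = ∑-comm (λ i j → g (el i) (el j))

      ΣF-∑ : ∀ m (g : F.Carrier → ℕ → R.Carrier) → ΣF (λ x → ∑ m (g x)) ≈ ∑ m (λ i → ΣF (λ x → g x i))
      ΣF-∑ m g = begin
        sum {suc n} (λ i → ∑ m (g (el i)))                   ≈⟨ sum-cong-≋ {suc n} (λ i → R.reflexive (∑≡sum m (g (el i)))) ⟩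
        sum {suc n} (λ i → sum {m} (λ j → g (el i) (toℕ j))) ≈⟨ ∑-comm {suc n} {m} (λ i j → g (el i) (toℕ j)) ⟩
        sum {m} (λ j → sum {suc n} (λ i → g (el i) (toℕ j))) ≡⟨ ∑≡sum m (λ j → sum {suc n} (λ i → g (el i) j)) ⟨
        ∑ m (λ j → sum {suc n} (λ i → g (el i) j))           ∎

      ΣF-reindex : ∀ (σ τ : F.Carrier → F.Carrier) → (∀ {x y} → x F.≈ y → σ x F.≈ σ y) → (∀ {x y} → x F.≈ y → τ x F.≈ τ y) →
                   (∀ x → σ (τ x) F.≈ x) → (∀ x → τ (σ x) F.≈ x) →
                   ∀ {g} → Congruent g → ΣF (λ x → g (σ x)) ≈ ΣF g
      ΣF-reindex σ τ σ-cong τ-cong στ τσ {g} g-cong = begin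
        sum (λ i → g (σ (el i)))                ≈⟨ sum-cong-≋ (λ i → g-cong (F.sym (element-index (σ (el i))))) ⟩
        sum (λ i → g (el (index (σ (el i))))) ≈⟨ sum-permute (g ∘ el) π ⟨
        sum (g ∘ el)                            ∎
        where
        invert : ∀ (α β : F.Carrier → F.Carrier) → (∀ {x y} → x F.≈ y → α x F.≈ α y) → (∀ x → α (β x) F.≈ x) →
                 ∀ i → index (α (el (index (β (el i))))) ≡ i
        invert α β α-cong αβ i = ≡.trans (index-cong (F.trans (α-cong (element-index _)) (αβ (el i)))) (index-element i)
        π : Permutation (suc n) (suc n)
        π = permutation (λ i → index (σ (el i))) (λ i → index (τ (el i)))
                        (invert σ τ σ-cong στ) (invert τ σ τ-cong τσ)

      ΣF-single : ∀ y g → Congruent g → (∀ x → ¬ x F.≈ y → g x ≈ 0#) → ΣF g ≈ g y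
      ΣF-single y g g-cong off = begin
        sum (g ∘ el)      ≈⟨ sum-single (index y) (g ∘ el) (λ i i≢ → off (el i) (λ eq → i≢ (≡.trans (≡.sym (index-element i)) (index-cong eq)))) ⟩
        g (el (index y))  ≈⟨ g-cong (element-index y) ⟩
        g y                    ∎

    ΣF-exp : ∀ g → ΣF g ≈ g F.0# + ∑ n (λ e → g (γ ^ e))
    ΣF-exp g = R.reflexive (ΣF≡ g)

    ΣF-zero : ∀ {g} → (∀ x → g x ≈ 0#) → ΣF g ≈ 0#
    ΣF-zero {g} eq = begin
      ΣF g                       ≈⟨ ΣF-cong (λ x → R.trans (eq x) (R.sym (R.zeroˡ 0#))) ⟩
      ΣF (λ _ → 0# * 0#)         ≈⟨ ΣF-*ˡ 0# (λ _ → 0#) ⟨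
      0# * ΣF (λ _ → 0#)         ≈⟨ R.zeroˡ _ ⟩
      0#                         ∎

    ΣF-δ : ∀ y g → Congruent g → ΣF (λ x → ⟦ x ≟ y ⟧ * g x) ≈ g y
    ΣF-δ y g g-cong = begin
      ΣF (λ x → ⟦ x ≟ y ⟧ * g x)  ≈⟨ ΣF-single y (λ x → ⟦ x ≟ y ⟧ * g x)
                                       (λ {x} {x′} eq → R.*-cong (⟦⟧-⇔ (x ≟ y) (x′ ≟ y) (F.trans (F.sym eq)) (F.trans eq)) (g-cong eq))
                                       (λ x x≉y → R.trans (R.*-congʳ (⟦⟧-no (x ≟ y) x≉y)) (R.zeroˡ _)) ⟩
      ⟦ y ≟ y ⟧ * g y             ≈⟨ R.*-congʳ (⟦⟧-yes (y ≟ y) F.refl) ⟩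
      1# * g y                    ≈⟨ R.*-identityˡ _ ⟩
      g y                         ∎

    ΣF-translate : ∀ a {g} → Congruent g → ΣF (λ x → g (a F.+ x)) ≈ ΣF g
    ΣF-translate a = ΣF-reindex (a F.+_) (F.- a F.+_) F.+-congˡ F.+-congˡ
      (λ x → cancel (F.-‿inverseʳ a) x) (λ x → cancel (F.-‿inverseˡ a) x)
      where
      cancel : ∀ {a b} → a F.+ b F.≈ F.0# → ∀ x → a F.+ (b F.+ x) F.≈ x
      cancel eq x = F.trans (F.sym (F.+-assoc _ _ _)) (F.trans (F.+-congʳ eq) (F.+-identityˡ x))

    ΣF-scale : ∀ {a} → ¬ a F.≈ F.0# → ∀ {g} → Congruent g → ΣF (λ x → g (a F.* x)) ≈ ΣF g
    ΣF-scale {a} a≉0 with b , ab≈1 ← inverse-of a a≉0 = ΣF-reindex (a F.*_) (b F.*_) F.*-congˡ F.*-congˡ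
      (λ x → cancel ab≈1 x) (λ x → cancel (F.trans (F.*-comm b a) ab≈1) x)
      where
      cancel : ∀ {a b} → a F.* b F.≈ F.1# → ∀ x → a F.* (b F.* x) F.≈ x
      cancel eq x = F.trans (F.sym (F.*-assoc _ _ _)) (F.trans (F.*-congʳ eq) (F.*-identityˡ x))

  module FieldSumHom {c ℓ} (F : CommutativeRing c ℓ) {q : ℕ} (ff : IsFiniteField F q)
                     (γ : CommutativeRing.Carrier F) (γ-primitive : IsPrimitiveElement F γ)
                     {n : ℕ} (isOrder : Cyclic.IsOrder F ff γ γ-primitive n)
                     {c₁ ℓ₁ c₂ ℓ₂} (R : CommutativeRing c₁ ℓ₁) (S : CommutativeRing c₂ ℓ₂) where
    private
      module R = CommutativeRing R
      module S = CommutativeRing S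
      module ΣR = FieldSum F ff γ γ-primitive isOrder R
      module ΣS = FieldSum F ff γ γ-primitive isOrder S
    open import Relation.Binary.Reasoning.Setoid S.setoid

    ΣF-homo : (h : R.Carrier → S.Carrier) → h R.0# S.≈ S.0# →
              (∀ x y → h (x R.+ y) S.≈ h x S.+ h y) → ∀ g → h (ΣR.ΣF g) S.≈ ΣS.ΣF (λ x → h (g x))
    ΣF-homo h h0 h+ g = begin
      h (ΣR.ΣF g)                                         ≡⟨ ≡.cong h (ΣR.ΣF≡ g) ⟩
      h (g _ R.+ Sum.∑ R.commutativeSemiring n _)         ≈⟨ h+ _ _ ⟩
      h (g _) S.+ h (Sum.∑ R.commutativeSemiring n _)     ≈⟨ S.+-congˡ (SumHom.∑-homo R.commutativeSemiring S.commutativeSemiring h h0 h+ n _) ⟩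
      h (g _) S.+ Sum.∑ S.commutativeSemiring n _         ≈⟨ ΣS.ΣF-exp (λ x → h (g x)) ⟨
      ΣS.ΣF (λ x → h (g x))                               ∎

-- Characteristic, Frobenius and power sums

module FieldArithmetic where

  open import Algebra.Bundles using (CommutativeRing; CommutativeSemiring)
  open import Data.Fin.Base as Fin using (Fin; toℕ; fromℕ<; inject₁; fromℕ)
  open import Data.Fin.Properties using (toℕ<n; toℕ-fromℕ<; toℕ-inject₁; toℕ-fromℕ) renaming (all? to allFin?)
  open import Data.Integer.Base as ℤ using (ℤ; +_; ∣_∣)
  import Data.Integer.Properties as ℤ
  open import Data.Nat.Base as ℕ using (ℕ; zero; suc; _<_; _≤_; z<s; s<s; _∸_; NonZero)
  open import Data.Nat.Combinatorics using (_C_; nCn≡1)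
  open import Data.Nat.Coprimality as Coprimality using (Coprime; coprime-Bézout; prime⇒coprime)
  open import Data.Nat.Divisibility using (_∣_; divides; _∣?_; ∣⇒≤; m%n≡0⇒n∣m)
  open import Data.Nat.DivMod using (_%_; _/_; m%n<n; m≡m%n+[m/n]*n; [m+kn]%n≡m%n; m<n⇒m%n≡m)
  open import Data.Nat.GCD using (module Bézout)
  open import Data.Nat.Primality using (Prime; prime?; prime⇒nonZero)
  import Data.Nat.Properties as ℕ
  open import Data.Product.Base using (_,_; ∃-syntax; proj₁; proj₂)
  open import Function.Base using (_∘_)
  open import Relation.Binary.Definitions using (tri<; tri≈; tri>)
  open import Relation.Binary.PropositionalEquality as ≡ using (_≡_)
  open import Relation.Nullary.Decidable using (yes; no; from-yes)
  open import Relation.Nullary.Negation using (¬_; contradiction)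

  open FiniteSums
  open NumericalData
  open CyclicField
  open FieldSums

  DividesBinomials : ℕ → Set
  DividesBinomials p = ∀ i → 0 < i → i < p → p ∣ p C i

  11-divides-binomials : DividesBinomials 11
  11-divides-binomials (suc i) _ (s<s i<10) = ≡.subst (λ j → 11 ∣ 11 C suc j) (toℕ-fromℕ< i<10) (check (fromℕ< i<10))
    where
    check : ∀ (i : Fin 10) → 11 ∣ 11 C suc (toℕ i)
    check = from-yes (allFin? (λ (i : Fin 10) → 11 ∣? 11 C suc (toℕ i)))

  module PrimePower {c ℓ} (R : CommutativeRing c ℓ) {p : ℕ} (p∣C : DividesBinomials p) where
    open CommutativeRing R hiding (zero)
    open import Algebra.Properties.CommutativeSemiring.Exp commutativeSemiring
    open import Algebra.Properties.Semiring.Mult semiring renaming (_×_ to _⨯_)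
    open import Algebra.Properties.CommutativeSemiring.Binomial commutativeSemiring using (theorem; binomialExpansion)
    open import Algebra.Properties.Semiring.Sum semiring using (sum; sum-cong-≋; *-distribˡ-sum; sum-init-last)
    open import Relation.Binary.Reasoning.Setoid setoid

    ⨯-sum : ∀ m {k} (g : Fin k → Carrier) → sum (λ i → m ⨯ g i) ≈ m ⨯ sum g
    ⨯-sum m {zero}  g = sym (trans (sym (⨯-assoc-1 m 0#)) (zeroʳ _))
      where
      ⨯-assoc-1 : ∀ m x → (m ⨯ 1#) * x ≈ m ⨯ x
      ⨯-assoc-1 m x = trans (×-assoc-* m 1# x) (×-congʳ m (*-identityˡ x))
    ⨯-sum m {suc k} g = trans (+-congˡ (⨯-sum m (g ∘ Fin.suc))) (sym (×-distrib-+ (g Fin.zero) _ m))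
      where open import Algebra.Properties.CommutativeMonoid.Mult +-commutativeMonoid using (×-distrib-+)

    middle : ∀ x y i → 0 < i → i < p → ∃[ w ] (p C i) ⨯ (x ^ i * y ^ (p ∸ i)) ≈ p ⨯ (x * w)
    middle x y (suc i) 0<i i<p with divides c eq ← p∣C (suc i) 0<i i<p = c ⨯ (x ^ i * y ^ (p ∸ suc i)) , (begin
      (p C suc i) ⨯ (x ^ suc i * y ^ (p ∸ suc i))    ≈⟨ ×-congˡ (≡.trans eq (ℕ.*-comm c p)) ⟩
      (p ℕ.* c) ⨯ (x ^ suc i * y ^ (p ∸ suc i))      ≈⟨ ×-assocˡ _ p c ⟨
      p ⨯ (c ⨯ (x ^ suc i * y ^ (p ∸ suc i)))        ≈⟨ ×-congʳ p (×-congʳ c (*-assoc x (x ^ i) _)) ⟩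
      p ⨯ (c ⨯ (x * (x ^ i * y ^ (p ∸ suc i))))      ≈⟨ ×-congʳ p (×-comm-* c x _) ⟨
      p ⨯ (x * (c ⨯ (x ^ i * y ^ (p ∸ suc i))))      ∎)

    sum-multiple : ∀ x {k} (g : Fin k → Carrier) → (∀ i → ∃[ w ] g i ≈ p ⨯ (x * w)) → ∃[ w ] sum g ≈ p ⨯ (x * w)
    sum-multiple x {k} g multiple = sum (λ i → proj₁ (multiple i)) , (begin
      sum g                                          ≈⟨ sum-cong-≋ {k} (λ i → proj₂ (multiple i)) ⟩
      sum (λ i → p ⨯ (x * proj₁ (multiple i)))       ≈⟨ ⨯-sum p {k} (λ i → x * proj₁ (multiple i)) ⟩
      p ⨯ sum (λ i → x * proj₁ (multiple i))         ≈⟨ ×-congʳ p (*-distribˡ-sum {k} x (λ i → proj₁ (multiple i))) ⟨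
      p ⨯ (x * sum (λ i → proj₁ (multiple i)))       ∎)

    -- The factor x of the middle terms is kept on purpose: with x = `τ` it yields a multiple of p
    -- τ. Over F the whole middle vanishes.
    [x+y]^p : ∀ {r} → p ≡ suc r → ∀ x y → ∃[ w ] (x + y) ^ p ≈ y ^ p + (p ⨯ (x * w) + x ^ p)
    [x+y]^p {r} p≡1+r x y = proj₁ mid , (begin
      (x + y) ^ p                                                      ≈⟨ expansion p ⟩
      binomialExpansion x y p                                          ≈⟨ reflexive (≡.cong (λ m → sum {suc m} (term ∘ toℕ)) p≡1+r) ⟩
      term 0 + sum {suc r} (λ i → term (suc (toℕ i)))                  ≈⟨ +-cong first (sum-init-last {r} (λ i → term (suc (toℕ i)))) ⟩
      y ^ p + (sum {r} (λ i → term (suc (toℕ (inject₁ i)))) + term (suc (toℕ (fromℕ r))))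
        ≈⟨ +-congˡ (+-cong (proj₂ mid) last) ⟩
      y ^ p + (p ⨯ (x * proj₁ mid) + x ^ p)                            ∎)
      where
      term : ℕ → Carrier
      term i = (p C i) ⨯ (x ^ i * y ^ (p ∸ i))
      expansion : ∀ m → (x + y) ^ m ≈ binomialExpansion x y m
      expansion m = theorem m x y
      first : term 0 ≈ y ^ p
      first = trans (×-homo-1 _) (*-identityˡ _)
      last : term (suc (toℕ (fromℕ r))) ≈ x ^ p
      last = begin
        term (suc (toℕ (fromℕ r)))           ≈⟨ reflexive (≡.cong term (≡.trans (≡.cong suc (toℕ-fromℕ r)) (≡.sym p≡1+r))) ⟩
        (p C p) ⨯ (x ^ p * y ^ (p ∸ p))      ≈⟨ ×-cong (nCn≡1 p) (*-congˡ (^-congʳ y (ℕ.n∸n≡0 p))) ⟩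
        1 ⨯ (x ^ p * 1#)                     ≈⟨ trans (×-homo-1 _) (*-identityʳ _) ⟩
        x ^ p                                ∎
      mid : ∃[ w ] sum {r} (λ i → term (suc (toℕ (inject₁ i)))) ≈ p ⨯ (x * w)
      mid = sum-multiple x {r} _ (λ i → middle x y _ z<s
        (≡.subst₂ _<_ (≡.cong suc (≡.sym (toℕ-inject₁ i))) (≡.sym p≡1+r) (s<s (toℕ<n i))))

  module FieldBase {a b} (C : Constants) (F : CommutativeRing a b) (ff : IsFiniteField F (Constants.p C ℕ.^ Constants.f C))
                   (γ : CommutativeRing.Carrier F) (γ-primitive : IsPrimitiveElement F γ) where
    open Constants C using (p; r; ℓ; M; N; f; θ; κ; n; p≡11; r≡10; ℓ≡43; M≢0; N≢0; N≡ℓM; p^f≡1+n; n≡Nrκ; f≡1+2θ; 0<θ; p^θ+2; p^f≡1; orbit; residues) public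
    open CommutativeRing F hiding (zero) public
    open import Algebra.Properties.CommutativeSemiring.Exp commutativeSemiring public
    open import Algebra.Properties.Semiring.Mult semiring renaming (_×_ to _⨯_) public
    open import Algebra.Properties.Ring ring using (-1*x≈-x; -‿distribˡ-*; -‿distribʳ-*; [y-z]x≈yx-zx) public
    open import Algebra.Properties.Group +-group using (x∙y⁻¹≈ε⇒x≈y; x≈y⇒x∙y⁻¹≈ε) public
    open Cyclic F ff γ γ-primitive public
    abstract
      isOrder : IsOrder n
      isOrder = order≡ p^f≡1+n
    open Order isOrder public
    open IsOrder isOrder using (0<n; γ^n≈1; distinct) public
    module SumOver {c d} (R : CommutativeRing c d) = FieldSum F ff γ γ-primitive isOrder R
    open SumOver F
    open Sum commutativeSemiring
    open import Relation.Binary.Reasoning.Setoid setoid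

    p-prime : Prime p
    p-prime = ≡.subst Prime (≡.sym p≡11) (from-yes (prime? 11))

    p≡1+r : p ≡ suc r
    p≡1+r = ≡.trans p≡11 (≡.cong suc (≡.sym r≡10))

    instance
      p≢0 : NonZero p
      p≢0 = prime⇒nonZero p-prime

    p-divides-binomials : DividesBinomials p
    p-divides-binomials = ≡.subst DividesBinomials (≡.sym p≡11) 11-divides-binomials

    +-cancel : ∀ {x y} → x + y ≈ y → x ≈ 0#
    +-cancel {x} {y} eq = begin
      x              ≈⟨ +-identityʳ x ⟨
      x + 0#         ≈⟨ +-congˡ (-‿inverseʳ y) ⟨
      x + (y - y)    ≈⟨ +-assoc x y (- y) ⟨
      x + y - y      ≈⟨ +-congʳ eq ⟩
      y - y          ≈⟨ -‿inverseʳ y ⟩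
      0#             ∎

    ⨯-via-1 : ∀ m x → m ⨯ x ≈ (m ⨯ 1#) * x
    ⨯-via-1 m x = sym (trans (×-assoc-* m 1# x) (×-congʳ m (*-identityˡ x)))

    ⨯-^ : ∀ m i → (m ℕ.^ i) ⨯ 1# ≈ (m ⨯ 1#) ^ i
    ⨯-^ m zero    = ×-homo-1 1#
    ⨯-^ m (suc i) = trans (×1-homo-* m (m ℕ.^ i)) (*-congˡ (⨯-^ m i))

    ΣF-1 : ΣF (λ _ → 1#) ≈ (p ℕ.^ f) ⨯ 1#
    ΣF-1 = begin
      ΣF (λ _ → 1#)              ≈⟨ ΣF-exp (λ _ → 1#) ⟩
      1# + ∑ n (λ _ → 1#)        ≈⟨ +-congˡ (∑-const n 1#) ⟩
      suc n ⨯ 1#                 ≈⟨ ×-congˡ p^f≡1+n ⟨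
      (p ℕ.^ f) ⨯ 1#             ∎

    -- Translation by 1 fixes the sum of all elements, so the sum of 1 over F, which is (p · 1)^f,
    -- is 0; a nonzero p · 1 would have a nonzero power.
    p⨯1≈0 : p ⨯ 1# ≈ 0#
    p⨯1≈0 with p ⨯ 1# ≟ 0#
    ... | yes eq = eq
    ... | no neq = contradiction (trans (sym (⨯-^ p f)) (trans (sym ΣF-1) zero-sum)) (^-≉0 neq f)
      where
      zero-sum : ΣF (λ _ → 1#) ≈ 0#
      zero-sum = +-cancel (begin
        ΣF (λ _ → 1#) + ΣF (λ x → x)  ≈⟨ ΣF-+ (λ _ → 1#) (λ x → x) ⟨
        ΣF (λ x → 1# + x)             ≈⟨ ΣF-translate 1# (λ eq → eq) ⟩
        ΣF (λ x → x)                  ∎)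

    p⨯x≈0 : ∀ x → p ⨯ x ≈ 0#
    p⨯x≈0 x = trans (⨯-via-1 p x) (trans (*-congʳ p⨯1≈0) (zeroˡ x))

    ⨯-% : ∀ m x → m ⨯ x ≈ (m % p) ⨯ x
    ⨯-% m x = begin
      m ⨯ x                                   ≈⟨ ×-congˡ (m≡m%n+[m/n]*n m p) ⟩
      (m % p ℕ.+ m / p ℕ.* p) ⨯ x             ≈⟨ ×-homo-+ x (m % p) (m / p ℕ.* p) ⟩
      (m % p) ⨯ x + (m / p ℕ.* p) ⨯ x         ≈⟨ +-congˡ (×-congˡ (ℕ.*-comm (m / p) p)) ⟩
      (m % p) ⨯ x + (p ℕ.* (m / p)) ⨯ x       ≈⟨ +-congˡ (×-assocˡ x p (m / p)) ⟨
      (m % p) ⨯ x + p ⨯ ((m / p) ⨯ x)           ≈⟨ +-congˡ (p⨯x≈0 _) ⟩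
      (m % p) ⨯ x + 0#                        ≈⟨ +-identityʳ _ ⟩
      (m % p) ⨯ x                             ∎

    *-multiple-≈0 : ∀ u {m} → m ⨯ 1# ≈ 0# → (u ℕ.* m) ⨯ 1# ≈ 0#
    *-multiple-≈0 u {m} eq = trans (×1-homo-* u m) (trans (*-congˡ eq) (zeroʳ _))

    coprime-not-both-0 : ∀ {i j} → Coprime i j → i ⨯ 1# ≈ 0# → j ⨯ 1# ≈ 0# → 1# ≈ 0#
    coprime-not-both-0 {i} {j} cop i0 j0 with coprime-Bézout cop
    ... | Bézout.+- x y eq = trans (sym (trans (+-congˡ (*-multiple-≈0 y j0)) (+-identityʳ 1#))) (trans (×-congˡ eq) (*-multiple-≈0 x i0))
    ... | Bézout.-+ x y eq = trans (sym (trans (+-congˡ (*-multiple-≈0 x i0)) (+-identityʳ 1#))) (trans (×-congˡ eq) (*-multiple-≈0 y j0))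

    ⨯1≈0⇒p∣ : ∀ m → m ⨯ 1# ≈ 0# → p ∣ m
    ⨯1≈0⇒p∣ m eq with m % p ℕ.≟ 0
    ... | yes m%p≡0 = m%n≡0⇒n∣m m p m%p≡0
    ... | no  m%p≢0 = contradiction (coprime-not-both-0 (prime⇒coprime p-prime {{ℕ.≢-nonZero m%p≢0}} (m%n<n m p)) p⨯1≈0 (trans (sym (⨯-% m 1#)) eq)) 1≉0

    ⨯1≈0⇒%≡0 : ∀ m → m ⨯ 1# ≈ 0# → m % p ≡ 0
    ⨯1≈0⇒%≡0 m eq with divides c ≡.refl ← ⨯1≈0⇒p∣ m eq = [m+kn]%n≡0 c
      where
      [m+kn]%n≡0 : ∀ c → (c ℕ.* p) % p ≡ 0
      [m+kn]%n≡0 c = ≡.trans ([m+kn]%n≡m%n 0 c p) (m<n⇒m%n≡m (ℕ.>-nonZero⁻¹ p))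

    difference : ∀ {i j} → i < j → j ⨯ 1# ≈ i ⨯ 1# → p ≤ j ∸ i
    difference {i} {j} i<j eq = ∣⇒≤ {{ℕ.>-nonZero (ℕ.m<n⇒0<n∸m i<j)}} (⨯1≈0⇒p∣ (j ∸ i)
      (+-cancel (trans (sym (×-homo-+ 1# (j ∸ i) i)) (trans (×-congˡ (ℕ.m∸n+n≡m (ℕ.<⇒≤ i<j))) eq))))

    ⨯1-injective : ∀ {i j} → i < p → j < p → i ⨯ 1# ≈ j ⨯ 1# → i ≡ j
    ⨯1-injective {i} {j} i<p j<p eq with ℕ.<-cmp i j
    ... | tri≈ _ i≡j _ = i≡j
    ... | tri< i<j _ _ = contradiction (difference i<j (sym eq)) (ℕ.<⇒≱ (ℕ.≤-<-trans (ℕ.m∸n≤m j i) j<p))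
    ... | tri> _ _ j<i = contradiction (difference j<i eq) (ℕ.<⇒≱ (ℕ.≤-<-trans (ℕ.m∸n≤m i j) i<p))

    frobenius-+ : ∀ x y → (x + y) ^ p ≈ x ^ p + y ^ p
    frobenius-+ x y with w , eq ← PrimePower.[x+y]^p F p-divides-binomials p≡1+r x y = begin
      (x + y) ^ p                          ≈⟨ eq ⟩
      y ^ p + (p ⨯ (x * w) + x ^ p)        ≈⟨ +-congˡ (trans (+-congʳ (p⨯x≈0 _)) (+-identityˡ _)) ⟩
      y ^ p + x ^ p                        ≈⟨ +-comm _ _ ⟩
      x ^ p + y ^ p                        ∎

    0^ : ∀ i .{{_ : NonZero i}} → 0# ^ i ≈ 0#
    0^ (suc i) = zeroˡ _

    frobenius-⨯ : ∀ m → (m ⨯ 1#) ^ p ≈ m ⨯ 1#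
    frobenius-⨯ zero    = 0^ p
    frobenius-⨯ (suc m) = trans (frobenius-+ 1# (m ⨯ 1#)) (+-cong (1^ p) (frobenius-⨯ m))

    frobenius-∑ : ∀ m g → (∑ m g) ^ p ≈ ∑ m (λ i → g i ^ p)
    frobenius-∑ zero    g = 0^ p
    frobenius-∑ (suc m) g = trans (frobenius-+ (g 0) _) (+-congˡ (frobenius-∑ m (g ∘ suc)))

    x^q≈x : ∀ x → x ^ (p ℕ.^ f) ≈ x
    x^q≈x x with x ≟ 0#
    ... | yes x≈0 = trans (^-cong x≈0 p^f≡1+n) (trans (zeroˡ _) (sym x≈0))
    ... | no x≉0 with e , e<n , x≈γ^e ← log x x≉0 = begin
      x ^ (p ℕ.^ f)              ≈⟨ ^-cong x≈γ^e p^f≡1+n ⟩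
      (γ ^ e) ^ suc n            ≈⟨ ^-assocʳ γ e (suc n) ⟩
      γ ^ (e ℕ.* suc n)          ≈⟨ ^-congʳ γ (ℕ.*-suc e n) ⟩
      γ ^ (e ℕ.+ e ℕ.* n)        ≈⟨ γ^-multiple γ^n≈1 e e ⟩
      γ ^ e                      ≈⟨ x≈γ^e ⟨
      x                          ∎

    frobenius-inverse : Carrier → Carrier
    frobenius-inverse x = x ^ (p ℕ.^ ℕ.pred f)

    private instance
      f≢0 : NonZero f
      f≢0 = ≡.subst NonZero (≡.sym f≡1+2θ) _

    p*p^[f-1] : p ℕ.* p ℕ.^ ℕ.pred f ≡ p ℕ.^ f
    p*p^[f-1] = ≡.cong (p ℕ.^_) (ℕ.suc-pred f)

    frobenius-inverseˡ : ∀ x → frobenius-inverse (x ^ p) ≈ x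
    frobenius-inverseˡ x = trans (^-assocʳ x p _) (trans (^-congʳ x p*p^[f-1]) (x^q≈x x))

    frobenius-inverseʳ : ∀ x → frobenius-inverse x ^ p ≈ x
    frobenius-inverseʳ x = trans (^-assocʳ x (p ℕ.^ ℕ.pred f) p) (trans (^-congʳ x (≡.trans (ℕ.*-comm (p ℕ.^ ℕ.pred f) p) p*p^[f-1])) (x^q≈x x))

    -- The substitution x ↦ γ x multiplies the sum by γ^i, which differs from 1 because n does not
    -- divide i.
    ΣF-power : ∀ i .{{_ : NonZero i}} → ¬ n ∣ i → ΣF (λ x → x ^ i) ≈ 0#
    ΣF-power i n∤i = xy≈0⇒y≈0 (γ ^ i - 1#) γ^i-1≉0 (begin
      (γ ^ i - 1#) * S                ≈⟨ [y-z]x≈yx-zx S (γ ^ i) 1# ⟩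
      γ ^ i * S - 1# * S              ≈⟨ +-cong shift (-‿cong (*-identityˡ S)) ⟩
      S - S                           ≈⟨ -‿inverseʳ S ⟩
      0#                              ∎)
      where
      S = ΣF (λ x → x ^ i)
      shift : γ ^ i * S ≈ S
      shift = begin
        γ ^ i * S                       ≈⟨ ΣF-*ˡ (γ ^ i) (λ x → x ^ i) ⟩
        ΣF (λ x → γ ^ i * x ^ i)        ≈⟨ ΣF-cong (λ x → ^-distrib-* γ x i) ⟨
        ΣF (λ x → (γ * x) ^ i)          ≈⟨ ΣF-scale γ≉0 {λ x → x ^ i} (^-congˡ i) ⟩
        S                               ∎
      γ^i-1≉0 : ¬ γ ^ i - 1# ≈ 0#
      γ^i-1≉0 eq = n∤i (m%n≡0⇒n∣m i n (≡.trans (γ^-mod {i} {0} (x∙y⁻¹≈ε⇒x≈y (γ ^ i) 1# eq)) (m<n⇒m%n≡m 0<n)))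

    -- Each nonzero x contributes 1 and x = 0 contributes 0, so the sum is n · 1, while n + 1 = q
    -- vanishes in F.
    ΣF-power-n : ΣF (λ x → x ^ n) ≈ - 1#
    ΣF-power-n = begin
      ΣF (λ x → x ^ n)                     ≈⟨ ΣF-exp (λ x → x ^ n) ⟩
      0# ^ n + ∑ n (λ e → (γ ^ e) ^ n)     ≈⟨ +-cong (0^ n) (∑-cong n (λ e → trans (^-assocʳ γ e n) (γ^-multiple γ^n≈1 0 e))) ⟩
      0# + ∑ n (λ _ → 1#)                  ≈⟨ trans (+-identityˡ _) (∑-const n 1#) ⟩
      n ⨯ 1#                               ≈⟨ +-identityˡ _ ⟨
      0# + n ⨯ 1#                          ≈⟨ +-congʳ (-‿inverseˡ 1#) ⟨
      - 1# + 1# + n ⨯ 1#                   ≈⟨ +-assoc _ _ _ ⟩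
      - 1# + suc n ⨯ 1#                    ≈⟨ +-congˡ (trans (×-congˡ (≡.sym p^f≡1+n)) (trans (⨯-^ p f) (trans (^-congˡ f p⨯1≈0) (0^ f)))) ⟩
      - 1# + 0#                            ≈⟨ +-identityʳ _ ⟩
      - 1#                                 ∎

-- Integral monoid rings

module MonoidRing where

  open import Algebra.Bundles using (CommutativeRing; CommutativeMonoid)
  open import Data.Integer.Base as ℤ using (ℤ; 0ℤ)
  import Data.Integer.Properties as ℤ
  open import Data.List.Base using (List; []; _∷_; _++_; map)
  open import Data.Product.Base using (_,_; _×_)
  open import Data.Sign.Base as Sign using (Sign)
  open import Level using (_⊔_)
  open import Relation.Binary.Core using (Rel)
  open import Relation.Binary.PropositionalEquality as ≡ using (_≡_; cong; cong₂)

  -- The integral monoid ring of G: two formal signed sums are equal when every function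
  -- G → ℤ has the same integral over both.
  module Ring[_] {g ℓg} (G : CommutativeMonoid g ℓg) where
    open CommutativeMonoid G renaming (Carrier to |G|; _≈_ to _≈ᴳ_)

    Element : Set g
    Element = List (Sign × |G|)

    [_]ᴳ : |G| → Element
    [ x ]ᴳ = (Sign.+ , x) ∷ []

    scale : Sign × |G| → Element → Element
    scale (s , x) = map (λ (t , y) → s Sign.* t , x ∙ y)

    infixl 7 _⊗_
    _⊗_ : Element → Element → Element
    []      ⊗ β = []
    (t ∷ α) ⊗ β = scale t β ++ α ⊗ β

    neg : Element → Element
    neg = scale (Sign.- , ε)

    module Integral {c ℓ} (R : CommutativeRing c ℓ) where
      open CommutativeRing R renaming (Carrier to |R|) hiding (zero)
      open import Algebra.Properties.Ring ring using (-‿distribˡ-*)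
      open import Algebra.Properties.AbelianGroup +-abelianGroup using () renaming (⁻¹-∙-comm to -‿+-comm; ⁻¹-involutive to -‿involutive; ε⁻¹≈ε to -0≈0)
      open import Relation.Binary.Reasoning.Setoid (CommutativeRing.setoid R)
      private
        _≈ᴿ_ = CommutativeRing._≈_ R
        module R = CommutativeRing R

      sgn : Sign → |R| → |R|
      sgn Sign.+ x = x
      sgn Sign.- x = - x

      sgn-cong : ∀ s {x y} → x ≈ᴿ y → sgn s x ≈ᴿ sgn s y
      sgn-cong Sign.+ eq = eq
      sgn-cong Sign.- eq = -‿cong eq

      sgn-0 : ∀ s → sgn s 0# ≈ᴿ 0#
      sgn-0 Sign.+ = R.refl
      sgn-0 Sign.- = -0≈0

      sgn-+ : ∀ s x y → sgn s (x + y) ≈ᴿ (sgn s x + sgn s y)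
      sgn-+ Sign.+ x y = R.refl
      sgn-+ Sign.- x y = R.sym (-‿+-comm x y)

      sgn-*ʳ : ∀ s x y → (sgn s x * y) ≈ᴿ sgn s (x * y)
      sgn-*ʳ Sign.+ x y = R.refl
      sgn-*ʳ Sign.- x y = R.sym (-‿distribˡ-* x y)

      sgn-sgn : ∀ s t x → sgn (s Sign.* t) x ≈ᴿ sgn s (sgn t x)
      sgn-sgn Sign.+ t      x = R.refl
      sgn-sgn Sign.- Sign.+ x = R.refl
      sgn-sgn Sign.- Sign.- x = R.sym (-‿involutive x)

      sgn-comm : ∀ s t x → sgn s (sgn t x) ≈ᴿ sgn t (sgn s x)
      sgn-comm Sign.+ t      x = R.refl
      sgn-comm Sign.- Sign.+ x = R.refl
      sgn-comm Sign.- Sign.- x = R.refl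

      ∫ : Element → (|G| → |R|) → |R|
      ∫ []            φ = 0#
      ∫ ((s , x) ∷ α) φ = sgn s (φ x) + ∫ α φ

      ∫-cong : ∀ α {φ χ} → (∀ x → φ x ≈ᴿ χ x) → ∫ α φ ≈ᴿ ∫ α χ
      ∫-cong []            eq = R.refl
      ∫-cong ((s , x) ∷ α) eq = +-cong (sgn-cong s (eq x)) (∫-cong α eq)

      ∫-++ : ∀ α β φ → ∫ (α ++ β) φ ≈ᴿ (∫ α φ + ∫ β φ)
      ∫-++ []            β φ = R.sym (+-identityˡ _)
      ∫-++ ((s , x) ∷ α) β φ = R.trans (+-congˡ (∫-++ α β φ)) (R.sym (+-assoc _ _ _))

      ∫-scale : ∀ s x β φ → ∫ (scale (s , x) β) φ ≈ᴿ sgn s (∫ β (λ y → φ (x ∙ y)))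
      ∫-scale s x []            φ = R.sym (sgn-0 s)
      ∫-scale s x ((t , y) ∷ β) φ = R.trans (+-cong (sgn-sgn s t _) (∫-scale s x β φ)) (R.sym (sgn-+ s _ _))

      -- Integration against a product is iterated integration. The laws of `⊗` and the
      -- multiplicativity of evaluation maps all reduce to this.
      ∫-⊗ : ∀ α β φ → ∫ (α ⊗ β) φ ≈ᴿ ∫ α (λ x → ∫ β (λ y → φ (x ∙ y)))
      ∫-⊗ []            β φ = R.refl
      ∫-⊗ ((s , x) ∷ α) β φ = R.trans (∫-++ (scale (s , x) β) (α ⊗ β) φ) (+-cong (∫-scale s x β φ) (∫-⊗ α β φ))

      ∫-zero : ∀ α {φ} → (∀ x → φ x ≈ᴿ 0#) → ∫ α φ ≈ᴿ 0#
      ∫-zero []            eq = R.refl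
      ∫-zero ((s , x) ∷ α) eq = R.trans (+-cong (R.trans (sgn-cong s (eq x)) (sgn-0 s)) (∫-zero α eq)) (+-identityˡ 0#)

      ∫-+ : ∀ α φ χ → ∫ α (λ x → φ x + χ x) ≈ᴿ (∫ α φ + ∫ α χ)
      ∫-+ []            φ χ = R.sym (+-identityˡ 0#)
      ∫-+ ((s , x) ∷ α) φ χ = begin
        sgn s (φ x + χ x) + ∫ α (λ x → φ x + χ x)          ≈⟨ +-cong (sgn-+ s _ _) (∫-+ α φ χ) ⟩
        (sgn s (φ x) + sgn s (χ x)) + (∫ α φ + ∫ α χ)      ≈⟨ interchange _ _ _ _ ⟩
        (sgn s (φ x) + ∫ α φ) + (sgn s (χ x) + ∫ α χ)      ∎
        where open import Algebra.Properties.CommutativeSemigroup (CommutativeMonoid.commutativeSemigroup +-commutativeMonoid) using (interchange)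

      ∫-sgn : ∀ s α φ → ∫ α (λ x → sgn s (φ x)) ≈ᴿ sgn s (∫ α φ)
      ∫-sgn s []            φ = R.sym (sgn-0 s)
      ∫-sgn s ((t , x) ∷ α) φ = R.trans (+-cong (sgn-comm t s _) (∫-sgn s α φ)) (R.sym (sgn-+ s _ _))

      ∫-*ʳ : ∀ α φ a → ∫ α (λ x → φ x * a) ≈ᴿ (∫ α φ * a)
      ∫-*ʳ []            φ a = R.sym (R.zeroˡ a)
      ∫-*ʳ ((s , x) ∷ α) φ a = R.trans (+-cong (R.sym (sgn-*ʳ s _ a)) (∫-*ʳ α φ a)) (R.sym (distribʳ a _ _))

      ∫-swap : ∀ α β (φ : |G| → |G| → |R|) → ∫ α (λ x → ∫ β (λ y → φ x y)) ≈ᴿ ∫ β (λ y → ∫ α (λ x → φ x y))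
      ∫-swap []            β φ = R.sym (∫-zero β (λ _ → R.refl))
      ∫-swap ((s , x) ∷ α) β φ = begin
        sgn s (∫ β (φ x)) + ∫ α (λ x → ∫ β (φ x))                ≈⟨ +-cong (R.sym (∫-sgn s β (φ x))) (∫-swap α β φ) ⟩
        ∫ β (λ y → sgn s (φ x y)) + ∫ β (λ y → ∫ α (λ x → φ x y)) ≈⟨ ∫-+ β _ _ ⟨
        ∫ β (λ y → sgn s (φ x y) + ∫ α (λ x → φ x y))            ∎

      ∫-unit : ∀ x φ → ∫ [ x ]ᴳ φ ≈ᴿ φ x
      ∫-unit x φ = +-identityʳ (φ x)

    open Integral ℤ.+-*-commutativeRing public using () renaming
      (∫ to ∫ᶻ; ∫-cong to ∫ᶻ-cong; ∫-++ to ∫ᶻ-++; ∫-scale to ∫ᶻ-scale; ∫-⊗ to ∫ᶻ-⊗; ∫-swap to ∫ᶻ-swap; ∫-unit to ∫ᶻ-unit; ∫-*ʳ to ∫ᶻ-*ʳ; sgn to sgnᶻ)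

    Respects : (|G| → ℤ) → Set _
    Respects φ = ∀ {x y} → x ≈ᴳ y → φ x ≡ φ y

    infix 4 _≋_
    _≋_ : Rel Element (g ⊔ ℓg)
    α ≋ β = ∀ φ → Respects φ → ∫ᶻ α φ ≡ ∫ᶻ β φ

    ⊗-cong : ∀ {α α′ β β′} → α ≋ α′ → β ≋ β′ → α ⊗ β ≋ α′ ⊗ β′
    ⊗-cong {α} {α′} {β} {β′} p q φ φ-resp = begin
      ∫ᶻ (α ⊗ β) φ                                 ≡⟨ ∫ᶻ-⊗ α β φ ⟩
      ∫ᶻ α (λ x → ∫ᶻ β (λ y → φ (x ∙ y)))          ≡⟨ p _ (λ eq → ∫ᶻ-cong β (λ y → φ-resp (∙-congʳ eq))) ⟩
      ∫ᶻ α′ (λ x → ∫ᶻ β (λ y → φ (x ∙ y)))         ≡⟨ ∫ᶻ-cong α′ (λ x → q _ (λ eq → φ-resp (∙-congˡ eq))) ⟩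
      ∫ᶻ α′ (λ x → ∫ᶻ β′ (λ y → φ (x ∙ y)))        ≡⟨ ∫ᶻ-⊗ α′ β′ φ ⟨
      ∫ᶻ (α′ ⊗ β′) φ                               ∎
      where open ≡.≡-Reasoning

    ⊗-comm : ∀ α β → α ⊗ β ≋ β ⊗ α
    ⊗-comm α β φ φ-resp = begin
      ∫ᶻ (α ⊗ β) φ                                 ≡⟨ ∫ᶻ-⊗ α β φ ⟩
      ∫ᶻ α (λ x → ∫ᶻ β (λ y → φ (x ∙ y)))          ≡⟨ ∫ᶻ-swap α β (λ x y → φ (x ∙ y)) ⟩
      ∫ᶻ β (λ y → ∫ᶻ α (λ x → φ (x ∙ y)))          ≡⟨ ∫ᶻ-cong β (λ y → ∫ᶻ-cong α (λ x → φ-resp (comm x y))) ⟩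
      ∫ᶻ β (λ y → ∫ᶻ α (λ x → φ (y ∙ x)))          ≡⟨ ∫ᶻ-⊗ β α φ ⟨
      ∫ᶻ (β ⊗ α) φ                                 ∎
      where open ≡.≡-Reasoning

    ⊗-assoc : ∀ α β δ → (α ⊗ β) ⊗ δ ≋ α ⊗ (β ⊗ δ)
    ⊗-assoc α β δ φ φ-resp = begin
      ∫ᶻ ((α ⊗ β) ⊗ δ) φ                                              ≡⟨ ∫ᶻ-⊗ (α ⊗ β) δ φ ⟩
      ∫ᶻ (α ⊗ β) (λ x → ∫ᶻ δ (λ z → φ (x ∙ z)))                       ≡⟨ ∫ᶻ-⊗ α β _ ⟩
      ∫ᶻ α (λ x → ∫ᶻ β (λ y → ∫ᶻ δ (λ z → φ (x ∙ y ∙ z))))            ≡⟨ ∫ᶻ-cong α (λ x → ∫ᶻ-cong β (λ y → ∫ᶻ-cong δ (λ z → φ-resp (assoc x y z)))) ⟩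
      ∫ᶻ α (λ x → ∫ᶻ β (λ y → ∫ᶻ δ (λ z → φ (x ∙ (y ∙ z)))))          ≡⟨ ∫ᶻ-cong α (λ x → ∫ᶻ-⊗ β δ (λ y → φ (x ∙ y))) ⟨
      ∫ᶻ α (λ x → ∫ᶻ (β ⊗ δ) (λ y → φ (x ∙ y)))                       ≡⟨ ∫ᶻ-⊗ α (β ⊗ δ) φ ⟨
      ∫ᶻ (α ⊗ (β ⊗ δ)) φ                                              ∎
      where open ≡.≡-Reasoning

    ⊗-identityˡ : ∀ α → [ ε ]ᴳ ⊗ α ≋ α
    ⊗-identityˡ α φ φ-resp = ≡.trans (∫ᶻ-⊗ [ ε ]ᴳ α φ) (≡.trans (∫ᶻ-unit ε (λ x → ∫ᶻ α (λ y → φ (x ∙ y)))) (∫ᶻ-cong α (λ y → φ-resp (identityˡ y))))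

    ⊗-distribʳ : ∀ α β δ → (β ++ δ) ⊗ α ≋ β ⊗ α ++ δ ⊗ α
    ⊗-distribʳ α β δ φ φ-resp = begin
      ∫ᶻ ((β ++ δ) ⊗ α) φ                  ≡⟨ ∫ᶻ-⊗ (β ++ δ) α φ ⟩
      ∫ᶻ (β ++ δ) _                        ≡⟨ ∫ᶻ-++ β δ _ ⟩
      ∫ᶻ β _ ℤ.+ ∫ᶻ δ _                    ≡⟨ cong₂ ℤ._+_ (∫ᶻ-⊗ β α φ) (∫ᶻ-⊗ δ α φ) ⟨
      ∫ᶻ (β ⊗ α) φ ℤ.+ ∫ᶻ (δ ⊗ α) φ        ≡⟨ ∫ᶻ-++ (β ⊗ α) (δ ⊗ α) φ ⟨
      ∫ᶻ (β ⊗ α ++ δ ⊗ α) φ                ∎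
      where open ≡.≡-Reasoning

    ++-cong : ∀ {α α′ β β′} → α ≋ α′ → β ≋ β′ → α ++ β ≋ α′ ++ β′
    ++-cong {α} {α′} {β} {β′} p q φ φ-resp = ≡.trans (∫ᶻ-++ α β φ) (≡.trans (cong₂ ℤ._+_ (p φ φ-resp) (q φ φ-resp)) (≡.sym (∫ᶻ-++ α′ β′ φ)))

    ++-comm : ∀ α β → α ++ β ≋ β ++ α
    ++-comm α β φ _ = ≡.trans (∫ᶻ-++ α β φ) (≡.trans (ℤ.+-comm (∫ᶻ α φ) (∫ᶻ β φ)) (≡.sym (∫ᶻ-++ β α φ)))

    ++-assoc′ : ∀ α β δ → (α ++ β) ++ δ ≋ α ++ (β ++ δ)
    ++-assoc′ α β δ φ _ = cong (λ ξ → ∫ᶻ ξ φ) (++-assoc α β δ)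
      where open import Data.List.Properties using (++-assoc)

    ∫ᶻ-neg : ∀ α φ → Respects φ → ∫ᶻ (neg α) φ ≡ ℤ.- ∫ᶻ α φ
    ∫ᶻ-neg α φ φ-resp = ≡.trans (∫ᶻ-scale Sign.- ε α φ) (cong ℤ.-_ (∫ᶻ-cong α (λ y → φ-resp (identityˡ y))))

    neg-inverseˡ : ∀ α → neg α ++ α ≋ []
    neg-inverseˡ α φ φ-resp = ≡.trans (∫ᶻ-++ (neg α) α φ) (≡.trans (cong (ℤ._+ ∫ᶻ α φ) (∫ᶻ-neg α φ φ-resp)) (ℤ.+-inverseˡ (∫ᶻ α φ)))

    neg-cong : ∀ {α β} → α ≋ β → neg α ≋ neg β
    neg-cong {α} {β} p φ φ-resp = ≡.trans (∫ᶻ-neg α φ φ-resp) (≡.trans (cong ℤ.-_ (p φ φ-resp)) (≡.sym (∫ᶻ-neg β φ φ-resp)))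

    ≋-trans : ∀ {α β δ} → α ≋ β → β ≋ δ → α ≋ δ
    ≋-trans p q φ φ-resp = ≡.trans (p φ φ-resp) (q φ φ-resp)

    ≋-sym : ∀ {α β} → α ≋ β → β ≋ α
    ≋-sym p φ φ-resp = ≡.sym (p φ φ-resp)

    monoidRing : CommutativeRing g (g ⊔ ℓg)
    monoidRing = record
      { Carrier = Element ; _≈_ = _≋_ ; _+_ = _++_ ; _*_ = _⊗_ ; -_ = neg ; 0# = [] ; 1# = [ ε ]ᴳ
      ; isCommutativeRing = record
        { isRing = record
          { +-isAbelianGroup = record
            { isGroup = record
              { isMonoid = record
                { isSemigroup = record
                  { isMagma = record
                    { isEquivalence = record { refl = λ _ _ → ≡.refl ; sym = λ {α} {β} → ≋-sym {α} {β} ; trans = λ {α} {β} {δ} → ≋-trans {α} {β} {δ} }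
                    ; ∙-cong = λ {α} {α′} {β} {β′} → ++-cong {α} {α′} {β} {β′} }
                  ; assoc = ++-assoc′ }
                ; identity = (λ _ _ _ → ≡.refl) , (λ α → ≋-trans {α ++ []} {[] ++ α} {α} (++-comm α []) (λ _ _ → ≡.refl)) }
              ; inverse = neg-inverseˡ , (λ α → ≋-trans {α ++ neg α} {neg α ++ α} {[]} (++-comm α (neg α)) (neg-inverseˡ α))
              ; ⁻¹-cong = λ {α} {β} → neg-cong {α} {β} }
            ; comm = ++-comm }
          ; *-cong = λ {α} {α′} {β} {β′} → ⊗-cong {α} {α′} {β} {β′}
          ; *-assoc = ⊗-assoc
          ; *-identity = ⊗-identityˡ , (λ α → ≋-trans {α ⊗ [ ε ]ᴳ} {[ ε ]ᴳ ⊗ α} {α} (⊗-comm α [ ε ]ᴳ) (⊗-identityˡ α))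
          ; distrib = (λ α β δ → ≋-trans {α ⊗ (β ++ δ)} {(β ++ δ) ⊗ α} {α ⊗ β ++ α ⊗ δ} (⊗-comm α (β ++ δ))
                         (≋-trans {(β ++ δ) ⊗ α} {β ⊗ α ++ δ ⊗ α} {α ⊗ β ++ α ⊗ δ} (⊗-distribʳ α β δ)
                           (++-cong {β ⊗ α} {α ⊗ β} {δ ⊗ α} {α ⊗ δ} (⊗-comm β α) (⊗-comm δ α))))
                      , ⊗-distribʳ }
        ; *-comm = ⊗-comm } }

    []-homo : ∀ x y → [ x ]ᴳ ⊗ [ y ]ᴳ ≋ [ x ∙ y ]ᴳ
    []-homo x y φ _ = ≡.refl

    []-cong : ∀ {x y} → x ≈ᴳ y → [ x ]ᴳ ≋ [ y ]ᴳ
    []-cong eq φ φ-resp = cong (ℤ._+ 0ℤ) (φ-resp eq)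

-- The prime field and the trace

module Trace where

  open import Algebra.Bundles using (CommutativeRing)
  open import Data.Fin.Base as Fin using (Fin; toℕ; fromℕ<)
  open import Data.Fin.Properties using (toℕ<n; toℕ-fromℕ<; toℕ-injective; any?) renaming (all? to allFin?)
  open import Data.Integer.Base as ℤ using (ℤ; +_)
  import Data.Integer.Properties as ℤ
  open import Data.Nat.Base as ℕ using (ℕ; zero; suc; _<_; z<s; s<s; NonZero)
  open import Data.Nat.Divisibility using (_∣_; divides; ∣⇒≤; *-cancelʳ-∣; m%n≡0⇒n∣m)
  open import Data.Nat.DivMod using (_%_; m<n⇒m%n≡m)
  import Data.Nat.Properties as ℕ
  open import Data.Product.Base using (_,_; ∃-syntax; _×_; proj₁; proj₂)
  open import Function.Definitions using (Injective)
  open import Relation.Binary.PropositionalEquality as ≡ using (_≡_)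
  open import Relation.Nullary.Decidable using (Dec; yes; no; from-yes; ¬?; decidable-stable)
  open import Relation.Nullary.Negation using (¬_; contradiction)

  open FiniteSums
  open NumericalData
  open CyclicField
  open FieldSums
  open FieldArithmetic

  -- For 0 ≤ a ≤ r this is the sum of ζ^a over the primitive (r + 1)-th roots of unity ζ, when r + 1 is prime.
  weight : ℕ → ℕ → ℤ
  weight r zero    = + r
  weight r (suc _) = ℤ.-1ℤ

  -- Every pair of primitive roots is (ζ, ζ^u) for exactly one u with 1 ≤ u ≤ r, so multiplying the
  -- sums of ζ^a and of ζ^b gives the sums of ζ^(a+ub).
  WeightProduct : ℕ → Set
  WeightProduct r = ∀ a b → a < suc r → b < suc r →
    weight r a ℤ.* weight r b ≡ Sumᶻ.∑ r (λ u → weight r ((a ℕ.+ suc u ℕ.* b) % suc r))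

  weight-product-10 : WeightProduct 10
  weight-product-10 a b a<11 b<11 = ≡.subst₂ Product (toℕ-fromℕ< a<11) (toℕ-fromℕ< b<11) (check (fromℕ< a<11) (fromℕ< b<11))
    where
    Product : ℕ → ℕ → Set
    Product a b = weight 10 a ℤ.* weight 10 b ≡ Sumᶻ.∑ 10 (λ u → weight 10 ((a ℕ.+ suc u ℕ.* b) % 11))
    product? : ∀ a b → Dec (Product a b)
    product? a b = _ ℤ.≟ _
    check : ∀ (a b : Fin 11) → Product (toℕ a) (toℕ b)
    check = from-yes (allFin? (λ (a : Fin 11) → allFin? (λ (b : Fin 11) → product? (toℕ a) (toℕ b))))

  module TraceForm {a b} (C : Constants) (F : CommutativeRing a b) (ff : IsFiniteField F (Constants.p C ℕ.^ Constants.f C))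
                   (γ : CommutativeRing.Carrier F) (γ-primitive : IsPrimitiveElement F γ) where
    open FieldBase C F ff γ γ-primitive public
    open SumOver F using (ΣF; ΣF-cong; ΣF-*ˡ; ΣF-∑; ΣF-zero)
    open Sum commutativeSemiring
    open import Relation.Binary.Reasoning.Setoid setoid

    -- L = (q - 1) / (p - 1), so the powers of γ^L are the prime field units.
    L : ℕ
    L = N ℕ.* κ

    n≡Lr : n ≡ L ℕ.* r
    n≡Lr = ≡.trans n≡Nrκ (≡.trans (≡.cong (N ℕ.*_) (ℕ.*-comm r κ)) (≡.sym (ℕ.*-assoc N κ r)))

    private instance
      L*r≢0 : NonZero (L ℕ.* r)
      L*r≢0 = ≡.subst NonZero n≡Lr n≢0
      L≢0 : NonZero L
      L≢0 = ℕ.m*n≢0⇒m≢0 L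
      r≢0 : NonZero r
      r≢0 = ℕ.m*n≢0⇒n≢0 L

    p-power-fixed : ∀ {y} → ¬ y ≈ 0# → y ^ p ≈ y → ∃[ j ] j < r × y ≈ γ ^ (L ℕ.* j)
    p-power-fixed {y} y≉0 y^p≈y with log y y≉0
    ... | e , e<n , y≈γ^e = step (*-cancelʳ-∣ r (≡.subst₂ _∣_ n≡Lr ≡.refl n∣er))
      where
      y^r≈1 : y ^ r ≈ 1#
      y^r≈1 = cancelˡ y y≉0 (trans (trans (^-congʳ y (≡.sym p≡1+r)) y^p≈y) (sym (*-identityʳ y)))
      n∣er : n ∣ e ℕ.* r
      n∣er = m%n≡0⇒n∣m (e ℕ.* r) n (≡.trans (γ^-mod {e ℕ.* r} {0} (trans (sym (^-assocʳ γ e r)) (trans (^-congˡ r (sym y≈γ^e)) y^r≈1))) (m<n⇒m%n≡m 0<n))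
      step : L ∣ e → ∃[ j ] j < r × y ≈ γ ^ (L ℕ.* j)
      step (divides j eq) = j , ℕ.*-cancelˡ-< L j r (≡.subst₂ _<_ (≡.trans eq (ℕ.*-comm j L)) n≡Lr e<n) , trans y≈γ^e (^-congʳ γ (≡.trans eq (ℕ.*-comm j L)))

    multiple≉0 : ∀ {m} → 0 < m → m < p → ¬ m ⨯ 1# ≈ 0#
    multiple≉0 0<m m<p eq = ℕ.<⇒≱ m<p (∣⇒≤ {{ℕ.>-nonZero 0<m}} (⨯1≈0⇒p∣ _ eq))

    -- The r nonzero multiples of 1 are fixed by Frobenius, hence are distinct powers of γ^L. There
    -- are only r such powers, so every nonzero fixed element occurs among the multiples.
    prime-field : ∀ y → y ^ p ≈ y → ∃[ m ] m < p × y ≈ m ⨯ 1#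
    prime-field y y^p≈y with y ≟ 0#
    ... | yes y≈0 = 0 , ℕ.>-nonZero⁻¹ p , y≈0
    ... | no y≉0 = suc (toℕ i) , 1+i<p i , (begin
      y                                  ≈⟨ proj₂ (proj₂ J) ⟩
      γ ^ (L ℕ.* proj₁ J)                ≈⟨ ^-congʳ γ (≡.cong (L ℕ.*_) (≡.sym (≡.trans (≡.cong toℕ (proj₂ hit)) (toℕ-fromℕ< _)))) ⟩
      γ ^ (L ℕ.* toℕ (σ i))              ≈⟨ σ-spec i ⟨
      suc (toℕ i) ⨯ 1#                   ∎)
      where
      1+i<p : ∀ (i : Fin r) → suc (toℕ i) < p
      1+i<p i = ≡.subst (suc (toℕ i) <_) (≡.sym p≡1+r) (s<s (toℕ<n i))
      exponent : (i : Fin r) → ∃[ j ] j < r × suc (toℕ i) ⨯ 1# ≈ γ ^ (L ℕ.* j)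
      exponent i = p-power-fixed (multiple≉0 z<s (1+i<p i)) (frobenius-⨯ (suc (toℕ i)))
      σ : Fin r → Fin r
      σ i = fromℕ< (proj₁ (proj₂ (exponent i)))
      σ-spec : ∀ i → suc (toℕ i) ⨯ 1# ≈ γ ^ (L ℕ.* toℕ (σ i))
      σ-spec i = trans (proj₂ (proj₂ (exponent i))) (^-congʳ γ (≡.cong (L ℕ.*_) (≡.sym (toℕ-fromℕ< (proj₁ (proj₂ (exponent i)))))))
      σ-injective : Injective _≡_ _≡_ σ
      σ-injective {i} {j} eq = toℕ-injective (ℕ.suc-injective (⨯1-injective (1+i<p i) (1+i<p j)
        (trans (σ-spec i) (trans (^-congʳ γ (≡.cong (λ k → L ℕ.* toℕ k) eq)) (sym (σ-spec j))))))
      J : ∃[ j ] j < r × y ≈ γ ^ (L ℕ.* j)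
      J = p-power-fixed y≉0 y^p≈y
      target : Fin r
      target = fromℕ< (proj₁ (proj₂ J))
      hit : ∃[ i ] σ i ≡ target
      hit = injective⇒surjective σ (λ {i} {j} → σ-injective {i} {j}) target
      i : Fin r
      i = proj₁ hit

    Tr : Carrier → Carrier
    Tr x = ∑ f (λ i → x ^ (p ℕ.^ i))

    Tr-cong : ∀ {x y} → x ≈ y → Tr x ≈ Tr y
    Tr-cong eq = ∑-cong f (λ i → ^-congˡ (p ℕ.^ i) eq)

    ^-p^suc : ∀ x i → (x ^ (p ℕ.^ i)) ^ p ≈ x ^ (p ℕ.^ suc i)
    ^-p^suc x i = trans (^-assocʳ x (p ℕ.^ i) p) (^-congʳ x (ℕ.*-comm (p ℕ.^ i) p))

    frobenius^-+ : ∀ i x y → (x + y) ^ (p ℕ.^ i) ≈ x ^ (p ℕ.^ i) + y ^ (p ℕ.^ i)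
    frobenius^-+ zero    x y = trans (*-identityʳ _) (sym (+-cong (*-identityʳ x) (*-identityʳ y)))
    frobenius^-+ (suc i) x y = begin
      (x + y) ^ (p ℕ.^ suc i)                      ≈⟨ ^-p^suc (x + y) i ⟨
      ((x + y) ^ (p ℕ.^ i)) ^ p                    ≈⟨ ^-congˡ p (frobenius^-+ i x y) ⟩
      (x ^ (p ℕ.^ i) + y ^ (p ℕ.^ i)) ^ p          ≈⟨ frobenius-+ _ _ ⟩
      (x ^ (p ℕ.^ i)) ^ p + (y ^ (p ℕ.^ i)) ^ p    ≈⟨ +-cong (^-p^suc x i) (^-p^suc y i) ⟩
      x ^ (p ℕ.^ suc i) + y ^ (p ℕ.^ suc i)        ∎

    frobenius^-⨯ : ∀ i m → (m ⨯ 1#) ^ (p ℕ.^ i) ≈ m ⨯ 1#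
    frobenius^-⨯ zero    m = *-identityʳ _
    frobenius^-⨯ (suc i) m = trans (sym (^-p^suc _ i)) (trans (^-congˡ p (frobenius^-⨯ i m)) (frobenius-⨯ m))

    Tr-+ : ∀ x y → Tr (x + y) ≈ Tr x + Tr y
    Tr-+ x y = trans (∑-cong f (λ i → frobenius^-+ i x y)) (∑-+ f _ _)

    Tr-⨯ : ∀ m x → Tr ((m ⨯ 1#) * x) ≈ (m ⨯ 1#) * Tr x
    Tr-⨯ m x = trans (∑-cong f (λ i → trans (^-distrib-* _ x (p ℕ.^ i)) (*-congʳ (frobenius^-⨯ i m)))) (sym (∑-*ˡ f _ _))

    shifted-trace : ∀ x → ∑ f (λ i → x ^ (p ℕ.^ suc i)) ≈ Tr x
    shifted-trace x = ∑-cyclic₁ f (λ i → x ^ (p ℕ.^ i)) (trans (x^q≈x x) (sym (*-identityʳ x)))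

    Tr-frobenius : ∀ x → Tr (x ^ p) ≈ Tr x
    Tr-frobenius x = trans (∑-cong f (λ i → ^-assocʳ x p (p ℕ.^ i))) (shifted-trace x)

    Tr^p : ∀ x → Tr x ^ p ≈ Tr x
    Tr^p x = trans (frobenius-∑ f _) (trans (∑-cong f (^-p^suc x)) (shifted-trace x))

    tr : ∀ x → ∃[ m ] m < p × Tr x ≈ m ⨯ 1#
    tr x = prime-field (Tr x) (Tr^p x)

    Tr-0 : Tr 0# ≈ 0#
    Tr-0 = ∑-zero f (λ i _ → 0^ (p ℕ.^ i) {{ℕ.m^n≢0 p i}})

    private
      f′ : ℕ
      f′ = 2 ℕ.* θ

    -- The coefficient of x in Tr x is recovered by pairing with x^(n−1).
    ΣF-Tr : ΣF (λ x → x ^ ℕ.pred n * Tr x) ≈ - 1#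
    ΣF-Tr = begin
      ΣF (λ x → x ^ ℕ.pred n * Tr x)                          ≈⟨ ΣF-cong (λ x → trans (∑-*ˡ f _ _) (∑-cong f (λ i → sym (^-homo-* x (ℕ.pred n) (p ℕ.^ i))))) ⟩
      ΣF (λ x → ∑ f (λ i → x ^ (ℕ.pred n ℕ.+ p ℕ.^ i)))       ≈⟨ ΣF-∑ f _ ⟩
      ∑ f (λ i → S i)                                         ≈⟨ reflexive (≡.cong (λ m → ∑ m S) f≡1+2θ) ⟩
      S 0 + ∑ f′ (λ i → S (suc i))                            ≈⟨ +-cong S0 (∑-zero f′ S+) ⟩
      - 1# + 0#                                               ≈⟨ +-identityʳ _ ⟩
      - 1#                                                    ∎
      where
      S : ℕ → Carrier
      S i = ΣF (λ x → x ^ (ℕ.pred n ℕ.+ p ℕ.^ i))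
      S0 : S 0 ≈ - 1#
      S0 = trans (ΣF-cong (λ x → ^-congʳ x (≡.trans (ℕ.+-comm (ℕ.pred n) 1) (ℕ.suc-pred n)))) ΣF-power-n
      1<p : 1 < p
      1<p = ≡.subst (1 <_) (≡.sym p≡1+r) (s<s (ℕ.>-nonZero⁻¹ r))
      S+ : ∀ i → i < f′ → S (suc i) ≈ 0#
      S+ i i<f′ = ΣF-power (ℕ.pred n ℕ.+ p ℕ.^ suc i) {{ℕ.>-nonZero (ℕ.≤-trans (ℕ.m^n>0 p (suc i)) (ℕ.m≤n+m _ (ℕ.pred n)))}} n∤
        where
        P = p ℕ.^ suc i
        1<P : 1 < P
        1<P = ℕ.<-≤-trans 1<p (ℕ.m≤m*n p (p ℕ.^ i) {{ℕ.m^n≢0 p i}})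
        P<q : P < suc n
        P<q = ≡.subst (P <_) p^f≡1+n (ℕ.^-monoʳ-< p 1<p (≡.subst (suc i <_) (≡.sym f≡1+2θ) (s<s i<f′)))
        -- The exponent is n + (P - 1) with 0 < P - 1 < n, so n cannot divide it.
        sum≡ : ℕ.pred n ℕ.+ P ≡ n ℕ.+ ℕ.pred P
        sum≡ = ≡.trans (≡.cong (ℕ.pred n ℕ.+_) (≡.sym (ℕ.suc-pred P {{ℕ.>-nonZero (ℕ.<-trans z<s 1<P)}})))
                       (≡.trans (ℕ.+-suc (ℕ.pred n) (ℕ.pred P)) (≡.cong (ℕ._+ ℕ.pred P) (ℕ.suc-pred n)))
        n∤ : ¬ n ∣ ℕ.pred n ℕ.+ P
        n∤ d = ℕ.<⇒≱ (ℕ.≤-trans (ℕ.≤-reflexive (ℕ.suc-pred P {{ℕ.>-nonZero (ℕ.<-trans z<s 1<P)}})) (ℕ.s≤s⁻¹ P<q))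
                      (∣⇒≤ {{ℕ.>-nonZero (ℕ.pred-mono-≤ 1<P)}} (∣m+n∣m⇒∣n (≡.subst (n ∣_) sum≡ d) ∣-refl))
          where open import Data.Nat.Divisibility using (∣m+n∣m⇒∣n; ∣-refl)

    -- A trace vanishing everywhere would make the sum of `ΣF-Tr` equal to 0 instead of -1.
    Tr-nonzero : ∃[ y ] ¬ Tr y ≈ 0#
    Tr-nonzero with any? (λ i → ¬? (Tr (element {n} i) ≟ 0#))
    ... | yes (i , Tr≉0) = element i , Tr≉0
    ... | no none = contradiction (begin
      1#                               ≈⟨ -‿involutive 1# ⟨
      - - 1#                           ≈⟨ -‿cong ΣF-Tr ⟨
      - ΣF (λ x → x ^ ℕ.pred n * Tr x) ≈⟨ -‿cong (ΣF-zero (λ x → trans (*-congˡ (Tr≈0 x)) (zeroʳ _))) ⟩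
      - 0#                             ≈⟨ ε⁻¹≈ε ⟩
      0#                               ∎) 1≉0
      where
      open import Algebra.Properties.Group +-group using () renaming (⁻¹-involutive to -‿involutive; ε⁻¹≈ε to ε⁻¹≈ε)
      Tr≈0 : ∀ x → Tr x ≈ 0#
      Tr≈0 x = trans (Tr-cong (sym (element-index x)))
                 (decidable-stable (Tr (element (index x)) ≟ 0#) (λ neq → none (index x , neq)))

-- The integral additive character and Fourier inversion

module Character where

  open import Algebra.Bundles using (CommutativeRing)
  open import Data.Integer.Base as ℤ using (ℤ; +_; 0ℤ; 1ℤ; -1ℤ)
  import Data.Integer.Properties as ℤ
  import Data.Integer.Divisibility.Signed as ℤ
  open import Data.Integer.Tactic.RingSolver using (solve-∀)
  open import Data.Nat.Base as ℕ using (ℕ; zero; suc; _<_; z<s; s<s; NonZero)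
  open import Data.Nat.DivMod using (_%_; %-congʳ; m<n⇒m%n≡m)
  import Data.Nat.Properties as ℕ
  open import Data.Product.Base using (_,_; ∃-syntax; _×_)
  open import Relation.Binary.PropositionalEquality as ≡ using (_≡_; cong; cong₂)
  open import Relation.Nullary.Decidable using (Dec; yes; no)
  open import Relation.Nullary.Negation using (¬_; contradiction)

  open FiniteSums
  open NumericalData
  open CyclicField
  open FieldSums
  open FieldArithmetic
  open Trace

  module AdditiveCharacter {a b} (C : Constants) (F : CommutativeRing a b) (ff : IsFiniteField F (Constants.p C ℕ.^ Constants.f C))
                   (γ : CommutativeRing.Carrier F) (γ-primitive : IsPrimitiveElement F γ) where
    open TraceForm C F ff γ γ-primitive public
    open SumOver ℤ.+-*-commutativeRing public using ()
      renaming (ΣF to Σᶻ; ΣF-cong to Σᶻ-cong; ΣF-exp to Σᶻ-exp; ΣF-+ to Σᶻ-+; ΣF-*ˡ to Σᶻ-*ˡ; ΣF-*ʳ to Σᶻ-*ʳ; ΣF-swap to Σᶻ-swap; ΣF-∑ to Σᶻ-∑; ΣF-reindex to Σᶻ-reindex; ΣF-single to Σᶻ-single; ΣF-translate to Σᶻ-translate; ΣF-scale to Σᶻ-scale; Congruent to Congruentᶻ; ⟦_⟧ to ⟦_⟧ᶻ; ⟦⟧-yes to ⟦⟧ᶻ-yes; ⟦⟧-no to ⟦⟧ᶻ-no; ⟦⟧-⇔ to ⟦⟧ᶻ-⇔)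
    open Sumᶻ public using () renaming (∑ to ∑ᶻ; ∑-cong to ∑ᶻ-cong; ∑-cong< to ∑ᶻ-cong<; ∑-zero to ∑ᶻ-zero; ∑-+ to ∑ᶻ-+; ∑-*ˡ to ∑ᶻ-*ˡ; ∑-*ʳ to ∑ᶻ-*ʳ; ∑-split to ∑ᶻ-split; ∑-last to ∑ᶻ-last; ∑-cyclic to ∑ᶻ-cyclic; ∑-cyclic₁ to ∑ᶻ-cyclic₁; ∑-block to ∑ᶻ-block; ∑-multiply to ∑ᶻ-multiply)
    open ≡.≡-Reasoning

    ∑ᶻ-const : ∀ m x → ∑ᶻ m (λ _ → x) ≡ + m ℤ.* x
    ∑ᶻ-const zero    x = ≡.refl
    ∑ᶻ-const (suc m) x = ≡.trans (cong (λ z → x ℤ.+ z) (∑ᶻ-const m x)) (≡.sym (ℤ.suc-* (+ m) x))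

    level : ∀ {c} {A : Set c} → Dec A → ℤ
    level (yes _) = + r
    level (no _)  = -1ℤ

    level-yes : ∀ {c} {A : Set c} (d : Dec A) → A → level d ≡ + r
    level-yes (yes _) _ = ≡.refl
    level-yes (no ¬a) a = contradiction a ¬a

    level-no : ∀ {c} {A : Set c} (d : Dec A) → ¬ A → level d ≡ -1ℤ
    level-no (yes a) ¬a = contradiction a ¬a
    level-no (no _)  _  = ≡.refl

    level-⇔ : ∀ {c d} {A : Set c} {B : Set d} (d : Dec A) (e : Dec B) → (A → B) → (B → A) → level d ≡ level e
    level-⇔ (yes x) e to from = ≡.sym (level-yes e (to x))
    level-⇔ (no ¬x) e to from = ≡.sym (level-no e (λ y → ¬x (from y)))

    level-difference : ∀ {c d} {A : Set c} {B : Set d} (d : Dec A) (e : Dec B) → + p ℤ.∣ level d ℤ.- level e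
    level-difference (yes _) (yes _) = ℤ.divides 0ℤ (ℤ.+-inverseʳ (+ r))
    level-difference (yes _) (no _)  = ℤ.divides 1ℤ (≡.trans (cong +_ (≡.trans (ℕ.+-comm r 1) (≡.sym p≡1+r))) (≡.sym (ℤ.*-identityˡ (+ p))))
    level-difference (no _)  (yes _) = ℤ.divides -1ℤ (≡.trans (negate (+ r)) (cong (-1ℤ ℤ.*_) (cong +_ (≡.sym p≡1+r))))
      where
      negate : ∀ x → -1ℤ ℤ.- x ≡ -1ℤ ℤ.* (1ℤ ℤ.+ x)
      negate = solve-∀
    level-difference (no _)  (no _)  = ℤ.divides 0ℤ ≡.refl

    ψ : Carrier → ℤ
    ψ v = level (v ≟ 0#)

    ψ-cong : Congruentᶻ ψ
    ψ-cong {x} {y} eq = level-⇔ (x ≟ 0#) (y ≟ 0#) (trans (sym eq)) (trans eq)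

    -- The only values are r and -1, and r + 1 = p. This is the integral shadow of ζ ≡ 1 modulo ζ -
    -- 1.
    ψ-difference : ∀ v w → + p ℤ.∣ ψ v ℤ.- ψ w
    ψ-difference v w = level-difference (v ≟ 0#) (w ≟ 0#)

    weight-% : ∀ m → ψ (m ⨯ 1#) ≡ weight r (m % suc r)
    weight-% m with m % suc r in eq
    ... | zero  = level-yes (m ⨯ 1# ≟ 0#) (trans (⨯-% m 1#) (×-congˡ {1#} {m % p} {0} (≡.trans (%-congʳ {o = m} p≡1+r) eq)))
    ... | suc _ = level-no (m ⨯ 1# ≟ 0#) (λ m⨯1≈0 → ℕ.1+n≢0 (≡.trans (≡.sym eq) (≡.trans (≡.sym (%-congʳ {o = m} p≡1+r)) (⨯1≈0⇒%≡0 m m⨯1≈0))))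

    -- Shifted by one, so that u < r runs through the nonzero elements of the prime field; the last
    -- one, at `pred r`, is -1.
    scalar : ℕ → Carrier
    scalar u = suc u ⨯ 1#

    scalar≉0 : ∀ {u} → u < r → ¬ scalar u ≈ 0#
    scalar≉0 {u} u<r = multiple≉0 {suc u} z<s (≡.subst (suc u <_) (≡.sym p≡1+r) (s<s u<r))

    weight-product : WeightProduct r
    weight-product = ≡.subst WeightProduct (≡.sym r≡10) weight-product-10

    ψ-product : ∀ {v w m k} → m < p → v ≈ m ⨯ 1# → k < p → w ≈ k ⨯ 1# →
                ψ v ℤ.* ψ w ≡ ∑ᶻ r (λ u → ψ (v + scalar u * w))
    ψ-product {v} {w} {m} {k} m<p v≈m k<p w≈k = begin
      ψ v ℤ.* ψ w                                              ≡⟨ cong₂ ℤ._*_ (value m<p v≈m) (value k<p w≈k) ⟩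
      weight r m ℤ.* weight r k                                ≡⟨ weight-product m k (≡.subst (m <_) p≡1+r m<p) (≡.subst (k <_) p≡1+r k<p) ⟩
      ∑ᶻ r (λ u → weight r ((m ℕ.+ suc u ℕ.* k) % suc r))      ≡⟨ ∑ᶻ-cong r (λ u → ≡.trans (≡.sym (weight-% (m ℕ.+ suc u ℕ.* k))) (ψ-cong (combine u))) ⟩
      ∑ᶻ r (λ u → ψ (v + scalar u * w))                        ∎
      where
      value : ∀ {v m} → m < p → v ≈ m ⨯ 1# → ψ v ≡ weight r m
      value {v} {m} m<p v≈m = ≡.trans (ψ-cong v≈m) (≡.trans (weight-% m) (cong (weight r) (m<n⇒m%n≡m (≡.subst (m <_) p≡1+r m<p))))
      combine : ∀ u → (m ℕ.+ suc u ℕ.* k) ⨯ 1# ≈ v + scalar u * w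
      combine u = trans (×-homo-+ 1# m (suc u ℕ.* k)) (+-cong (sym v≈m) (trans (×1-homo-* (suc u) k) (*-congˡ (sym w≈k))))

    -- The sum of the additive characters x ↦ ζ^(Tr x) over the primitive p-th roots of unity ζ,
    -- so that everything stays in ℤ.
    h : Carrier → ℤ
    h x = ψ (Tr x)

    h-cong : Congruentᶻ h
    h-cong eq = ψ-cong (Tr-cong eq)

    h-0 : h 0# ≡ + r
    h-0 = level-yes (Tr 0# ≟ 0#) Tr-0

    h-frobenius : ∀ x → h (x ^ p) ≡ h x
    h-frobenius x = ψ-cong (Tr-frobenius x)

    h-product : ∀ x y → h x ℤ.* h y ≡ ∑ᶻ r (λ u → h (x + scalar u * y))
    h-product x y with m , m<p , Trx ← tr x | k , k<p , Try ← tr y = ≡.trans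
      (ψ-product m<p Trx k<p Try)
      (∑ᶻ-cong r (λ u → ψ-cong (sym (trans (Tr-+ x _) (+-congˡ (Tr-⨯ (suc u) y))))))

    h-multiple : ∀ m {x} → ¬ m ⨯ 1# ≈ 0# → h ((m ⨯ 1#) * x) ≡ h x
    h-multiple m {x} m≉0 = level-⇔ (Tr ((m ⨯ 1#) * x) ≟ 0#) (Tr x ≟ 0#)
      (λ eq → xy≈0⇒y≈0 (m ⨯ 1#) m≉0 (trans (sym (Tr-⨯ m x)) eq))
      (λ eq → trans (Tr-⨯ m x) (trans (*-congˡ eq) (zeroʳ _)))

    γ^L∈prime-field : ∃[ m ] m < p × γ ^ L ≈ m ⨯ 1#
    γ^L∈prime-field = prime-field (γ ^ L) (begin′
      (γ ^ L) ^ p                ≈⟨ ^-assocʳ γ L p ⟩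
      γ ^ (L ℕ.* p)              ≈⟨ ^-congʳ γ (≡.trans (cong (L ℕ.*_) p≡1+r) (≡.trans (ℕ.*-suc L r) (cong (λ z → L ℕ.+ z) (≡.trans (≡.sym n≡Lr) (≡.sym (ℕ.*-identityˡ n)))))) ⟩
      γ ^ (L ℕ.+ 1 ℕ.* n)        ≈⟨ γ^-multiple γ^n≈1 L 1 ⟩
      γ ^ L                      ∎′)
      where open import Relation.Binary.Reasoning.Setoid setoid renaming (begin_ to begin′_; _∎ to _∎′)

    -- A factor from the prime field comes out of the trace and, being nonzero, does not affect
    -- whether the trace vanishes. Hence h is constant on cosets of the prime field units.
    h-γ^L : ∀ x → h (γ ^ L * x) ≡ h x
    h-γ^L x with m , _ , eq ← γ^L∈prime-field =
      ≡.trans (h-cong (*-congʳ eq)) (h-multiple m (λ m≈0 → γ^≉0 L (trans eq m≈0)))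

    -- For y of nonzero trace h y = -1, while `h-product` and translation turn S · h y into r S;
    -- hence (r + 1) S = 0.
    Σᶻ-h : Σᶻ h ≡ 0ℤ
    Σᶻ-h with y , Try≉0 ← Tr-nonzero = ℤ.*-cancelˡ-≡ (+ suc r) (Σᶻ h) 0ℤ (begin
      + suc r ℤ.* S            ≡⟨ ℤ.suc-* (+ r) S ⟩
      S ℤ.+ + r ℤ.* S          ≡⟨ cong (λ z → S ℤ.+ z) (begin
        + r ℤ.* S                                              ≡⟨ ∑ᶻ-const r S ⟨
        ∑ᶻ r (λ u → S)                                         ≡⟨ ∑ᶻ-cong r (λ u → ≡.trans (Σᶻ-cong (λ x → h-cong (+-comm x _))) (Σᶻ-translate (scalar u * y) h-cong)) ⟨
        ∑ᶻ r (λ u → Σᶻ (λ x → h (x + scalar u * y)))           ≡⟨ Σᶻ-∑ r (λ x u → h (x + scalar u * y)) ⟨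
        Σᶻ (λ x → ∑ᶻ r (λ u → h (x + scalar u * y)))           ≡⟨ Σᶻ-cong (λ x → h-product x y) ⟨
        Σᶻ (λ x → h x ℤ.* h y)                                 ≡⟨ Σᶻ-*ʳ (h y) h ⟨
        S ℤ.* h y                                              ≡⟨ cong (S ℤ.*_) (level-no (Tr y ≟ 0#) Try≉0) ⟩
        S ℤ.* -1ℤ                                              ∎) ⟩
      S ℤ.+ S ℤ.* -1ℤ          ≡⟨ cancel S ⟩
      0ℤ                       ≡⟨ ℤ.*-zeroʳ (+ suc r) ⟨
      + suc r ℤ.* 0ℤ           ∎)
      where
      S = Σᶻ h
      cancel : ∀ S → S ℤ.+ S ℤ.* -1ℤ ≡ 0ℤ
      cancel = solve-∀

    Q : ℤ
    Q = + suc n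

    orthogonality : ∀ x → Σᶻ (λ c → h (c * x)) ≡ ⟦ x ≟ 0# ⟧ᶻ ℤ.* (Q ℤ.* + r)
    orthogonality x with x ≟ 0#
    ... | yes x≈0 = begin
      Σᶻ (λ c → h (c * x))                  ≡⟨ Σᶻ-cong (λ c → ≡.trans (h-cong (trans (*-congˡ x≈0) (zeroʳ c))) h-0) ⟩
      Σᶻ (λ _ → + r)                        ≡⟨ Σᶻ-exp (λ _ → + r) ⟩
      + r ℤ.+ ∑ᶻ n (λ _ → + r)              ≡⟨ ∑ᶻ-const (suc n) (+ r) ⟩
      Q ℤ.* + r                             ≡⟨ ℤ.*-identityˡ _ ⟨
      1ℤ ℤ.* (Q ℤ.* + r)                    ∎
    ... | no x≉0 = begin
      Σᶻ (λ c → h (c * x))                  ≡⟨ Σᶻ-cong (λ c → h-cong (*-comm c x)) ⟩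
      Σᶻ (λ c → h (x * c))                  ≡⟨ Σᶻ-scale x≉0 h-cong ⟩
      Σᶻ h                                  ≡⟨ Σᶻ-h ⟩
      0ℤ                                    ≡⟨ ℤ.*-zeroˡ (Q ℤ.* + r) ⟨
      0ℤ ℤ.* (Q ℤ.* + r)                    ∎

    -1≈scalar : scalar (ℕ.pred r) ≈ - 1#
    -1≈scalar = inverseʳ-unique 1# (scalar (ℕ.pred r)) (trans (×-congˡ (≡.trans (cong suc (ℕ.suc-pred r)) (≡.sym p≡1+r))) p⨯1≈0)
      where
      open import Algebra.Properties.Group +-group using (inverseʳ-unique)
      instance
        r≢0 : NonZero r
        r≢0 = ≡.subst NonZero (≡.sym r≡10) _

    module Transform (φ : Carrier → ℤ) (φ-cong : Congruentᶻ φ) (φ-invariant : ∀ u x → u < r → φ (scalar u * x) ≡ φ x) where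

      -- h bundles r additive characters, and the invariance of φ makes their transforms coincide,
      -- so this is r times the usual transform.
      φ̂ : Carrier → ℤ
      φ̂ c = Σᶻ (λ x → φ x ℤ.* h (c * x))

      φ-neg : ∀ x → φ (- x) ≡ φ x
      φ-neg x = ≡.trans (φ-cong (sym (trans (*-congʳ -1≈scalar) (-1*x≈-x x)))) (φ-invariant (ℕ.pred r) x (ℕ.≤-reflexive (ℕ.suc-pred r)))
        where
        instance
          r≢0 : NonZero r
          r≢0 = ≡.subst NonZero (≡.sym r≡10) _

      φ̂-cong : Congruentᶻ φ̂
      φ̂-cong eq = Σᶻ-cong (λ x → cong (φ x ℤ.*_) (h-cong (*-congʳ eq)))

      reindex-scalar : ∀ {u} → u < r → ∀ {g} → Congruentᶻ g → Σᶻ (λ x → φ x ℤ.* g (scalar u * x)) ≡ Σᶻ (λ x → φ x ℤ.* g x)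
      reindex-scalar {u} u<r {g} g-cong = ≡.trans
        (Σᶻ-cong (λ x → cong (ℤ._* g (scalar u * x)) (≡.sym (φ-invariant u x u<r))))
        (Σᶻ-scale (scalar≉0 u<r) {λ x → φ x ℤ.* g x} (λ eq → cong₂ ℤ._*_ (φ-cong eq) (g-cong eq)))

      -- `h-product` spreads h (c x) h (c w) over r scalars u. Orthogonality in c leaves only u x =
      -- -w, and invariance of φ makes the r contributions equal; one factor r counts them, the
      -- other is h 0.
      inversion : ∀ w → Σᶻ (λ c → φ̂ c ℤ.* h (c * w)) ≡ (+ r ℤ.* (Q ℤ.* + r)) ℤ.* φ w
      inversion w = begin
        Σᶻ (λ c → φ̂ c ℤ.* h (c * w))
          ≡⟨ Σᶻ-cong (λ c → ≡.trans (Σᶻ-*ʳ (h (c * w)) (λ x → φ x ℤ.* h (c * x))) (Σᶻ-cong (λ x → regroup c x))) ⟩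
        Σᶻ (λ c → Σᶻ (λ x → φ x ℤ.* ∑ᶻ r (λ u → h (c * (w + scalar u * x)))))
          ≡⟨ Σᶻ-swap (λ c x → φ x ℤ.* ∑ᶻ r (λ u → h (c * (w + scalar u * x)))) ⟩
        Σᶻ (λ x → Σᶻ (λ c → φ x ℤ.* ∑ᶻ r (λ u → h (c * (w + scalar u * x)))))
          ≡⟨ Σᶻ-cong (λ x → ≡.trans (≡.sym (Σᶻ-*ˡ (φ x) (λ c → ∑ᶻ r (λ u → h (c * (w + scalar u * x)))))) (≡.trans (cong (φ x ℤ.*_) (≡.trans (Σᶻ-∑ r (λ c u → h (c * (w + scalar u * x)))) (∑ᶻ-cong r (λ u → orthogonality (w + scalar u * x))))) (∑ᶻ-*ˡ r (φ x) (λ u → δ (scalar u * x))))) ⟩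
        Σᶻ (λ x → ∑ᶻ r (λ u → φ x ℤ.* δ (scalar u * x)))
          ≡⟨ Σᶻ-∑ r (λ x u → φ x ℤ.* δ (scalar u * x)) ⟩
        ∑ᶻ r (λ u → Σᶻ (λ x → φ x ℤ.* δ (scalar u * x)))
          ≡⟨ ∑ᶻ-cong< r (λ u u<r → ≡.trans (reindex-scalar u<r δ-cong) single) ⟩
        ∑ᶻ r (λ u → φ w ℤ.* (Q ℤ.* + r))
          ≡⟨ ∑ᶻ-const r _ ⟩
        + r ℤ.* (φ w ℤ.* (Q ℤ.* + r))
          ≡⟨ rotate (+ r) (φ w) (Q ℤ.* + r) ⟩
        (+ r ℤ.* (Q ℤ.* + r)) ℤ.* φ w ∎
        where
        rotate : ∀ a b c → a ℤ.* (b ℤ.* c) ≡ (a ℤ.* c) ℤ.* b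
        rotate = solve-∀
        rotate′ : ∀ a b c → a ℤ.* b ℤ.* c ≡ a ℤ.* (c ℤ.* b)
        rotate′ = solve-∀
        δ : Carrier → ℤ
        δ y = ⟦ w + y ≟ 0# ⟧ᶻ ℤ.* (Q ℤ.* + r)
        δ-cong : Congruentᶻ δ
        δ-cong {x} {y} eq = cong (ℤ._* (Q ℤ.* + r)) (⟦⟧ᶻ-⇔ (w + x ≟ 0#) (w + y ≟ 0#) (trans (+-congˡ (sym eq))) (trans (+-congˡ eq)))
        regroup : ∀ c x → φ x ℤ.* h (c * x) ℤ.* h (c * w) ≡ φ x ℤ.* ∑ᶻ r (λ u → h (c * (w + scalar u * x)))
        regroup c x = ≡.trans (rotate′ (φ x) (h (c * x)) (h (c * w))) (cong (φ x ℤ.*_) (≡.trans (h-product (c * w) (c * x))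
          (∑ᶻ-cong r (λ u → h-cong (trans (+-congˡ (trans (sym (*-assoc _ c x)) (trans (*-congʳ (*-comm _ c)) (*-assoc c _ x)))) (sym (distribˡ c w _)))))))
        single : Σᶻ (λ x → φ x ℤ.* δ x) ≡ φ w ℤ.* (Q ℤ.* + r)
        single = begin
          Σᶻ (λ x → φ x ℤ.* δ x)               ≡⟨ Σᶻ-single (- w) (λ x → φ x ℤ.* δ x) (λ eq → cong₂ ℤ._*_ (φ-cong eq) (δ-cong eq)) off ⟩
          φ (- w) ℤ.* δ (- w)                  ≡⟨ cong₂ ℤ._*_ (φ-neg w) (≡.trans (cong (ℤ._* (Q ℤ.* + r)) (⟦⟧ᶻ-yes (w - w ≟ 0#) (-‿inverseʳ w))) (ℤ.*-identityˡ _)) ⟩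
          φ w ℤ.* (Q ℤ.* + r)                  ∎
          where
          open import Algebra.Properties.Group +-group using (inverseʳ-unique)
          off : ∀ x → ¬ x ≈ - w → φ x ℤ.* δ x ≡ 0ℤ
          off x neq = ≡.trans (cong (λ z → φ x ℤ.* (z ℤ.* (Q ℤ.* + r))) (⟦⟧ᶻ-no (w + x ≟ 0#) (λ eq → neq (inverseʳ-unique w x eq)))) (ℤ.*-zeroʳ (φ x))

      -- One factor `φ̂ c` is expanded while the other is kept for `inversion` at w + u y, so the
      -- square transforms into the autocorrelation of φ.
      correlation : ∀ w → Σᶻ (λ c → φ̂ c ℤ.* φ̂ c ℤ.* h (c * w)) ≡ (+ r ℤ.* (+ r ℤ.* (Q ℤ.* + r))) ℤ.* Σᶻ (λ y → φ y ℤ.* φ (w + y))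
      correlation w = begin
        Σᶻ (λ c → φ̂ c ℤ.* φ̂ c ℤ.* h (c * w))
          ≡⟨ Σᶻ-cong (λ c → expand c) ⟩
        Σᶻ (λ c → Σᶻ (λ y → φ y ℤ.* ∑ᶻ r (λ u → φ̂ c ℤ.* h (c * (w + scalar u * y)))))
          ≡⟨ Σᶻ-swap (λ c y → φ y ℤ.* ∑ᶻ r (λ u → φ̂ c ℤ.* h (c * (w + scalar u * y)))) ⟩
        Σᶻ (λ y → Σᶻ (λ c → φ y ℤ.* ∑ᶻ r (λ u → φ̂ c ℤ.* h (c * (w + scalar u * y)))))
          ≡⟨ Σᶻ-cong (λ y → ≡.trans (≡.sym (Σᶻ-*ˡ (φ y) (λ c → ∑ᶻ r (λ u → φ̂ c ℤ.* h (c * (w + scalar u * y)))))) (≡.trans (cong (φ y ℤ.*_) (≡.trans (Σᶻ-∑ r (λ c u → φ̂ c ℤ.* h (c * (w + scalar u * y)))) (∑ᶻ-cong r (λ u → inversion (w + scalar u * y))))) (∑ᶻ-*ˡ r (φ y) (λ u → K ℤ.* φ (w + scalar u * y))))) ⟩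
        Σᶻ (λ y → ∑ᶻ r (λ u → φ y ℤ.* (K ℤ.* φ (w + scalar u * y))))
          ≡⟨ Σᶻ-∑ r (λ y u → φ y ℤ.* (K ℤ.* φ (w + scalar u * y))) ⟩
        ∑ᶻ r (λ u → Σᶻ (λ y → φ y ℤ.* (K ℤ.* φ (w + scalar u * y))))
          ≡⟨ ∑ᶻ-cong< r (λ u u<r → reindex-scalar u<r {λ y → K ℤ.* φ (w + y)} (λ eq → cong (K ℤ.*_) (φ-cong (+-congˡ eq)))) ⟩
        ∑ᶻ r (λ u → Σᶻ (λ y → φ y ℤ.* (K ℤ.* φ (w + y))))
          ≡⟨ ∑ᶻ-const r _ ⟩
        + r ℤ.* Σᶻ (λ y → φ y ℤ.* (K ℤ.* φ (w + y)))
          ≡⟨ cong (+ r ℤ.*_) (≡.trans (Σᶻ-cong (λ y → swap (φ y) K (φ (w + y)))) (≡.sym (Σᶻ-*ˡ K (λ y → φ y ℤ.* φ (w + y))))) ⟩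
        + r ℤ.* (K ℤ.* Σᶻ (λ y → φ y ℤ.* φ (w + y)))
          ≡⟨ ℤ.*-assoc (+ r) K _ ⟨
        (+ r ℤ.* K) ℤ.* Σᶻ (λ y → φ y ℤ.* φ (w + y)) ∎
        where
        K : ℤ
        K = + r ℤ.* (Q ℤ.* + r)
        swap : ∀ a b c → a ℤ.* (b ℤ.* c) ≡ b ℤ.* (a ℤ.* c)
        swap = solve-∀
        rotate : ∀ a b c d → a ℤ.* (b ℤ.* c) ℤ.* d ≡ b ℤ.* (a ℤ.* (d ℤ.* c))
        rotate = solve-∀
        expand : ∀ c → φ̂ c ℤ.* φ̂ c ℤ.* h (c * w) ≡ Σᶻ (λ y → φ y ℤ.* ∑ᶻ r (λ u → φ̂ c ℤ.* h (c * (w + scalar u * y))))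
        expand c = begin
          φ̂ c ℤ.* φ̂ c ℤ.* h (c * w)                                        ≡⟨ cong (ℤ._* h (c * w)) (Σᶻ-*ˡ (φ̂ c) (λ y → φ y ℤ.* h (c * y))) ⟩
          Σᶻ (λ y → φ̂ c ℤ.* (φ y ℤ.* h (c * y))) ℤ.* h (c * w)             ≡⟨ Σᶻ-*ʳ (h (c * w)) (λ y → φ̂ c ℤ.* (φ y ℤ.* h (c * y))) ⟩
          Σᶻ (λ y → φ̂ c ℤ.* (φ y ℤ.* h (c * y)) ℤ.* h (c * w))             ≡⟨ Σᶻ-cong (λ y → ≡.trans (rotate (φ̂ c) (φ y) (h (c * y)) (h (c * w))) (cong (λ z → φ y ℤ.* (φ̂ c ℤ.* z)) (h-product (c * w) (c * y)))) ⟩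
          Σᶻ (λ y → φ y ℤ.* (φ̂ c ℤ.* ∑ᶻ r (λ u → h (c * w + scalar u * (c * y)))))
            ≡⟨ Σᶻ-cong (λ y → cong (φ y ℤ.*_) (≡.trans (∑ᶻ-*ˡ r (φ̂ c) (λ u → h (c * w + scalar u * (c * y)))) (∑ᶻ-cong r (λ u → cong (φ̂ c ℤ.*_) (h-cong (trans (+-congˡ (trans (sym (*-assoc _ c y)) (trans (*-congʳ (*-comm _ c)) (*-assoc c _ y)))) (sym (distribˡ c w _)))))))) ⟩
          Σᶻ (λ y → φ y ℤ.* ∑ᶻ r (λ u → φ̂ c ℤ.* h (c * (w + scalar u * y)))) ∎

-- Stickelberger's congruence in the group ring

module Stickelberger where

  open import Algebra.Bundles using (CommutativeRing; CommutativeSemiring)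
  open import Data.Nat.Base as ℕ using (ℕ; zero; suc; _<_; _≤_; z<s; s<s; _∸_; NonZero)
  open import Data.Nat.Divisibility using (_∣_; divides; ∣⇒≤; ∣m+n∣m⇒∣n; m∣m*n)
  open import Data.Nat.DivMod
  open import Data.Nat.Tactic.RingSolver using (solve-∀)
  import Data.Nat.Properties as ℕ
  open import Data.Product.Base using (_,_; ∃-syntax; _×_; proj₁; proj₂)
  open import Level using (Level; _⊔_) renaming (suc to lsuc)
  open import Relation.Binary.PropositionalEquality as ≡ using (_≡_; cong; cong₂)
  open import Relation.Nullary.Decidable using (Dec; yes; no)
  open import Relation.Nullary.Negation using (¬_)

  open FiniteSums
  open NumericalData
  open CyclicField
  open FieldSums
  open FieldArithmetic
  open Trace

  -- What is needed of K₁ = ℤ[(F, *)] and K = ℤ[(F, +) × (F, *)].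
  record GroupRings {a b} (F : CommutativeRing a b) (c d : Level) : Set (a ⊔ b ⊔ lsuc (c ⊔ d)) where
    private module F = CommutativeRing F
    field
      K₁ K : CommutativeRing c d
    private
      module K₁ = CommutativeRing K₁
      module K = CommutativeRing K
    field
      ⟨_⟩      : F.Carrier → K₁.Carrier
      ⟨_∙_⟩    : F.Carrier → F.Carrier → K.Carrier
      lift     : K₁.Carrier → K.Carrier
      ev       : K₁.Carrier → F.Carrier
      gen-cong : ∀ {v v′ e e′} → v F.≈ v′ → e F.≈ e′ → ⟨ v ∙ e ⟩ K.≈ ⟨ v′ ∙ e′ ⟩
      gen-*    : ∀ v e v′ e′ → ⟨ v ∙ e ⟩ K.* ⟨ v′ ∙ e′ ⟩ K.≈ ⟨ v F.+ v′ ∙ e F.* e′ ⟩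
      gen-1    : ⟨ F.0# ∙ F.1# ⟩ K.≈ K.1#
      lift-gen : ∀ e → lift ⟨ e ⟩ K.≈ ⟨ F.0# ∙ e ⟩
      lift-0   : lift K₁.0# K.≈ K.0#
      lift-+   : ∀ x y → lift (x K₁.+ y) K.≈ lift x K.+ lift y
      lift-*   : ∀ x y → lift (x K₁.* y) K.≈ lift x K.* lift y
      lift-neg : ∀ x → lift (K₁.- x) K.≈ K.- lift x
      ev-gen   : ∀ e → ev ⟨ e ⟩ F.≈ e
      ev-0     : ev K₁.0# F.≈ F.0#
      ev-+     : ∀ x y → ev (x K₁.+ y) F.≈ ev x F.+ ev y
      ev-*     : ∀ x y → ev (x K₁.* y) F.≈ ev x F.* ev y
      ev-neg   : ∀ x → ev (K₁.- x) F.≈ F.- ev x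

  module Digits (C : Constants) (p≡1+r : Constants.p C ≡ ℕ.suc (Constants.r C)) (a : ℕ) (0<a : 0 < a) (a<ℓ : a < Constants.ℓ C) where
    open Constants C
    open Sum ℕ.+-*-commutativeSemiring

    -- Long division of a by N in base p: digit i is the i-th most significant digit of a n / N = prefix f.
    residue digit prefix weight-upto : ℕ → ℕ
    residue zero    = a
    residue (suc i) = (p ℕ.* residue i) % N
    digit i = (p ℕ.* residue i) / N
    prefix zero    = 0
    prefix (suc i) = p ℕ.* prefix i ℕ.+ digit i
    weight-upto i = ∑ i digit

    a<N : a < N
    a<N = ℕ.<-≤-trans a<ℓ (ℕ.≤-trans (ℕ.m≤m*n ℓ M) (ℕ.≤-reflexive (≡.sym N≡ℓM)))

    residue<N : ∀ i → residue i < N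
    residue<N zero    = a<N
    residue<N (suc i) = m%n<n (p ℕ.* residue i) N

    residue≡ : ∀ i → residue i ≡ (p ℕ.^ i ℕ.* a) % N
    residue≡ zero    = ≡.trans (≡.sym (m<n⇒m%n≡m a<N)) (cong (_% N) (≡.sym (ℕ.*-identityˡ a)))
    residue≡ (suc i) = begin
      (p ℕ.* residue i) % N                            ≡⟨ %-distribˡ-* p (residue i) N ⟩
      ((p % N) ℕ.* (residue i % N)) % N                ≡⟨ cong (λ x → ((p % N) ℕ.* x) % N) (≡.trans (cong (_% N) (residue≡ i)) (m%n%n≡m%n (p ℕ.^ i ℕ.* a) N)) ⟩
      ((p % N) ℕ.* ((p ℕ.^ i ℕ.* a) % N)) % N          ≡⟨ %-distribˡ-* p (p ℕ.^ i ℕ.* a) N ⟨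
      (p ℕ.* (p ℕ.^ i ℕ.* a)) % N                      ≡⟨ cong (_% N) (ℕ.*-assoc p (p ℕ.^ i) a) ⟨
      (p ℕ.* p ℕ.^ i ℕ.* a) % N                        ∎
      where open ≡.≡-Reasoning

    division : ∀ i → p ℕ.* residue i ≡ residue (suc i) ℕ.+ digit i ℕ.* N
    division i = m≡m%n+[m/n]*n (p ℕ.* residue i) N

    digit<p : ∀ i → digit i < p
    digit<p i = m<n*o⇒m/o<n (ℕ.*-monoʳ-< p {{p≢0}} (residue<N i))
      where
      p≢0 : NonZero p
      p≢0 = ≡.subst NonZero (≡.sym p≡1+r) _

    prefix-equation : ∀ i → prefix i ℕ.* N ℕ.+ residue i ≡ p ℕ.^ i ℕ.* a
    prefix-equation zero    = ≡.sym (ℕ.*-identityˡ a)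
    prefix-equation (suc i) = begin
      (p ℕ.* prefix i ℕ.+ digit i) ℕ.* N ℕ.+ residue (suc i)      ≡⟨ collect p (prefix i) (digit i) N (residue (suc i)) ⟩
      p ℕ.* (prefix i ℕ.* N) ℕ.+ (residue (suc i) ℕ.+ digit i ℕ.* N) ≡⟨ cong (λ x → p ℕ.* (prefix i ℕ.* N) ℕ.+ x) (division i) ⟨
      p ℕ.* (prefix i ℕ.* N) ℕ.+ p ℕ.* residue i                  ≡⟨ ℕ.*-distribˡ-+ p (prefix i ℕ.* N) (residue i) ⟨
      p ℕ.* (prefix i ℕ.* N ℕ.+ residue i)                        ≡⟨ cong (p ℕ.*_) (prefix-equation i) ⟩
      p ℕ.* (p ℕ.^ i ℕ.* a)                                       ≡⟨ ℕ.*-assoc p (p ℕ.^ i) a ⟨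
      p ℕ.* p ℕ.^ i ℕ.* a                                         ∎
      where
      open ≡.≡-Reasoning
      collect : ∀ p A d N r → (p ℕ.* A ℕ.+ d) ℕ.* N ℕ.+ r ≡ p ℕ.* (A ℕ.* N) ℕ.+ (r ℕ.+ d ℕ.* N)
      collect = solve-∀

    residue-f : residue f ≡ a
    residue-f = begin
      residue f                        ≡⟨ residue≡ f ⟩
      (p ℕ.^ f ℕ.* a) % N              ≡⟨ %-distribˡ-* (p ℕ.^ f) a N ⟩
      ((p ℕ.^ f) % N ℕ.* (a % N)) % N  ≡⟨ cong (λ x → (x ℕ.* (a % N)) % N) p^f≡1 ⟩
      (1 % N ℕ.* (a % N)) % N          ≡⟨ %-distribˡ-* 1 a N ⟨
      (1 ℕ.* a) % N                    ≡⟨ cong (_% N) (ℕ.*-identityˡ a) ⟩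
      a % N                            ≡⟨ m<n⇒m%n≡m a<N ⟩
      a                                ∎
      where open ≡.≡-Reasoning

    prefix-f : prefix f ℕ.* N ≡ n ℕ.* a
    prefix-f = ℕ.+-cancelʳ-≡ a (prefix f ℕ.* N) (n ℕ.* a) (begin
      prefix f ℕ.* N ℕ.+ a             ≡⟨ cong (λ x → prefix f ℕ.* N ℕ.+ x) residue-f ⟨
      prefix f ℕ.* N ℕ.+ residue f     ≡⟨ prefix-equation f ⟩
      p ℕ.^ f ℕ.* a                    ≡⟨ cong (ℕ._* a) p^f≡1+n ⟩
      a ℕ.+ n ℕ.* a                    ≡⟨ ℕ.+-comm a (n ℕ.* a) ⟩
      n ℕ.* a ℕ.+ a                    ∎)
      where open ≡.≡-Reasoning

    prefix-mono : ∀ {i j} → i ≤ j → prefix i ≤ prefix j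
    prefix-mono {i} {j} i≤j = ≡.subst (λ k → prefix i ≤ prefix k) (ℕ.m+[n∸m]≡n i≤j) (go (j ∸ i))
      where
      step : ∀ k → prefix k ≤ prefix (suc k)
      step k = ℕ.≤-trans (≡.subst (λ x → prefix k ≤ x ℕ.* prefix k) (≡.sym p≡1+r) (ℕ.m≤m+n (prefix k) _)) (ℕ.m≤m+n (p ℕ.* prefix k) (digit k))
      go : ∀ d → prefix i ≤ prefix (i ℕ.+ d)
      go zero    = ℕ.≤-reflexive (cong prefix (≡.sym (ℕ.+-identityʳ i)))
      go (suc d) = ℕ.≤-trans (go d) (ℕ.≤-trans (step (i ℕ.+ d)) (ℕ.≤-reflexive (cong prefix (≡.sym (ℕ.+-suc i d)))))

    prefix<n : 0 < n → ∀ {i} → i ≤ f → prefix i < n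
    prefix<n 0<n {i} i≤f = ℕ.≤-<-trans (prefix-mono i≤f) (ℕ.*-cancelʳ-< N (prefix f) n (begin-strict
      prefix f ℕ.* N    ≡⟨ prefix-f ⟩
      n ℕ.* a           <⟨ ℕ.*-monoʳ-< n {{ℕ.>-nonZero 0<n}} a<N ⟩
      n ℕ.* N           ∎))
      where open ℕ.≤-Reasoning

    -- The relation p · residue = next residue + digit · N is summed over one period. The shifted
    -- residues have the same total, so p - 1 = r times that total remains.
    digit-sum : N ℕ.* weight-upto f ≡ r ℕ.* ∑ f residue
    digit-sum = ℕ.+-cancelˡ-≡ (∑ f residue) _ _ (begin
      ∑ f residue ℕ.+ N ℕ.* ∑ f digit                              ≡⟨ cong₂ ℕ._+_ (≡.sym (∑-cyclic₁ f residue residue-f)) (≡.trans (∑-*ˡ f N digit) (∑-cong f (λ i → ℕ.*-comm N (digit i)))) ⟩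
      ∑ f (λ i → residue (suc i)) ℕ.+ ∑ f (λ i → digit i ℕ.* N)    ≡⟨ ∑-+ f _ _ ⟨
      ∑ f (λ i → residue (suc i) ℕ.+ digit i ℕ.* N)                ≡⟨ ∑-cong f division ⟨
      ∑ f (λ i → p ℕ.* residue i)                                  ≡⟨ ∑-*ˡ f p residue ⟨
      p ℕ.* ∑ f residue                                            ≡⟨ cong (ℕ._* ∑ f residue) p≡1+r ⟩
      ∑ f residue ℕ.+ r ℕ.* ∑ f residue                            ∎)
      where open ≡.≡-Reasoning

    -- The digit sum is the exponent of ζ_p - 1 in Stickelberger's congruence; r factors ζ_p - 1
    -- amount to one factor p, hence r θ.
    digit-sum-bound : r ℕ.* θ ≤ weight-upto f
    digit-sum-bound = ℕ.*-cancelˡ-≤ N (begin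
      N ℕ.* (r ℕ.* θ)                  ≡⟨ rotate N r θ ⟩
      r ℕ.* (N ℕ.* θ)                  ≤⟨ ℕ.*-monoʳ-≤ r (residues a 0<a a<ℓ) ⟩
      r ℕ.* ∑ f (λ i → (p ℕ.^ i ℕ.* a) % N) ≡⟨ cong (r ℕ.*_) (∑-cong f residue≡) ⟨
      r ℕ.* ∑ f residue                ≡⟨ digit-sum ⟨
      N ℕ.* weight-upto f              ∎)
      where
      open ℕ.≤-Reasoning
      rotate : ∀ a b c → a ℕ.* (b ℕ.* c) ≡ b ℕ.* (a ℕ.* c)
      rotate = solve-∀

  module Congruence {a b c d} (C : Constants) (F : CommutativeRing a b) (ff : IsFiniteField F (Constants.p C ℕ.^ Constants.f C))
                   (γ : CommutativeRing.Carrier F) (γ-primitive : IsPrimitiveElement F γ)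
                   (rings : GroupRings F c d) where
    open TraceForm C F ff γ γ-primitive
    open GroupRings rings
    private
      module K₁ = CommutativeRing K₁
      module K = CommutativeRing K
    open SumOver F using (ΣF; ΣF-cong; ΣF-+; ΣF-*ˡ; ΣF-reindex)
    open SumOver K using () renaming (ΣF to Σᴷ; ΣF-cong to Σᴷ-cong; ΣF-+ to Σᴷ-+; ΣF-*ˡ to Σᴷ-*ˡ; ΣF-*ʳ to Σᴷ-*ʳ; ΣF-swap to Σᴷ-swap; ΣF-translate to Σᴷ-translate; ΣF-scale to Σᴷ-scale; ΣF-reindex to Σᴷ-reindex)
    open SumOver K₁ using () renaming (ΣF to Σ¹)
    open import Algebra.Properties.CommutativeSemiring.Exp K.commutativeSemiring using () renaming (_^_ to _^ᴷ_; ^-homo-* to ^ᴷ-homo-*; ^-congˡ to ^ᴷ-congˡ)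
    open import Algebra.Properties.Semiring.Mult K.semiring using () renaming (_×_ to _⨯ᴷ_; ×-congʳ to ⨯ᴷ-congʳ; ×-assocˡ to ⨯ᴷ-assocˡ; ×-assoc-* to ⨯ᴷ-assoc-*; ×-comm-* to ⨯ᴷ-comm-*; ×-homo-1 to ⨯ᴷ-homo-1)
    open import Algebra.Properties.Ring K.ring using () renaming ([y-z]x≈yx-zx to [y-z]x≈yx-zxᴷ; -‿distribʳ-* to -‿distribʳ-*ᴷ)
    import Relation.Binary.Reasoning.Setoid setoid as F-Reasoning
    import Relation.Binary.Reasoning.Setoid K.setoid as K-Reasoning
    import Algebra.Solver.CommutativeMonoid K.*-commutativeMonoid as S

    1<n : 1 < n
    1<n = ℕ.<-≤-trans 1<r (∣⇒≤ (divides L n≡Lr))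
      where
      1<r : 1 < r
      1<r = ≡.subst (1 <_) (≡.sym r≡10) (s<s z<s)

    z^n≈1 : ∀ {z} → ¬ z ≈ 0# → z ^ n ≈ 1#
    z^n≈1 {z} z≉0 with e , e<n , z≈γ^e ← log z z≉0 = begin
      z ^ n              ≈⟨ ^-congˡ n z≈γ^e ⟩
      (γ ^ e) ^ n        ≈⟨ ^-assocʳ γ e n ⟩
      γ ^ (e ℕ.* n)      ≈⟨ γ^-multiple γ^n≈1 0 e ⟩
      1#                 ∎
      where open F-Reasoning

    z^[n+i] : ∀ z i → 0 < i → z ^ (n ℕ.+ i) ≈ z ^ i
    z^[n+i] z (suc i) _ with z ≟ 0#
    ... | yes z≈0 = trans (^-congˡ (n ℕ.+ suc i) z≈0) (trans (trans (^-congʳ 0# (ℕ.+-suc n i)) (zeroˡ _)) (sym (trans (^-congˡ (suc i) z≈0) (zeroˡ _))))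
    ... | no z≉0 = trans (^-homo-* z n (suc i)) (trans (*-congʳ (z^n≈1 z≉0)) (*-identityˡ _))

    z^[jn+i] : ∀ z j i → 0 < i → z ^ (j ℕ.* n ℕ.+ i) ≈ z ^ i
    z^[jn+i] z zero    i 0<i = refl
    z^[jn+i] z (suc j) i 0<i = trans (^-congʳ z (ℕ.+-assoc n (j ℕ.* n) i)) (trans (z^[n+i] z (j ℕ.* n ℕ.+ i) (ℕ.≤-trans 0<i (ℕ.m≤n+m i (j ℕ.* n)))) (z^[jn+i] z j i 0<i))

    -- c[ B ∙ i ] is the Jacobi sum J(ω^B, ω^i) reduced modulo the prime at which ω becomes the identity of F^*.
    module Jacobi where
      open F-Reasoning

      c[_∙_] : ℕ → ℕ → Carrier
      c[ B ∙ i ] = ΣF (λ w → (- w + 1#) ^ B * w ^ i)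

      c-zero : ∀ i → c[ 0 ∙ i ] ≈ ΣF (λ w → w ^ i)
      c-zero i = ΣF-cong (λ w → *-identityˡ _)

      c-suc : ∀ B i → c[ suc B ∙ i ] ≈ c[ B ∙ i ] - c[ B ∙ suc i ]
      c-suc B i = begin
        ΣF (λ w → (- w + 1#) * (- w + 1#) ^ B * w ^ i)
          ≈⟨ ΣF-cong (λ w → expand w ((- w + 1#) ^ B) (w ^ i)) ⟩
        ΣF (λ w → (- w + 1#) ^ B * w ^ i + - 1# * ((- w + 1#) ^ B * w ^ suc i))
          ≈⟨ ΣF-+ _ _ ⟩
        c[ B ∙ i ] + ΣF (λ w → - 1# * ((- w + 1#) ^ B * w ^ suc i))
          ≈⟨ +-congˡ (trans (sym (ΣF-*ˡ (- 1#) _)) (-1*x≈-x _)) ⟩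
        c[ B ∙ i ] - c[ B ∙ suc i ] ∎
        where
        expand : ∀ w u v → (- w + 1#) * u * v ≈ u * v + - 1# * (u * (w * v))
        expand w u v = begin
          (- w + 1#) * u * v                 ≈⟨ *-assoc _ u v ⟩
          (- w + 1#) * (u * v)               ≈⟨ distribʳ (u * v) (- w) 1# ⟩
          - w * (u * v) + 1# * (u * v)       ≈⟨ +-comm _ _ ⟩
          1# * (u * v) + - w * (u * v)       ≈⟨ +-cong (*-identityˡ _) (trans (sym (-‿distribˡ-* w (u * v))) (trans (-‿cong (trans (sym (*-assoc w u v)) (trans (*-congʳ (*-comm w u)) (*-assoc u w v)))) (sym (-1*x≈-x _)))) ⟩
          u * v + - 1# * (u * (w * v))       ∎

      -- The recursion lowers B and raises i by at most one, which preserves the bound. At B = 0 the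
      -- exponent lies strictly between n and 2 n, where power sums vanish.
      c-high : ∀ B i → n < i → i ℕ.+ B < n ℕ.+ n → c[ B ∙ i ] ≈ 0#
      c-high zero    i n<i i<2n = trans (c-zero i) (ΣF-power i {{ℕ.>-nonZero (ℕ.<-trans 0<n n<i)}} n∤i)
        where
        n∤i : ¬ n ∣ i
        n∤i d = ℕ.<⇒≱ (ℕ.+-cancelˡ-< n (i ∸ n) n (≡.subst₂ _<_ (≡.trans (ℕ.+-identityʳ i) (≡.sym i≡)) ≡.refl i<2n))
                  (∣⇒≤ {{ℕ.>-nonZero (ℕ.m<n⇒0<n∸m n<i)}} (∣m+n∣m⇒∣n (≡.subst (n ∣_) (≡.sym i≡) d) (divides 1 (≡.sym (ℕ.*-identityˡ n)))))
          where
          i≡ : n ℕ.+ (i ∸ n) ≡ i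
          i≡ = ℕ.m+[n∸m]≡n (ℕ.<⇒≤ n<i)
      c-high (suc B) i n<i i+B<2n = trans (c-suc B i) (trans (+-cong (c-high B i n<i (ℕ.<-trans (ℕ.n<1+n _) bound)) (-‿cong (c-high B (suc i) (ℕ.<-trans n<i (ℕ.n<1+n i)) bound))) (-‿inverseʳ 0#))
        where
        bound : suc (i ℕ.+ B) < n ℕ.+ n
        bound = ≡.subst (_< n ℕ.+ n) (ℕ.+-suc i B) i+B<2n

      c-n : ∀ B → B < n → c[ B ∙ n ] ≈ - 1#
      c-n zero    _   = trans (c-zero n) ΣF-power-n
      c-n (suc B) B<n = begin
        c[ suc B ∙ n ]                    ≈⟨ c-suc B n ⟩
        c[ B ∙ n ] - c[ B ∙ suc n ]       ≈⟨ +-cong (c-n B (ℕ.<-trans (ℕ.n<1+n B) B<n)) (-‿cong (c-high B (suc n) (ℕ.n<1+n n) (≡.subst (_< n ℕ.+ n) (ℕ.+-suc n B) (ℕ.+-monoʳ-< n B<n)))) ⟩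
        - 1# - 0#                         ≈⟨ x-0≈x _ ⟩
        - 1#                              ∎
        where
        x-0≈x : ∀ x → x - 0# ≈ x
        x-0≈x x = trans (+-congˡ -0≈0) (+-identityʳ x)
          where open import Algebra.Properties.Group +-group using () renaming (ε⁻¹≈ε to -0≈0)

      -- It starts from a vanishing power sum, and each step subtracts `c[ B ∙ n ]`, which is -1.
      c-jacobi : ∀ B → B ≤ n → c[ B ∙ n ∸ 1 ] ≈ B ⨯ 1#
      c-jacobi zero    _   = trans (c-zero (n ∸ 1)) (ΣF-power (n ∸ 1) {{n-1≢0}} (λ d → ℕ.<⇒≱ (ℕ.≤-reflexive (ℕ.suc-pred n)) (∣⇒≤ {{n-1≢0}} d)))
        where
        n-1≢0 : NonZero (n ∸ 1)
        n-1≢0 = ℕ.>-nonZero (ℕ.m<n⇒0<n∸m 1<n)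
      c-jacobi (suc B) B<n = begin
        c[ suc B ∙ n ∸ 1 ]                          ≈⟨ c-suc B (n ∸ 1) ⟩
        c[ B ∙ n ∸ 1 ] - c[ B ∙ suc (n ∸ 1) ]       ≈⟨ +-cong (c-jacobi B (ℕ.<⇒≤ B<n)) (-‿cong (trans (reflexive (cong c[ B ∙_] (ℕ.suc-pred n))) (c-n B B<n))) ⟩
        B ⨯ 1# - - 1#                               ≈⟨ +-congˡ (-‿involutive 1#) ⟩
        B ⨯ 1# + 1#                                 ≈⟨ +-comm _ _ ⟩
        suc B ⨯ 1#                                  ∎
        where open import Algebra.Properties.Group +-group using () renaming (⁻¹-involutive to -‿involutive)

      1-involutive : ∀ x → - (- x + 1#) + 1# ≈ x
      1-involutive x = begin
        - (- x + 1#) + 1#      ≈⟨ +-congʳ (-‿+-comm (- x) 1#) ⟨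
        - - x - 1# + 1#        ≈⟨ +-assoc _ _ _ ⟩
        - - x + (- 1# + 1#)    ≈⟨ +-cong (-‿involutive x) (-‿inverseˡ 1#) ⟩
        x + 0#                 ≈⟨ +-identityʳ x ⟩
        x                      ∎
        where
        open import Algebra.Properties.AbelianGroup +-abelianGroup using () renaming (⁻¹-∙-comm to -‿+-comm; ⁻¹-involutive to -‿involutive)

      jacobi-sum : ∀ B → B ≤ n → ΣF (λ x → x ^ B * (- x + 1#) ^ (n ∸ 1)) ≈ B ⨯ 1#
      jacobi-sum B B≤n = begin
        ΣF (λ x → x ^ B * (- x + 1#) ^ (n ∸ 1))
          ≈⟨ ΣF-reindex σ σ σ-cong σ-cong 1-involutive 1-involutive (λ {x} {y} eq → *-cong (^-congˡ B eq) (^-congˡ (n ∸ 1) (σ-cong eq))) ⟨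
        ΣF (λ x → (- x + 1#) ^ B * (- (- x + 1#) + 1#) ^ (n ∸ 1))
          ≈⟨ ΣF-cong (λ x → *-congˡ (^-congˡ (n ∸ 1) (1-involutive x))) ⟩
        c[ B ∙ n ∸ 1 ]
          ≈⟨ c-jacobi B B≤n ⟩
        B ⨯ 1# ∎
        where
        σ : Carrier → Carrier
        σ x = - x + 1#
        σ-cong : ∀ {x y} → x ≈ y → σ x ≈ σ y
        σ-cong eq = +-congʳ (-‿cong eq)

    -- Under a character ω of F^* and a p-th root of unity, X A becomes the Gauss sum of ω^(−A) and
    -- τ becomes ζ_p − 1.
    X : ℕ → K.Carrier
    X A = Σᴷ (λ x → ⟨ Tr x ∙ x ^ (n ∸ A) ⟩)

    τ : K.Carrier
    τ = ⟨ 1# ∙ 1# ⟩ K.- K.1#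

    module _ where
      open K-Reasoning

      1+τ : ⟨ 1# ∙ 1# ⟩ K.≈ τ K.+ K.1#
      1+τ = begin
        ⟨ 1# ∙ 1# ⟩                              ≈⟨ K.+-identityʳ _ ⟨
        ⟨ 1# ∙ 1# ⟩ K.+ K.0#                     ≈⟨ K.+-congˡ (K.-‿inverseˡ K.1#) ⟨
        ⟨ 1# ∙ 1# ⟩ K.+ (K.- K.1# K.+ K.1#)      ≈⟨ K.+-assoc _ _ _ ⟨
        τ K.+ K.1#                               ∎

      -- This is ζ^m ≡ 1 modulo ζ - 1: the additive entry is cleared one unit at a time, each
      -- costing a multiple of `τ`.
      gen-multiple : ∀ m e → ∃[ β ] ⟨ m ⨯ 1# ∙ e ⟩ K.≈ ⟨ 0# ∙ e ⟩ K.+ τ K.* β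
      gen-multiple zero    e = K.0# , K.sym (K.trans (K.+-congˡ (K.zeroʳ τ)) (K.+-identityʳ _))
      gen-multiple (suc m) e with β , eq ← gen-multiple m e = β K.+ ⟨ m ⨯ 1# ∙ e ⟩ , (begin
        ⟨ 1# + m ⨯ 1# ∙ e ⟩                                      ≈⟨ gen-cong refl (sym (*-identityˡ e)) ⟩
        ⟨ 1# + m ⨯ 1# ∙ 1# * e ⟩                                 ≈⟨ gen-* 1# 1# (m ⨯ 1#) e ⟨
        ⟨ 1# ∙ 1# ⟩ K.* ⟨ m ⨯ 1# ∙ e ⟩                           ≈⟨ K.*-congʳ 1+τ ⟩
        (τ K.+ K.1#) K.* ⟨ m ⨯ 1# ∙ e ⟩                          ≈⟨ K.trans (K.distribʳ _ τ K.1#) (K.trans (K.+-congˡ (K.*-identityˡ _)) (K.+-comm _ _)) ⟩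
        ⟨ m ⨯ 1# ∙ e ⟩ K.+ τ K.* ⟨ m ⨯ 1# ∙ e ⟩                  ≈⟨ K.+-congʳ eq ⟩
        ⟨ 0# ∙ e ⟩ K.+ τ K.* β K.+ τ K.* ⟨ m ⨯ 1# ∙ e ⟩          ≈⟨ K.trans (K.+-assoc _ _ _) (K.+-congˡ (K.sym (K.distribˡ τ β _))) ⟩
        ⟨ 0# ∙ e ⟩ K.+ τ K.* (β K.+ ⟨ m ⨯ 1# ∙ e ⟩)              ∎)

      -- It replaces the projection to a character: it annihilates whatever multiplication by e
      -- fixes, while a character whose value at e is not 1 takes it to a nonzero number.
      ν : Carrier → K₁.Carrier
      ν e = ⟨ e ⟩ K₁.+ K₁.- ⟨ 1# ⟩

      ν* : ∀ e y → lift (ν e) K.* y K.≈ ⟨ 0# ∙ e ⟩ K.* y K.- y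
      ν* e y = begin
        lift (ν e) K.* y                                ≈⟨ K.*-congʳ (K.trans (lift-+ _ _) (K.+-cong (lift-gen e) (K.trans (lift-neg _) (K.-‿cong (K.trans (lift-gen 1#) gen-1))))) ⟩
        (⟨ 0# ∙ e ⟩ K.- K.1#) K.* y                     ≈⟨ [y-z]x≈yx-zxᴷ y ⟨ 0# ∙ e ⟩ K.1# ⟩
        ⟨ 0# ∙ e ⟩ K.* y K.- K.1# K.* y                 ≈⟨ K.+-congˡ (K.-‿cong (K.*-identityˡ y)) ⟩
        ⟨ 0# ∙ e ⟩ K.* y K.- y                          ∎

      ν-kills : ∀ e y → ⟨ 0# ∙ e ⟩ K.* y K.≈ y → lift (ν e) K.* y K.≈ K.0#
      ν-kills e y eq = K.trans (ν* e y) (K.trans (K.+-congʳ eq) (K.-‿inverseʳ y))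

      gen₀-* : ∀ e v e′ → ⟨ 0# ∙ e ⟩ K.* ⟨ v ∙ e′ ⟩ K.≈ ⟨ v ∙ e * e′ ⟩
      gen₀-* e v e′ = K.trans (gen-* 0# e v e′) (gen-cong (+-identityˡ v) refl)

      Σᴷ-invariant : ∀ (g : Carrier → Carrier) → (∀ {x y} → x ≈ y → g x ≈ g y) → ∀ e → (∀ x → e * g x ≈ g (γ * x)) →
                     ⟨ 0# ∙ e ⟩ K.* Σᴷ (λ x → ⟨ 0# ∙ g x ⟩) K.≈ Σᴷ (λ x → ⟨ 0# ∙ g x ⟩)
      Σᴷ-invariant g g-cong e twist = begin
        ⟨ 0# ∙ e ⟩ K.* Σᴷ (λ x → ⟨ 0# ∙ g x ⟩)        ≈⟨ Σᴷ-*ˡ _ _ ⟩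
        Σᴷ (λ x → ⟨ 0# ∙ e ⟩ K.* ⟨ 0# ∙ g x ⟩)        ≈⟨ Σᴷ-cong (λ x → K.trans (gen₀-* e 0# (g x)) (gen-cong refl (twist x))) ⟩
        Σᴷ (λ x → ⟨ 0# ∙ g (γ * x) ⟩)                 ≈⟨ Σᴷ-scale γ≉0 {λ x → ⟨ 0# ∙ g x ⟩} (λ eq → gen-cong refl (g-cong eq)) ⟩
        Σᴷ (λ x → ⟨ 0# ∙ g x ⟩)                       ∎

      -- Modulo `τ` the additive character disappears from X 1. What is left is fixed by γ^(n-1), as
      -- the substitution x ↦ γ x shows, and is therefore killed by `ν`.
      X₁-in-τ : ∃[ β ] lift (ν (γ ^ (n ∸ 1))) K.* X 1 K.≈ τ K.* β
      X₁-in-τ = lift (ν e) K.* Σᴷ β , (begin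
        lift (ν e) K.* X 1                                         ≈⟨ K.*-congˡ (Σᴷ-cong (λ x → K.trans (gen-cong (proj₂ (proj₂ (tr x))) refl) (proj₂ (parts x)))) ⟩
        lift (ν e) K.* Σᴷ (λ x → ⟨ 0# ∙ x ^ (n ∸ 1) ⟩ K.+ τ K.* β x)  ≈⟨ K.*-congˡ (K.trans (Σᴷ-+ _ _) (K.+-congˡ (K.sym (Σᴷ-*ˡ τ β)))) ⟩
        lift (ν e) K.* (S₀ K.+ τ K.* Σᴷ β)                         ≈⟨ K.distribˡ _ _ _ ⟩
        lift (ν e) K.* S₀ K.+ lift (ν e) K.* (τ K.* Σᴷ β)          ≈⟨ K.+-cong killed (S.solve 3 (λ x y z → x S.⊕ (y S.⊕ z) S.⊜ y S.⊕ (x S.⊕ z)) K.refl _ τ _) ⟩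
        K.0# K.+ τ K.* (lift (ν e) K.* Σᴷ β)                       ≈⟨ K.+-identityˡ _ ⟩
        τ K.* (lift (ν e) K.* Σᴷ β)                                ∎)
        where
        e : Carrier
        e = γ ^ (n ∸ 1)
        parts : ∀ x → ∃[ β ] ⟨ proj₁ (tr x) ⨯ 1# ∙ x ^ (n ∸ 1) ⟩ K.≈ ⟨ 0# ∙ x ^ (n ∸ 1) ⟩ K.+ τ K.* β
        parts x = gen-multiple (proj₁ (tr x)) (x ^ (n ∸ 1))
        β : Carrier → K.Carrier
        β x = proj₁ (parts x)
        S₀ : K.Carrier
        S₀ = Σᴷ (λ x → ⟨ 0# ∙ x ^ (n ∸ 1) ⟩)
        killed : lift (ν e) K.* S₀ K.≈ K.0#
        killed = ν-kills e S₀ (Σᴷ-invariant (_^ (n ∸ 1)) (^-congˡ (n ∸ 1)) e (λ x → sym (^-distrib-* γ x (n ∸ 1))))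

      exponents : ∀ {A} → suc A < n → (n ∸ A) ℕ.+ (n ∸ 1) ≡ n ℕ.+ (n ∸ suc A)
      exponents {A} 1+A<n = E.begin
        (n ∸ A) ℕ.+ (n ∸ 1)                E.≡⟨ cong (ℕ._+ (n ∸ 1)) (ℕ.+-∸-assoc 1 (ℕ.<⇒≤ 1+A<n)) ⟩
        suc (n ∸ suc A) ℕ.+ (n ∸ 1)        E.≡⟨ ℕ.+-suc (n ∸ suc A) (n ∸ 1) ⟨
        (n ∸ suc A) ℕ.+ suc (n ∸ 1)        E.≡⟨ cong (λ x → n ∸ suc A ℕ.+ x) (ℕ.suc-pred n) ⟩
        (n ∸ suc A) ℕ.+ n                  E.≡⟨ ℕ.+-comm (n ∸ suc A) n ⟩
        n ℕ.+ (n ∸ suc A)                  E.∎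
        where module E = ≡.≡-Reasoning

      -- The Jacobi sum is formed in K₁, where it can be evaluated in F, and its copy `j` in K,
      -- where the product formula lives.
      J : ℕ → K₁.Carrier
      J A = Σ¹ (λ x → ⟨ x ^ (n ∸ A) * (- x + 1#) ^ (n ∸ 1) ⟩)

      j : ℕ → K.Carrier
      j A = Σᴷ (λ x → ⟨ 0# ∙ x ^ (n ∸ A) * (- x + 1#) ^ (n ∸ 1) ⟩)

      lift-J : ∀ A → lift (J A) K.≈ j A
      lift-J A = K.trans (FieldSumHom.ΣF-homo F ff γ γ-primitive isOrder K₁ K lift lift-0 lift-+ _) (Σᴷ-cong (λ x → lift-gen _))

      ev-J : ∀ A → ev (J A) ≈ (n ∸ A) ⨯ 1#
      ev-J A = trans (FieldSumHom.ΣF-homo F ff γ γ-primitive isOrder K₁ F ev ev-0 ev-+ _)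
                     (trans (ΣF-cong (λ x → ev-gen _)) (Jacobi.jacobi-sum (n ∸ A) (ℕ.m∸n≤m n A)))

      -- g(χ) g(χ′) = J(χ, χ′) g(χχ′) in the monoid ring; the factor ν kills the terms with z = 0.
      product : ∀ {A} → suc A < n → let ν′ = lift (ν (γ ^ (n ∸ suc A))) in
                ν′ K.* (X A K.* X 1) K.≈ ν′ K.* (X (suc A) K.* j A)
      product {A} 1+A<n = begin
        ν′ K.* (X A K.* X 1)                 ≈⟨ K.*-congˡ convolution ⟩
        ν′ K.* Σᴷ I                          ≈⟨ Σᴷ-*ˡ ν′ I ⟩
        Σᴷ (λ z → ν′ K.* I z)                ≈⟨ Σᴷ-cong (λ z → pointwise z) ⟩
        Σᴷ (λ z → ν′ K.* (⟨ Tr z ∙ z ^ B′ ⟩ K.* j A))    ≈⟨ Σᴷ-*ˡ ν′ _ ⟨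
        ν′ K.* Σᴷ (λ z → ⟨ Tr z ∙ z ^ B′ ⟩ K.* j A)      ≈⟨ K.*-congˡ (Σᴷ-*ʳ (j A) _) ⟨
        ν′ K.* (X (suc A) K.* j A)           ∎
        where
        B B₁ B′ : ℕ
        B = n ∸ A
        B₁ = n ∸ 1
        B′ = n ∸ suc A
        ν′ : K.Carrier
        ν′ = lift (ν (γ ^ B′))
        0<B′ : 0 < B′
        0<B′ = ℕ.m<n⇒0<n∸m 1+A<n
        powers : ∀ z → z ^ B * z ^ B₁ ≈ z ^ B′
        powers z = trans (sym (^-homo-* z B B₁)) (trans (^-congʳ z (exponents 1+A<n)) (z^[n+i] z B′ 0<B′))
        I : Carrier → K.Carrier
        I z = Σᴷ (λ x → ⟨ Tr z ∙ x ^ B * (- x + z) ^ B₁ ⟩)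
        convolution : X A K.* X 1 K.≈ Σᴷ I
        convolution = begin
          X A K.* X 1
            ≈⟨ Σᴷ-*ʳ (X 1) _ ⟩
          Σᴷ (λ x → ⟨ Tr x ∙ x ^ B ⟩ K.* X 1)
            ≈⟨ Σᴷ-cong (λ x → K.trans (Σᴷ-*ˡ _ _) (Σᴷ-cong (λ y → gen-* (Tr x) (x ^ B) (Tr y) (y ^ B₁)))) ⟩
          Σᴷ (λ x → Σᴷ (λ y → ⟨ Tr x + Tr y ∙ x ^ B * y ^ B₁ ⟩))
            ≈⟨ Σᴷ-cong (λ x → Σᴷ-translate (- x) {λ y → ⟨ Tr x + Tr y ∙ x ^ B * y ^ B₁ ⟩} (λ eq → gen-cong (+-congˡ (Tr-cong eq)) (*-congˡ (^-congˡ B₁ eq)))) ⟨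
          Σᴷ (λ x → Σᴷ (λ z → ⟨ Tr x + Tr (- x + z) ∙ x ^ B * (- x + z) ^ B₁ ⟩))
            ≈⟨ Σᴷ-cong (λ x → Σᴷ-cong (λ z → gen-cong (trans (sym (Tr-+ x (- x + z))) (Tr-cong (trans (sym (+-assoc x (- x) z)) (trans (+-congʳ (-‿inverseʳ x)) (+-identityˡ z))))) refl)) ⟩
          Σᴷ (λ x → Σᴷ (λ z → ⟨ Tr z ∙ x ^ B * (- x + z) ^ B₁ ⟩))
            ≈⟨ Σᴷ-swap _ ⟩
          Σᴷ I ∎
        summand-cong : ∀ v z {x y} → x ≈ y → ⟨ v ∙ x ^ B * (- x + z) ^ B₁ ⟩ K.≈ ⟨ v ∙ y ^ B * (- y + z) ^ B₁ ⟩
        summand-cong v z eq = gen-cong refl (*-cong (^-congˡ B eq) (^-congˡ B₁ (+-congʳ (-‿cong eq))))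
        interchange : ∀ s t u v → (s * t) * (u * v) ≈ (s * u) * (t * v)
        interchange = CSG.interchange
          where import Algebra.Properties.CommutativeSemigroup *-commutativeSemigroup as CSG
        nonzero : ∀ z → ¬ z ≈ 0# → I z K.≈ ⟨ Tr z ∙ z ^ B′ ⟩ K.* j A
        nonzero z z≉0 = begin
          I z                                                               ≈⟨ Σᴷ-scale z≉0 {λ x → ⟨ Tr z ∙ x ^ B * (- x + z) ^ B₁ ⟩} (summand-cong (Tr z) z) ⟨
          Σᴷ (λ x → ⟨ Tr z ∙ (z * x) ^ B * (- (z * x) + z) ^ B₁ ⟩)          ≈⟨ Σᴷ-cong (λ x → gen-cong (sym (+-identityʳ (Tr z))) (factor x)) ⟩
          Σᴷ (λ x → ⟨ Tr z + 0# ∙ z ^ B′ * (x ^ B * (- x + 1#) ^ B₁) ⟩)     ≈⟨ Σᴷ-cong (λ x → gen-* (Tr z) (z ^ B′) 0# _) ⟨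
          Σᴷ (λ x → ⟨ Tr z ∙ z ^ B′ ⟩ K.* ⟨ 0# ∙ x ^ B * (- x + 1#) ^ B₁ ⟩) ≈⟨ Σᴷ-*ˡ _ _ ⟨
          ⟨ Tr z ∙ z ^ B′ ⟩ K.* j A                                         ∎
          where
          factor : ∀ x → (z * x) ^ B * (- (z * x) + z) ^ B₁ ≈ z ^ B′ * (x ^ B * (- x + 1#) ^ B₁)
          factor x = F-Reasoning.begin
            (z * x) ^ B * (- (z * x) + z) ^ B₁                  F-Reasoning.≈⟨ *-cong (^-distrib-* z x B) (^-congˡ B₁ (trans (+-cong (-‿distribʳ-* z x) (sym (*-identityʳ z))) (sym (distribˡ z (- x) 1#)))) ⟩
            (z ^ B * x ^ B) * (z * (- x + 1#)) ^ B₁             F-Reasoning.≈⟨ *-congˡ (^-distrib-* z (- x + 1#) B₁) ⟩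
            (z ^ B * x ^ B) * (z ^ B₁ * (- x + 1#) ^ B₁)        F-Reasoning.≈⟨ interchange _ _ _ _ ⟩
            (z ^ B * z ^ B₁) * (x ^ B * (- x + 1#) ^ B₁)        F-Reasoning.≈⟨ *-congʳ (powers z) ⟩
            z ^ B′ * (x ^ B * (- x + 1#) ^ B₁)                  F-Reasoning.∎
        -- The monoid (F, *) contains 0, so a generator with multiplicative entry 0 is a basis
        -- element and not zero. `ν′` kills the right side because 0 absorbs γ^B′, and the left side
        -- because I at 0 is invariant under x ↦ γ x.
        zero-term : ∀ z → z ≈ 0# → ν′ K.* I z K.≈ ν′ K.* (⟨ Tr z ∙ z ^ B′ ⟩ K.* j A)
        zero-term z z≈0 = K.trans (K.*-congˡ I≈) (K.trans (ν-kills (γ ^ B′) I₀ invariant) (K.sym (K.trans (K.sym (K.*-assoc _ _ _)) (K.trans (K.*-congʳ killed) (K.zeroˡ _)))))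
          where
          g : Carrier → Carrier
          g x = x ^ B * (- x) ^ B₁
          I₀ : K.Carrier
          I₀ = Σᴷ (λ x → ⟨ 0# ∙ g x ⟩)
          I≈ : I z K.≈ I₀
          I≈ = Σᴷ-cong (λ x → gen-cong (trans (Tr-cong z≈0) Tr-0) (*-congˡ (^-congˡ B₁ (trans (+-congˡ z≈0) (+-identityʳ _)))))
          twist : ∀ x → γ ^ B′ * g x ≈ g (γ * x)
          twist x = F-Reasoning.begin
            γ ^ B′ * (x ^ B * (- x) ^ B₁)                  F-Reasoning.≈⟨ *-congʳ (powers γ) ⟨
            (γ ^ B * γ ^ B₁) * (x ^ B * (- x) ^ B₁)        F-Reasoning.≈⟨ interchange _ _ _ _ ⟩
            (γ ^ B * x ^ B) * (γ ^ B₁ * (- x) ^ B₁)        F-Reasoning.≈⟨ *-cong (sym (^-distrib-* γ x B)) (trans (sym (^-distrib-* γ (- x) B₁)) (^-congˡ B₁ (sym (-‿distribʳ-* γ x)))) ⟩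
            (γ * x) ^ B * (- (γ * x)) ^ B₁                 F-Reasoning.∎
          invariant : ⟨ 0# ∙ γ ^ B′ ⟩ K.* I₀ K.≈ I₀
          invariant = Σᴷ-invariant g (λ eq → *-cong (^-congˡ B eq) (^-congˡ B₁ (-‿cong eq))) (γ ^ B′) twist
          killed : ν′ K.* ⟨ Tr z ∙ z ^ B′ ⟩ K.≈ K.0#
          killed = ν-kills (γ ^ B′) _ (K.trans (gen₀-* (γ ^ B′) (Tr z) (z ^ B′)) (gen-cong refl (trans (*-congˡ z^B′≈0) (trans (zeroʳ _) (sym z^B′≈0)))))
            where
            z^B′≈0 : z ^ B′ ≈ 0#
            z^B′≈0 = trans (^-congˡ B′ z≈0) (0^ B′ {{ℕ.>-nonZero 0<B′}})
        pointwise : ∀ z → ν′ K.* I z K.≈ ν′ K.* (⟨ Tr z ∙ z ^ B′ ⟩ K.* j A)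
        pointwise z = helper z (z ≟ 0#)
          where
          helper : ∀ z → Dec (z ≈ 0#) → ν′ K.* I z K.≈ ν′ K.* (⟨ Tr z ∙ z ^ B′ ⟩ K.* j A)
          helper z (yes z≈0) = zero-term z z≈0
          helper z (no z≉0)  = K.*-congˡ (nonzero z z≉0)

      -- The Gauss sum of ω^(−A) is divisible by (ζ_p − 1)^s at the prime where ω reduces to the identity of F^*.
      record Divides (s A : ℕ) : Set (a ⊔ b ⊔ c ⊔ d) where
        field
          Z       : K₁.Carrier
          ev-Z≉0  : ¬ ev Z ≈ 0#
          β       : K.Carrier
          divides-X : lift Z K.* X A K.≈ τ ^ᴷ s K.* β

      divides-0 : Divides 0 0
      divides-0 = record { Z = ⟨ 1# ⟩ ; ev-Z≉0 = λ eq → 1≉0 (trans (sym (ev-gen 1#)) eq) ; β = lift ⟨ 1# ⟩ K.* X 0 ; divides-X = K.sym (K.*-identityˡ _) }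

      ev-ν : ∀ e → ev (ν e) ≈ e - 1#
      ev-ν e = trans (ev-+ _ _) (+-cong (ev-gen e) (trans (ev-neg _) (-‿cong (ev-gen 1#))))

      ev-ν≉0 : ∀ {i} → 0 < i → i < n → ¬ ev (ν (γ ^ i)) ≈ 0#
      ev-ν≉0 {i} 0<i i<n eq = ℕ.<⇒≢ 0<i (≡.sym (γ^-injective i<n 0<n (x∙y⁻¹≈ε⇒x≈y _ _ (trans (sym (ev-ν (γ ^ i))) eq))))

      -- `product` passes the power of `τ` in X A, together with the extra one in X 1, to X (A + 1).
      -- The price is the factor ν₁ ν₀ J A in Z; its last part evaluates to n - A = -(A + 1), which
      -- is nonzero because p ∤ A + 1.
      divides-suc : ∀ {s A} → suc A < n → ¬ p ∣ suc A → Divides s A → Divides (suc s) (suc A)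
      divides-suc {s} {A} 1+A<n p∤1+A D = record
        { Z = ν₁ K₁.* (ν₀ K₁.* (D.Z K₁.* J A))
        ; ev-Z≉0 = ev-product ν₁≉0 (ev-product ν₀≉0 (ev-product D.ev-Z≉0 J≉0))
        ; β = lift ν₁ K.* (D.β K.* proj₁ X₁-in-τ)
        ; divides-X = begin
            lift (ν₁ K₁.* (ν₀ K₁.* (D.Z K₁.* J A))) K.* X (suc A)
              ≈⟨ K.*-congʳ (K.trans (lift-* _ _) (K.*-congˡ (K.trans (lift-* _ _) (K.*-congˡ (K.trans (lift-* _ _) (K.*-congˡ (lift-J A))))))) ⟩
            (lift ν₁ K.* (lift ν₀ K.* (lift D.Z K.* j A))) K.* X (suc A)
              ≈⟨ S.solve 5 (λ v₁ v₀ z y x → (v₁ S.⊕ (v₀ S.⊕ (z S.⊕ y))) S.⊕ x S.⊜ (v₁ S.⊕ (x S.⊕ y)) S.⊕ (v₀ S.⊕ z)) K.refl _ _ _ _ _ ⟩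
            (lift ν₁ K.* (X (suc A) K.* j A)) K.* (lift ν₀ K.* lift D.Z)
              ≈⟨ K.*-congʳ (product 1+A<n) ⟨
            (lift ν₁ K.* (X A K.* X 1)) K.* (lift ν₀ K.* lift D.Z)
              ≈⟨ S.solve 5 (λ v₁ v₀ z y x → (v₁ S.⊕ (x S.⊕ y)) S.⊕ (v₀ S.⊕ z) S.⊜ v₁ S.⊕ ((z S.⊕ x) S.⊕ (v₀ S.⊕ y))) K.refl _ _ _ _ _ ⟩
            lift ν₁ K.* ((lift D.Z K.* X A) K.* (lift ν₀ K.* X 1))
              ≈⟨ K.*-congˡ (K.*-cong D.divides-X (proj₂ X₁-in-τ)) ⟩
            lift ν₁ K.* ((τ ^ᴷ s K.* D.β) K.* (τ K.* proj₁ X₁-in-τ))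
              ≈⟨ S.solve 5 (λ v t b u c → v S.⊕ ((t S.⊕ b) S.⊕ (u S.⊕ c)) S.⊜ (u S.⊕ t) S.⊕ (v S.⊕ (b S.⊕ c))) K.refl _ _ _ _ _ ⟩
            (τ K.* τ ^ᴷ s) K.* (lift ν₁ K.* (D.β K.* proj₁ X₁-in-τ)) ∎
        }
        where
        module D = Divides D
        ν₀ ν₁ : K₁.Carrier
        ν₀ = ν (γ ^ (n ∸ 1))
        ν₁ = ν (γ ^ (n ∸ suc A))
        ev-product : ∀ {x y} → ¬ ev x ≈ 0# → ¬ ev y ≈ 0# → ¬ ev (x K₁.* y) ≈ 0#
        ev-product x≉0 y≉0 eq = *-≉0 x≉0 y≉0 (trans (sym (ev-* _ _)) eq)
        ν₀≉0 = ev-ν≉0 (ℕ.m<n⇒0<n∸m 1<n) (ℕ.∸-monoʳ-< {o = 0} z<s 0<n)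
        ν₁≉0 = ev-ν≉0 (ℕ.m<n⇒0<n∸m 1+A<n) (ℕ.∸-monoʳ-< {o = 0} z<s (ℕ.<⇒≤ 1+A<n))
        J≉0 : ¬ ev (J A) ≈ 0#
        J≉0 eq = p∤1+A (⨯1≈0⇒p∣ (suc A) (+-cancel (F-Reasoning.begin
          suc A ⨯ 1# + (n ∸ A) ⨯ 1#      F-Reasoning.≈⟨ ×-homo-+ 1# (suc A) (n ∸ A) ⟨
          (suc A ℕ.+ (n ∸ A)) ⨯ 1#       F-Reasoning.≈⟨ ×-congˡ (cong suc (ℕ.m+[n∸m]≡n (ℕ.<⇒≤ (ℕ.<-trans (ℕ.n<1+n A) 1+A<n)))) ⟩
          suc n ⨯ 1#                     F-Reasoning.≈⟨ trans (×-congˡ (≡.sym p^f≡1+n)) (trans (⨯-^ p f) (trans (^-congˡ f p⨯1≈0) (0^ f {{≡.subst NonZero (≡.sym f≡1+2θ) _}}))) ⟩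
          0#                             F-Reasoning.≈⟨ trans (sym (ev-J A)) eq ⟨
          (n ∸ A) ⨯ 1#                   F-Reasoning.∎)))

      -- x ↦ x^p permutes F and preserves traces, and p (n - A) differs from n - p A by a multiple
      -- of n, so X (p A) and X A are the same element.
      divides-frobenius : ∀ {s A} → p ℕ.* A < n → Divides s A → Divides s (p ℕ.* A)
      divides-frobenius {s} {A} pA<n D = record { Divides D ; divides-X = K.trans (K.*-congˡ X-frobenius) (Divides.divides-X D) }
        where
        exponent : p ℕ.* (n ∸ A) ≡ r ℕ.* n ℕ.+ (n ∸ p ℕ.* A)
        exponent = E.begin
          p ℕ.* (n ∸ A)                    E.≡⟨ ℕ.*-distribˡ-∸ p n A ⟩
          p ℕ.* n ∸ p ℕ.* A                E.≡⟨ cong (λ x → x ℕ.* n ∸ p ℕ.* A) p≡1+r ⟩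
          (n ℕ.+ r ℕ.* n) ∸ p ℕ.* A        E.≡⟨ cong (_∸ p ℕ.* A) (ℕ.+-comm n (r ℕ.* n)) ⟩
          (r ℕ.* n ℕ.+ n) ∸ p ℕ.* A        E.≡⟨ ℕ.+-∸-assoc (r ℕ.* n) (ℕ.<⇒≤ pA<n) ⟩
          r ℕ.* n ℕ.+ (n ∸ p ℕ.* A)        E.∎
          where module E = ≡.≡-Reasoning
        X-frobenius : X (p ℕ.* A) K.≈ X A
        X-frobenius = begin
          X (p ℕ.* A)
            ≈⟨ Σᴷ-cong (λ x → gen-cong (sym (Tr-frobenius x)) (sym (trans (^-assocʳ x p (n ∸ A)) (trans (^-congʳ x exponent) (z^[jn+i] x r _ (ℕ.m<n⇒0<n∸m pA<n)))))) ⟩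
          Σᴷ (λ x → ⟨ Tr (x ^ p) ∙ (x ^ p) ^ (n ∸ A) ⟩)
            ≈⟨ Σᴷ-reindex (_^ p) frobenius-inverse (^-congˡ p) (^-congˡ (p ℕ.^ ℕ.pred f)) frobenius-inverseʳ frobenius-inverseˡ
                 {λ x → ⟨ Tr x ∙ x ^ (n ∸ A) ⟩} (λ eq → gen-cong (Tr-cong eq) (^-congˡ (n ∸ A) eq)) ⟩
          X A ∎

      -- A digit is appended by one multiplication by p, followed by c increments. No number passed
      -- on the way is a multiple of p, since c < p.
      divides-digit : ∀ {s A} c → c < p → c ℕ.+ p ℕ.* A < n → Divides s A → Divides (c ℕ.+ s) (c ℕ.+ p ℕ.* A)
      divides-digit {s} {A} zero    c<p bound D = divides-frobenius bound D
      divides-digit {s} {A} (suc c) c<p bound D =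
        divides-suc bound p∤ (divides-digit c (ℕ.<-trans (ℕ.n<1+n c) c<p) (ℕ.<-trans (ℕ.n<1+n _) bound) D)
        where
        p∤ : ¬ p ∣ suc c ℕ.+ p ℕ.* A
        p∤ d = ℕ.<⇒≱ c<p (∣⇒≤ (∣m+n∣m⇒∣n (≡.subst (p ∣_) (ℕ.+-comm (suc c) (p ℕ.* A)) d) (m∣m*n A)))

      module Expansion (a : ℕ) (0<a : 0 < a) (a<ℓ : a < ℓ) where
        open Digits C p≡1+r a 0<a a<ℓ public

        divides-prefix : ∀ i → i ≤ f → Divides (weight-upto i) (prefix i)
        divides-prefix zero    _   = divides-0
        divides-prefix (suc i) i<f = ≡.subst₂ Divides weights prefixes
          (divides-digit (digit i) (digit<p i) (≡.subst (_< n) (≡.sym prefixes) (prefix<n 0<n i<f)) (divides-prefix i (ℕ.<⇒≤ i<f)))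
          where
          prefixes : digit i ℕ.+ p ℕ.* prefix i ≡ prefix (suc i)
          prefixes = ℕ.+-comm (digit i) (p ℕ.* prefix i)
          weights : digit i ℕ.+ weight-upto i ≡ weight-upto (suc i)
          weights = ≡.trans (ℕ.+-comm (digit i) (weight-upto i)) (≡.sym (Sum.∑-last ℕ.+-*-commutativeSemiring i digit))

      negate-multiple : ∀ m x → K.- (m ⨯ᴷ x) K.≈ m ⨯ᴷ (K.- x)
      negate-multiple m x = begin
        K.- (m ⨯ᴷ x)                    ≈⟨ -1*x≈-xᴷ _ ⟨
        K.- K.1# K.* (m ⨯ᴷ x)           ≈⟨ ⨯ᴷ-comm-* m (K.- K.1#) x ⟩
        m ⨯ᴷ (K.- K.1# K.* x)           ≈⟨ ⨯ᴷ-congʳ m (-1*x≈-xᴷ x) ⟩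
        m ⨯ᴷ (K.- x)                    ∎
        where open import Algebra.Properties.Ring K.ring using () renaming (-1*x≈-x to -1*x≈-xᴷ)

      gen-^ : ∀ m → ⟨ 1# ∙ 1# ⟩ ^ᴷ m K.≈ ⟨ m ⨯ 1# ∙ 1# ⟩
      gen-^ zero    = K.sym gen-1
      gen-^ (suc m) = K.trans (K.*-congˡ (gen-^ m)) (K.trans (gen-* _ _ _ _) (gen-cong refl (*-identityˡ 1#)))

      -- 1 + τ is the generator with additive entry 1, whose p-th power is 1, so τ^p is minus the
      -- middle binomial terms.
      τ^p : ∃[ w ] τ ^ᴷ p K.≈ p ⨯ᴷ (τ K.* w)
      τ^p with w , eq ← PrimePower.[x+y]^p K p-divides-binomials p≡1+r τ K.1# = K.- w , (begin
        τ ^ᴷ p                                                ≈⟨ inverseʳ-unique _ _ vanishes ⟩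
        K.- (p ⨯ᴷ (τ K.* w))                                  ≈⟨ negate-multiple p _ ⟩
        p ⨯ᴷ (K.- (τ K.* w))                                  ≈⟨ ⨯ᴷ-congʳ p (-‿distribʳ-*ᴷ τ w) ⟩
        p ⨯ᴷ (τ K.* (K.- w))                                  ∎)
        where
        open import Algebra.Properties.Group K.+-group using (inverseʳ-unique; ∙-cancelˡ)
        1^ᴷ : ∀ m → K.1# ^ᴷ m K.≈ K.1#
        1^ᴷ zero    = K.refl
        1^ᴷ (suc m) = K.trans (K.*-identityˡ _) (1^ᴷ m)
        vanishes : p ⨯ᴷ (τ K.* w) K.+ τ ^ᴷ p K.≈ K.0#
        vanishes = ∙-cancelˡ K.1# _ _ (begin
          K.1# K.+ (p ⨯ᴷ (τ K.* w) K.+ τ ^ᴷ p)             ≈⟨ K.+-congʳ (1^ᴷ p) ⟨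
          K.1# ^ᴷ p K.+ (p ⨯ᴷ (τ K.* w) K.+ τ ^ᴷ p)        ≈⟨ eq ⟨
          (τ K.+ K.1#) ^ᴷ p                                ≈⟨ ^ᴷ-congˡ p 1+τ ⟨
          ⟨ 1# ∙ 1# ⟩ ^ᴷ p                                 ≈⟨ gen-^ p ⟩
          ⟨ p ⨯ 1# ∙ 1# ⟩                                  ≈⟨ gen-cong p⨯1≈0 refl ⟩
          ⟨ 0# ∙ 1# ⟩                                      ≈⟨ gen-1 ⟩
          K.1#                                             ≈⟨ K.+-identityʳ K.1# ⟨
          K.1# K.+ K.0#                                    ∎)

      -- One τ has to be retained: each block of r further factors completes it to τ^p and is
      -- exchanged for a factor p and a new τ.
      τ^[1+rj] : ∀ j → ∃[ w ] τ ^ᴷ suc (j ℕ.* r) K.≈ (p ℕ.^ j) ⨯ᴷ (τ K.* w)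
      τ^[1+rj] zero    = K.1# , K.sym (⨯ᴷ-homo-1 _)
      τ^[1+rj] (suc j) with w , eq ← τ^[1+rj] j | w′ , eq′ ← τ^p = w′ K.* w , (begin
        τ ^ᴷ suc (r ℕ.+ j ℕ.* r)                         ≈⟨ K.reflexive (cong (τ ^ᴷ_) (≡.trans (cong suc (ℕ.+-comm r (j ℕ.* r))) ≡.refl)) ⟩
        τ ^ᴷ (suc (j ℕ.* r) ℕ.+ r)                       ≈⟨ ^ᴷ-homo-* τ (suc (j ℕ.* r)) r ⟩
        τ ^ᴷ suc (j ℕ.* r) K.* τ ^ᴷ r                    ≈⟨ K.*-congʳ eq ⟩
        ((p ℕ.^ j) ⨯ᴷ (τ K.* w)) K.* τ ^ᴷ r              ≈⟨ ⨯ᴷ-assoc-* (p ℕ.^ j) _ _ ⟩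
        (p ℕ.^ j) ⨯ᴷ ((τ K.* w) K.* τ ^ᴷ r)              ≈⟨ ⨯ᴷ-congʳ (p ℕ.^ j) (S.solve 3 (λ t w u → (t S.⊕ w) S.⊕ u S.⊜ (t S.⊕ u) S.⊕ w) K.refl _ _ _) ⟩
        (p ℕ.^ j) ⨯ᴷ ((τ K.* τ ^ᴷ r) K.* w)              ≈⟨ ⨯ᴷ-congʳ (p ℕ.^ j) (K.*-congʳ (K.trans (K.reflexive (cong (τ ^ᴷ_) (≡.sym p≡1+r))) eq′)) ⟩
        (p ℕ.^ j) ⨯ᴷ ((p ⨯ᴷ (τ K.* w′)) K.* w)           ≈⟨ ⨯ᴷ-congʳ (p ℕ.^ j) (K.trans (⨯ᴷ-assoc-* p _ _) (⨯ᴷ-congʳ p (K.*-assoc _ _ _))) ⟩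
        (p ℕ.^ j) ⨯ᴷ (p ⨯ᴷ (τ K.* (w′ K.* w)))           ≈⟨ ⨯ᴷ-assocˡ _ (p ℕ.^ j) p ⟩
        (p ℕ.^ j ℕ.* p) ⨯ᴷ (τ K.* (w′ K.* w))            ≈⟨ K.reflexive (cong (_⨯ᴷ (τ K.* (w′ K.* w))) (ℕ.*-comm (p ℕ.^ j) p)) ⟩
        (p ℕ.^ suc j) ⨯ᴷ (τ K.* (w′ K.* w))              ∎)

      -- A N = n a makes ω^(-A) a character of order dividing N. Of the digit sum s ≥ r θ, the part
      -- 1 + r (θ - 1) is converted into p^(θ-1) and one τ. That τ yields the last factor p only
      -- after integration, in `p∣∫τβ`.
      stickelberger : ∀ a → 0 < a → a < ℓ → ∃[ A ] A < n × A ℕ.* N ≡ n ℕ.* a ×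
                      (∃[ Z ] ¬ ev Z ≈ 0# × (∃[ β ] lift Z K.* X A K.≈ (p ℕ.^ ℕ.pred θ) ⨯ᴷ (τ K.* β)))
      stickelberger a 0<a a<ℓ = prefix f , prefix<n 0<n ℕ.≤-refl , prefix-f , D.Z , D.ev-Z≉0 , proj₁ power K.* (τ ^ᴷ (s ∸ e) K.* D.β) , (begin
        lift D.Z K.* X (prefix f)                                  ≈⟨ D.divides-X ⟩
        τ ^ᴷ s K.* D.β                                             ≈⟨ K.*-congʳ (K.trans (K.reflexive (cong (τ ^ᴷ_) (≡.sym (ℕ.m+[n∸m]≡n e≤s)))) (^ᴷ-homo-* τ e (s ∸ e))) ⟩
        (τ ^ᴷ e K.* τ ^ᴷ (s ∸ e)) K.* D.β                          ≈⟨ K.trans (K.*-assoc _ _ _) (K.*-congʳ (proj₂ power)) ⟩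
        ((p ℕ.^ ℕ.pred θ) ⨯ᴷ (τ K.* proj₁ power)) K.* (τ ^ᴷ (s ∸ e) K.* D.β)
                                                                   ≈⟨ K.trans (⨯ᴷ-assoc-* (p ℕ.^ ℕ.pred θ) _ _) (⨯ᴷ-congʳ (p ℕ.^ ℕ.pred θ) (K.*-assoc _ _ _)) ⟩
        (p ℕ.^ ℕ.pred θ) ⨯ᴷ (τ K.* (proj₁ power K.* (τ ^ᴷ (s ∸ e) K.* D.β))) ∎)
        where
        open Expansion a 0<a a<ℓ
        module D = Divides (divides-prefix f ℕ.≤-refl)
        s e : ℕ
        s = weight-upto f
        e = suc (ℕ.pred θ ℕ.* r)
        power = τ^[1+rj] (ℕ.pred θ)
        0<r : 0 < r
        0<r = ≡.subst (0 <_) (≡.sym r≡10) z<s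
        e≤s : e ≤ s
        e≤s = ℕ.≤-trans (ℕ.+-monoˡ-≤ (ℕ.pred θ ℕ.* r) 0<r)
                (ℕ.≤-trans (ℕ.≤-reflexive (≡.trans (cong (ℕ._* r) (ℕ.suc-pred θ {{ℕ.>-nonZero 0<θ}})) (ℕ.*-comm θ r))) digit-sum-bound)

-- The group rings realised, and integers extracted from them

module GroupRingModel where

  open import Algebra.Bundles using (CommutativeRing)
  open import Algebra.Construct.DirectProduct using (commutativeMonoid)
  open import Data.Integer.Base as ℤ using (ℤ; +_; -[1+_]; 0ℤ; _⊖_)
  import Data.Integer.Properties as ℤ
  import Data.Integer.Divisibility.Signed as ℤ
  open import Data.Integer.Tactic.RingSolver using (solve-∀)
  open import Data.List.Base using (List; []; _∷_; map)
  open import Data.List.Properties using (map-++)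
  open import Data.Nat.Base as ℕ using (ℕ; zero; suc; _∸_)
  open import Data.Nat.Divisibility using (_∣_; divides)
  import Data.Nat.Properties as ℕ
  open import Data.Product.Base using (_,_; _×_; proj₁; proj₂)
  open import Data.Sign.Base as Sign using (Sign)
  open import Level using (_⊔_)
  open import Relation.Binary.PropositionalEquality as ≡ using (_≡_; cong; cong₂)
  open import Relation.Nullary.Decidable using (Dec; yes; no)
  open import Relation.Nullary.Negation using (¬_)

  open FiniteSums
  open NumericalData
  open CyclicField
  open FieldSums
  open FieldArithmetic
  open MonoidRing
  open Trace
  open Character
  open Stickelberger

  module Model {a b} (F : CommutativeRing a b) where
    open CommutativeRing F hiding (zero)

    module R₁ = Ring[_] *-commutativeMonoid
    module R₂ = Ring[_] (commutativeMonoid +-commutativeMonoid *-commutativeMonoid)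
    module ∫ꟳ = R₁.Integral F
    private
      module K₁ = CommutativeRing R₁.monoidRing
      module K = CommutativeRing R₂.monoidRing

    lift : K₁.Carrier → K.Carrier
    lift = map (λ (s , e) → s , (0# , e))

    -- The ring homomorphism that is the identity on the monoid (F, *); its kernel takes the place
    -- of a prime above p.
    ev : K₁.Carrier → Carrier
    ev α = ∫ꟳ.∫ α (λ e → e)

    ∫-lift : ∀ α φ → R₂.∫ᶻ (lift α) φ ≡ R₁.∫ᶻ α (λ e → φ (0# , e))
    ∫-lift []            φ = ≡.refl
    ∫-lift ((s , e) ∷ α) φ = cong (λ z → R₁.sgnᶻ s (φ (0# , e)) ℤ.+ z) (∫-lift α φ)

    lift-* : ∀ α β → lift (α R₁.⊗ β) R₂.≋ lift α R₂.⊗ lift β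
    lift-* α β φ φ-resp = begin
      R₂.∫ᶻ (lift (α R₁.⊗ β)) φ                                             ≡⟨ ∫-lift (α R₁.⊗ β) φ ⟩
      R₁.∫ᶻ (α R₁.⊗ β) (λ e → φ (0# , e))                                   ≡⟨ R₁.∫ᶻ-⊗ α β (λ e → φ (0# , e)) ⟩
      R₁.∫ᶻ α (λ x → R₁.∫ᶻ β (λ y → φ (0# , x * y)))                        ≡⟨ R₁.∫ᶻ-cong α (λ x → R₁.∫ᶻ-cong β (λ y → φ-resp (sym (+-identityˡ 0#) , refl))) ⟩
      R₁.∫ᶻ α (λ x → R₁.∫ᶻ β (λ y → φ (0# + 0# , x * y)))                   ≡⟨ R₁.∫ᶻ-cong α (λ x → ∫-lift β (λ (w , y) → φ (0# + w , x * y))) ⟨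
      R₁.∫ᶻ α (λ x → R₂.∫ᶻ (lift β) (λ (w , y) → φ (0# + w , x * y)))       ≡⟨ ∫-lift α (λ (v , x) → R₂.∫ᶻ (lift β) (λ (w , y) → φ (v + w , x * y))) ⟨
      R₂.∫ᶻ (lift α) (λ (v , x) → R₂.∫ᶻ (lift β) (λ (w , y) → φ (v + w , x * y))) ≡⟨ R₂.∫ᶻ-⊗ (lift α) (lift β) φ ⟨
      R₂.∫ᶻ (lift α R₂.⊗ lift β) φ                                          ∎
      where open ≡.≡-Reasoning

    lift-neg : ∀ α → lift (R₁.neg α) R₂.≋ R₂.neg (lift α)
    lift-neg α φ φ-resp = begin
      R₂.∫ᶻ (lift (R₁.neg α)) φ                 ≡⟨ ∫-lift (R₁.neg α) φ ⟩
      R₁.∫ᶻ (R₁.neg α) (λ e → φ (0# , e))       ≡⟨ R₁.∫ᶻ-neg α (λ e → φ (0# , e)) (λ eq → φ-resp (refl , eq)) ⟩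
      ℤ.- R₁.∫ᶻ α (λ e → φ (0# , e))            ≡⟨ cong ℤ.-_ (∫-lift α φ) ⟨
      ℤ.- R₂.∫ᶻ (lift α) φ                      ≡⟨ R₂.∫ᶻ-neg (lift α) φ φ-resp ⟨
      R₂.∫ᶻ (R₂.neg (lift α)) φ                 ∎
      where open ≡.≡-Reasoning

    ev-* : ∀ α β → ev (α R₁.⊗ β) ≈ ev α * ev β
    ev-* α β = begin
      ev (α R₁.⊗ β)                             ≈⟨ ∫ꟳ.∫-⊗ α β (λ e → e) ⟩
      ∫ꟳ.∫ α (λ x → ∫ꟳ.∫ β (λ y → x * y))       ≈⟨ ∫ꟳ.∫-cong α (λ x → trans (∫ꟳ.∫-cong β (λ y → *-comm x y)) (trans (∫ꟳ.∫-*ʳ β (λ y → y) x) (*-comm _ x))) ⟩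
      ∫ꟳ.∫ α (λ x → x * ev β)                   ≈⟨ ∫ꟳ.∫-*ʳ α (λ x → x) (ev β) ⟩
      ev α * ev β                               ∎
      where open import Relation.Binary.Reasoning.Setoid setoid

    ev-neg : ∀ α → ev (R₁.neg α) ≈ - ev α
    ev-neg α = trans (∫ꟳ.∫-scale Sign.- 1# α (λ e → e)) (-‿cong (∫ꟳ.∫-cong α (λ y → *-identityˡ y)))

    groupRings : GroupRings F a (a ⊔ b)
    groupRings = record
      { K₁ = R₁.monoidRing ; K = R₂.monoidRing ; ⟨_⟩ = R₁.[_]ᴳ ; ⟨_∙_⟩ = λ v e → R₂.[ v , e ]ᴳ ; lift = lift ; ev = ev
      ; gen-cong = λ p q → R₂.[]-cong (p , q) ; gen-* = λ v e v′ e′ → R₂.[]-homo (v , e) (v′ , e′) ; gen-1 = λ _ _ → ≡.refl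
      ; lift-gen = λ e _ _ → ≡.refl ; lift-0 = λ _ _ → ≡.refl
      ; lift-+ = λ α β φ _ → cong (λ ξ → R₂.∫ᶻ ξ φ) (map-++ _ α β) ; lift-* = lift-* ; lift-neg = lift-neg
      ; ev-gen = λ e → +-identityʳ e ; ev-0 = refl ; ev-+ = λ α β → ∫ꟳ.∫-++ α β (λ e → e) ; ev-* = ev-* ; ev-neg = ev-neg }

  module Extraction {a b} (C : Constants) (F : CommutativeRing a b) (ff : IsFiniteField F (Constants.p C ℕ.^ Constants.f C))
                   (γ : CommutativeRing.Carrier F) (γ-primitive : IsPrimitiveElement F γ) where
    open AdditiveCharacter C F ff γ γ-primitive public
    open Model F public using (module R₁; module R₂; module ∫ꟳ; lift; ev; ∫-lift; groupRings)
    open Congruence C F ff γ γ-primitive groupRings public using (X; τ; stickelberger; z^n≈1; z^[n+i]; z^[jn+i]; 1<n)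
    private
      module K₁ = CommutativeRing R₁.monoidRing
      module K = CommutativeRing R₂.monoidRing
    open import Algebra.Properties.Semiring.Mult K.semiring using () renaming (_×_ to _⨯ᴷ_)

    ∫-∣ : ∀ {d} α φ → (∀ x → d ℤ.∣ φ x) → d ℤ.∣ R₂.∫ᶻ α φ
    ∫-∣ []                 φ d∣ = ℤ.divides 0ℤ ≡.refl
    ∫-∣ ((Sign.+ , x) ∷ α) φ d∣ = ℤ.∣m∣n⇒∣m+n (d∣ x) (∫-∣ α φ d∣)
    ∫-∣ ((Sign.- , x) ∷ α) φ d∣ = ℤ.∣m∣n⇒∣m+n (ℤ.∣m⇒∣-m (d∣ x)) (∫-∣ α φ d∣)

    ∫-⨯ : ∀ m α φ → R₂.∫ᶻ (m ⨯ᴷ α) φ ≡ + m ℤ.* R₂.∫ᶻ α φ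
    ∫-⨯ zero    α φ = ≡.refl
    ∫-⨯ (suc m) α φ = ≡.trans (R₂.∫ᶻ-++ α (m ⨯ᴷ α) φ) (≡.trans (cong (λ z → R₂.∫ᶻ α φ ℤ.+ z) (∫-⨯ m α φ)) (≡.sym (ℤ.suc-* (+ m) _)))

    module _ (φ : Carrier → ℤ) (φ-cong : Congruentᶻ φ) where

      Φ : Carrier × Carrier → ℤ
      Φ (v , e) = ψ v ℤ.* φ e

      Φ-resp : R₂.Respects Φ
      Φ-resp (p , q) = cong₂ ℤ._*_ (ψ-cong p) (φ-cong q)

      -- Multiplication by τ becomes a difference in the additive argument of ψ, and all values of ψ
      -- are congruent modulo p.
      p∣∫τβ : ∀ β → + p ℤ.∣ R₂.∫ᶻ (τ R₂.⊗ β) Φ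
      p∣∫τβ β = ≡.subst (+ p ℤ.∣_) (≡.sym (≡.trans (R₂.⊗-comm τ β Φ Φ-resp) (R₂.∫ᶻ-⊗ β τ Φ))) (∫-∣ β _ step)
        where
        step : ∀ y → + p ℤ.∣ R₂.∫ᶻ τ (λ x → Φ (proj₁ y + proj₁ x , proj₂ y * proj₂ x))
        step (v , e) with ℤ.divides q eq ← ψ-difference (v + 1#) (v + (0# + 0#)) = ℤ.divides (φ (e * 1#) ℤ.* q) (begin
          s ℤ.+ (ℤ.- (t ℤ.* φ (e * (1# * 1#))) ℤ.+ 0ℤ)   ≡⟨ cong (λ z → s ℤ.+ (ℤ.- (t ℤ.* z) ℤ.+ 0ℤ)) (φ-cong (*-congˡ (*-identityˡ 1#))) ⟩
          s ℤ.+ (ℤ.- (t ℤ.* φ (e * 1#)) ℤ.+ 0ℤ)          ≡⟨ factor (ψ (v + 1#)) t (φ (e * 1#)) ⟩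
          φ (e * 1#) ℤ.* (ψ (v + 1#) ℤ.- t)              ≡⟨ cong (φ (e * 1#) ℤ.*_) eq ⟩
          φ (e * 1#) ℤ.* (q ℤ.* + p)                     ≡⟨ ℤ.*-assoc (φ (e * 1#)) q (+ p) ⟨
          φ (e * 1#) ℤ.* q ℤ.* + p                       ∎)
          where
          open ≡.≡-Reasoning
          s t : ℤ
          s = ψ (v + 1#) ℤ.* φ (e * 1#)
          t = ψ (v + (0# + 0#))
          factor : ∀ x t y → x ℤ.* y ℤ.+ (ℤ.- (t ℤ.* y) ℤ.+ 0ℤ) ≡ y ℤ.* (x ℤ.- t)
          factor = solve-∀

      ∫X : ∀ A χ → R₂.∫ᶻ (X A) χ ≡ Σᶻ (λ x → χ (Tr x , x ^ (n ∸ A)))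
      ∫X A χ = ≡.trans (FieldSumHom.ΣF-homo F ff γ γ-primitive isOrder R₂.monoidRing ℤ.+-*-commutativeRing (λ α → R₂.∫ᶻ α χ) ≡.refl (λ α β → R₂.∫ᶻ-++ α β χ) _)
                       (Σᶻ-cong (λ x → ℤ.+-identityʳ _))

      extract : ∀ A Z m β → lift Z R₂.⊗ X A R₂.≋ m ⨯ᴷ (τ R₂.⊗ β) →
                + m ℤ.* + p ℤ.∣ R₁.∫ᶻ Z (λ z → Σᶻ (λ x → h x ℤ.* φ (z * x ^ (n ∸ A))))
      extract A Z m β eq = ≡.subst (+ m ℤ.* + p ℤ.∣_) (begin
        + m ℤ.* R₂.∫ᶻ (τ R₂.⊗ β) Φ                                               ≡⟨ ∫-⨯ m (τ R₂.⊗ β) Φ ⟨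
        R₂.∫ᶻ (m ⨯ᴷ (τ R₂.⊗ β)) Φ                                                ≡⟨ eq Φ Φ-resp ⟨
        R₂.∫ᶻ (lift Z R₂.⊗ X A) Φ                                                ≡⟨ R₂.∫ᶻ-⊗ (lift Z) (X A) Φ ⟩
        R₂.∫ᶻ (lift Z) (λ x → R₂.∫ᶻ (X A) (λ y → Φ (proj₁ x + proj₁ y , proj₂ x * proj₂ y))) ≡⟨ ∫-lift Z _ ⟩
        R₁.∫ᶻ Z (λ z → R₂.∫ᶻ (X A) (λ y → Φ (0# + proj₁ y , z * proj₂ y)))       ≡⟨ R₁.∫ᶻ-cong Z (λ z → ≡.trans (∫X A _) (Σᶻ-cong (λ x → cong (ℤ._* φ (z * x ^ (n ∸ A))) (ψ-cong (+-identityˡ (Tr x)))))) ⟩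
        R₁.∫ᶻ Z (λ z → Σᶻ (λ x → h x ℤ.* φ (z * x ^ (n ∸ A))))                   ∎)
        (*-monoʳ-∣ (+ m) (p∣∫τβ β))
        where
        open ≡.≡-Reasoning
        *-monoʳ-∣ : ∀ k {i j} → i ℤ.∣ j → k ℤ.* i ℤ.∣ k ℤ.* j
        *-monoʳ-∣ k {i} (ℤ.divides q ≡.refl) = ℤ.divides q (rotate k q i)
          where
          rotate : ∀ k q i → k ℤ.* (q ℤ.* i) ≡ q ℤ.* (k ℤ.* i)
          rotate = solve-∀

    ι : ℤ → Carrier
    ι (+ m)      = m ⨯ 1#
    ι (-[1+ m ]) = - (suc m ⨯ 1#)

    module _ where
      open import Relation.Binary.Reasoning.Setoid setoid
      open import Algebra.Properties.AbelianGroup +-abelianGroup using () renaming (⁻¹-∙-comm to -‿+-comm; ⁻¹-involutive to -‿involutive; ε⁻¹≈ε to -0≈0)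

      ι-⊖ : ∀ m k → ι (m ⊖ k) ≈ m ⨯ 1# - k ⨯ 1#
      ι-⊖ zero    zero    = sym (-‿inverseʳ 0#)
      ι-⊖ zero    (suc k) = sym (+-identityˡ _)
      ι-⊖ (suc m) zero    = sym (trans (+-congˡ -0≈0) (+-identityʳ _))
      ι-⊖ (suc m) (suc k) = begin
        ι (suc m ⊖ suc k)                        ≈⟨ reflexive (cong ι (ℤ.[1+m]⊖[1+n]≡m⊖n m k)) ⟩
        ι (m ⊖ k)                                ≈⟨ ι-⊖ m k ⟩
        m ⨯ 1# - k ⨯ 1#                          ≈⟨ +-congʳ (+-identityˡ _) ⟨
        0# + m ⨯ 1# - k ⨯ 1#                     ≈⟨ +-congʳ (+-congʳ (-‿inverseʳ 1#)) ⟨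
        1# - 1# + m ⨯ 1# - k ⨯ 1#                ≈⟨ +-congʳ (trans (+-assoc _ _ _) (trans (+-congˡ (+-comm _ _)) (sym (+-assoc _ _ _)))) ⟩
        1# + m ⨯ 1# - 1# - k ⨯ 1#                ≈⟨ trans (+-assoc _ _ _) (+-congˡ (-‿+-comm _ _)) ⟩
        suc m ⨯ 1# - suc k ⨯ 1#                  ∎

      ι-+ : ∀ i j → ι (i ℤ.+ j) ≈ ι i + ι j
      ι-+ (+ m)      (+ k)      = ×-homo-+ 1# m k
      ι-+ (+ m)      (-[1+ k ]) = ι-⊖ m (suc k)
      ι-+ (-[1+ m ]) (+ k)      = trans (ι-⊖ k (suc m)) (+-comm _ _)
      ι-+ (-[1+ m ]) (-[1+ k ]) = begin
        - (suc (suc (m ℕ.+ k)) ⨯ 1#)             ≈⟨ -‿cong (trans (×-congˡ (cong suc (≡.sym (ℕ.+-suc m k)))) (×-homo-+ 1# (suc m) (suc k))) ⟩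
        - (suc m ⨯ 1# + suc k ⨯ 1#)              ≈⟨ -‿+-comm _ _ ⟨
        - (suc m ⨯ 1#) - suc k ⨯ 1#              ∎

      ι-neg : ∀ i → ι (ℤ.- i) ≈ - ι i
      ι-neg (+ zero)   = sym -0≈0
      ι-neg (+ suc m)  = refl
      ι-neg (-[1+ m ]) = sym (-‿involutive _)

      ι-multiple : ∀ m i → ι (+ m ℤ.* i) ≈ m ⨯ ι i
      ι-multiple zero    i = refl
      ι-multiple (suc m) i = trans (reflexive (cong ι (ℤ.suc-* (+ m) i))) (trans (ι-+ i _) (+-congˡ (ι-multiple m i)))

      ι-∣ : ∀ {i} → + p ℤ.∣ i → ι i ≈ 0#
      ι-∣ (ℤ.divides q ≡.refl) = trans (reflexive (cong ι (ℤ.*-comm q (+ p)))) (trans (ι-multiple p q) (p⨯x≈0 _))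

      ι≈0 : ∀ i → ι i ≈ 0# → + p ℤ.∣ i
      ι≈0 (+ m)      eq with divides q ≡.refl ← ⨯1≈0⇒p∣ m eq = ℤ.divides (+ q) (ℤ.pos-* q p)
      ι≈0 (-[1+ m ]) eq with divides q e ← ⨯1≈0⇒p∣ (suc m) (trans (sym (-‿involutive _)) (trans (-‿cong eq) -0≈0)) =
        ℤ.divides (ℤ.- (+ q)) (≡.trans (cong (λ k → ℤ.- (+ k)) e) (≡.trans (cong ℤ.-_ (ℤ.pos-* q p)) (ℤ.neg-distribˡ-* (+ q) (+ p))))

      open SumOver F using (ΣF; ΣF-cong; ΣF-+; ΣF-*ˡ; ΣF-∑; ΣF-zero; ΣF-δ; ⟦_⟧)
      open Sum commutativeSemiring

      ι-∑ : ∀ m g → ι (∑ᶻ m g) ≈ ∑ m (λ i → ι (g i))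
      ι-∑ m g = SumHom.∑-homo (CommutativeRing.commutativeSemiring ℤ.+-*-commutativeRing) commutativeSemiring ι refl ι-+ m g

      ι-∫ : ∀ α φ → ι (R₁.∫ᶻ α φ) ≈ ∫ꟳ.∫ α (λ x → ι (φ x))
      ι-∫ []                 φ = refl
      ι-∫ ((Sign.+ , x) ∷ α) φ = trans (ι-+ (φ x) _) (+-congˡ (ι-∫ α φ))
      ι-∫ ((Sign.- , x) ∷ α) φ = trans (ι-+ (ℤ.- φ x) _) (+-cong (ι-neg (φ x)) (ι-∫ α φ))

      ι-δ : ∀ {c} {A : Set c} y (d : Dec A) → ι (y ℤ.* ⟦ d ⟧ᶻ) ≈ ι y * ⟦ d ⟧
      ι-δ y (yes _) = trans (reflexive (cong ι (ℤ.*-identityʳ y))) (sym (*-identityʳ _))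
      ι-δ y (no _)  = trans (reflexive (cong ι (ℤ.*-zeroʳ y))) (sym (zeroʳ _))

      ΣF-∫ : ∀ α (g : Carrier → Carrier → Carrier) → ΣF (λ u → ∫ꟳ.∫ α (g u)) ≈ ∫ꟳ.∫ α (λ z → ΣF (λ u → g u z))
      ΣF-∫ []            g = ΣF-zero (λ _ → refl)
      ΣF-∫ ((s , z) ∷ α) g = trans (ΣF-+ _ _) (+-cong (signed s) (ΣF-∫ α g))
        where
        signed : ∀ s → ΣF (λ u → ∫ꟳ.sgn s (g u z)) ≈ ∫ꟳ.sgn s (ΣF (λ u → g u z))
        signed Sign.+ = refl
        signed Sign.- = trans (ΣF-cong (λ u → sym (-1*x≈-x _))) (trans (sym (ΣF-*ˡ (- 1#) _)) (-1*x≈-x _))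

      -- Testing against the Dirac functions turns a congruence mod p for all
      -- integrals into an equation in F.
      annihilate : ∀ Z → ¬ ev Z ≈ 0# → ∀ m (y : ℕ → ℤ) (e : ℕ → Carrier) →
                   (∀ φ → Congruentᶻ φ → + p ℤ.∣ R₁.∫ᶻ Z (λ z → ∑ᶻ m (λ j → y j ℤ.* φ (z * e j)))) →
                   ∑ m (λ j → ι (y j) * e j) ≈ 0#
      annihilate Z ev-Z≉0 m y e p∣ = xy≈0⇒y≈0 (ev Z) ev-Z≉0 (begin
        ev Z * S                                                       ≈⟨ ∫ꟳ.∫-*ʳ Z (λ z → z) S ⟨
        ∫ꟳ.∫ Z (λ z → z * S)                                           ≈⟨ ∫ꟳ.∫-cong Z expand ⟨
        ∫ꟳ.∫ Z (λ z → ΣF (λ u → ∑ m (λ j → ι (y j ℤ.* δ u (z * e j))) * u))   ≈⟨ ΣF-∫ Z _ ⟨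
        ΣF (λ u → ∫ꟳ.∫ Z (λ z → ∑ m (λ j → ι (y j ℤ.* δ u (z * e j))) * u))   ≈⟨ ΣF-zero vanish ⟩
        0#                                                             ∎)
        where
        S : Carrier
        S = ∑ m (λ j → ι (y j) * e j)
        δ : Carrier → Carrier → ℤ
        δ u x = ⟦ u ≟ x ⟧ᶻ
        vanish : ∀ u → ∫ꟳ.∫ Z (λ z → ∑ m (λ j → ι (y j ℤ.* δ u (z * e j))) * u) ≈ 0#
        vanish u = begin
          ∫ꟳ.∫ Z (λ z → ∑ m (λ j → ι (y j ℤ.* δ u (z * e j))) * u)     ≈⟨ ∫ꟳ.∫-*ʳ Z _ u ⟩
          ∫ꟳ.∫ Z (λ z → ∑ m (λ j → ι (y j ℤ.* δ u (z * e j)))) * u     ≈⟨ *-congʳ (∫ꟳ.∫-cong Z (λ z → sym (ι-∑ m _))) ⟩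
          ∫ꟳ.∫ Z (λ z → ι (∑ᶻ m (λ j → y j ℤ.* δ u (z * e j)))) * u    ≈⟨ *-congʳ (ι-∫ Z _) ⟨
          ι (R₁.∫ᶻ Z (λ z → ∑ᶻ m (λ j → y j ℤ.* δ u (z * e j)))) * u   ≈⟨ *-congʳ (ι-∣ (p∣ (δ u) (λ {x} {x′} eq → ⟦⟧ᶻ-⇔ (u ≟ x) (u ≟ x′) (λ q → trans q eq) (λ q → trans q (sym eq))))) ⟩
          0# * u                                                       ≈⟨ zeroˡ u ⟩
          0#                                                           ∎
        -- Summing u times the Dirac function of u recovers the argument z e_j, and integrating z
        -- over Z then produces `ev Z`.
        expand : ∀ z → ΣF (λ u → ∑ m (λ j → ι (y j ℤ.* δ u (z * e j))) * u) ≈ z * S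
        expand z = begin
          ΣF (λ u → ∑ m (λ j → ι (y j ℤ.* δ u (z * e j))) * u)         ≈⟨ ΣF-cong (λ u → trans (∑-*ʳ m u _) (∑-cong m (λ j → trans (*-congʳ (ι-δ (y j) (u ≟ z * e j))) (*-assoc _ _ u)))) ⟩
          ΣF (λ u → ∑ m (λ j → ι (y j) * (⟦ u ≟ z * e j ⟧ * u)))       ≈⟨ ΣF-∑ m _ ⟩
          ∑ m (λ j → ΣF (λ u → ι (y j) * (⟦ u ≟ z * e j ⟧ * u)))       ≈⟨ ∑-cong m (λ j → trans (sym (ΣF-*ˡ (ι (y j)) _)) (*-congˡ (ΣF-δ (z * e j) (λ u → u) (λ eq → eq)))) ⟩
          ∑ m (λ j → ι (y j) * (z * e j))                              ≈⟨ ∑-cong m (λ j → trans (sym (*-assoc _ z _)) (trans (*-congʳ (*-comm _ z)) (*-assoc z _ _))) ⟩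
          ∑ m (λ j → z * (ι (y j) * e j))                              ≈⟨ ∑-*ˡ m z _ ⟨
          z * S                                                        ∎

-- Gauss periods and their interval sums

module Periods where

  open import Algebra.Bundles using (CommutativeRing)
  open import Data.Integer.Base as ℤ using (ℤ; +_; 0ℤ; 1ℤ; -1ℤ)
  import Data.Integer.Properties as ℤ
  open import Data.Integer.Tactic.RingSolver using (solve-∀)
  open import Data.Nat.Base as ℕ using (ℕ; zero; suc; _<_; _≤_; s<s; NonZero)
  open import Data.Nat.Divisibility using (_∣_; divides; ∣⇒≤)
  open import Data.Nat.DivMod using (_%_; _/_; m≡m%n+[m/n]*n; [m+kn]%n≡m%n)
  import Data.Nat.Properties as ℕ
  import Data.Nat.Tactic.RingSolver as ℕ
  open import Data.Product.Base using (_,_; ∃-syntax; _×_)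
  open import Data.Sum.Base using (inj₁; inj₂)
  open import Relation.Binary.PropositionalEquality as ≡ using (_≡_; cong; cong₂)
  open import Relation.Nullary.Negation using (¬_)

  open FiniteSums
  open NumericalData
  open GroupRingModel

  module GaussPeriods {a b} (C : Constants) (F : CommutativeRing a b) (ff : IsFiniteField F (Constants.p C ℕ.^ Constants.f C))
                   (γ : CommutativeRing.Carrier F) (γ-primitive : IsPrimitiveElement F γ) where
    open Extraction C F ff γ γ-primitive public
    open ≡.≡-Reasoning

    hγ : ℕ → ℤ
    hγ e = h (γ ^ e)

    hγ-cong : ∀ {i j} → i ≡ j → hγ i ≡ hγ j
    hγ-cong = cong hγ

    hγ-+L : ∀ t j → hγ (t ℕ.+ j ℕ.* L) ≡ hγ t
    hγ-+L t zero    = hγ-cong (ℕ.+-identityʳ t)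
    hγ-+L t (suc j) = begin
      hγ (t ℕ.+ (L ℕ.+ j ℕ.* L))         ≡⟨ hγ-cong (rotate t L (j ℕ.* L)) ⟩
      hγ (L ℕ.+ (t ℕ.+ j ℕ.* L))         ≡⟨ h-cong (^-homo-* γ L (t ℕ.+ j ℕ.* L)) ⟩
      h (γ ^ L * γ ^ (t ℕ.+ j ℕ.* L))    ≡⟨ h-γ^L _ ⟩
      hγ (t ℕ.+ j ℕ.* L)                 ≡⟨ hγ-+L t j ⟩
      hγ t                               ∎
      where
      rotate : ∀ t L x → t ℕ.+ (L ℕ.+ x) ≡ L ℕ.+ (t ℕ.+ x)
      rotate = ℕ.solve-∀

    instance
      κ≢0 : NonZero κ
      κ≢0 = ℕ.m*n≢0⇒n≢0 r {{ℕ.m*n≢0⇒n≢0 N {{≡.subst NonZero n≡Nrκ n≢0}}}}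
      r≢0 : NonZero r
      r≢0 = ≡.subst NonZero (≡.sym r≡10) _
      ℓ≢0 : NonZero ℓ
      ℓ≢0 = ≡.subst NonZero (≡.sym ℓ≡43) _

    -- The class C_t consists of κ cosets of the prime field units and h already sums over one
    -- coset, so this is the genuine Gauss period, a rational integer.
    η : ℕ → ℤ
    η t = ∑ᶻ κ (λ j → hγ (t ℕ.+ j ℕ.* N))

    η-+N : ∀ t → η (t ℕ.+ N) ≡ η t
    η-+N t = ≡.trans (∑ᶻ-cong κ (λ j → hγ-cong (ℕ.+-assoc t N (j ℕ.* N))))
                     (∑ᶻ-cyclic₁ κ (λ j → hγ (t ℕ.+ j ℕ.* N))
                       (≡.trans (hγ-cong (cong (t ℕ.+_) (≡.trans (ℕ.*-comm κ N) (≡.sym (ℕ.+-identityʳ L))))) (≡.trans (hγ-+L t 1) (hγ-cong (≡.sym (ℕ.+-identityʳ t))))))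

    η-+jN : ∀ t j → η (t ℕ.+ j ℕ.* N) ≡ η t
    η-+jN t zero    = cong η (ℕ.+-identityʳ t)
    η-+jN t (suc j) = ≡.trans (cong η (rotate t N (j ℕ.* N))) (≡.trans (η-+N (t ℕ.+ j ℕ.* N)) (η-+jN t j))
      where
      rotate : ∀ t N x → t ℕ.+ (N ℕ.+ x) ≡ t ℕ.+ x ℕ.+ N
      rotate = ℕ.solve-∀

    η-% : ∀ t → η (t % N) ≡ η t
    η-% t = ≡.trans (≡.sym (η-+jN (t % N) (t / N))) (cong η (≡.sym (m≡m%n+[m/n]*n t N)))

    η-cong-mod : ∀ {s t} → s % N ≡ t % N → η s ≡ η t
    η-cong-mod {s} {t} eq = ≡.trans (≡.sym (η-% s)) (≡.trans (cong η eq) (η-% t))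

    class-sum : ∀ t → ∑ᶻ (r ℕ.* κ) (λ j → hγ (t ℕ.+ j ℕ.* N)) ≡ + r ℤ.* η t
    class-sum t = begin
      ∑ᶻ (r ℕ.* κ) (λ j → hγ (t ℕ.+ j ℕ.* N))                        ≡⟨ ∑ᶻ-block κ r (λ j → hγ (t ℕ.+ j ℕ.* N)) ⟩
      ∑ᶻ κ (λ i → ∑ᶻ r (λ j → hγ (t ℕ.+ (i ℕ.+ j ℕ.* κ) ℕ.* N)))      ≡⟨ ∑ᶻ-cong κ (λ i → ∑ᶻ-cong r (λ j → ≡.trans (hγ-cong (regroup t i j κ N)) (hγ-+L (t ℕ.+ i ℕ.* N) j))) ⟩
      ∑ᶻ κ (λ i → ∑ᶻ r (λ _ → hγ (t ℕ.+ i ℕ.* N)))                    ≡⟨ ∑ᶻ-cong κ (λ i → ∑ᶻ-const r _) ⟩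
      ∑ᶻ κ (λ i → + r ℤ.* hγ (t ℕ.+ i ℕ.* N))                         ≡⟨ ∑ᶻ-*ˡ κ (+ r) _ ⟨
      + r ℤ.* η t                                                     ∎
      where
      regroup : ∀ t i j κ N → t ℕ.+ (i ℕ.+ j ℕ.* κ) ℕ.* N ≡ t ℕ.+ i ℕ.* N ℕ.+ j ℕ.* (N ℕ.* κ)
      regroup = ℕ.solve-∀

    sum-by-classes : ∀ t (c : ℕ → ℤ) → (∀ i j → c (i ℕ.+ j ℕ.* N) ≡ c i) →
                     ∑ᶻ n (λ e → hγ (t ℕ.+ e) ℤ.* c e) ≡ + r ℤ.* ∑ᶻ N (λ i → η (t ℕ.+ i) ℤ.* c i)
    sum-by-classes t c c-period = begin
      ∑ᶻ n g                                                ≡⟨ cong (λ m → ∑ᶻ m g) (≡.trans n≡Nrκ (ℕ.*-comm N (r ℕ.* κ))) ⟩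
      ∑ᶻ (r ℕ.* κ ℕ.* N) g                                  ≡⟨ ∑ᶻ-block N (r ℕ.* κ) g ⟩
      ∑ᶻ N (λ i → ∑ᶻ (r ℕ.* κ) (λ j → g (i ℕ.+ j ℕ.* N)))   ≡⟨ ∑ᶻ-cong N (λ i → ∑ᶻ-cong (r ℕ.* κ) (λ j → cong₂ ℤ._*_ (hγ-cong (≡.sym (ℕ.+-assoc t i (j ℕ.* N)))) (c-period i j))) ⟩
      ∑ᶻ N (λ i → ∑ᶻ (r ℕ.* κ) (λ j → hγ (t ℕ.+ i ℕ.+ j ℕ.* N) ℤ.* c i))
        ≡⟨ ∑ᶻ-cong N (λ i → ≡.trans (≡.sym (∑ᶻ-*ʳ (r ℕ.* κ) (c i) _)) (≡.trans (cong (ℤ._* c i) (class-sum (t ℕ.+ i))) (ℤ.*-assoc (+ r) _ (c i)))) ⟩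
      ∑ᶻ N (λ i → + r ℤ.* (η (t ℕ.+ i) ℤ.* c i))            ≡⟨ ∑ᶻ-*ˡ N (+ r) _ ⟨
      + r ℤ.* ∑ᶻ N (λ i → η (t ℕ.+ i) ℤ.* c i)              ∎
      where
      g : ℕ → ℤ
      g e = hγ (t ℕ.+ e) ℤ.* c e

    hγ-p* : ∀ e → hγ (p ℕ.* e) ≡ hγ e
    hγ-p* e = ≡.trans (h-cong (trans (^-congʳ γ (ℕ.*-comm p e)) (sym (^-assocʳ γ e p)))) (h-frobenius (γ ^ e))

    -- Frobenius preserves h, and p permutes the representatives j because it is a unit modulo κ:
    -- p^f = 1 + n and κ ∣ n.
    η-p* : ∀ t → η (p ℕ.* t) ≡ η t
    η-p* t = begin
      ∑ᶻ κ g                                    ≡⟨ ∑ᶻ-multiply κ p (p ℕ.^ ℕ.pred f) inverse-mod g g-period ⟨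
      ∑ᶻ κ (λ j → g (p ℕ.* j))                  ≡⟨ ∑ᶻ-cong κ (λ j → ≡.trans (hγ-cong (factor p t j N)) (hγ-p* (t ℕ.+ j ℕ.* N))) ⟩
      η t                                       ∎
      where
      g : ℕ → ℤ
      g j = hγ (p ℕ.* t ℕ.+ j ℕ.* N)
      factor : ∀ p t j N → p ℕ.* t ℕ.+ p ℕ.* j ℕ.* N ≡ p ℕ.* (t ℕ.+ j ℕ.* N)
      factor = ℕ.solve-∀
      g-period : ∀ i → g (i % κ) ≡ g i
      g-period i = ≡.trans (≡.sym (hγ-+L (p ℕ.* t ℕ.+ (i % κ) ℕ.* N) (i / κ)))
        (hγ-cong (≡.trans (regroup (p ℕ.* t) (i % κ) (i / κ) N κ) (cong (λ x → p ℕ.* t ℕ.+ x ℕ.* N) (≡.sym (m≡m%n+[m/n]*n i κ)))))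
        where
        regroup : ∀ t x y N κ → t ℕ.+ x ℕ.* N ℕ.+ y ℕ.* (N ℕ.* κ) ≡ t ℕ.+ (x ℕ.+ y ℕ.* κ) ℕ.* N
        regroup = ℕ.solve-∀
      inverse-mod : (p ℕ.* p ℕ.^ ℕ.pred f) % κ ≡ 1 % κ
      inverse-mod = ≡.trans (cong (_% κ) (≡.trans p*p^[f-1] (≡.trans p^f≡1+n (cong suc (≡.trans n≡Nrκ (≡.sym (ℕ.*-assoc N r κ))))))) ([m+kn]%n≡m%n 1 (N ℕ.* r) κ)

    η-p^* : ∀ i t → η (p ℕ.^ i ℕ.* t) ≡ η t
    η-p^* zero    t = cong η (ℕ.*-identityˡ t)
    η-p^* (suc i) t = ≡.trans (cong η (ℕ.*-assoc p (p ℕ.^ i) t)) (≡.trans (η-p* (p ℕ.^ i ℕ.* t)) (η-p^* i t))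

    -- The decomposition group of p contains 1 + ℓℤ, so η_t depends only on t mod M unless M ∣ t.
    η-shift : ∀ t → ¬ M ∣ t → ∀ s → η (t ℕ.+ M ℕ.* s) ≡ η t
    η-shift t M∤t s with i , eq ← orbit t M∤t s = ≡.trans (η-cong-mod (≡.sym eq)) (η-p^* i t)

    ∑η : ∑ᶻ N η ≡ -1ℤ
    ∑η = ℤ.*-cancelˡ-≡ (+ r) (∑ᶻ N η) -1ℤ (begin
      + r ℤ.* ∑ᶻ N η                                       ≡⟨ cong (+ r ℤ.*_) (∑ᶻ-cong N (λ i → ℤ.*-identityʳ (η i))) ⟨
      + r ℤ.* ∑ᶻ N (λ i → η i ℤ.* 1ℤ)                      ≡⟨ sum-by-classes 0 (λ _ → 1ℤ) (λ _ _ → ≡.refl) ⟨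
      ∑ᶻ n (λ e → hγ e ℤ.* 1ℤ)                             ≡⟨ ∑ᶻ-cong n (λ e → ℤ.*-identityʳ (hγ e)) ⟩
      ∑ᶻ n hγ                                              ≡⟨ isolate (+ r) (∑ᶻ n hγ) ⟩
      + r ℤ.* -1ℤ ℤ.+ (+ r ℤ.+ ∑ᶻ n hγ)                    ≡⟨ cong (λ z → + r ℤ.* -1ℤ ℤ.+ (z ℤ.+ ∑ᶻ n hγ)) h-0 ⟨
      + r ℤ.* -1ℤ ℤ.+ (h 0# ℤ.+ ∑ᶻ n hγ)                   ≡⟨ cong (λ z → + r ℤ.* -1ℤ ℤ.+ z) (≡.trans (≡.sym (Σᶻ-exp h)) Σᶻ-h) ⟩
      + r ℤ.* -1ℤ ℤ.+ 0ℤ                                   ≡⟨ ℤ.+-identityʳ _ ⟩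
      + r ℤ.* -1ℤ                                          ∎)
      where
      isolate : ∀ x y → y ≡ x ℤ.* -1ℤ ℤ.+ (x ℤ.+ y)
      isolate = solve-∀

    E : ℤ
    E = ∑ᶻ ℓ (λ s → η (s ℕ.* M))

    -- ℓ times the deviation of η on the multiples of M from its mean there; the factor ℓ keeps the
    -- projection integral.
    w : ℕ → ℤ
    w j = + ℓ ℤ.* η (j ℕ.* M) ℤ.- E

    w-period : ∀ j → w (j % ℓ) ≡ w j
    w-period j = cong (λ z → + ℓ ℤ.* z ℤ.- E) (≡.trans (≡.sym (η-+jN ((j % ℓ) ℕ.* M) (j / ℓ))) (cong η (begin
      (j % ℓ) ℕ.* M ℕ.+ (j / ℓ) ℕ.* N              ≡⟨ cong (λ x → (j % ℓ) ℕ.* M ℕ.+ (j / ℓ) ℕ.* x) N≡ℓM ⟩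
      (j % ℓ) ℕ.* M ℕ.+ (j / ℓ) ℕ.* (ℓ ℕ.* M)      ≡⟨ regroup (j % ℓ) (j / ℓ) ℓ M ⟩
      (j % ℓ ℕ.+ j / ℓ ℕ.* ℓ) ℕ.* M                ≡⟨ cong (ℕ._* M) (m≡m%n+[m/n]*n j ℓ) ⟨
      j ℕ.* M                                      ∎)))
      where
      regroup : ∀ x y l M → x ℕ.* M ℕ.+ y ℕ.* (l ℕ.* M) ≡ (x ℕ.+ y ℕ.* l) ℕ.* M
      regroup = ℕ.solve-∀

    ∑w : ∑ᶻ ℓ w ≡ 0ℤ
    ∑w = begin
      ∑ᶻ ℓ (λ j → + ℓ ℤ.* η (j ℕ.* M) ℤ.- E)                    ≡⟨ ∑ᶻ-+ ℓ _ _ ⟩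
      ∑ᶻ ℓ (λ j → + ℓ ℤ.* η (j ℕ.* M)) ℤ.+ ∑ᶻ ℓ (λ _ → ℤ.- E)   ≡⟨ cong₂ ℤ._+_ (∑ᶻ-*ˡ ℓ (+ ℓ) _) (≡.sym (∑ᶻ-const ℓ (ℤ.- E))) ⟨
      + ℓ ℤ.* E ℤ.+ + ℓ ℤ.* (ℤ.- E)                              ≡⟨ cancel (+ ℓ) E ⟩
      0ℤ                                                         ∎
      where
      cancel : ∀ x y → x ℤ.* y ℤ.+ x ℤ.* (ℤ.- y) ≡ 0ℤ
      cancel = solve-∀

    M∤ : ∀ i → suc i < M → ¬ M ∣ suc i
    M∤ i i<M d = ℕ.<⇒≱ i<M (∣⇒≤ d)

    η-row : ∀ i → suc i < M → ∀ j → η (suc i ℕ.+ j ℕ.* M) ≡ η (suc i)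
    η-row i i<M j = ≡.trans (cong (λ x → η (suc i ℕ.+ x)) (ℕ.*-comm j M)) (η-shift (suc i) (M∤ i i<M) j)

    by-rows : ∀ (g : ℕ → ℤ) → ∑ᶻ N g ≡ ∑ᶻ ℓ (λ j → g (j ℕ.* M)) ℤ.+ ∑ᶻ (ℕ.pred M) (λ i → ∑ᶻ ℓ (λ j → g (suc i ℕ.+ j ℕ.* M)))
    by-rows g = begin
      ∑ᶻ N g                                             ≡⟨ cong (λ m → ∑ᶻ m g) N≡ℓM ⟩
      ∑ᶻ (ℓ ℕ.* M) g                                     ≡⟨ ∑ᶻ-block M ℓ g ⟩
      ∑ᶻ M (λ i → ∑ᶻ ℓ (λ j → g (i ℕ.+ j ℕ.* M)))        ≡⟨ cong (λ m → ∑ᶻ m (λ i → ∑ᶻ ℓ (λ j → g (i ℕ.+ j ℕ.* M)))) (ℕ.suc-pred M) ⟨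
      ∑ᶻ (suc (ℕ.pred M)) (λ i → ∑ᶻ ℓ (λ j → g (i ℕ.+ j ℕ.* M))) ∎

    pred-bound : ∀ {i} → i < ℕ.pred M → suc i < M
    pred-bound i<M-1 = ≡.subst (_ <_) (ℕ.suc-pred M) (s<s i<M-1)

    -- The projection of η to the characters of order exactly N is supported on M ℤ, with values w.
    primitive-part : ∀ (φ : ℕ → ℤ) → (∀ t → φ (t ℕ.+ N) ≡ φ t) →
                     ∑ᶻ N (λ t → η t ℤ.* (+ ℓ ℤ.* φ t ℤ.- ∑ᶻ ℓ (λ s → φ (t ℕ.+ s ℕ.* M)))) ≡ ∑ᶻ ℓ (λ j → w j ℤ.* φ (j ℕ.* M))
    primitive-part φ φ-period = begin
      ∑ᶻ N G
        ≡⟨ by-rows G ⟩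
      ∑ᶻ ℓ (λ j → G (j ℕ.* M)) ℤ.+ ∑ᶻ (ℕ.pred M) (λ i → ∑ᶻ ℓ (λ j → G (suc i ℕ.+ j ℕ.* M)))
        ≡⟨ cong₂ ℤ._+_ zero-row (∑ᶻ-zero (ℕ.pred M) (λ i i<M-1 → row i (pred-bound i<M-1))) ⟩
      ∑ᶻ ℓ (λ j → w j ℤ.* φ (j ℕ.* M)) ℤ.+ 0ℤ
        ≡⟨ ℤ.+-identityʳ _ ⟩
      ∑ᶻ ℓ (λ j → w j ℤ.* φ (j ℕ.* M)) ∎
      where
      G : ℕ → ℤ
      G t = η t ℤ.* (+ ℓ ℤ.* φ t ℤ.- ∑ᶻ ℓ (λ s → φ (t ℕ.+ s ℕ.* M)))
      Ψ : ℕ → ℤ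
      Ψ i = ∑ᶻ ℓ (λ s → φ (i ℕ.+ s ℕ.* M))
      Ψ-invariant : ∀ i j → ∑ᶻ ℓ (λ s → φ (i ℕ.+ j ℕ.* M ℕ.+ s ℕ.* M)) ≡ Ψ i
      Ψ-invariant i j = ≡.trans (∑ᶻ-cong ℓ (λ s → cong φ (regroup i j s M))) (∑ᶻ-cyclic ℓ (λ s → φ (i ℕ.+ s ℕ.* M)) period j)
        where
        regroup : ∀ i j s M → i ℕ.+ j ℕ.* M ℕ.+ s ℕ.* M ≡ i ℕ.+ (j ℕ.+ s) ℕ.* M
        regroup = ℕ.solve-∀
        period : ∀ s → φ (i ℕ.+ (ℓ ℕ.+ s) ℕ.* M) ≡ φ (i ℕ.+ s ℕ.* M)
        period s = ≡.trans (cong φ (≡.trans (shift i ℓ s M) (cong (λ x → i ℕ.+ s ℕ.* M ℕ.+ x) (≡.sym N≡ℓM)))) (φ-period (i ℕ.+ s ℕ.* M))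
          where
          shift : ∀ i l s M → i ℕ.+ (l ℕ.+ s) ℕ.* M ≡ i ℕ.+ s ℕ.* M ℕ.+ l ℕ.* M
          shift = ℕ.solve-∀
      ∑-difference : ∀ (g : ℕ → ℤ) c → ∑ᶻ ℓ (λ j → + ℓ ℤ.* g j ℤ.- c) ≡ + ℓ ℤ.* ∑ᶻ ℓ g ℤ.- + ℓ ℤ.* c
      ∑-difference g c = ≡.trans (∑ᶻ-+ ℓ _ _) (cong₂ ℤ._+_ (≡.sym (∑ᶻ-*ˡ ℓ (+ ℓ) g)) (≡.trans (∑ᶻ-const ℓ (ℤ.- c)) (≡.sym (ℤ.neg-distribʳ-* (+ ℓ) c))))
      -- η is constant along the row, so only the row sum of ℓ φ minus its row total remains, and
      -- that is 0.
      row : ∀ i → suc i < M → ∑ᶻ ℓ (λ j → G (suc i ℕ.+ j ℕ.* M)) ≡ 0ℤ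
      row i i<M = begin
        ∑ᶻ ℓ (λ j → G (suc i ℕ.+ j ℕ.* M))
          ≡⟨ ∑ᶻ-cong ℓ (λ j → cong₂ (λ x y → x ℤ.* (+ ℓ ℤ.* φ (suc i ℕ.+ j ℕ.* M) ℤ.- y)) (η-row i i<M j) (Ψ-invariant (suc i) j)) ⟩
        ∑ᶻ ℓ (λ j → η (suc i) ℤ.* (+ ℓ ℤ.* φ (suc i ℕ.+ j ℕ.* M) ℤ.- Ψ (suc i)))
          ≡⟨ ∑ᶻ-*ˡ ℓ (η (suc i)) _ ⟨
        η (suc i) ℤ.* ∑ᶻ ℓ (λ j → + ℓ ℤ.* φ (suc i ℕ.+ j ℕ.* M) ℤ.- Ψ (suc i))
          ≡⟨ cong (η (suc i) ℤ.*_) (∑-difference (λ j → φ (suc i ℕ.+ j ℕ.* M)) (Ψ (suc i))) ⟩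
        η (suc i) ℤ.* (+ ℓ ℤ.* Ψ (suc i) ℤ.- + ℓ ℤ.* Ψ (suc i))
          ≡⟨ cancel (η (suc i)) (+ ℓ ℤ.* Ψ (suc i)) ⟩
        0ℤ ∎
        where
        cancel : ∀ x y → x ℤ.* (y ℤ.- y) ≡ 0ℤ
        cancel = solve-∀
      zero-row : ∑ᶻ ℓ (λ j → G (j ℕ.* M)) ≡ ∑ᶻ ℓ (λ j → w j ℤ.* φ (j ℕ.* M))
      zero-row = begin
        ∑ᶻ ℓ (λ j → G (j ℕ.* M))
          ≡⟨ ∑ᶻ-cong ℓ (λ j → ≡.trans (cong (λ y → ηM j ℤ.* (+ ℓ ℤ.* φM j ℤ.- y)) (Ψ-invariant 0 j)) (expand₁ (ηM j) (+ ℓ) (φM j) (Ψ 0))) ⟩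
        ∑ᶻ ℓ (λ j → + ℓ ℤ.* ηM j ℤ.* φM j ℤ.+ ηM j ℤ.* (ℤ.- Ψ 0))
          ≡⟨ ≡.trans (∑ᶻ-+ ℓ _ _) (cong (λ z → ∑ᶻ ℓ (λ j → + ℓ ℤ.* ηM j ℤ.* φM j) ℤ.+ z) (≡.sym (∑ᶻ-*ʳ ℓ (ℤ.- Ψ 0) ηM))) ⟩
        ∑ᶻ ℓ (λ j → + ℓ ℤ.* ηM j ℤ.* φM j) ℤ.+ E ℤ.* (ℤ.- Ψ 0)
          ≡⟨ cong (λ z → ∑ᶻ ℓ (λ j → + ℓ ℤ.* ηM j ℤ.* φM j) ℤ.+ z) (≡.trans (move E (Ψ 0)) (∑ᶻ-*ˡ ℓ (ℤ.- E) φM)) ⟩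
        ∑ᶻ ℓ (λ j → + ℓ ℤ.* ηM j ℤ.* φM j) ℤ.+ ∑ᶻ ℓ (λ j → ℤ.- E ℤ.* φM j)
          ≡⟨ ≡.sym (∑ᶻ-+ ℓ _ _) ⟩
        ∑ᶻ ℓ (λ j → + ℓ ℤ.* ηM j ℤ.* φM j ℤ.+ ℤ.- E ℤ.* φM j)
          ≡⟨ ∑ᶻ-cong ℓ (λ j → ≡.sym (ℤ.*-distribʳ-+ (φM j) (+ ℓ ℤ.* ηM j) (ℤ.- E))) ⟩
        ∑ᶻ ℓ (λ j → w j ℤ.* φM j) ∎
        where
        ηM φM : ℕ → ℤ
        ηM j = η (j ℕ.* M)
        φM j = φ (j ℕ.* M)
        expand₁ : ∀ x l y z → x ℤ.* (l ℤ.* y ℤ.- z) ≡ l ℤ.* x ℤ.* y ℤ.+ x ℤ.* (ℤ.- z)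
        expand₁ = solve-∀
        move : ∀ x y → x ℤ.* (ℤ.- y) ≡ ℤ.- x ℤ.* y
        move = solve-∀

    S : ℕ → ℤ
    S t = ∑ᶻ M (λ i → η (t ℕ.+ i))

    S-suc : ∀ t → S (suc t) ℤ.+ η t ≡ S t ℤ.+ η (t ℕ.+ M)
    S-suc t = begin
      S (suc t) ℤ.+ η t                                     ≡⟨ cong₂ ℤ._+_ (∑ᶻ-cong M (λ i → cong η (≡.sym (ℕ.+-suc t i)))) (cong η (≡.sym (ℕ.+-identityʳ t))) ⟩
      ∑ᶻ M (λ i → η (t ℕ.+ suc i)) ℤ.+ η (t ℕ.+ 0)          ≡⟨ ℤ.+-comm _ (η (t ℕ.+ 0)) ⟩
      ∑ᶻ (suc M) (λ i → η (t ℕ.+ i))                        ≡⟨ ∑ᶻ-last M (λ i → η (t ℕ.+ i)) ⟩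
      S t ℤ.+ η (t ℕ.+ M)                                   ∎

    rest : ℤ
    rest = ∑ᶻ (ℕ.pred M) (λ i → η (suc i))

    S-0 : S 0 ≡ rest ℤ.+ η 0
    S-0 = ≡.trans (cong (λ m → ∑ᶻ m η) (≡.sym (ℕ.suc-pred M))) (ℤ.+-comm (η 0) rest)

    E+ℓrest : E ℤ.+ + ℓ ℤ.* rest ≡ -1ℤ
    E+ℓrest = begin
      E ℤ.+ + ℓ ℤ.* rest
        ≡⟨ cong (λ z → E ℤ.+ z) (≡.trans (∑ᶻ-*ˡ (ℕ.pred M) (+ ℓ) _) (∑ᶻ-cong< (ℕ.pred M) (λ i i<M-1 → ≡.sym (≡.trans (∑ᶻ-cong ℓ (η-row i (pred-bound i<M-1))) (∑ᶻ-const ℓ _))))) ⟩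
      E ℤ.+ ∑ᶻ (ℕ.pred M) (λ i → ∑ᶻ ℓ (λ j → η (suc i ℕ.+ j ℕ.* M)))
        ≡⟨ by-rows η ⟨
      ∑ᶻ N η
        ≡⟨ ∑η ⟩
      -1ℤ ∎

    -- An interval of length M contains exactly one multiple j M of M.
    S-locate : ∀ t → ∃[ j ] S t ≡ rest ℤ.+ η (j ℕ.* M) × t ≤ j ℕ.* M × j ℕ.* M < t ℕ.+ M
    S-locate zero = 0 , S-0 , ℕ.z≤n , ℕ.>-nonZero⁻¹ M
    S-locate (suc t) with j , eq , t≤jM , jM<t+M ← S-locate t with ℕ.m≤n⇒m<n∨m≡n t≤jM
    -- Here M does not divide t, so the period at t that leaves the interval equals the one at t + M
    -- that enters.
    ... | inj₁ t<jM = j , (begin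
      S (suc t)                                    ≡⟨ isolate (S (suc t)) (η t) ⟩
      (S (suc t) ℤ.+ η t) ℤ.- η t                  ≡⟨ cong (ℤ._- η t) (≡.trans (S-suc t) (cong₂ ℤ._+_ eq (≡.trans (cong (λ x → η (t ℕ.+ x)) (≡.sym (ℕ.*-identityʳ M))) (η-shift t M∤t 1)))) ⟩
      (rest ℤ.+ η (j ℕ.* M) ℤ.+ η t) ℤ.- η t       ≡⟨ isolate (rest ℤ.+ η (j ℕ.* M)) (η t) ⟨
      rest ℤ.+ η (j ℕ.* M)                         ∎) , t<jM , ℕ.<-trans jM<t+M (ℕ.n<1+n _)
      where
      isolate : ∀ x y → x ≡ (x ℤ.+ y) ℤ.- y
      isolate = solve-∀
      M∤t : ¬ M ∣ t
      M∤t (divides q t≡qM) = ℕ.<⇒≱ t<jM (ℕ.≤-trans (ℕ.*-monoˡ-≤ M j≤q) (ℕ.≤-reflexive (≡.sym t≡qM)))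
        where
        j≤q : j ≤ q
        j≤q = ℕ.s≤s⁻¹ (ℕ.*-cancelʳ-< M j (suc q) (≡.subst (j ℕ.* M <_) (≡.trans (cong (ℕ._+ M) t≡qM) (ℕ.+-comm (q ℕ.* M) M)) jM<t+M))
    -- Here the multiple t = j M leaves the interval and (j + 1) M enters.
    ... | inj₂ t≡jM = suc j , (begin
      S (suc t)                                                  ≡⟨ isolate (S (suc t)) (η t) ⟩
      (S (suc t) ℤ.+ η t) ℤ.- η t                                ≡⟨ cong (ℤ._- η t) (≡.trans (S-suc t) (cong (ℤ._+ η (t ℕ.+ M)) eq)) ⟩
      (rest ℤ.+ η (j ℕ.* M) ℤ.+ η (t ℕ.+ M)) ℤ.- η t             ≡⟨ cong₂ (λ x y → (rest ℤ.+ η (j ℕ.* M) ℤ.+ x) ℤ.- y) (cong η (≡.trans (cong (ℕ._+ M) t≡jM) (ℕ.+-comm (j ℕ.* M) M))) (cong η t≡jM) ⟩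
      (rest ℤ.+ η (j ℕ.* M) ℤ.+ η (suc j ℕ.* M)) ℤ.- η (j ℕ.* M) ≡⟨ cancel rest (η (j ℕ.* M)) (η (suc j ℕ.* M)) ⟩
      rest ℤ.+ η (suc j ℕ.* M)                                   ∎) ,
      ≡.subst (λ x → suc x ≤ suc j ℕ.* M) (≡.sym t≡jM) (ℕ.+-monoˡ-≤ (j ℕ.* M) (ℕ.>-nonZero⁻¹ M)) ,
      ≡.subst (λ x → suc j ℕ.* M < suc x ℕ.+ M) (≡.sym t≡jM) (ℕ.≤-reflexive (cong suc (ℕ.+-comm M (j ℕ.* M))))
      where
      isolate : ∀ x y → x ≡ (x ℤ.+ y) ℤ.- y
      isolate = solve-∀
      cancel : ∀ x y z → (x ℤ.+ y ℤ.+ z) ℤ.- y ≡ x ℤ.+ z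
      cancel = solve-∀

    -- By `S-locate` the interval sum is `rest` plus the period at one multiple of M. In ℓ S the
    -- part E + ℓ `rest` is the total -1 of all periods, which the added 1 cancels.
    ℓS+1≡w : ∀ t → ∃[ j ] + ℓ ℤ.* S t ℤ.+ 1ℤ ≡ w j
    ℓS+1≡w t with j , eq , _ ← S-locate t = j , (begin
      + ℓ ℤ.* S t ℤ.+ 1ℤ                                                ≡⟨ cong (λ z → + ℓ ℤ.* z ℤ.+ 1ℤ) eq ⟩
      + ℓ ℤ.* (rest ℤ.+ η (j ℕ.* M)) ℤ.+ 1ℤ                             ≡⟨ expand (+ ℓ) rest (η (j ℕ.* M)) E ⟩
      (+ ℓ ℤ.* η (j ℕ.* M) ℤ.- E) ℤ.+ ((E ℤ.+ + ℓ ℤ.* rest) ℤ.+ 1ℤ)     ≡⟨ cong (λ z → w j ℤ.+ (z ℤ.+ 1ℤ)) E+ℓrest ⟩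
      w j ℤ.+ 0ℤ                                                        ≡⟨ ℤ.+-identityʳ (w j) ⟩
      w j                                                               ∎)
      where
      expand : ∀ l x y e → l ℤ.* (x ℤ.+ y) ℤ.+ 1ℤ ≡ (l ℤ.* y ℤ.- e) ℤ.+ ((e ℤ.+ l ℤ.* x) ℤ.+ 1ℤ)
      expand = solve-∀

-- Divisibility of the periods by 11^θ

module Divisibility where

  open import Algebra.Bundles using (CommutativeRing)
  open import Data.Integer.Base as ℤ using (ℤ; +_; 0ℤ)
  import Data.Integer.Properties as ℤ
  import Data.Integer.Divisibility.Signed as ℤ
  open import Data.Integer.Tactic.RingSolver using (solve-∀)
  open import Data.Nat.Base as ℕ using (ℕ; zero; suc; _<_; _≤_; z<s; _∸_; NonZero)
  open import Data.Nat.Divisibility using (_∣_; divides; _∣?_; *-cancelˡ-∣; m%n≡0⇒n∣m)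
  open import Data.Nat.DivMod using (_%_; m%n<n; m<n⇒m%n≡m; [m+kn]%n≡m%n)
  import Data.Nat.Properties as ℕ
  import Data.Nat.Tactic.RingSolver as ℕ
  open import Data.Product.Base using (_,_)
  open import Relation.Binary.PropositionalEquality as ≡ using (_≡_; cong; cong₂)
  open import Relation.Nullary.Decidable using (from-no)
  open import Relation.Nullary.Negation using (¬_)

  open FiniteSums
  open NumericalData
  open Periods

  module PeriodDivisibility {a b} (C : Constants) (F : CommutativeRing a b) (ff : IsFiniteField F (Constants.p C ℕ.^ Constants.f C))
                   (γ : CommutativeRing.Carrier F) (γ-primitive : IsPrimitiveElement F γ) where
    open GaussPeriods C F ff γ γ-primitive public
    open Sum commutativeSemiring using (∑; ∑-cong; ∑-cong<; ∑-*ˡ; ∑-*ʳ; ∑-zero; ∑-swap; ∑-const; ∑-single)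

    k : ℕ
    k = r ℕ.* κ

    ζ : Carrier
    ζ = γ ^ (k ℕ.* M)

    n≡kMℓ : n ≡ k ℕ.* M ℕ.* ℓ
    n≡kMℓ = ≡.trans n≡Nrκ (≡.trans (cong (ℕ._* k) N≡ℓM) (rotate ℓ M k))
      where
      rotate : ∀ l M k → l ℕ.* M ℕ.* k ≡ k ℕ.* M ℕ.* l
      rotate = ℕ.solve-∀

    module _ where
      open import Relation.Binary.Reasoning.Setoid setoid

      ζ^ℓ≈1 : ζ ^ ℓ ≈ 1#
      ζ^ℓ≈1 = trans (^-assocʳ γ (k ℕ.* M) ℓ) (trans (^-congʳ γ (≡.sym n≡kMℓ)) γ^n≈1)

      ζ-multiple : ∀ i → ζ ^ (i ℕ.* ℓ) ≈ 1#
      ζ-multiple i = trans (^-congʳ ζ (ℕ.*-comm i ℓ)) (trans (sym (^-assocʳ ζ ℓ i)) (trans (^-congˡ i ζ^ℓ≈1) (1^ i)))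

      ζ^≈1⇒ℓ∣ : ∀ i → ζ ^ i ≈ 1# → ℓ ∣ i
      ζ^≈1⇒ℓ∣ i eq = *-cancelˡ-∣ (k ℕ.* M) {{kM≢0}} (≡.subst (_∣ k ℕ.* M ℕ.* i) n≡kMℓ
        (m%n≡0⇒n∣m (k ℕ.* M ℕ.* i) n (≡.trans (γ^-mod {k ℕ.* M ℕ.* i} {0} (trans (sym (^-assocʳ γ (k ℕ.* M) i)) eq)) (m<n⇒m%n≡m 0<n))))
        where
        kM≢0 : NonZero (k ℕ.* M)
        kM≢0 = ℕ.m*n≢0 k M {{ℕ.m*n≢0 r κ}}

      geometric : ∀ ρ m → ¬ ρ ≈ 1# → ρ ^ m ≈ 1# → ∑ m (λ i → ρ ^ i) ≈ 0#
      geometric ρ m ρ≉1 ρ^m≈1 = xy≈0⇒y≈0 (ρ - 1#) (λ eq → ρ≉1 (x∙y⁻¹≈ε⇒x≈y ρ 1# eq)) (begin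
        (ρ - 1#) * G                     ≈⟨ [y-z]x≈yx-zx G ρ 1# ⟩
        ρ * G - 1# * G                   ≈⟨ +-cong (∑-*ˡ m ρ _) (-‿cong (*-identityˡ G)) ⟩
        ∑ m (λ i → ρ ^ suc i) - G        ≈⟨ +-congʳ (Sum.∑-cyclic₁ commutativeSemiring m (ρ ^_) ρ^m≈1) ⟩
        G - G                            ≈⟨ -‿inverseʳ G ⟩
        0#                               ∎)
        where
        G : Carrier
        G = ∑ m (λ i → ρ ^ i)

      -- Congruent to j₀ - j modulo ℓ without subtraction.
      offset : ℕ → ℕ → ℕ
      offset j₀ j = j₀ ℕ.+ (ℓ ∸ 1) ℕ.* j

      offset+j : ∀ j₀ j → offset j₀ j ℕ.+ j ≡ j₀ ℕ.+ j ℕ.* ℓ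
      offset+j j₀ j = ≡.trans (regroup j₀ (ℓ ∸ 1) j) (cong (λ x → j₀ ℕ.+ j ℕ.* x) (ℕ.suc-pred ℓ))
        where
        regroup : ∀ x l j → x ℕ.+ l ℕ.* j ℕ.+ j ≡ x ℕ.+ j ℕ.* (1 ℕ.+ l)
        regroup = ℕ.solve-∀

      offset-diagonal : ∀ j → ζ ^ offset j j ≈ 1#
      offset-diagonal j = trans (^-congʳ ζ (≡.trans (regroup (ℓ ∸ 1) j) (cong (j ℕ.*_) (ℕ.suc-pred ℓ)))) (ζ-multiple j)
        where
        regroup : ∀ l j → j ℕ.+ l ℕ.* j ≡ j ℕ.* (1 ℕ.+ l)
        regroup = ℕ.solve-∀

      offset-off-diagonal : ∀ {j₀ j} → j₀ < ℓ → j < ℓ → ζ ^ offset j₀ j ≈ 1# → j ≡ j₀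
      offset-off-diagonal {j₀} {j} j₀<ℓ j<ℓ eq with divides q b≡qℓ ← ζ^≈1⇒ℓ∣ (offset j₀ j) eq = E.begin
        j                              E.≡⟨ m<n⇒m%n≡m j<ℓ ⟨
        j % ℓ                          E.≡⟨ [m+kn]%n≡m%n j q ℓ ⟨
        (j ℕ.+ q ℕ.* ℓ) % ℓ            E.≡⟨ cong (_% ℓ) (≡.trans (ℕ.+-comm j (q ℕ.* ℓ)) (≡.trans (cong (ℕ._+ j) (≡.sym b≡qℓ)) (offset+j j₀ j))) ⟩
        (j₀ ℕ.+ j ℕ.* ℓ) % ℓ           E.≡⟨ [m+kn]%n≡m%n j₀ j ℓ ⟩
        j₀ % ℓ                         E.≡⟨ m<n⇒m%n≡m j₀<ℓ ⟩
        j₀                             E.∎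
        where module E = ≡.≡-Reasoning

      -- The exponent ℓ ∸ a stands for −a.
      fourier-inversion : ∀ (c : ℕ → Carrier) → (∀ a → a < ℓ → ∑ ℓ (λ j → c j * (ζ ^ (ℓ ∸ a)) ^ j) ≈ 0#) →
                          ∀ j₀ → j₀ < ℓ → ℓ ⨯ c j₀ ≈ 0#
      fourier-inversion c transform≈0 j₀ j₀<ℓ = begin
        ℓ ⨯ c j₀                                                          ≈⟨ trans (⨯-via-1 ℓ (c j₀)) (*-comm _ _) ⟩
        c j₀ * (ℓ ⨯ 1#)                                                   ≈⟨ select j₀<ℓ ⟨
        ∑ ℓ (λ j → c j * ∑ ℓ (λ a → (ζ ^ offset j₀ j) ^ a))               ≈⟨ ∑-cong ℓ (λ j → ∑-*ˡ ℓ (c j) _) ⟩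
        ∑ ℓ (λ j → ∑ ℓ (λ a → c j * (ζ ^ offset j₀ j) ^ a))               ≈⟨ ∑-swap ℓ ℓ _ ⟩
        ∑ ℓ (λ a → ∑ ℓ (λ j → c j * (ζ ^ offset j₀ j) ^ a))               ≈⟨ ∑-zero ℓ (λ a a<ℓ → trans (∑-cong ℓ (λ j → rearrange a j (ℕ.<⇒≤ a<ℓ))) (trans (sym (∑-*ˡ ℓ _ _)) (trans (*-congˡ (transform≈0 a a<ℓ)) (zeroʳ _)))) ⟩
        0#                                                                ∎
        where
        rearrange : ∀ a j → a ≤ ℓ → c j * (ζ ^ offset j₀ j) ^ a ≈ ζ ^ (j₀ ℕ.* a) * (c j * (ζ ^ (ℓ ∸ a)) ^ j)
        rearrange a j a≤ℓ = begin
          c j * (ζ ^ offset j₀ j) ^ a                        ≈⟨ *-congˡ (trans (^-assocʳ ζ (offset j₀ j) a) (trans (^-congʳ ζ exponent₁) (^-homo-* ζ (j₀ ℕ.* a) _))) ⟩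
          c j * (ζ ^ (j₀ ℕ.* a) * ζ ^ ((ℓ ∸ 1) ℕ.* a ℕ.* j)) ≈⟨ *-congˡ (*-congˡ (trans (sym (^-assocʳ ζ ((ℓ ∸ 1) ℕ.* a) j)) (^-congˡ j negated))) ⟩
          c j * (ζ ^ (j₀ ℕ.* a) * (ζ ^ (ℓ ∸ a)) ^ j)         ≈⟨ trans (sym (*-assoc _ _ _)) (trans (*-congʳ (*-comm _ _)) (*-assoc _ _ _)) ⟩
          ζ ^ (j₀ ℕ.* a) * (c j * (ζ ^ (ℓ ∸ a)) ^ j)         ∎
          where
          exponent₁ : offset j₀ j ℕ.* a ≡ j₀ ℕ.* a ℕ.+ (ℓ ∸ 1) ℕ.* a ℕ.* j
          exponent₁ = regroup j₀ (ℓ ∸ 1) j a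
            where
            regroup : ∀ x l j a → (x ℕ.+ l ℕ.* j) ℕ.* a ≡ x ℕ.* a ℕ.+ l ℕ.* a ℕ.* j
            regroup = ℕ.solve-∀
          negated : ζ ^ ((ℓ ∸ 1) ℕ.* a) ≈ ζ ^ (ℓ ∸ a)
          negated = cancelˡ (ζ ^ a) (^-≉0 (γ^≉0 (k ℕ.* M)) a) (begin
            ζ ^ a * ζ ^ ((ℓ ∸ 1) ℕ.* a)       ≈⟨ ^-homo-* ζ a _ ⟨
            ζ ^ (suc (ℓ ∸ 1) ℕ.* a)           ≈⟨ ^-congʳ ζ (≡.trans (cong (ℕ._* a) (ℕ.suc-pred ℓ)) (ℕ.*-comm ℓ a)) ⟩
            ζ ^ (a ℕ.* ℓ)                     ≈⟨ ζ-multiple a ⟩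
            1#                                ≈⟨ ζ^ℓ≈1 ⟨
            ζ ^ ℓ                             ≈⟨ ^-congʳ ζ (ℕ.m+[n∸m]≡n a≤ℓ) ⟨
            ζ ^ (a ℕ.+ (ℓ ∸ a))               ≈⟨ ^-homo-* ζ a (ℓ ∸ a) ⟩
            ζ ^ a * ζ ^ (ℓ ∸ a)               ∎)
        select : j₀ < ℓ → ∑ ℓ (λ j → c j * ∑ ℓ (λ a → (ζ ^ offset j₀ j) ^ a)) ≈ c j₀ * (ℓ ⨯ 1#)
        select j₀<ℓ = trans
          (∑-single ℓ j₀ _ j₀<ℓ (λ j j<ℓ j≢j₀ → trans (*-congˡ (geometric (ζ ^ offset j₀ j) ℓ (λ eq → j≢j₀ (offset-off-diagonal j₀<ℓ j<ℓ eq))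
            (trans (^-assocʳ ζ (offset j₀ j) ℓ) (ζ-multiple (offset j₀ j))))) (zeroʳ _)))
          (*-congˡ (trans (∑-cong ℓ (λ a → trans (^-congˡ a (offset-diagonal j₀)) (1^ a))) (∑-const ℓ 1#)))

    ℓ⨯1≉0 : ¬ ℓ ⨯ 1# ≈ 0#
    ℓ⨯1≉0 eq = from-no (11 ∣? 43) (≡.subst₂ _∣_ p≡11 ℓ≡43 (⨯1≈0⇒p∣ ℓ eq))

    r⨯1≉0 : ¬ r ⨯ 1# ≈ 0#
    r⨯1≉0 eq = from-no (11 ∣? 10) (≡.subst₂ _∣_ p≡11 r≡10 (⨯1≈0⇒p∣ r eq))

    ι-multiple≈0 : ∀ {m} i → ¬ m ⨯ 1# ≈ 0# → m ⨯ ι i ≈ 0# → ι i ≈ 0#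
    ι-multiple≈0 {m} i m≉0 eq = xy≈0⇒y≈0 (m ⨯ 1#) m≉0 (trans (sym (⨯-via-1 m (ι i))) eq)

    open ≡.≡-Reasoning

    module Pairing (a A : ℕ) (A<n : A < n) (AN≡na : A ℕ.* N ≡ n ℕ.* a) (a<ℓ : a < ℓ) where

      -- The value at γ of ω^(-A), with ω the identity of F^*: an N-th root of unity whose M-th
      -- power is ζ^(-a).
      ξ : Carrier
      ξ = γ ^ (n ∸ A)

      ξ^N≈1 : ξ ^ N ≈ 1#
      ξ^N≈1 = trans (^-assocʳ γ (n ∸ A) N) (trans (^-congʳ γ exponent) (γ^-multiple γ^n≈1 0 (N ∸ a)))
        where
        exponent : (n ∸ A) ℕ.* N ≡ (N ∸ a) ℕ.* n
        exponent = begin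
          (n ∸ A) ℕ.* N            ≡⟨ ℕ.*-distribʳ-∸ N n A ⟩
          n ℕ.* N ∸ A ℕ.* N        ≡⟨ cong (n ℕ.* N ∸_) AN≡na ⟩
          n ℕ.* N ∸ n ℕ.* a        ≡⟨ ℕ.*-distribˡ-∸ n N a ⟨
          n ℕ.* (N ∸ a)            ≡⟨ ℕ.*-comm n (N ∸ a) ⟩
          (N ∸ a) ℕ.* n            ∎

      A≡ak : A ≡ a ℕ.* k
      A≡ak = ℕ.*-cancelʳ-≡ A (a ℕ.* k) N (≡.trans AN≡na (≡.trans (cong (ℕ._* a) n≡Nrκ) (rotate N k a)))
        where
        rotate : ∀ N k a → N ℕ.* k ℕ.* a ≡ a ℕ.* k ℕ.* N
        rotate = ℕ.solve-∀

      ξ^M : ξ ^ M ≈ ζ ^ (ℓ ∸ a)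
      ξ^M = cancelˡ (γ ^ (A ℕ.* M)) (γ^≉0 (A ℕ.* M)) (trans left (sym right))
        where
        left : γ ^ (A ℕ.* M) * ξ ^ M ≈ 1#
        left = trans (*-congˡ (^-assocʳ γ (n ∸ A) M)) (trans (sym (^-homo-* γ (A ℕ.* M) ((n ∸ A) ℕ.* M)))
          (trans (^-congʳ γ (≡.trans (≡.sym (ℕ.*-distribʳ-+ M A (n ∸ A))) (≡.trans (cong (ℕ._* M) (ℕ.m+[n∸m]≡n (ℕ.<⇒≤ A<n))) (ℕ.*-comm n M)))) (γ^-multiple γ^n≈1 0 M)))
        right : γ ^ (A ℕ.* M) * ζ ^ (ℓ ∸ a) ≈ 1#
        right = trans (*-congˡ (^-assocʳ γ (k ℕ.* M) (ℓ ∸ a))) (trans (sym (^-homo-* γ (A ℕ.* M) (k ℕ.* M ℕ.* (ℓ ∸ a)))) (trans (^-congʳ γ exponent) γ^n≈1))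
          where
          exponent : A ℕ.* M ℕ.+ k ℕ.* M ℕ.* (ℓ ∸ a) ≡ n
          exponent = begin
            A ℕ.* M ℕ.+ k ℕ.* M ℕ.* (ℓ ∸ a)            ≡⟨ cong (λ x → x ℕ.* M ℕ.+ k ℕ.* M ℕ.* (ℓ ∸ a)) A≡ak ⟩
            a ℕ.* k ℕ.* M ℕ.+ k ℕ.* M ℕ.* (ℓ ∸ a)      ≡⟨ collect a k M (ℓ ∸ a) ⟩
            k ℕ.* M ℕ.* (a ℕ.+ (ℓ ∸ a))                ≡⟨ cong (k ℕ.* M ℕ.*_) (ℕ.m+[n∸m]≡n (ℕ.<⇒≤ a<ℓ)) ⟩
            k ℕ.* M ℕ.* ℓ                              ≡⟨ n≡kMℓ ⟨
            n                                          ∎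
            where
            collect : ∀ a k M x → a ℕ.* k ℕ.* M ℕ.+ k ℕ.* M ℕ.* x ≡ k ℕ.* M ℕ.* (a ℕ.+ x)
            collect = ℕ.solve-∀

      -- At x = γ^e the argument of φ is z ξ^e, so exponents sort into periods. The bracket is the
      -- form that `primitive-part` accepts; it leaves only multiples j M, where ξ^(jM) = ζ^(-aj).
      pairing : ∀ (φ : Carrier → ℤ) → Congruentᶻ φ → ∀ z →
                Σᶻ (λ x → h x ℤ.* (+ ℓ ℤ.* φ (z * x ^ (n ∸ A)) ℤ.- ∑ᶻ ℓ (λ s → φ (z * x ^ (n ∸ A) * ξ ^ (s ℕ.* M)))))
                ≡ + r ℤ.* ∑ᶻ ℓ (λ j → w j ℤ.* φ (z * (ζ ^ (ℓ ∸ a)) ^ j))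
      pairing φ φ-cong z = begin
        Σᶻ (λ x → h x ℤ.* φ′ (z * x ^ (n ∸ A)))
          ≡⟨ Σᶻ-exp (λ x → h x ℤ.* φ′ (z * x ^ (n ∸ A))) ⟩
        h 0# ℤ.* φ′ (z * 0# ^ (n ∸ A)) ℤ.+ ∑ᶻ n (λ e → hγ e ℤ.* φ′ (z * (γ ^ e) ^ (n ∸ A)))
          ≡⟨ cong₂ ℤ._+_ (≡.trans (cong (h 0# ℤ.*_) zero-term) (ℤ.*-zeroʳ (h 0#))) (∑ᶻ-cong n (λ e → cong (hγ e ℤ.*_) (φ′-cong (*-congˡ (power e))))) ⟩
        0ℤ ℤ.+ ∑ᶻ n (λ e → hγ e ℤ.* φ′ (z * ξ ^ e))
          ≡⟨ ℤ.+-identityˡ _ ⟩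
        ∑ᶻ n (λ e → hγ e ℤ.* φ′ (z * ξ ^ e))
          ≡⟨ sum-by-classes 0 (λ e → φ′ (z * ξ ^ e)) (λ i j → φ′-cong (*-congˡ (ξ-period i j))) ⟩
        + r ℤ.* ∑ᶻ N (λ i → η i ℤ.* φ′ (z * ξ ^ i))
          ≡⟨ cong (+ r ℤ.*_) (∑ᶻ-cong N (λ i → cong (λ x → η i ℤ.* (+ ℓ ℤ.* φ (z * ξ ^ i) ℤ.- x)) (∑ᶻ-cong ℓ (λ s → φ-cong (trans (*-assoc z _ _) (*-congˡ (sym (^-homo-* ξ i (s ℕ.* M))))))))) ⟩
        + r ℤ.* ∑ᶻ N (λ i → η i ℤ.* (+ ℓ ℤ.* φ (z * ξ ^ i) ℤ.- ∑ᶻ ℓ (λ s → φ (z * ξ ^ (i ℕ.+ s ℕ.* M)))))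
          ≡⟨ cong (+ r ℤ.*_) (primitive-part (λ t → φ (z * ξ ^ t)) (λ t → φ-cong (*-congˡ (trans (^-congʳ ξ (cong (t ℕ.+_) (≡.sym (ℕ.*-identityˡ N)))) (ξ-period t 1))))) ⟩
        + r ℤ.* ∑ᶻ ℓ (λ j → w j ℤ.* φ (z * ξ ^ (j ℕ.* M)))
          ≡⟨ cong (+ r ℤ.*_) (∑ᶻ-cong ℓ (λ j → cong (w j ℤ.*_) (φ-cong (*-congˡ (trans (^-congʳ ξ (ℕ.*-comm j M)) (trans (sym (^-assocʳ ξ M j)) (^-congˡ j ξ^M))))))) ⟩
        + r ℤ.* ∑ᶻ ℓ (λ j → w j ℤ.* φ (z * (ζ ^ (ℓ ∸ a)) ^ j)) ∎
        where
        φ′ : Carrier → ℤ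
        φ′ y = + ℓ ℤ.* φ y ℤ.- ∑ᶻ ℓ (λ s → φ (y * ξ ^ (s ℕ.* M)))
        φ′-cong : Congruentᶻ φ′
        φ′-cong eq = cong₂ (λ x y → + ℓ ℤ.* x ℤ.- y) (φ-cong eq) (∑ᶻ-cong ℓ (λ s → φ-cong (*-congʳ eq)))
        power : ∀ e → (γ ^ e) ^ (n ∸ A) ≈ ξ ^ e
        power e = trans (^-assocʳ γ e (n ∸ A)) (trans (^-congʳ γ (ℕ.*-comm e (n ∸ A))) (sym (^-assocʳ γ (n ∸ A) e)))
        ξ-period : ∀ i j → ξ ^ (i ℕ.+ j ℕ.* N) ≈ ξ ^ i
        ξ-period i j = trans (^-homo-* ξ i (j ℕ.* N)) (trans (*-congˡ (trans (^-congʳ ξ (ℕ.*-comm j N)) (trans (sym (^-assocʳ ξ N j)) (trans (^-congˡ j ξ^N≈1) (1^ j))))) (*-identityʳ _))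
        vanishing : z * 0# ^ (n ∸ A) ≈ 0#
        vanishing = trans (*-congˡ (0^ (n ∸ A) {{ℕ.>-nonZero (ℕ.m<n⇒0<n∸m A<n)}})) (zeroʳ z)
        zero-term : φ′ (z * 0# ^ (n ∸ A)) ≡ 0ℤ
        zero-term = begin
          φ′ (z * 0# ^ (n ∸ A))                                ≡⟨ φ′-cong vanishing ⟩
          + ℓ ℤ.* φ 0# ℤ.- ∑ᶻ ℓ (λ s → φ (0# * ξ ^ (s ℕ.* M))) ≡⟨ cong (λ x → + ℓ ℤ.* φ 0# ℤ.- x) (≡.trans (∑ᶻ-cong ℓ (λ s → φ-cong (zeroˡ _))) (∑ᶻ-const ℓ (φ 0#))) ⟩
          + ℓ ℤ.* φ 0# ℤ.- + ℓ ℤ.* φ 0#                        ≡⟨ ℤ.+-inverseʳ (+ ℓ ℤ.* φ 0#) ⟩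
          0ℤ                                                   ∎

    -- If p^i ∣ w with i < θ, then the transform of w / p^i vanishes modulo p.
    module Step (i : ℕ) (i<θ : i < θ) (y : ℕ → ℤ) (w≡ : ∀ j → w j ≡ y j ℤ.* + (p ℕ.^ i)) where

      p^i≢0 : NonZero (p ℕ.^ i)
      p^i≢0 = ℕ.m^n≢0 p i

      p^θ : + (p ℕ.^ ℕ.pred θ) ℤ.* + p ≡ + (p ℕ.^ i) ℤ.* (+ p ℤ.* + (p ℕ.^ (θ ∸ suc i)))
      p^θ = begin
        + (p ℕ.^ ℕ.pred θ) ℤ.* + p                             ≡⟨ ℤ.pos-* (p ℕ.^ ℕ.pred θ) p ⟨
        + (p ℕ.^ ℕ.pred θ ℕ.* p)                               ≡⟨ cong +_ naturals ⟩
        + (p ℕ.^ i ℕ.* (p ℕ.* p ℕ.^ (θ ∸ suc i)))              ≡⟨ ≡.trans (ℤ.pos-* (p ℕ.^ i) _) (cong (λ z → + (p ℕ.^ i) ℤ.* z) (ℤ.pos-* p _)) ⟩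
        + (p ℕ.^ i) ℤ.* (+ p ℤ.* + (p ℕ.^ (θ ∸ suc i)))        ∎
        where
        naturals : p ℕ.^ ℕ.pred θ ℕ.* p ≡ p ℕ.^ i ℕ.* (p ℕ.* p ℕ.^ (θ ∸ suc i))
        naturals = begin
          p ℕ.^ ℕ.pred θ ℕ.* p                          ≡⟨ ℕ.*-comm _ p ⟩
          p ℕ.^ suc (ℕ.pred θ)                          ≡⟨ cong (p ℕ.^_) (ℕ.suc-pred θ {{ℕ.>-nonZero 0<θ}}) ⟩
          p ℕ.^ θ                                       ≡⟨ cong (p ℕ.^_) (≡.trans (≡.sym (ℕ.m+[n∸m]≡n i<θ)) (≡.sym (ℕ.+-suc i (θ ∸ suc i)))) ⟩
          p ℕ.^ (i ℕ.+ suc (θ ∸ suc i))                 ≡⟨ ℕ.^-distribˡ-+-* p i (suc (θ ∸ suc i)) ⟩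
          p ℕ.^ i ℕ.* (p ℕ.* p ℕ.^ (θ ∸ suc i))         ∎

      -- The integral built from w is divisible by p^θ = p^i · p · p^(θ-i-1). Cancelling p^i leaves
      -- a factor p for y, and `annihilate` converts this into an equation in F.
      transform-nontrivial : ∀ a → 0 < a → a < ℓ → ∑ ℓ (λ j → ι (+ r ℤ.* y j) * (ζ ^ (ℓ ∸ a)) ^ j) ≈ 0#
      transform-nontrivial a 0<a a<ℓ with A , A<n , AN≡na , Z , ev-Z≉0 , β , eq ← stickelberger a 0<a a<ℓ =
        annihilate Z ev-Z≉0 ℓ (λ j → + r ℤ.* y j) (λ j → (ζ ^ (ℓ ∸ a)) ^ j) divisible
        where
        open Pairing a A A<n AN≡na a<ℓ
        divisible : ∀ φ → Congruentᶻ φ → + p ℤ.∣ R₁.∫ᶻ Z (λ z → ∑ᶻ ℓ (λ j → + r ℤ.* y j ℤ.* φ (z * (ζ ^ (ℓ ∸ a)) ^ j)))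
        divisible φ φ-cong = ℤ.∣-trans (ℤ.∣m⇒∣m*n (+ (p ℕ.^ (θ ∸ suc i))) ℤ.∣-refl)
          (ℤ.*-cancelˡ-∣ (+ (p ℕ.^ i)) {{p^i≢0}} (≡.subst₂ ℤ._∣_ p^θ integral (extract φ′ φ′-cong A Z (p ℕ.^ ℕ.pred θ) β eq)))
          where
          φ′ : Carrier → ℤ
          φ′ x = + ℓ ℤ.* φ x ℤ.- ∑ᶻ ℓ (λ s → φ (x * ξ ^ (s ℕ.* M)))
          φ′-cong : Congruentᶻ φ′
          φ′-cong eq = cong₂ (λ x y → + ℓ ℤ.* x ℤ.- y) (φ-cong eq) (∑ᶻ-cong ℓ (λ s → φ-cong (*-congʳ eq)))
          e : ℕ → Carrier
          e j = (ζ ^ (ℓ ∸ a)) ^ j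
          integral : R₁.∫ᶻ Z (λ z → Σᶻ (λ x → h x ℤ.* φ′ (z * x ^ (n ∸ A)))) ≡
                     + (p ℕ.^ i) ℤ.* R₁.∫ᶻ Z (λ z → ∑ᶻ ℓ (λ j → + r ℤ.* y j ℤ.* φ (z * e j)))
          integral = begin
            R₁.∫ᶻ Z (λ z → Σᶻ (λ x → h x ℤ.* φ′ (z * x ^ (n ∸ A))))
              ≡⟨ R₁.∫ᶻ-cong Z (λ z → ≡.trans (pairing φ φ-cong z) (factor z)) ⟩
            R₁.∫ᶻ Z (λ z → ∑ᶻ ℓ (λ j → + r ℤ.* y j ℤ.* φ (z * e j)) ℤ.* + (p ℕ.^ i))
              ≡⟨ R₁.∫ᶻ-*ʳ Z _ (+ (p ℕ.^ i)) ⟩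
            R₁.∫ᶻ Z (λ z → ∑ᶻ ℓ (λ j → + r ℤ.* y j ℤ.* φ (z * e j))) ℤ.* + (p ℕ.^ i)
              ≡⟨ ℤ.*-comm _ (+ (p ℕ.^ i)) ⟩
            + (p ℕ.^ i) ℤ.* R₁.∫ᶻ Z (λ z → ∑ᶻ ℓ (λ j → + r ℤ.* y j ℤ.* φ (z * e j))) ∎
            where
            regroup : ∀ r y P f → r ℤ.* (y ℤ.* P ℤ.* f) ≡ r ℤ.* y ℤ.* f ℤ.* P
            regroup = solve-∀
            factor : ∀ z → + r ℤ.* ∑ᶻ ℓ (λ j → w j ℤ.* φ (z * e j)) ≡ ∑ᶻ ℓ (λ j → + r ℤ.* y j ℤ.* φ (z * e j)) ℤ.* + (p ℕ.^ i)
            factor z = ≡.trans (∑ᶻ-*ˡ ℓ (+ r) _) (≡.trans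
              (∑ᶻ-cong ℓ (λ j → ≡.trans (cong (λ x → + r ℤ.* (x ℤ.* φ (z * e j))) (w≡ j)) (regroup (+ r) (y j) (+ (p ℕ.^ i)) (φ (z * e j)))))
              (≡.sym (∑ᶻ-*ʳ ℓ (+ (p ℕ.^ i)) _)))

      ∑y : ∑ᶻ ℓ y ≡ 0ℤ
      ∑y = ℤ.*-cancelʳ-≡ (∑ᶻ ℓ y) 0ℤ (+ (p ℕ.^ i)) {{p^i≢0}} (≡.trans (∑ᶻ-*ʳ ℓ (+ (p ℕ.^ i)) y) (≡.trans (∑ᶻ-cong ℓ (λ j → ≡.sym (w≡ j))) (≡.trans ∑w (≡.sym (ℤ.*-zeroˡ (+ (p ℕ.^ i)))))))

      -- a = 0 is the trivial character of ℤ/ℓ, outside the reach of the Gauss sum estimate; there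
      -- the sum vanishes already in ℤ, by `∑y`.
      transform : ∀ a → a < ℓ → ∑ ℓ (λ j → ι (+ r ℤ.* y j) * (ζ ^ (ℓ ∸ a)) ^ j) ≈ 0#
      transform zero    _   = trans (∑-cong ℓ (λ j → trans (*-congˡ (trans (^-congˡ j ζ^ℓ≈1) (1^ j))) (*-identityʳ _)))
        (trans (sym (ι-∑ ℓ (λ j → + r ℤ.* y j))) (reflexive (cong ι (≡.trans (≡.sym (∑ᶻ-*ˡ ℓ (+ r) y)) (≡.trans (cong (+ r ℤ.*_) ∑y) (ℤ.*-zeroʳ (+ r)))))))
      transform (suc a) a<ℓ = transform-nontrivial (suc a) z<s a<ℓ

      p∣y : ∀ j → j < ℓ → + p ℤ.∣ y j
      p∣y j j<ℓ = ι≈0 (y j) (ι-multiple≈0 {r} (y j) r⨯1≉0 (trans (sym (ι-multiple r (y j)))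
        (ι-multiple≈0 {ℓ} (+ r ℤ.* y j) ℓ⨯1≉0 (fourier-inversion (λ j → ι (+ r ℤ.* y j)) transform j j<ℓ))))

    ∣-product : ∀ {x y i} → x ≡ y ℤ.* + (p ℕ.^ i) → + p ℤ.∣ y → + (p ℕ.^ suc i) ℤ.∣ x
    ∣-product {x} {y} {i} x≡ (ℤ.divides z eq) = ℤ.divides z (begin
      x                                    ≡⟨ x≡ ⟩
      y ℤ.* + (p ℕ.^ i)                    ≡⟨ cong (ℤ._* + (p ℕ.^ i)) eq ⟩
      z ℤ.* + p ℤ.* + (p ℕ.^ i)            ≡⟨ ≡.trans (ℤ.*-assoc z (+ p) _) (cong (z ℤ.*_) (≡.sym (ℤ.pos-* p (p ℕ.^ i)))) ⟩
      z ℤ.* + (p ℕ.^ suc i)                ∎)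

    -- One factor p is gained at a time, because an equation in F sees the quotient y only modulo p.
    -- Inversion covers j < ℓ, and periodicity the rest.
    p^θ∣w : ∀ i → i ≤ θ → ∀ j → + (p ℕ.^ i) ℤ.∣ w j
    p^θ∣w zero    _   j = ℤ.divides (w j) (≡.sym (ℤ.*-identityʳ (w j)))
    p^θ∣w (suc i) i<θ j = ≡.subst (+ (p ℕ.^ suc i) ℤ.∣_) (w-period j) (combine (j % ℓ) (m%n<n j ℓ))
      where
      previous : ∀ j → + (p ℕ.^ i) ℤ.∣ w j
      previous = p^θ∣w i (ℕ.<⇒≤ i<θ)
      y : ℕ → ℤ
      y j = ℤ.quotient (previous j)
      w≡ : ∀ j → w j ≡ y j ℤ.* + (p ℕ.^ i)
      w≡ j = ℤ._∣_.equality (previous j)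
      combine : ∀ j → j < ℓ → + (p ℕ.^ suc i) ℤ.∣ w j
      combine j j<ℓ = ∣-product {w j} {y j} {i} (w≡ j) (Step.p∣y i i<θ y w≡ j j<ℓ)

-- The two nontrivial character values of D

module TwoValues where

  open import Algebra.Bundles using (CommutativeRing)
  open import Data.Integer.Base as ℤ using (ℤ; +_; -[1+_]; 0ℤ; 1ℤ; +≤+)
  import Data.Integer.Properties as ℤ
  import Data.Integer.Divisibility.Signed as ℤ
  open import Data.Integer.Tactic.RingSolver using (solve-∀)
  open import Data.Nat.Base as ℕ using (ℕ; zero; suc; _<_; _≤_; z<s; s<s; z≤n; _∸_; NonZero)
  open import Data.Nat.Divisibility using (_∣_; divides)
  open import Data.Nat.DivMod using (_%_; _/_; m%n<n; m<n⇒m%n≡m; [m+kn]%n≡m%n; m≡m%n+[m/n]*n; m<n*o⇒m/o<n; m*n/n≡m; m∣n⇒o%n%m≡o%m)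
  import Data.Nat.Properties as ℕ
  import Data.Nat.Tactic.RingSolver as ℕ
  open import Data.Product.Base using (_,_; ∃-syntax; _×_; proj₁; proj₂)
  open import Relation.Binary.PropositionalEquality as ≡ using (_≡_; cong; cong₂)
  open import Relation.Nullary.Decidable using (Dec; yes; no; map′)
  open import Relation.Nullary.Negation using (¬_; contradiction)

  open FiniteSums
  open NumericalData
  open Divisibility

  ∑-nonnegative : ∀ n (g : ℕ → ℤ) → (∀ i → i < n → 0ℤ ℤ.≤ g i) → 0ℤ ℤ.≤ Sumᶻ.∑ n g
  ∑-nonnegative zero    g nonneg = ℤ.≤-refl
  ∑-nonnegative (suc n) g nonneg = ℤ.+-mono-≤ (nonneg 0 z<s) (∑-nonnegative n (λ i → g (suc i)) (λ i i<n → nonneg (suc i) (s<s i<n)))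

  ∑-nonnegative-zero : ∀ n (g : ℕ → ℤ) → (∀ i → i < n → 0ℤ ℤ.≤ g i) → Sumᶻ.∑ n g ≡ 0ℤ → ∀ i → i < n → g i ≡ 0ℤ
  ∑-nonnegative-zero (suc n) g nonneg sum≡0 = λ { zero _ → head≡0 ; (suc i) (s<s i<n) → ∑-nonnegative-zero n (λ i → g (suc i)) tail-nonneg tail≡0 i i<n }
    where
    tail-nonneg : ∀ i → i < n → 0ℤ ℤ.≤ g (suc i)
    tail-nonneg i i<n = nonneg (suc i) (s<s i<n)
    tail : ℤ
    tail = Sumᶻ.∑ n (λ i → g (suc i))
    head≡0 : g 0 ≡ 0ℤ
    head≡0 = ℤ.≤-antisym (ℤ.≤-trans (ℤ.≤-reflexive (≡.sym (ℤ.+-identityʳ (g 0))))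
      (ℤ.≤-trans (ℤ.+-monoʳ-≤ (g 0) (∑-nonnegative n _ tail-nonneg)) (ℤ.≤-reflexive sum≡0))) (nonneg 0 z<s)
    tail≡0 : tail ≡ 0ℤ
    tail≡0 = ≡.trans (≡.sym (ℤ.+-identityˡ tail)) (≡.trans (cong (ℤ._+ tail) (≡.sym head≡0)) sum≡0)

  z[z+1]≥0 : ∀ z → 0ℤ ℤ.≤ z ℤ.* (z ℤ.+ 1ℤ)
  z[z+1]≥0 (+ m)      = ≡.subst (0ℤ ℤ.≤_) (ℤ.pos-* m (m ℕ.+ 1)) (+≤+ z≤n)
  z[z+1]≥0 (-[1+ m ]) = ≡.subst (0ℤ ℤ.≤_) (≡.trans (ℤ.pos-* (suc m) m) (reflect (+ m))) (+≤+ z≤n)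
    where
    reflect : ∀ x → (1ℤ ℤ.+ x) ℤ.* x ≡ (ℤ.- (1ℤ ℤ.+ x)) ℤ.* (ℤ.- (1ℤ ℤ.+ x) ℤ.+ 1ℤ)
    reflect = solve-∀

  module CharacterValues {a b} (C : Constants) (F : CommutativeRing a b) (ff : IsFiniteField F (Constants.p C ℕ.^ Constants.f C))
                   (γ : CommutativeRing.Carrier F) (γ-primitive : IsPrimitiveElement F γ) where
    open PeriodDivisibility C F ff γ γ-primitive public

    D : Carrier → Set b
    D = ClassUnion F (p ℕ.^ f) N γ M

    number-of-cosets : (p ℕ.^ f ∸ 1) / N ≡ k
    number-of-cosets = ≡.trans (cong (λ x → (x ∸ 1) / N) p^f≡1+n) (≡.trans (cong (_/ N) (≡.trans n≡Nrκ (ℕ.*-comm N k))) (m*n/n≡m k N))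

    M≤N : M ≤ N
    M≤N = ≡.subst (M ≤_) (≡.sym N≡ℓM) (ℕ.m≤n*m M ℓ)

    N∣n : N ∣ n
    N∣n = divides k (≡.trans n≡Nrκ (ℕ.*-comm N k))

    D-resp : ∀ {x y} → x ≈ y → D x → D y
    D-resp x≈y (i , i<M , j , j<k , x≈) = i , i<M , j , j<k , trans (sym x≈y) x≈

    D-power : ∀ {e} → e % N < M → D (γ ^ e)
    -- e is reduced modulo n first, since a class admits only j below (q - 1) / N; residues modulo N
    -- survive because N ∣ n.
    D-power {e} e%N<M = D-resp (γ^-% e) (e′ % N , ≡.subst (_< M) (≡.sym (m∣n⇒o%n%m≡o%m N n e N∣n)) e%N<M , e′ / N ,
      ≡.subst (e′ / N <_) (≡.sym number-of-cosets) (m<n*o⇒m/o<n (≡.subst (e′ <_) (≡.trans n≡Nrκ (ℕ.*-comm N k)) (m%n<n e n))) ,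
      ^-congʳ γ (m≡m%n+[m/n]*n e′ N))
      where
      e′ : ℕ
      e′ = e % n

    power-D : ∀ {x} → D x → ∃[ e ] x ≈ γ ^ e × e % N < M
    power-D (i , i<M , j , _ , x≈) = i ℕ.+ j ℕ.* N , x≈ ,
      ≡.subst (_< M) (≡.sym (≡.trans ([m+kn]%n≡m%n i j N) (m<n⇒m%n≡m (ℕ.<-≤-trans i<M M≤N)))) i<M

    power-in-D : ∀ {e} → D (γ ^ e) → e % N < M
    power-in-D {e} d with e′ , eq , e′%N<M ← power-D d = ≡.subst (_< M) (begin
      e′ % N          ≡⟨ m∣n⇒o%n%m≡o%m N n e′ N∣n ⟨
      e′ % n % N      ≡⟨ cong (_% N) (γ^-mod {e′} {e} (sym eq)) ⟩
      e % n % N       ≡⟨ m∣n⇒o%n%m≡o%m N n e N∣n ⟩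
      e % N           ∎) e′%N<M
      where open ≡.≡-Reasoning

    0∉D : ∀ {x} → x ≈ 0# → ¬ D x
    0∉D x≈0 d with e , x≈γ^e , _ ← power-D d = γ^≉0 e (trans (sym x≈γ^e) x≈0)

    D? : ∀ x → Dec (D x)
    D? x with x ≟ 0#
    ... | yes x≈0 = no (0∉D x≈0)
    ... | no x≉0 with e , _ , x≈γ^e ← log x x≉0 =
      map′ (λ lt → D-resp (sym x≈γ^e) (D-power lt)) (λ d → power-in-D (D-resp x≈γ^e d)) (e % N ℕ.<? M)

    [γ^e]-shift : ∀ j e → (L ℕ.* j ℕ.+ e) % N ≡ e % N
    [γ^e]-shift j e = ≡.trans (cong (_% N) (rotate N κ j e)) ([m+kn]%n≡m%n e (κ ℕ.* j) N)
      where
      rotate : ∀ N κ j e → N ℕ.* κ ℕ.* j ℕ.+ e ≡ e ℕ.+ κ ℕ.* j ℕ.* N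
      rotate = ℕ.solve-∀

    module _ {c : Carrier} {j : ℕ} (c≈ : c ≈ γ ^ (L ℕ.* j)) where

      D-coset : ∀ {x} → D x → D (c * x)
      D-coset {x} d with e , x≈γ^e , e%N<M ← power-D d =
        D-resp (trans (^-homo-* γ (L ℕ.* j) e) (sym (*-cong c≈ x≈γ^e))) (D-power (≡.subst (_< M) (≡.sym ([γ^e]-shift j e)) e%N<M))

      coset-D : ∀ {x} → D (c * x) → D x
      coset-D {x} d with x ≟ 0#
      ... | yes x≈0 = contradiction d (0∉D (trans (*-congˡ x≈0) (zeroʳ c)))
      ... | no x≉0 with e , _ , x≈γ^e ← log x x≉0 =
        D-resp (sym x≈γ^e) (D-power (≡.subst (_< M) ([γ^e]-shift j e) (power-in-D (D-resp (trans (*-cong c≈ x≈γ^e) (sym (^-homo-* γ (L ℕ.* j) e))) d))))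

    scalar-power : ∀ {u} → u < r → ∃[ j ] scalar u ≈ γ ^ (L ℕ.* j)
    scalar-power {u} u<r = proj₁ power , proj₂ (proj₂ power)
      where
      power : ∃[ j ] j < r × scalar u ≈ γ ^ (L ℕ.* j)
      power = p-power-fixed (scalar≉0 u<r) (frobenius-⨯ (suc u))

    χ : Carrier → ℤ
    χ x = ⟦ D? x ⟧ᶻ

    χ-cong : Congruentᶻ χ
    χ-cong {x} {y} eq = ⟦⟧ᶻ-⇔ (D? x) (D? y) (D-resp eq) (D-resp (sym eq))

    -- Prime field units are powers of γ^L, and N ∣ L, so they preserve every cyclotomic class.
    χ-invariant : ∀ u x → u < r → χ (scalar u * x) ≡ χ x
    χ-invariant u x u<r = ⟦⟧ᶻ-⇔ (D? (scalar u * x)) (D? x) (coset-D (proj₂ (scalar-power u<r))) (D-coset (proj₂ (scalar-power u<r)))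

    open Transform χ χ-cong χ-invariant public renaming (φ̂ to χ̂; φ̂-cong to χ̂-cong)
    open ≡.≡-Reasoning

    χ-power : ∀ e → χ (γ ^ e) ≡ ⟦ e % N ℕ.<? M ⟧ᶻ
    χ-power e = ⟦⟧ᶻ-⇔ (D? (γ ^ e)) (e % N ℕ.<? M) power-in-D D-power

    χ-0 : χ 0# ≡ 0ℤ
    χ-0 = ⟦⟧ᶻ-no (D? 0#) (0∉D refl)

    class : ℕ → ℤ
    class i = ⟦ i % N ℕ.<? M ⟧ᶻ

    class-period : ∀ i j → class (i ℕ.+ j ℕ.* N) ≡ class i
    class-period i j = cong (λ x → ⟦ x ℕ.<? M ⟧ᶻ) ([m+kn]%n≡m%n i j N)

    restrict-to-classes : ∀ (g : ℕ → ℤ) → ∑ᶻ N (λ i → g i ℤ.* class i) ≡ ∑ᶻ M g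
    restrict-to-classes g = begin
      ∑ᶻ N (λ i → g i ℤ.* class i)
        ≡⟨ cong (λ m → ∑ᶻ m (λ i → g i ℤ.* class i)) (ℕ.m+[n∸m]≡n M≤N) ⟨
      ∑ᶻ (M ℕ.+ (N ∸ M)) (λ i → g i ℤ.* class i)
        ≡⟨ ∑ᶻ-split M (N ∸ M) _ ⟩
      ∑ᶻ M (λ i → g i ℤ.* class i) ℤ.+ ∑ᶻ (N ∸ M) (λ i → g (M ℕ.+ i) ℤ.* class (M ℕ.+ i))
        ≡⟨ cong₂ ℤ._+_ (∑ᶻ-cong< M inside) (∑ᶻ-zero (N ∸ M) outside) ⟩
      ∑ᶻ M g ℤ.+ 0ℤ
        ≡⟨ ℤ.+-identityʳ _ ⟩
      ∑ᶻ M g ∎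
      where
      inside : ∀ i → i < M → g i ℤ.* class i ≡ g i
      inside i i<M = ≡.trans (cong (g i ℤ.*_) (⟦⟧ᶻ-yes (i % N ℕ.<? M) (≡.subst (_< M) (≡.sym (m<n⇒m%n≡m (ℕ.<-≤-trans i<M M≤N))) i<M))) (ℤ.*-identityʳ (g i))
      outside : ∀ i → i < N ∸ M → g (M ℕ.+ i) ℤ.* class (M ℕ.+ i) ≡ 0ℤ
      outside i i<N-M = ≡.trans (cong (g (M ℕ.+ i) ℤ.*_) (⟦⟧ᶻ-no ((M ℕ.+ i) % N ℕ.<? M) (λ lt → ℕ.<⇒≱ lt (ℕ.≤-trans (ℕ.m≤m+n M i) (ℕ.≤-reflexive (≡.sym (m<n⇒m%n≡m M+i<N))))))) (ℤ.*-zeroʳ (g (M ℕ.+ i)))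
        where
        M+i<N : M ℕ.+ i < N
        M+i<N = ≡.subst (M ℕ.+ i <_) (ℕ.m+[n∸m]≡n M≤N) (ℕ.+-monoʳ-< M i<N-M)

    χ̂-power : ∀ t → χ̂ (γ ^ t) ≡ + r ℤ.* S t
    χ̂-power t = begin
      Σᶻ (λ x → χ x ℤ.* h (γ ^ t * x))
        ≡⟨ Σᶻ-exp _ ⟩
      χ 0# ℤ.* h (γ ^ t * 0#) ℤ.+ ∑ᶻ n (λ e → χ (γ ^ e) ℤ.* h (γ ^ t * γ ^ e))
        ≡⟨ cong₂ ℤ._+_ (≡.trans (cong (ℤ._* h (γ ^ t * 0#)) χ-0) (ℤ.*-zeroˡ (h (γ ^ t * 0#))))
                       (∑ᶻ-cong n (λ e → ≡.trans (cong₂ ℤ._*_ (χ-power e) (h-cong (sym (^-homo-* γ t e)))) (ℤ.*-comm (class e) (hγ (t ℕ.+ e))))) ⟩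
      0ℤ ℤ.+ ∑ᶻ n (λ e → hγ (t ℕ.+ e) ℤ.* class e)
        ≡⟨ ≡.trans (ℤ.+-identityˡ _) (sum-by-classes t class class-period) ⟩
      + r ℤ.* ∑ᶻ N (λ i → η (t ℕ.+ i) ℤ.* class i)
        ≡⟨ cong (+ r ℤ.*_) (restrict-to-classes (λ i → η (t ℕ.+ i))) ⟩
      + r ℤ.* S t ∎

    size : ℤ
    size = Σᶻ χ

    size≡ : size ≡ + (k ℕ.* M)
    size≡ = begin
      Σᶻ χ                                                         ≡⟨ Σᶻ-exp χ ⟩
      χ 0# ℤ.+ ∑ᶻ n (λ e → χ (γ ^ e))                              ≡⟨ cong₂ ℤ._+_ χ-0 (∑ᶻ-cong n χ-power) ⟩
      0ℤ ℤ.+ ∑ᶻ n class                                            ≡⟨ ≡.trans (ℤ.+-identityˡ _) (cong (λ m → ∑ᶻ m class) (≡.trans n≡Nrκ (ℕ.*-comm N k))) ⟩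
      ∑ᶻ (k ℕ.* N) class                                           ≡⟨ ∑ᶻ-block N k class ⟩
      ∑ᶻ N (λ i → ∑ᶻ k (λ j → class (i ℕ.+ j ℕ.* N)))              ≡⟨ ∑ᶻ-cong N (λ i → ≡.trans (∑ᶻ-cong k (class-period i)) (∑ᶻ-const k (class i))) ⟩
      ∑ᶻ N (λ i → + k ℤ.* class i)                                 ≡⟨ restrict-to-classes (λ _ → + k) ⟩
      ∑ᶻ M (λ _ → + k)                                             ≡⟨ ∑ᶻ-const M (+ k) ⟩
      + M ℤ.* + k                                                  ≡⟨ ≡.trans (ℤ.*-comm (+ M) (+ k)) (≡.sym (ℤ.pos-* k M)) ⟩
      + (k ℕ.* M)                                                  ∎

    ℓ*size : + ℓ ℤ.* size ≡ + n
    ℓ*size = ≡.trans (cong (+ ℓ ℤ.*_) size≡) (≡.trans (≡.sym (ℤ.pos-* ℓ (k ℕ.* M))) (cong +_ (≡.trans (ℕ.*-comm ℓ (k ℕ.* M)) (≡.sym n≡kMℓ))))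

    χ̂-0 : χ̂ 0# ≡ + r ℤ.* size
    χ̂-0 = ≡.trans (Σᶻ-cong (λ x → ≡.trans (cong (χ x ℤ.*_) (≡.trans (h-cong (zeroˡ x)) h-0)) (ℤ.*-comm (χ x) (+ r)))) (≡.sym (Σᶻ-*ˡ (+ r) χ))

    Σᶻ-h0 : ∀ g → Σᶻ (λ c → g c ℤ.* h (c * 0#)) ≡ + r ℤ.* Σᶻ g
    Σᶻ-h0 g = ≡.trans (Σᶻ-cong (λ c → ≡.trans (cong (g c ℤ.*_) (≡.trans (h-cong (zeroʳ c)) h-0)) (ℤ.*-comm (g c) (+ r)))) (≡.sym (Σᶻ-*ˡ (+ r) g))

    -- Inversion at w = 0 makes the full sum of `χ̂` a multiple of χ 0 = 0; removing the term at c =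
    -- 0, which is r · `size`, leaves r times the sum of the S.
    ∑S : ∑ᶻ n S ≡ ℤ.- size
    ∑S = ℤ.*-cancelˡ-≡ (+ r) (∑ᶻ n S) (ℤ.- size) (begin
      + r ℤ.* ∑ᶻ n S                                              ≡⟨ ≡.trans (∑ᶻ-*ˡ n (+ r) S) (∑ᶻ-cong n (λ t → ≡.sym (χ̂-power t))) ⟩
      ∑ᶻ n (λ t → χ̂ (γ ^ t))                                      ≡⟨ isolate (χ̂ 0#) _ ⟩
      (χ̂ 0# ℤ.+ ∑ᶻ n (λ t → χ̂ (γ ^ t))) ℤ.- χ̂ 0#                  ≡⟨ cong₂ ℤ._-_ (≡.trans (≡.sym (Σᶻ-exp χ̂)) total) χ̂-0 ⟩
      0ℤ ℤ.- + r ℤ.* size                                         ≡⟨ negate (+ r) size ⟩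
      + r ℤ.* (ℤ.- size)                                          ∎)
      where
      isolate : ∀ x y → y ≡ (x ℤ.+ y) ℤ.- x
      isolate = solve-∀
      negate : ∀ x y → 0ℤ ℤ.- x ℤ.* y ≡ x ℤ.* (ℤ.- y)
      negate = solve-∀
      total : Σᶻ χ̂ ≡ 0ℤ
      total = ℤ.*-cancelˡ-≡ (+ r) (Σᶻ χ̂) 0ℤ (begin
        + r ℤ.* Σᶻ χ̂                              ≡⟨ Σᶻ-h0 χ̂ ⟨
        Σᶻ (λ c → χ̂ c ℤ.* h (c * 0#))             ≡⟨ inversion 0# ⟩
        (+ r ℤ.* (Q ℤ.* + r)) ℤ.* χ 0#            ≡⟨ cong ((+ r ℤ.* (Q ℤ.* + r)) ℤ.*_) χ-0 ⟩
        (+ r ℤ.* (Q ℤ.* + r)) ℤ.* 0ℤ              ≡⟨ ≡.trans (ℤ.*-zeroʳ (+ r ℤ.* (Q ℤ.* + r))) (≡.sym (ℤ.*-zeroʳ (+ r))) ⟩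
        + r ℤ.* 0ℤ                                ∎)

    χ-idempotent : ∀ x → χ x ℤ.* χ x ≡ χ x
    χ-idempotent x with D? x
    ... | yes _ = ≡.refl
    ... | no _  = ≡.refl

    -- Parseval is `correlation` at w = 0, where χ² = χ turns the autocorrelation into `size`; the
    -- term at c = 0 is again removed.
    ∑S² : ∑ᶻ n (λ t → S t ℤ.* S t) ≡ Q ℤ.* size ℤ.- size ℤ.* size
    ∑S² = ℤ.*-cancelˡ-≡ (+ r) _ _ (ℤ.*-cancelˡ-≡ (+ r) _ _ (begin
      + r ℤ.* (+ r ℤ.* ∑ᶻ n (λ t → S t ℤ.* S t))
        ≡⟨ ≡.trans (≡.sym (ℤ.*-assoc (+ r) (+ r) _)) (≡.trans (∑ᶻ-*ˡ n (+ r ℤ.* + r) _) (∑ᶻ-cong n (λ t → ≡.trans (square (+ r) (S t)) (cong₂ ℤ._*_ (≡.sym (χ̂-power t)) (≡.sym (χ̂-power t)))))) ⟩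
      ∑ᶻ n (λ t → χ̂ (γ ^ t) ℤ.* χ̂ (γ ^ t))
        ≡⟨ isolate (χ̂ 0# ℤ.* χ̂ 0#) _ ⟩
      (χ̂ 0# ℤ.* χ̂ 0# ℤ.+ ∑ᶻ n (λ t → χ̂ (γ ^ t) ℤ.* χ̂ (γ ^ t))) ℤ.- χ̂ 0# ℤ.* χ̂ 0#
        ≡⟨ cong₂ ℤ._-_ (≡.trans (≡.sym (Σᶻ-exp (λ c → χ̂ c ℤ.* χ̂ c))) parseval) (cong₂ ℤ._*_ χ̂-0 χ̂-0) ⟩
      (+ r ℤ.* (Q ℤ.* + r)) ℤ.* size ℤ.- (+ r ℤ.* size) ℤ.* (+ r ℤ.* size)
        ≡⟨ factor (+ r) Q size ⟩
      + r ℤ.* (+ r ℤ.* (Q ℤ.* size ℤ.- size ℤ.* size)) ∎))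
      where
      square : ∀ r s → r ℤ.* r ℤ.* (s ℤ.* s) ≡ (r ℤ.* s) ℤ.* (r ℤ.* s)
      square = solve-∀
      isolate : ∀ x y → y ≡ (x ℤ.+ y) ℤ.- x
      isolate = solve-∀
      factor : ∀ r q d → (r ℤ.* (q ℤ.* r)) ℤ.* d ℤ.- (r ℤ.* d) ℤ.* (r ℤ.* d) ≡ r ℤ.* (r ℤ.* (q ℤ.* d ℤ.- d ℤ.* d))
      factor = solve-∀
      parseval : Σᶻ (λ c → χ̂ c ℤ.* χ̂ c) ≡ (+ r ℤ.* (Q ℤ.* + r)) ℤ.* size
      parseval = ℤ.*-cancelˡ-≡ (+ r) _ _ (begin
        + r ℤ.* Σᶻ (λ c → χ̂ c ℤ.* χ̂ c)                                                    ≡⟨ Σᶻ-h0 _ ⟨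
        Σᶻ (λ c → χ̂ c ℤ.* χ̂ c ℤ.* h (c * 0#))                                             ≡⟨ correlation 0# ⟩
        (+ r ℤ.* (+ r ℤ.* (Q ℤ.* + r))) ℤ.* Σᶻ (λ y → χ y ℤ.* χ (0# + y))                 ≡⟨ cong ((+ r ℤ.* (+ r ℤ.* (Q ℤ.* + r))) ℤ.*_) (Σᶻ-cong (λ y → ≡.trans (cong (χ y ℤ.*_) (χ-cong (+-identityˡ y))) (χ-idempotent y))) ⟩
        (+ r ℤ.* (+ r ℤ.* (Q ℤ.* + r))) ℤ.* size                                          ≡⟨ ℤ.*-assoc (+ r) _ size ⟩
        + r ℤ.* ((+ r ℤ.* (Q ℤ.* + r)) ℤ.* size)                                          ∎)

    W : ℕ → ℤ
    W t = + ℓ ℤ.* S t ℤ.+ 1ℤ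

    g : ℤ
    g = + (p ℕ.^ θ)

    abstract
      -- Abstract, so that the quotient `Y` read off from it does not unfold into the whole
      -- divisibility proof.
      g∣W : ∀ t → g ℤ.∣ W t
      g∣W t = ≡.subst (g ℤ.∣_) (≡.sym (proj₂ (ℓS+1≡w t))) (p^θ∣w θ ℕ.≤-refl (proj₁ (ℓS+1≡w t)))

    Q≡pg² : Q ≡ + p ℤ.* (g ℤ.* g)
    Q≡pg² = begin
      + suc n                                    ≡⟨ cong +_ p^f≡1+n ⟨
      + (p ℕ.^ f)                                ≡⟨ cong (λ x → + (p ℕ.^ x)) (≡.trans f≡1+2θ (cong (λ x → suc (θ ℕ.+ x)) (ℕ.+-identityʳ θ))) ⟩
      + (p ℕ.* p ℕ.^ (θ ℕ.+ θ))                  ≡⟨ cong (λ x → + (p ℕ.* x)) (ℕ.^-distribˡ-+-* p θ θ) ⟩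
      + (p ℕ.* (p ℕ.^ θ ℕ.* p ℕ.^ θ))            ≡⟨ ≡.trans (ℤ.pos-* p _) (cong (λ x → + p ℤ.* x) (ℤ.pos-* (p ℕ.^ θ) (p ℕ.^ θ))) ⟩
      + p ℤ.* (g ℤ.* g)                          ∎

    -- The numerical coincidence behind the theorem: ℓ = 1 + 2 v and v + 1 = 2 p.
    v : ℤ
    v = + 21

    ℓ≡1+2v : + ℓ ≡ 1ℤ ℤ.+ (v ℤ.+ v)
    ℓ≡1+2v = cong +_ ℓ≡43

    v+1≡2p : v ℤ.+ 1ℤ ≡ + p ℤ.+ + p
    v+1≡2p = cong (λ x → + (x ℕ.+ x)) (≡.sym p≡11)

    Y : ℕ → ℤ
    Y t = ℤ.quotient (g∣W t)

    W≡Yg : ∀ t → W t ≡ Y t ℤ.* g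
    W≡Yg t = ℤ._∣_.equality (g∣W t)

    ∑W : ∑ᶻ n W ≡ 0ℤ
    ∑W = begin
      ∑ᶻ n (λ t → + ℓ ℤ.* S t ℤ.+ 1ℤ)                  ≡⟨ ≡.trans (∑ᶻ-+ n _ _) (cong₂ ℤ._+_ (≡.sym (∑ᶻ-*ˡ n (+ ℓ) S)) (≡.trans (∑ᶻ-const n 1ℤ) (ℤ.*-identityʳ (+ n)))) ⟩
      + ℓ ℤ.* ∑ᶻ n S ℤ.+ + n                           ≡⟨ cong₂ (λ x y → + ℓ ℤ.* x ℤ.+ y) ∑S (≡.sym ℓ*size) ⟩
      + ℓ ℤ.* (ℤ.- size) ℤ.+ + ℓ ℤ.* size              ≡⟨ cancel (+ ℓ) size ⟩
      0ℤ                                               ∎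
      where
      cancel : ∀ x y → x ℤ.* (ℤ.- y) ℤ.+ x ℤ.* y ≡ 0ℤ
      cancel = solve-∀

    ∑W² : ∑ᶻ n (λ t → W t ℤ.* W t) ≡ + n ℤ.* ((+ ℓ ℤ.- 1ℤ) ℤ.* Q)
    ∑W² = begin
      ∑ᶻ n (λ t → W t ℤ.* W t)
        ≡⟨ ∑ᶻ-cong n (λ t → expand (+ ℓ) (S t)) ⟩
      ∑ᶻ n (λ t → + ℓ ℤ.* + ℓ ℤ.* (S t ℤ.* S t) ℤ.+ ((+ ℓ ℤ.+ + ℓ) ℤ.* S t ℤ.+ 1ℤ))
        ≡⟨ ≡.trans (∑ᶻ-+ n _ _) (cong₂ ℤ._+_ (≡.sym (∑ᶻ-*ˡ n (+ ℓ ℤ.* + ℓ) (λ t → S t ℤ.* S t))) (≡.trans (∑ᶻ-+ n _ _) (cong₂ ℤ._+_ (≡.sym (∑ᶻ-*ˡ n (+ ℓ ℤ.+ + ℓ) S)) (≡.trans (∑ᶻ-const n 1ℤ) (ℤ.*-identityʳ (+ n)))))) ⟩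
      + ℓ ℤ.* + ℓ ℤ.* ∑ᶻ n (λ t → S t ℤ.* S t) ℤ.+ ((+ ℓ ℤ.+ + ℓ) ℤ.* ∑ᶻ n S ℤ.+ + n)
        ≡⟨ cong₂ (λ x y → + ℓ ℤ.* + ℓ ℤ.* x ℤ.+ ((+ ℓ ℤ.+ + ℓ) ℤ.* y ℤ.+ + n)) ∑S² ∑S ⟩
      + ℓ ℤ.* + ℓ ℤ.* (Q ℤ.* size ℤ.- size ℤ.* size) ℤ.+ ((+ ℓ ℤ.+ + ℓ) ℤ.* (ℤ.- size) ℤ.+ + n)
        ≡⟨ cong (λ x → + ℓ ℤ.* + ℓ ℤ.* (Q ℤ.* size ℤ.- size ℤ.* size) ℤ.+ ((+ ℓ ℤ.+ + ℓ) ℤ.* (ℤ.- size) ℤ.+ x)) (≡.sym ℓ*size) ⟩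
      + ℓ ℤ.* + ℓ ℤ.* (Q ℤ.* size ℤ.- size ℤ.* size) ℤ.+ ((+ ℓ ℤ.+ + ℓ) ℤ.* (ℤ.- size) ℤ.+ + ℓ ℤ.* size)
        ≡⟨ collect (+ ℓ) Q size ⟩
      + ℓ ℤ.* size ℤ.* (+ ℓ ℤ.* Q ℤ.- + ℓ ℤ.* size ℤ.- 1ℤ)
        ≡⟨ cong (λ x → x ℤ.* (+ ℓ ℤ.* Q ℤ.- x ℤ.- 1ℤ)) ℓ*size ⟩
      + n ℤ.* (+ ℓ ℤ.* Q ℤ.- + n ℤ.- 1ℤ)
        ≡⟨ finish (+ n) (+ ℓ) ⟩
      + n ℤ.* ((+ ℓ ℤ.- 1ℤ) ℤ.* (1ℤ ℤ.+ + n)) ∎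
      where
      expand : ∀ l s → (l ℤ.* s ℤ.+ 1ℤ) ℤ.* (l ℤ.* s ℤ.+ 1ℤ) ≡ l ℤ.* l ℤ.* (s ℤ.* s) ℤ.+ ((l ℤ.+ l) ℤ.* s ℤ.+ 1ℤ)
      expand = solve-∀
      collect : ∀ l q d → l ℤ.* l ℤ.* (q ℤ.* d ℤ.- d ℤ.* d) ℤ.+ ((l ℤ.+ l) ℤ.* (ℤ.- d) ℤ.+ l ℤ.* d) ≡ l ℤ.* d ℤ.* (l ℤ.* q ℤ.- l ℤ.* d ℤ.- 1ℤ)
      collect = solve-∀
      finish : ∀ n l → n ℤ.* (l ℤ.* (1ℤ ℤ.+ n) ℤ.- n ℤ.- 1ℤ) ≡ n ℤ.* ((l ℤ.- 1ℤ) ℤ.* (1ℤ ℤ.+ n))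
      finish = solve-∀

    g≢0 : ℤ.NonZero g
    g≢0 = ℕ.m^n≢0 p θ

    ∑Y : ∑ᶻ n Y ≡ 0ℤ
    ∑Y = ℤ.*-cancelʳ-≡ _ _ g {{g≢0}} (≡.trans (∑ᶻ-*ʳ n g Y) (≡.trans (∑ᶻ-cong n (λ t → ≡.sym (W≡Yg t))) (≡.trans ∑W (≡.sym (ℤ.*-zeroˡ g)))))

    -- Division by g² turns (ℓ - 1) Q into 2 v p, and v + 1 = 2 p makes this v (v + 1).
    ∑Y² : ∑ᶻ n (λ t → Y t ℤ.* Y t) ≡ + n ℤ.* (v ℤ.* (v ℤ.+ 1ℤ))
    ∑Y² = ℤ.*-cancelʳ-≡ _ _ g {{g≢0}} (ℤ.*-cancelʳ-≡ _ _ g {{g≢0}} (begin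
      ∑ᶻ n (λ t → Y t ℤ.* Y t) ℤ.* g ℤ.* g
        ≡⟨ ≡.trans (ℤ.*-assoc (∑ᶻ n (λ t → Y t ℤ.* Y t)) g g) (≡.trans (∑ᶻ-*ʳ n (g ℤ.* g) (λ t → Y t ℤ.* Y t)) (∑ᶻ-cong n (λ t → ≡.trans (square (Y t) g) (cong₂ ℤ._*_ (≡.sym (W≡Yg t)) (≡.sym (W≡Yg t)))))) ⟩
      ∑ᶻ n (λ t → W t ℤ.* W t)
        ≡⟨ ∑W² ⟩
      + n ℤ.* ((+ ℓ ℤ.- 1ℤ) ℤ.* Q)
        ≡⟨ cong₂ (λ x y → + n ℤ.* ((x ℤ.- 1ℤ) ℤ.* y)) ℓ≡1+2v Q≡pg² ⟩
      + n ℤ.* ((1ℤ ℤ.+ (v ℤ.+ v) ℤ.- 1ℤ) ℤ.* (+ p ℤ.* (g ℤ.* g)))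
        ≡⟨ regroup (+ n) v (+ p) g ⟩
      + n ℤ.* (v ℤ.* (+ p ℤ.+ + p)) ℤ.* g ℤ.* g
        ≡⟨ cong (λ x → + n ℤ.* (v ℤ.* x) ℤ.* g ℤ.* g) v+1≡2p ⟨
      + n ℤ.* (v ℤ.* (v ℤ.+ 1ℤ)) ℤ.* g ℤ.* g ∎))
      where
      square : ∀ y g → y ℤ.* y ℤ.* (g ℤ.* g) ≡ (y ℤ.* g) ℤ.* (y ℤ.* g)
      square = solve-∀
      regroup : ∀ n v p g → n ℤ.* ((1ℤ ℤ.+ (v ℤ.+ v) ℤ.- 1ℤ) ℤ.* (p ℤ.* (g ℤ.* g))) ≡ n ℤ.* (v ℤ.* (p ℤ.+ p)) ℤ.* g ℤ.* g
      regroup = solve-∀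

    -- From g ≡ −2 and g Y = W ≡ 1 (mod ℓ).
    Y-mod-ℓ : ∀ t → ∃[ z ] Y t ≡ v ℤ.+ + ℓ ℤ.* z
    Y-mod-ℓ t = z , ≡.trans (solved (Y t) v (+ ℓ) s ℓ≡1+2v 2Y) (cong (λ x → v ℤ.+ x ℤ.* z) (≡.sym ℓ≡1+2v))
      where
      x s z : ℤ
      x = + proj₁ p^θ+2
      s = x ℤ.* Y t ℤ.- S t
      z = (v ℤ.+ 1ℤ) ℤ.* s ℤ.- Y t ℤ.- 1ℤ
      g+2 : g ℤ.+ (1ℤ ℤ.+ 1ℤ) ≡ + ℓ ℤ.* x
      g+2 = ≡.trans (cong +_ (proj₂ p^θ+2)) (ℤ.pos-* ℓ (proj₁ p^θ+2))
      2Y : Y t ℤ.+ Y t ≡ + ℓ ℤ.* s ℤ.- 1ℤ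
      2Y = begin
        Y t ℤ.+ Y t                                        ≡⟨ expand (Y t) g ⟩
        (g ℤ.+ (1ℤ ℤ.+ 1ℤ)) ℤ.* Y t ℤ.- Y t ℤ.* g          ≡⟨ cong₂ (λ a b → a ℤ.* Y t ℤ.- b) g+2 (≡.sym (W≡Yg t)) ⟩
        + ℓ ℤ.* x ℤ.* Y t ℤ.- (+ ℓ ℤ.* S t ℤ.+ 1ℤ)         ≡⟨ collect (+ ℓ) x (Y t) (S t) ⟩
        + ℓ ℤ.* s ℤ.- 1ℤ                                   ∎
        where
        expand : ∀ y g → y ℤ.+ y ≡ (g ℤ.+ (1ℤ ℤ.+ 1ℤ)) ℤ.* y ℤ.- y ℤ.* g
        expand = solve-∀
        collect : ∀ l x y s → l ℤ.* x ℤ.* y ℤ.- (l ℤ.* s ℤ.+ 1ℤ) ≡ l ℤ.* (x ℤ.* y ℤ.- s) ℤ.- 1ℤ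
        collect = solve-∀
      -- v + 1 is the inverse of 2 modulo ℓ = 1 + 2 v, so 2 Y ≡ -1 gives Y ≡ -(v + 1) ≡ v.
      solved : ∀ y v l s → l ≡ 1ℤ ℤ.+ (v ℤ.+ v) → y ℤ.+ y ≡ l ℤ.* s ℤ.- 1ℤ →
               y ≡ v ℤ.+ (1ℤ ℤ.+ (v ℤ.+ v)) ℤ.* ((v ℤ.+ 1ℤ) ℤ.* s ℤ.- y ℤ.- 1ℤ)
      solved y v l s ≡.refl eq = begin
        y                                                                                     ≡⟨ split y v ⟩
        (v ℤ.+ 1ℤ) ℤ.* (y ℤ.+ y) ℤ.- (1ℤ ℤ.+ (v ℤ.+ v)) ℤ.* y                                 ≡⟨ cong (λ x → (v ℤ.+ 1ℤ) ℤ.* x ℤ.- (1ℤ ℤ.+ (v ℤ.+ v)) ℤ.* y) eq ⟩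
        (v ℤ.+ 1ℤ) ℤ.* ((1ℤ ℤ.+ (v ℤ.+ v)) ℤ.* s ℤ.- 1ℤ) ℤ.- (1ℤ ℤ.+ (v ℤ.+ v)) ℤ.* y         ≡⟨ collect y v s ⟩
        v ℤ.+ (1ℤ ℤ.+ (v ℤ.+ v)) ℤ.* ((v ℤ.+ 1ℤ) ℤ.* s ℤ.- y ℤ.- 1ℤ)                          ∎
        where
        split : ∀ y v → y ≡ (v ℤ.+ 1ℤ) ℤ.* (y ℤ.+ y) ℤ.- (1ℤ ℤ.+ (v ℤ.+ v)) ℤ.* y
        split = solve-∀
        collect : ∀ y v s → (v ℤ.+ 1ℤ) ℤ.* ((1ℤ ℤ.+ (v ℤ.+ v)) ℤ.* s ℤ.- 1ℤ) ℤ.- (1ℤ ℤ.+ (v ℤ.+ v)) ℤ.* y ≡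
                            v ℤ.+ (1ℤ ℤ.+ (v ℤ.+ v)) ℤ.* ((v ℤ.+ 1ℤ) ℤ.* s ℤ.- y ℤ.- 1ℤ)
        collect = solve-∀

    -- Y ∈ {v, −v − 1}: each Y is v modulo ℓ, so (Y − v)(Y + v + 1) = ℓ² z (z + 1) ≥ 0, and these numbers have sum 0.
    two-values : ∀ t → t < n → (Y t ℤ.- v) ℤ.* (Y t ℤ.+ v ℤ.+ 1ℤ) ≡ 0ℤ
    two-values = ∑-nonnegative-zero n (λ t → (Y t ℤ.- v) ℤ.* (Y t ℤ.+ v ℤ.+ 1ℤ)) (λ t _ → nonneg t) (begin
      ∑ᶻ n (λ t → (Y t ℤ.- v) ℤ.* (Y t ℤ.+ v ℤ.+ 1ℤ))
        ≡⟨ ∑ᶻ-cong n (λ t → expand (Y t) v) ⟩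
      ∑ᶻ n (λ t → Y t ℤ.* Y t ℤ.+ (Y t ℤ.- v ℤ.* (v ℤ.+ 1ℤ)))
        ≡⟨ ≡.trans (∑ᶻ-+ n _ _) (cong₂ ℤ._+_ ∑Y² (≡.trans (∑ᶻ-+ n Y _) (cong₂ ℤ._+_ ∑Y (∑ᶻ-const n (ℤ.- (v ℤ.* (v ℤ.+ 1ℤ))))))) ⟩
      + n ℤ.* (v ℤ.* (v ℤ.+ 1ℤ)) ℤ.+ (0ℤ ℤ.+ + n ℤ.* (ℤ.- (v ℤ.* (v ℤ.+ 1ℤ))))
        ≡⟨ cancel (+ n) (v ℤ.* (v ℤ.+ 1ℤ)) ⟩
      0ℤ ∎)
      where
      expand : ∀ y v → (y ℤ.- v) ℤ.* (y ℤ.+ v ℤ.+ 1ℤ) ≡ y ℤ.* y ℤ.+ (y ℤ.- v ℤ.* (v ℤ.+ 1ℤ))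
      expand = solve-∀
      cancel : ∀ n x → n ℤ.* x ℤ.+ (0ℤ ℤ.+ n ℤ.* (ℤ.- x)) ≡ 0ℤ
      cancel = solve-∀
      nonneg : ∀ t → 0ℤ ℤ.≤ (Y t ℤ.- v) ℤ.* (Y t ℤ.+ v ℤ.+ 1ℤ)
      nonneg t = ≡.subst (0ℤ ℤ.≤_) (≡.sym product) (nonneg-product (z[z+1]≥0 z))
        where
        z : ℤ
        z = proj₁ (Y-mod-ℓ t)
        factor : ∀ v z → (v ℤ.+ (1ℤ ℤ.+ (v ℤ.+ v)) ℤ.* z ℤ.- v) ℤ.* (v ℤ.+ (1ℤ ℤ.+ (v ℤ.+ v)) ℤ.* z ℤ.+ v ℤ.+ 1ℤ) ≡
                          (1ℤ ℤ.+ (v ℤ.+ v)) ℤ.* (1ℤ ℤ.+ (v ℤ.+ v)) ℤ.* (z ℤ.* (z ℤ.+ 1ℤ))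
        factor = solve-∀
        product : (Y t ℤ.- v) ℤ.* (Y t ℤ.+ v ℤ.+ 1ℤ) ≡ (+ ℓ ℤ.* + ℓ) ℤ.* (z ℤ.* (z ℤ.+ 1ℤ))
        product = begin
          (Y t ℤ.- v) ℤ.* (Y t ℤ.+ v ℤ.+ 1ℤ)
            ≡⟨ cong (λ y → (y ℤ.- v) ℤ.* (y ℤ.+ v ℤ.+ 1ℤ)) (≡.trans (proj₂ (Y-mod-ℓ t)) (cong (λ l → v ℤ.+ l ℤ.* z) ℓ≡1+2v)) ⟩
          (v ℤ.+ (1ℤ ℤ.+ (v ℤ.+ v)) ℤ.* z ℤ.- v) ℤ.* (v ℤ.+ (1ℤ ℤ.+ (v ℤ.+ v)) ℤ.* z ℤ.+ v ℤ.+ 1ℤ)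
            ≡⟨ factor v z ⟩
          (1ℤ ℤ.+ (v ℤ.+ v)) ℤ.* (1ℤ ℤ.+ (v ℤ.+ v)) ℤ.* (z ℤ.* (z ℤ.+ 1ℤ))
            ≡⟨ cong (λ l → (l ℤ.* l) ℤ.* (z ℤ.* (z ℤ.+ 1ℤ))) ℓ≡1+2v ⟨
          (+ ℓ ℤ.* + ℓ) ℤ.* (z ℤ.* (z ℤ.+ 1ℤ)) ∎
        nonneg-product : ∀ {x} → 0ℤ ℤ.≤ x → 0ℤ ℤ.≤ (+ ℓ ℤ.* + ℓ) ℤ.* x
        nonneg-product {x} 0≤x = ≡.subst (ℤ._≤ (+ ℓ ℤ.* + ℓ) ℤ.* x) (ℤ.*-zeroʳ (+ ℓ ℤ.* + ℓ))
          (≡.subst (λ l → l ℤ.* 0ℤ ℤ.≤ l ℤ.* x) (ℤ.pos-* ℓ ℓ) (ℤ.*-monoˡ-≤-nonNeg (+ (ℓ ℕ.* ℓ)) 0≤x))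

    B c₀ : ℤ
    B = + r ℤ.* g
    c₀ = ℤ.- (B ℤ.* B ℤ.* (v ℤ.* (v ℤ.+ 1ℤ)))

    -- At γ^t the value of V is B · Y t, and `quadratic` is (V - B v)(V + B (v + 1)) expanded: the
    -- two possible values of Y, restated as a polynomial relation for `χ̂` to which inversion
    -- applies.
    V quadratic : Carrier → ℤ
    V c = + ℓ ℤ.* χ̂ c ℤ.+ + r
    quadratic c = V c ℤ.* V c ℤ.+ B ℤ.* V c ℤ.+ c₀

    quadratic-vanishes : ∀ c → ¬ c ≈ 0# → quadratic c ≡ 0ℤ
    quadratic-vanishes c c≉0 = on-power (proj₁ (log c c≉0)) (proj₁ (proj₂ (log c c≉0))) (proj₂ (proj₂ (log c c≉0)))
      where
      on-power : ∀ t → t < n → c ≈ γ ^ t → quadratic c ≡ 0ℤ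
      on-power t t<n c≈γ^t = begin
        quadratic c                                                              ≡⟨ cong (λ x → x ℤ.* x ℤ.+ B ℤ.* x ℤ.+ c₀) V≡ ⟩
        (+ r ℤ.* (Y t ℤ.* g)) ℤ.* (+ r ℤ.* (Y t ℤ.* g)) ℤ.+ B ℤ.* (+ r ℤ.* (Y t ℤ.* g)) ℤ.+ c₀  ≡⟨ factor (+ r) (Y t) g v ⟩
        B ℤ.* B ℤ.* ((Y t ℤ.- v) ℤ.* (Y t ℤ.+ v ℤ.+ 1ℤ))                         ≡⟨ cong (B ℤ.* B ℤ.*_) (two-values t t<n) ⟩
        B ℤ.* B ℤ.* 0ℤ                                                           ≡⟨ ℤ.*-zeroʳ (B ℤ.* B) ⟩
        0ℤ                                                                       ∎
        where
        factor : ∀ r y g v → (r ℤ.* (y ℤ.* g)) ℤ.* (r ℤ.* (y ℤ.* g)) ℤ.+ r ℤ.* g ℤ.* (r ℤ.* (y ℤ.* g)) ℤ.+ ℤ.- (r ℤ.* g ℤ.* (r ℤ.* g) ℤ.* (v ℤ.* (v ℤ.+ 1ℤ)))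
                               ≡ r ℤ.* g ℤ.* (r ℤ.* g) ℤ.* ((y ℤ.- v) ℤ.* (y ℤ.+ v ℤ.+ 1ℤ))
        factor = solve-∀
        collect : ∀ l r s → l ℤ.* (r ℤ.* s) ℤ.+ r ≡ r ℤ.* (l ℤ.* s ℤ.+ 1ℤ)
        collect = solve-∀
        V≡ : V c ≡ + r ℤ.* (Y t ℤ.* g)
        V≡ = ≡.trans (cong (λ x → + ℓ ℤ.* x ℤ.+ + r) (≡.trans (χ̂-cong c≈γ^t) (χ̂-power t))) (≡.trans (collect (+ ℓ) (+ r) (S t)) (cong (+ r ℤ.*_) (W≡Yg t)))

    differences : Carrier → ℤ
    differences w = Σᶻ (λ y → χ y ℤ.* χ (w + y))

    K : ℤ
    K = + r ℤ.* (Q ℤ.* + r)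

    -- `quadratic` vanishes away from 0, so its Fourier sum at w is `quadratic 0#` · r whatever w
    -- is. Expanded term by term, χ̂² contributes `differences w`, χ̂ contributes χ w, and the
    -- constant contributes nothing for w ≠ 0. So `differences` depends on w only through χ w.
    difference-equation : ∀ w → ¬ w ≈ 0# →
      + ℓ ℤ.* + ℓ ℤ.* (+ r ℤ.* K) ℤ.* differences w ≡ quadratic 0# ℤ.* + r ℤ.- (+ ℓ ℤ.* (+ r ℤ.+ + r) ℤ.+ B ℤ.* + ℓ) ℤ.* K ℤ.* χ w
    difference-equation w w≉0 = begin
      + ℓ ℤ.* + ℓ ℤ.* (+ r ℤ.* K) ℤ.* differences w                 ≡⟨ solve-for (+ ℓ ℤ.* + ℓ ℤ.* (+ r ℤ.* K) ℤ.* differences w) (b₁ ℤ.* K ℤ.* χ w) ⟩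
      (+ ℓ ℤ.* + ℓ ℤ.* (+ r ℤ.* K) ℤ.* differences w ℤ.+ b₁ ℤ.* K ℤ.* χ w) ℤ.- b₁ ℤ.* K ℤ.* χ w
                                                                    ≡⟨ cong (ℤ._- b₁ ℤ.* K ℤ.* χ w) (≡.trans (≡.sym expanded) concentrated) ⟩
      quadratic 0# ℤ.* + r ℤ.- b₁ ℤ.* K ℤ.* χ w                     ∎
      where
      b₁ b₀ : ℤ
      b₁ = + ℓ ℤ.* (+ r ℤ.+ + r) ℤ.+ B ℤ.* + ℓ
      b₀ = + r ℤ.* + r ℤ.+ B ℤ.* + r ℤ.+ c₀
      solve-for : ∀ x y → x ≡ (x ℤ.+ y) ℤ.- y
      solve-for = solve-∀
      concentrated : Σᶻ (λ c → quadratic c ℤ.* h (c * w)) ≡ quadratic 0# ℤ.* + r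
      concentrated = ≡.trans
        (Σᶻ-single 0# (λ c → quadratic c ℤ.* h (c * w)) (λ eq → cong₂ ℤ._*_ (cong (λ x → (+ ℓ ℤ.* x ℤ.+ + r) ℤ.* (+ ℓ ℤ.* x ℤ.+ + r) ℤ.+ B ℤ.* (+ ℓ ℤ.* x ℤ.+ + r) ℤ.+ c₀) (χ̂-cong eq)) (h-cong (*-congʳ eq)))
          (λ c c≉0 → ≡.trans (cong (ℤ._* h (c * w)) (quadratic-vanishes c c≉0)) (ℤ.*-zeroˡ (h (c * w)))))
        (cong (quadratic 0# ℤ.*_) (≡.trans (h-cong (zeroˡ w)) h-0))
      expand : ∀ l r B c x h → ((l ℤ.* x ℤ.+ r) ℤ.* (l ℤ.* x ℤ.+ r) ℤ.+ B ℤ.* (l ℤ.* x ℤ.+ r) ℤ.+ c) ℤ.* h ≡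
                               l ℤ.* l ℤ.* (x ℤ.* x ℤ.* h) ℤ.+ ((l ℤ.* (r ℤ.+ r) ℤ.+ B ℤ.* l) ℤ.* (x ℤ.* h) ℤ.+ (r ℤ.* r ℤ.+ B ℤ.* r ℤ.+ c) ℤ.* h)
      expand = solve-∀
      expanded : Σᶻ (λ c → quadratic c ℤ.* h (c * w)) ≡ + ℓ ℤ.* + ℓ ℤ.* (+ r ℤ.* K) ℤ.* differences w ℤ.+ b₁ ℤ.* K ℤ.* χ w
      expanded = begin
        Σᶻ (λ c → quadratic c ℤ.* h (c * w))
          ≡⟨ Σᶻ-cong (λ c → expand (+ ℓ) (+ r) B c₀ (χ̂ c) (h (c * w))) ⟩
        Σᶻ (λ c → + ℓ ℤ.* + ℓ ℤ.* (χ̂ c ℤ.* χ̂ c ℤ.* h (c * w)) ℤ.+ (b₁ ℤ.* (χ̂ c ℤ.* h (c * w)) ℤ.+ b₀ ℤ.* h (c * w)))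
          ≡⟨ ≡.trans (Σᶻ-+ _ _) (cong₂ ℤ._+_ (≡.sym (Σᶻ-*ˡ (+ ℓ ℤ.* + ℓ) _)) (≡.trans (Σᶻ-+ _ _) (cong₂ ℤ._+_ (≡.sym (Σᶻ-*ˡ b₁ _)) (≡.sym (Σᶻ-*ˡ b₀ _))))) ⟩
        + ℓ ℤ.* + ℓ ℤ.* Σᶻ (λ c → χ̂ c ℤ.* χ̂ c ℤ.* h (c * w)) ℤ.+ (b₁ ℤ.* Σᶻ (λ c → χ̂ c ℤ.* h (c * w)) ℤ.+ b₀ ℤ.* Σᶻ (λ c → h (c * w)))
          ≡⟨ cong₂ (λ x y → + ℓ ℤ.* + ℓ ℤ.* x ℤ.+ y) (correlation w) (cong₂ (λ x y → b₁ ℤ.* x ℤ.+ b₀ ℤ.* y) (inversion w) (≡.trans (orthogonality w) (≡.trans (cong (ℤ._* (Q ℤ.* + r)) (⟦⟧ᶻ-no (w ≟ 0#) w≉0)) (ℤ.*-zeroˡ (Q ℤ.* + r))))) ⟩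
        + ℓ ℤ.* + ℓ ℤ.* (+ r ℤ.* K ℤ.* differences w) ℤ.+ (b₁ ℤ.* (K ℤ.* χ w) ℤ.+ b₀ ℤ.* 0ℤ)
          ≡⟨ tidy (+ ℓ) (+ r ℤ.* K) (differences w) b₁ K (χ w) b₀ ⟩
        + ℓ ℤ.* + ℓ ℤ.* (+ r ℤ.* K) ℤ.* differences w ℤ.+ b₁ ℤ.* K ℤ.* χ w ∎
        where
        tidy : ∀ l rK d b₁ K x b₀ → l ℤ.* l ℤ.* (rK ℤ.* d) ℤ.+ (b₁ ℤ.* (K ℤ.* x) ℤ.+ b₀ ℤ.* 0ℤ) ≡ l ℤ.* l ℤ.* rK ℤ.* d ℤ.+ b₁ ℤ.* K ℤ.* x
        tidy = solve-∀

    differences-constant : ∀ {w w′} → ¬ w ≈ 0# → ¬ w′ ≈ 0# → χ w ≡ χ w′ → differences w ≡ differences w′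
    differences-constant {w} {w′} w≉0 w′≉0 eq = ℤ.*-cancelˡ-≡ (+ ℓ ℤ.* + ℓ ℤ.* (+ r ℤ.* K)) _ _ {{coefficient≢0}} (begin
      + ℓ ℤ.* + ℓ ℤ.* (+ r ℤ.* K) ℤ.* differences w     ≡⟨ difference-equation w w≉0 ⟩
      quadratic 0# ℤ.* + r ℤ.- b₁ ℤ.* K ℤ.* χ w         ≡⟨ cong (λ x → quadratic 0# ℤ.* + r ℤ.- b₁ ℤ.* K ℤ.* x) eq ⟩
      quadratic 0# ℤ.* + r ℤ.- b₁ ℤ.* K ℤ.* χ w′        ≡⟨ difference-equation w′ w′≉0 ⟨
      + ℓ ℤ.* + ℓ ℤ.* (+ r ℤ.* K) ℤ.* differences w′    ∎)
      where
      b₁ : ℤ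
      b₁ = + ℓ ℤ.* (+ r ℤ.+ + r) ℤ.+ B ℤ.* + ℓ
      coefficient≢0 : ℤ.NonZero (+ ℓ ℤ.* + ℓ ℤ.* (+ r ℤ.* K))
      coefficient≢0 = ℤ.i*j≢0 (+ ℓ ℤ.* + ℓ) (+ r ℤ.* K) {{ℤ.i*j≢0 (+ ℓ) (+ ℓ)}} {{ℤ.i*j≢0 (+ r) K {{r≢0}} {{ℤ.i*j≢0 (+ r) (Q ℤ.* + r) {{r≢0}} {{ℤ.i*j≢0 Q (+ r)}}}}}}

-- Counting neighbours

module Counting where

  open import Algebra.Bundles using (CommutativeRing)
  open import Data.Fin.Base as Fin using (Fin)
  open import Data.Integer.Base as ℤ using (ℤ; +_; 1ℤ)
  import Data.Integer.Properties as ℤ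
  open import Data.Nat.Base as ℕ using (ℕ; zero; suc; _<_)
  open import Data.Nat.DivMod using (m<n⇒m%n≡m)
  import Data.Nat.Properties as ℕ
  open import Data.Product.Base using (Σ; _,_; _×_; proj₁; proj₂)
  open import Level using (Level)
  open import Relation.Binary.Bundles using (Setoid)
  open import Relation.Binary.PropositionalEquality as ≡ using (_≡_; cong; cong₂)
  open import Relation.Nullary.Decidable using (Dec; yes; no; _×-dec_)
  open import Relation.Nullary.Negation using (¬_; contradiction)

  open FiniteSums
  open NumericalData
  open TwoValues

  private
    variable
      ℓ : Level

  -- One step of the enumeration of a decidable subset of Fin (suc m), with the
  -- decision for the first element as an argument.
  module _ {m : ℕ} {P : Fin (suc m) → Set ℓ} where

    count₊ : Dec (P Fin.zero) → ℕ → ℕ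
    count₊ (yes _) c = suc c
    count₊ (no _)  c = c

    rank₊ : ∀ {c} (d : Dec (P Fin.zero)) → (∀ i → P (Fin.suc i) → Fin c) → ∀ i → P i → Fin (count₊ d c)
    rank₊ (yes _) to Fin.zero    _ = Fin.zero
    rank₊ (yes _) to (Fin.suc i) p = Fin.suc (to i p)
    rank₊ (no ¬p) to Fin.zero    p = contradiction p ¬p
    rank₊ (no _)  to (Fin.suc i) p = to i p

    unrank₊ : ∀ {c} (d : Dec (P Fin.zero)) → (Fin c → Σ (Fin m) (λ i → P (Fin.suc i))) → Fin (count₊ d c) → Σ (Fin (suc m)) P
    unrank₊ (yes p) from Fin.zero    = Fin.zero , p
    unrank₊ (yes _) from (Fin.suc k) = Fin.suc (proj₁ (from k)) , proj₂ (from k)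
    unrank₊ (no _)  from k           = Fin.suc (proj₁ (from k)) , proj₂ (from k)

    unrank-rank₊ : ∀ {c} d (to : ∀ i → P (Fin.suc i) → Fin c) from → (∀ i pi → proj₁ (from (to i pi)) ≡ i) →
                   ∀ i pi → proj₁ (unrank₊ d from (rank₊ d to i pi)) ≡ i
    unrank-rank₊ (yes _) to from eq Fin.zero    pi = ≡.refl
    unrank-rank₊ (yes _) to from eq (Fin.suc i) pi = cong Fin.suc (eq i pi)
    unrank-rank₊ (no ¬p) to from eq Fin.zero    pi = contradiction pi ¬p
    unrank-rank₊ (no _)  to from eq (Fin.suc i) pi = cong Fin.suc (eq i pi)

    rank-unrank₊ : ∀ {c} d (to : ∀ i → P (Fin.suc i) → Fin c) from → (∀ k → to (proj₁ (from k)) (proj₂ (from k)) ≡ k) →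
                   ∀ k → rank₊ d to (proj₁ (unrank₊ d from k)) (proj₂ (unrank₊ d from k)) ≡ k
    rank-unrank₊ (yes _) to from eq Fin.zero    = ≡.refl
    rank-unrank₊ (yes _) to from eq (Fin.suc k) = cong Fin.suc (eq k)
    rank-unrank₊ (no _)  to from eq k           = eq k

    rank-irrelevant₊ : ∀ {c} d (to : ∀ i → P (Fin.suc i) → Fin c) → (∀ i pi pi′ → to i pi ≡ to i pi′) →
                       ∀ i pi pi′ → rank₊ d to i pi ≡ rank₊ d to i pi′
    rank-irrelevant₊ (yes _) to eq Fin.zero    pi pi′ = ≡.refl
    rank-irrelevant₊ (yes _) to eq (Fin.suc i) pi pi′ = cong Fin.suc (eq i pi pi′)
    rank-irrelevant₊ (no ¬p) to eq Fin.zero    pi pi′ = contradiction pi ¬p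
    rank-irrelevant₊ (no _)  to eq (Fin.suc i) pi pi′ = eq i pi pi′

  count : ∀ {m} {P : Fin m → Set ℓ} → (∀ i → Dec (P i)) → ℕ
  count {m = zero}  P? = 0
  count {m = suc m} {P} P? = count₊ {P = P} (P? Fin.zero) (count (λ i → P? (Fin.suc i)))

  rank : ∀ {m} {P : Fin m → Set ℓ} (P? : ∀ i → Dec (P i)) → ∀ i → P i → Fin (count P?)
  rank {m = suc m} P? = rank₊ (P? Fin.zero) (rank (λ i → P? (Fin.suc i)))

  unrank : ∀ {m} {P : Fin m → Set ℓ} (P? : ∀ i → Dec (P i)) → Fin (count P?) → Σ (Fin m) P
  unrank {m = suc m} P? = unrank₊ (P? Fin.zero) (unrank (λ i → P? (Fin.suc i)))

  unrank-rank : ∀ {m} {P : Fin m → Set ℓ} (P? : ∀ i → Dec (P i)) → ∀ i (pi : P i) → proj₁ (unrank P? (rank P? i pi)) ≡ i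
  unrank-rank {m = suc m} P? = unrank-rank₊ (P? Fin.zero) _ _ (unrank-rank (λ i → P? (Fin.suc i)))

  rank-unrank : ∀ {m} {P : Fin m → Set ℓ} (P? : ∀ i → Dec (P i)) → ∀ k → rank P? (proj₁ (unrank P? k)) (proj₂ (unrank P? k)) ≡ k
  rank-unrank {m = suc m} P? = rank-unrank₊ (P? Fin.zero) _ _ (rank-unrank (λ i → P? (Fin.suc i)))

  rank-irrelevant : ∀ {m} {P : Fin m → Set ℓ} (P? : ∀ i → Dec (P i)) → ∀ i (pi pi′ : P i) → rank P? i pi ≡ rank P? i pi′
  rank-irrelevant {m = suc m} P? = rank-irrelevant₊ (P? Fin.zero) _ (rank-irrelevant (λ i → P? (Fin.suc i)))

  rank-cong : ∀ {m} {P : Fin m → Set ℓ} (P? : ∀ i → Dec (P i)) → ∀ {i j} (pi : P i) (pj : P j) → i ≡ j → rank P? i pi ≡ rank P? j pj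
  rank-cong P? pi pj ≡.refl = rank-irrelevant P? _ pi pj

  -- Elements of the subset carry proofs of membership that its equality ignores; `rank-irrelevant`
  -- makes the bijection ignore them too.
  subsetoid-cardinality : ∀ {a b p m} (S : Setoid a b) (index : Setoid.Carrier S → Fin m) (element : Fin m → Setoid.Carrier S) →
    (∀ {x y} → Setoid._≈_ S x y → index x ≡ index y) → (∀ x → Setoid._≈_ S (element (index x)) x) → (∀ i → index (element i) ≡ i) →
    {P : Setoid.Carrier S → Set p} → (∀ {x y} → Setoid._≈_ S x y → P x → P y) → (P? : ∀ x → Dec (P x)) →
    HasCardinality (subsetoid S P) (count (λ i → P? (element i)))
  subsetoid-cardinality S index element index-cong element-index index-element {P} P-resp P? = record
    { to        = to
    ; from      = λ k → element (proj₁ (unrank Q? k)) , proj₂ (unrank Q? k)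
    ; to-cong   = λ {(x , px)} {(y , py)} eq → rank-cong Q? _ _ (index-cong eq)
    ; from-cong = λ { ≡.refl → S.refl }
    ; inverse   = (λ {k} {(x , px)} eq → ≡.trans (rank-cong Q? _ _ (≡.trans (index-cong eq) (index-element _))) (rank-unrank Q? k))
                , (λ { {(x , px)} ≡.refl → S.trans (S.reflexive (cong element (unrank-rank Q? (index x) _))) (element-index x) })
    }
    where
    module S = Setoid S
    Q? = λ i → P? (element i)
    to : Σ S.Carrier P → Fin (count Q?)
    to (x , px) = rank Q? (index x) (P-resp (S.sym (element-index x)) px)

  module StronglyRegular {a b} (C : Constants) (F : CommutativeRing a b) (ff : IsFiniteField F (Constants.p C ℕ.^ Constants.f C))
                   (γ : CommutativeRing.Carrier F) (γ-primitive : IsPrimitiveElement F γ) where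
    open CharacterValues C F ff γ γ-primitive hiding (ℓ)
    open ≡.≡-Reasoning

    size-of : ∀ {P : Carrier → Set b} → (∀ x → Dec (P x)) → ℕ
    size-of P? = count (λ (i : Fin (suc n)) → P? (element i))

    cardinality : ∀ {P : Carrier → Set b} → (∀ {x y} → x ≈ y → P x → P y) → (P? : ∀ x → Dec (P x)) → HasCardinality (subsetoid setoid P) (size-of P?)
    cardinality = subsetoid-cardinality setoid index element index-cong element-index index-element

    count-sum : ∀ {m} {P : Fin m → Set b} (P? : ∀ i → Dec (P i)) → + count P? ≡ Sumᶻ.sum (λ i → ⟦ P? i ⟧ᶻ)
    count-sum {zero}  P? = ≡.refl
    count-sum {suc m} P? with P? Fin.zero
    ... | yes _ = cong (λ z → 1ℤ ℤ.+ z) (count-sum (λ i → P? (Fin.suc i)))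
    ... | no _  = ≡.trans (count-sum (λ i → P? (Fin.suc i))) (≡.sym (ℤ.+-identityˡ _))

    size-sum : ∀ {P : Carrier → Set b} (P? : ∀ x → Dec (P x)) → + size-of P? ≡ Σᶻ (λ x → ⟦ P? x ⟧ᶻ)
    size-sum P? = ≡.trans (count-sum (λ i → P? (element i)))
      (≡.sym (≡.trans (Σᶻ-exp (λ x → ⟦ P? x ⟧ᶻ)) (cong (λ z → ⟦ P? 0# ⟧ᶻ ℤ.+ z) (Sumᶻ.∑≡sum n (λ e → ⟦ P? (γ ^ e) ⟧ᶻ)))))

    neighbour-resp : ∀ x {z z′} → z ≈ z′ → D (x - z) → D (x - z′)
    neighbour-resp x eq = D-resp (+-congˡ (-‿cong eq))

    neighbour? : ∀ x z → Dec (D (x - z))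
    neighbour? x z = D? (x - z)

    common? : ∀ x y z → Dec (D (x - z) × D (y - z))
    common? x y z = D? (x - z) ×-dec D? (y - z)

    x-[x-z]≈z : ∀ x z → x - (x - z) ≈ z
    x-[x-z]≈z x z = trans (+-congˡ (⁻¹-anti-homo‿- x z)) (trans (+-comm x (z - x)) (trans (+-assoc z (- x) x) (trans (+-congˡ (-‿inverseˡ x)) (+-identityʳ z))))
      where open import Algebra.Properties.AbelianGroup +-abelianGroup using (⁻¹-anti-homo‿-)

    reflect : ∀ x {g} → Congruentᶻ g → Σᶻ (λ z → g (x - z)) ≡ Σᶻ g
    reflect x = Σᶻ-reindex (λ z → x - z) (λ z → x - z) (λ eq → +-congˡ (-‿cong eq)) (λ eq → +-congˡ (-‿cong eq)) (x-[x-z]≈z x) (x-[x-z]≈z x)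

    degree : ∀ x → + size-of (neighbour? x) ≡ size
    degree x = ≡.trans (size-sum (neighbour? x)) (reflect x χ-cong)

    ⟦×-dec⟧ : ∀ {p q} {A : Set p} {B : Set q} (d : Dec A) (e : Dec B) → ⟦ d ×-dec e ⟧ᶻ ≡ ⟦ d ⟧ᶻ ℤ.* ⟦ e ⟧ᶻ
    ⟦×-dec⟧ (yes _) (yes _) = ≡.refl
    ⟦×-dec⟧ (yes _) (no _)  = ≡.refl
    ⟦×-dec⟧ (no _)  (yes _) = ≡.refl
    ⟦×-dec⟧ (no _)  (no _)  = ≡.refl

    -- The substitution u = y - z turns x - z into (x - y) + u, so common neighbours are counted by
    -- the autocorrelation of χ at x - y.
    common-neighbours : ∀ x y → + size-of (common? x y) ≡ differences (x - y)
    common-neighbours x y = begin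
      + size-of (common? x y)                           ≡⟨ size-sum (common? x y) ⟩
      Σᶻ (λ z → ⟦ common? x y z ⟧ᶻ)                     ≡⟨ Σᶻ-cong (λ z → ≡.trans (⟦×-dec⟧ (D? (x - z)) (D? (y - z))) (≡.trans (ℤ.*-comm (χ (x - z)) (χ (y - z))) (cong (χ (y - z) ℤ.*_) (χ-cong (sym (telescope z)))))) ⟩
      Σᶻ (λ z → χ (y - z) ℤ.* χ ((x - y) + (y - z)))    ≡⟨ reflect y {λ u → χ u ℤ.* χ ((x - y) + u)} (λ eq → cong₂ ℤ._*_ (χ-cong eq) (χ-cong (+-congˡ eq))) ⟩
      differences (x - y)                               ∎
      where
      telescope : ∀ z → (x - y) + (y - z) ≈ x - z
      telescope z = trans (+-assoc x (- y) (y - z)) (+-congˡ (trans (sym (+-assoc (- y) y (- z))) (trans (+-congʳ (-‿inverseˡ y)) (+-identityˡ (- z)))))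

    same-count : ∀ {x y x′ y′} → ¬ x ≈ y → ¬ x′ ≈ y′ → χ (x - y) ≡ χ (x′ - y′) → size-of (common? x y) ≡ size-of (common? x′ y′)
    same-count {x} {y} {x′} {y′} x≉y x′≉y′ eq = ℤ.+-injective (begin
      + size-of (common? x y)       ≡⟨ common-neighbours x y ⟩
      differences (x - y)           ≡⟨ differences-constant (λ d → x≉y (x∙y⁻¹≈ε⇒x≈y x y d)) (λ d → x′≉y′ (x∙y⁻¹≈ε⇒x≈y x′ y′ d)) eq ⟩
      differences (x′ - y′)         ≡⟨ common-neighbours x′ y′ ⟨
      + size-of (common? x′ y′)     ∎)

    x-0≈x : ∀ x → x - 0# ≈ x
    x-0≈x x = trans (+-congˡ -0≈0) (+-identityʳ x)
      where open import Algebra.Properties.Group +-group using () renaming (ε⁻¹≈ε to -0≈0)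

    M<N : M < N
    M<N = ≡.subst (M <_) (≡.trans (ℕ.*-comm M ℓ₀) (≡.sym N≡ℓM)) (ℕ.m<m*n M ℓ₀ 1<ℓ)
      where
      ℓ₀ = Constants.ℓ C
      1<ℓ : 1 < ℓ₀
      1<ℓ = ≡.subst (1 <_) (≡.sym ℓ≡43) (ℕ.s≤s (ℕ.s≤s ℕ.z≤n))

    1∈D : D (1# - 0#)
    1∈D = D-resp (sym (x-0≈x 1#)) (D-power {0} (≡.subst (_< M) (≡.sym (m<n⇒m%n≡m (ℕ.>-nonZero⁻¹ N))) (ℕ.>-nonZero⁻¹ M)))

    γ^M∉D : ¬ D (γ ^ M - 0#)
    γ^M∉D d = ℕ.<-irrefl (m<n⇒m%n≡m M<N) (power-in-D (D-resp (x-0≈x (γ ^ M)) d))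

    -- -1 is a prime field unit, hence a power of γ^L, and preserves D.
    D-sym : ∀ {x y} → D (x - y) → D (y - x)
    D-sym {x} {y} d = D-resp (trans (*-congʳ -1≈scalar) (trans (-1*x≈-x (x - y)) (⁻¹-anti-homo‿- x y))) (D-coset (proj₂ (scalar-power pred-r<r)) d)
      where
      open import Algebra.Properties.AbelianGroup +-abelianGroup using (⁻¹-anti-homo‿-)
      pred-r<r : ℕ.pred r < r
      pred-r<r = ℕ.≤-reflexive (ℕ.suc-pred r)

    -- The parameters stay counts at sample vertices: 1 and 0 are adjacent, and γ^M and 0 are not, M
    -- being the first exponent outside the classes of D. `degree` and `same-count` carry the counts
    -- to all vertices and pairs.
    isSRG : IsSRG setoid (Cay F D) (p ℕ.^ f) (size-of (neighbour? 0#)) (size-of (common? 1# 0#)) (size-of (common? (γ ^ M) 0#))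
    isSRG = record
      { E-resp-≈    = (λ {x} eq → neighbour-resp x eq) , (λ eq → D-resp (+-congʳ eq))
      ; loopless    = λ x → 0∉D (-‿inverseʳ x)
      ; undirected  = D-sym
      ; order       = IsFiniteField.cardinality ff
      ; regular     = λ x → ≡.subst (HasCardinality (subsetoid setoid (λ z → D (x - z))))
                              (ℤ.+-injective (≡.trans (degree x) (≡.sym (degree 0#))))
                              (cardinality (neighbour-resp x) (neighbour? x))
      ; notComplete = λ complete → γ^M∉D (complete (γ ^ M) 0# (γ^≉0 M))
      ; notEdgeless = λ edgeless → edgeless 1# 0# 1∈D
      ; adjacent    = λ x y x∼y → ≡.subst (HasCardinality (subsetoid setoid (λ z → D (x - z) × D (y - z))))
                        (same-count (λ x≈y → 0∉D (x≈y⇒x∙y⁻¹≈ε x≈y) x∼y) 1≉0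
                          (≡.trans (⟦⟧ᶻ-yes (D? (x - y)) x∼y) (≡.sym (⟦⟧ᶻ-yes (D? (1# - 0#)) 1∈D))))
                        (cardinality (common-resp x y) (common? x y))
      ; nonadjacent = λ x y x≉y x≁y → ≡.subst (HasCardinality (subsetoid setoid (λ z → D (x - z) × D (y - z))))
                        (same-count x≉y (γ^≉0 M) (≡.trans (⟦⟧ᶻ-no (D? (x - y)) x≁y) (≡.sym (⟦⟧ᶻ-no (D? (γ ^ M - 0#)) γ^M∉D))))
                        (cardinality (common-resp x y) (common? x y))
      }
      where
      common-resp : ∀ x y {z z′} → z ≈ z′ → D (x - z) × D (y - z) → D (x - z′) × D (y - z′)
      common-resp x y eq (d , e) = neighbour-resp x eq d , neighbour-resp y eq e

    stronglyRegular : IsStronglyRegular setoid (Cay F D)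
    stronglyRegular = _ , _ , _ , _ , isSRG

-- The exponent φ(43^m) / 6 and the conclusion

open NumericalData
open Totient
open Counting
open import Algebra.Bundles using (CommutativeRing)
open import Data.Nat.Base using (ℕ; suc; NonZero; _∸_; _^_; _*_; _/_; _≤_)
open import Data.Nat.Divisibility using (_∣_; ∣⇒≤)
open import Data.Nat.DivMod using (m*n/n≡m)
open import Data.Nat.Properties using (m^n≢0; m^n>0; *-assoc; *-comm; ≤-trans; m≤m*n)
open import Data.Product.Base using (_×_; _,_)
open import Relation.Binary.PropositionalEquality using (_≡_; sym; trans; cong; subst)

totient/6 : ∀ k → φ (43 ^ suc k) / 6 ≡ 43 ^ k * 7
totient/6 k = trans (cong (_/ 6) (trans (totient-prime-power (Base.ℓ-prime base) k)
  (trans (*-comm 42 (43 ^ k)) (sym (*-assoc (43 ^ k) 7 6))))) (m*n/n≡m (43 ^ k * 7) 6)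

mainTheorem4 : ∀ {c ℓ} (m : ℕ) → 1 ≤ m →
    let N = 43 ^ m
        f = φ (43 ^ m) / 6
        q = 11 ^ f
        instance
          N≢0 : NonZero (43 ^ m)
          N≢0 = m^n≢0 43 m
    in  IsOrd N 11 f
      × N ∣ q ∸ 1
      × ((F : CommutativeRing c ℓ) → IsFiniteField F q →
         (γ : CommutativeRing.Carrier F) → IsPrimitiveElement F γ →
         IsStronglyRegular (CommutativeRing.setoid F)
           (Cay F (ClassUnion F q N γ (43 ^ (m ∸ 1)))))
-- f occurs in the order, in the divisibility and in q, so `Statement` abstracts it and it is
-- replaced by 43^k · 7 everywhere at once.
mainTheorem4 {c} {ℓ} (suc k) _ = subst Statement (sym (totient/6 k)) (order , divisibility , regularity)
  where
  instance
    N≢0 : NonZero (43 ^ suc k)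
    N≢0 = m^n≢0 43 (suc k)
  module P = Numbers base k
  Statement : ℕ → Set _
  Statement f = IsOrd (43 ^ suc k) 11 f × 43 ^ suc k ∣ 11 ^ f ∸ 1 ×
    ((F : CommutativeRing c ℓ) → IsFiniteField F (11 ^ f) → (γ : CommutativeRing.Carrier F) → IsPrimitiveElement F γ →
     IsStronglyRegular (CommutativeRing.setoid F) (Cay F (ClassUnion F (11 ^ f) (43 ^ suc k) γ (43 ^ k))))
  order : IsOrd (43 ^ suc k) 11 (43 ^ k * 7)
  order = record
    { positive = ≤-trans (m^n>0 43 k) (m≤m*n (43 ^ k) 7)
    ; power≡1  = P.p^f≡1
    ; minimal  = λ { e@(suc _) _ eq → ∣⇒≤ (P.order-minimal e eq) } }
  divisibility : 43 ^ suc k ∣ 11 ^ (43 ^ k * 7) ∸ 1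
  divisibility = P.N∣p^f∸1
  regularity : (F : CommutativeRing c ℓ) → IsFiniteField F (11 ^ (43 ^ k * 7)) → (γ : CommutativeRing.Carrier F) → IsPrimitiveElement F γ →
               IsStronglyRegular (CommutativeRing.setoid F) (Cay F (ClassUnion F (11 ^ (43 ^ k * 7)) (43 ^ suc k) γ (43 ^ k)))
  regularity F ff γ γ-primitive = StronglyRegular.stronglyRegular P.constants F ff γ γ-primitive
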